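{- Let $q$ be odd with $q\ge5$, and let $G$ be a group of automorphisms of the Payne derived quadrangle $\mathcal{Q}^P$ of $W(q)$ acting regularly on the points of $\mathcal{Q}^P$. Then $G$ is conjugate (within $\mathrm{P\Gamma Sp}(4,q)_P$) to one of the groups of Constructions A, B, C, D described in the context.
   Context: Let $q=p^m$, $p$ prime. $V=\mathbb{F}_q^4$ carries the alternating form $(x,y)=x_1y_4-x_4y_1+x_2y_3-x_3y_2$; $W(q)$ has all points of $\mathrm{PG}(3,q)$ and the totally isotropic lines. $P=\langle(1,0,0,0)\rangle$. The Payne derived quadrangle $\mathcal{Q}^P$ has as points the points $\langle(a,b,c,1)\rangle$ not in $P^\perp$, and as lines the totally isotropic lines not through $P$ and the lines $\langle P,Q\rangle$, $Q\notin P^\perp$. $\mathrm{P\Gamma Sp}(4,q)_P$ is the stabilizer of $P$ in $\mathrm{P\Gamma Sp}(4,q)$; for $q\ge5$ it is the full automorphism group of $\mathcal{Q}^P$. A pair $(A,\sigma)$, $A\in\mathrm{GL}(4,q)$, $\sigma\in\mathrm{Aut}(\mathbb{F}_q)$, denotes the map $x\mapsto x^\sigma A$ on row vectors, with product $(A_1,\sigma_1)\circ(A_2,\sigma_2)=(A_1^{\sigma_2}A_2,\sigma_1\sigma_2)$. $E(a,b,c,t)$ is the matrix with rows $(1,0,0,0),(-c,1,0,0),(b-ct,t,1,0),(a,b,c,1)$. Given $T:\mathbb{F}_q^3\to\mathbb{F}_q$ and $\theta:\mathbb{F}_q^3\to\mathrm{Aut}(\mathbb{F}_q)$, put $\mathfrak{g}_{a,b,c}=(E(a,b,c,T(a,b,c)),\theta_{a,b,c})$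 and $G_{T,\theta}=\{\mathfrak{g}_{a,b,c}:a,b,c\in\mathbb{F}_q\}$. $\mathrm{tr}$ denotes $\mathrm{tr}_{\mathbb{F}_q/\mathbb{F}_p}$; a reduced linearized polynomial is $\sum_{i=0}^{m-1}s_iX^{p^i}$. Construction A: $\theta\equiv1$, $T(a,b,c)=S_1(c)$ for a reduced linearized polynomial $S_1$ over $\mathbb{F}_q$; the group is $G_{T,\theta}$. Construction B: $q=p^{pl}$, $p$ odd, $l\ge1$, $g(x)=x^{p^l}$; $S_1$ a reduced linearized polynomial with coefficients in $\mathbb{F}_{p^l}$; $\mu_C\in\mathbb{F}_{p^l}^*$; $\theta_{a,b,c}=g^{\mathrm{tr}(\mu_Cc)}$, $T(a,b,c)=S_1(c)$; group $G_{T,\theta}$. Construction C: $q=p^{pl}$, $p$ odd, $g(x)=x^{p^l}$; $\mu_B\in\mathbb{F}_{p^l}^*$; $s_0,\dots,s_{pl-1}\in\mathbb{F}_{p^l}$ with $\mu_Bs_i-s_{pl-i}^{p^i}\mu_B^{p^i}=0$ for $1\le i\le pl-1$; $S_1(X)=\sum_i s_iX^{p^i}$, $Q(x)=-\mathrm{tr}(\mu_BxS_1(x))$; $\theta_{a,b,c}=g^{\frac12Q(c)+\mathrm{tr}(\mu_Bb)}$ (exponent in $\mathbb{F}_p$), $T(a,b,c)=S_1(c)$; group $G_{T,\theta}$. Construction D: $q=3^{9l}$, $g(x)=x^{3^l}$, $g_1=g^3$; $u\in\mathbb{F}_{3^{3l}}$ with $\mu_C:=u-u^g\in\mathbb{F}_{3^l}^*$;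 $t_C\in\mathbb{F}_q^*$ with $\lambda_C:=\mathrm{tr}_{\mathbb{F}_q/\mathbb{F}_3}(\mu_Ct_C)\neq0$; $\mu_B\in\mathbb{F}_{3^l}^*$; $s_0,\dots,s_{9l-1}\in\mathbb{F}_{3^l}$ with $-\mu_Bs_i+s_{9l-i}^{3^i}\mu_B^{3^i}=\mu_Cu^{3^i}-u\mu_C^{3^i}$ for $1\le i\le 9l-1$; $\alpha\in\mathbb{F}_{3^{3l}}$, $\lambda\in\mathbb{F}_3$ with $g(\alpha)-\alpha=\lambda_Cu+\lambda\mu_C$. Set $S_1(X)=\sum_i s_iX^{3^i}$, $Q(x)=-\mathrm{tr}_{\mathbb{F}_q/\mathbb{F}_3}(\mu_BxS_1(x))$, $K=\{z:\mathrm{tr}_{\mathbb{F}_q/\mathbb{F}_3}(\mu_Cz)=0\}$. For $a,b\in\mathbb{F}_q$, $c\in K$ let $\mathfrak{g}_{a,b,c}=(E(a,b,c,S_1(c)),\,g_1^{\frac12Q(c)+\mathrm{tr}_{\mathbb{F}_q/\mathbb{F}_3}(\alpha c+\mu_Bb)})$, $G_K=\{\mathfrak{g}_{a,b,c}:a,b\in\mathbb{F}_q,c\in K\}$, $\mathfrak{g}_{0,0,t_C}=(E(0,0,t_C,S_1(t_C)),g)$; the group is $\langle G_K,\mathfrak{g}_{0,0,t_C}\rangle$. -}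

module Defs where

open import Data.Nat using (ℕ; zero; suc; _≤_; _<_; _∸_) renaming (_+_ to _+ℕ_; _*_ to _*ℕ_)
open import Data.Fin using (Fin) renaming (zero to f0; suc to fs)
open import Data.Product using (Σ; ∃; _×_; _,_; Σ-syntax; ∃-syntax)
open import Data.Sum using (_⊎_)
open import Data.List using (List; length)
open import Data.List.Membership.Propositional using (_∈_)
open import Data.List.Relation.Unary.Unique.Propositional using (Unique)
open import Relation.Binary.PropositionalEquality using (_≡_; _≢_)
open import Algebra.Structures using (IsCommutativeRing)

-- A finite field (equality is propositional equality).  F_q is
-- represented by an arbitrary finite field of cardinality q (unique up
-- to isomorphism).

record FiniteField : Set₁ where
  infixl 7 _*_
  infixl 6 _+_
  field
    Carrier  : Set
    _+_ _*_  : Carrier → Carrier → Carrier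
    -_       : Carrier → Carrier
    0# 1#    : Carrier
    _⁻¹      : Carrier → Carrier
    isCommutativeRing : IsCommutativeRing _≡_ _+_ _*_ -_ 0# 1#
    0≢1      : 0# ≢ 1#
    inverseʳ : ∀ x → x ≢ 0# → x * (x ⁻¹) ≡ 1#
    elements : List Carrier
    elements-complete : ∀ x → x ∈ elements
    elements-unique   : Unique elements

  card : ℕ
  card = length elements

-- Everything below lives over a finite field F of characteristic p.

module Theory (F : FiniteField) (p : ℕ) where
  open FiniteField F

  infixl 6 _-_
  _-_ : Carrier → Carrier → Carrier
  x - y = x + (- y)

  ι : ℕ → Carrier
  ι zero    = 0#
  ι (suc n) = 1# + ι n

  pow : Carrier → ℕ → Carrier
  pow x zero    = 1#
  pow x (suc n) = x * pow x n

  -- frob e x = x ^ (p ^ e); the automorphisms of F_q are exactly these.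
  frob : ℕ → Carrier → Carrier
  frob zero    x = x
  frob (suc e) x = pow (frob e x) p

  half : Carrier
  half = (ι 2) ⁻¹

  sumBelow : ℕ → (ℕ → Carrier) → Carrier
  sumBelow zero    f = 0#
  sumBelow (suc n) f = sumBelow n f + f n

  -- x ∈ F_{p^k}
  InSub : ℕ → Carrier → Set
  InSub k x = frob k x ≡ x

  tr : ℕ → Carrier → Carrier
  tr m x = sumBelow m (λ i → frob i x)

  lin : ℕ → (ℕ → Carrier) → Carrier → Carrier
  lin m s x = sumBelow m (λ i → s i * frob i x)

  i0 i1 i2 i3 : Fin 4
  i0 = f0
  i1 = fs f0
  i2 = fs (fs f0)
  i3 = fs (fs (fs f0))

  Vec4 : Set
  Vec4 = Fin 4 → Carrier

  Mat4 : Set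
  Mat4 = Fin 4 → Fin 4 → Carrier

  sum4 : (Fin 4 → Carrier) → Carrier
  sum4 f = f i0 + f i1 + f i2 + f i3

  vecMat : Vec4 → Mat4 → Vec4
  vecMat v A j = sum4 (λ k → v k * A k j)

  matMul : Mat4 → Mat4 → Mat4
  matMul A B i j = sum4 (λ k → A i k * B k j)

  idMat : Mat4
  idMat f0      f0      = 1#
  idMat f0      (fs _)  = 0#
  idMat (fs _)  f0      = 0#
  idMat (fs i)  (fs j)  = idMat' i j
    where
    idMat' : Fin 3 → Fin 3 → Carrier
    idMat' f0 f0 = 1#
    idMat' f0 (fs _) = 0#
    idMat' (fs _) f0 = 0#
    idMat' (fs f0) (fs f0) = 1#
    idMat' (fs f0) (fs (fs _)) = 0#
    idMat' (fs (fs _)) (fs f0) = 0#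
    idMat' (fs (fs f0)) (fs (fs f0)) = 1#

  Invertible : Mat4 → Set
  Invertible A = Σ[ B ∈ Mat4 ] ((∀ i j → matMul A B i j ≡ idMat i j)
                              × (∀ i j → matMul B A i j ≡ idMat i j))

  form : Vec4 → Vec4 → Carrier
  form x y = x i0 * y i3 - x i3 * y i0 + x i1 * y i2 - x i2 * y i1

  vec4 : Carrier → Carrier → Carrier → Carrier → Vec4
  vec4 a b c d f0 = a
  vec4 a b c d (fs f0) = b
  vec4 a b c d (fs (fs f0)) = c
  vec4 a b c d (fs (fs (fs f0))) = d

  rows : Vec4 → Vec4 → Vec4 → Vec4 → Mat4
  rows r0 r1 r2 r3 f0 = r0
  rows r0 r1 r2 r3 (fs f0) = r1
  rows r0 r1 r2 r3 (fs (fs f0)) = r2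
  rows r0 r1 r2 r3 (fs (fs (fs f0))) = r3

  E : Carrier → Carrier → Carrier → Carrier → Mat4
  E a b c t = rows (vec4 1# 0# 0# 0#)
                   (vec4 (- c) 1# 0# 0#)
                   (vec4 (b - c * t) t 1# 0#)
                   (vec4 a b c 1#)

  -- semilinear maps (A, σ) with σ = frob aut : x ↦ x^σ A on row vectors

  record Semilinear : Set where
    constructor mkS
    field
      mat : Mat4
      aut : ℕ
  open Semilinear public

  apply : Semilinear → Vec4 → Vec4
  apply s v = vecMat (λ i → frob (aut s) (v i)) (mat s)

  _∘ˢ_ : Semilinear → Semilinear → Semilinear
  mkS A₁ e₁ ∘ˢ mkS A₂ e₂ = mkS (matMul (λ i j → frob e₂ (A₁ i j)) A₂) (e₁ +ℕ e₂)

  idˢ : Semilinear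
  idˢ = mkS idMat 0

  -- equality in PΓL(4,q): same field automorphism, matrices equal up to a scalar
  _≈ˢ_ : Semilinear → Semilinear → Set
  s ≈ˢ t = (∀ x → frob (aut s) x ≡ frob (aut t) x)
         × (Σ[ c ∈ Carrier ] (c ≢ 0# × (∀ i j → mat s i j ≡ c * mat t i j)))

  -- (a representative of) an element of PΓSp(4,q)_P, P = ⟨(1,0,0,0)⟩
  InPΓSpP : Semilinear → Set
  InPΓSpP s = Invertible (mat s)
            × (Σ[ λ₀ ∈ Carrier ] (λ₀ ≢ 0# ×
                 (∀ x y → form (vecMat x (mat s)) (vecMat y (mat s)) ≡ λ₀ * form x y)))
            × (mat s i0 i1 ≡ 0#) × (mat s i0 i2 ≡ 0#) × (mat s i0 i3 ≡ 0#)

  -- the points of the Payne derived quadrangle: ⟨(a,b,c,1)⟩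

  Point : Set
  Point = Carrier × Carrier × Carrier

  pointVec : Point → Vec4
  pointVec (a , b , c) = vec4 a b c 1#

  MapsTo : Semilinear → Point → Point → Set
  MapsTo s X Y = Σ[ λ₀ ∈ Carrier ] (λ₀ ≢ 0# ×
                   (∀ i → apply s (pointVec X) i ≡ λ₀ * pointVec Y i))

  -- a subgroup of PΓSp(4,q)_P, given by a predicate on representatives
  record IsSubgroupPΓSpP (G : Semilinear → Set) : Set where
    field
      respects : ∀ g h → g ≈ˢ h → G g → G h
      inGroup  : ∀ g → G g → InPΓSpP g
      hasId    : G idˢ
      closed   : ∀ g h → G g → G h → G (g ∘ˢ h)
      inverses : ∀ g → G g → Σ[ h ∈ Semilinear ] (G h × (g ∘ˢ h) ≈ˢ idˢ)

  RegularOnPoints : (Semilinear → Set) → Set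
  RegularOnPoints G =
    ∀ X Y → (Σ[ g ∈ Semilinear ] (G g × MapsTo g X Y))
          × (∀ g h → G g → G h → MapsTo g X Y → MapsTo h X Y → g ≈ˢ h)

  ConjugateTo : (Semilinear → Set) → (Semilinear → Set) → Set
  ConjugateTo G H =
    Σ[ h ∈ Semilinear ] (InPΓSpP h ×
      (∀ g → (G g → Σ[ g' ∈ Semilinear ] (H g' × (g ∘ˢ h) ≈ˢ (h ∘ˢ g')))
           × (Σ[ g' ∈ Semilinear ] (H g' × (g ∘ˢ h) ≈ˢ (h ∘ˢ g')) → G g)))

  data Generated (H : Semilinear → Set) : Semilinear → Set where
    gen  : ∀ x → H x → Generated H x
    unit : ∀ x → x ≈ˢ idˢ → Generated H x
    mul  : ∀ a b x → Generated H a → Generated H b → (a ∘ˢ b) ≈ˢ x → Generated H x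
    inv  : ∀ a x → Generated H a → (a ∘ˢ x) ≈ˢ idˢ → Generated H x

  GroupA : ℕ → (ℕ → Carrier) → Semilinear → Set
  GroupA m s g = Σ[ a ∈ Carrier ] Σ[ b ∈ Carrier ] Σ[ c ∈ Carrier ]
                   (g ≈ˢ mkS (E a b c (lin m s c)) 0)

  CaseA : ℕ → (Semilinear → Set) → Set
  CaseA m G = Σ[ s ∈ (ℕ → Carrier) ] ConjugateTo G (GroupA m s)

  -- Construction B  (g = frob l, so g^k = frob (l*k))
  GroupB : ℕ → ℕ → (ℕ → Carrier) → Carrier → Semilinear → Set
  GroupB m l s μC g = Σ[ a ∈ Carrier ] Σ[ b ∈ Carrier ] Σ[ c ∈ Carrier ] Σ[ k ∈ ℕ ]
                        ((ι k ≡ tr m (μC * c))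
                        × g ≈ˢ mkS (E a b c (lin m s c)) (l *ℕ k))

  CaseB : ℕ → (Semilinear → Set) → Set
  CaseB m G = Σ[ l ∈ ℕ ] Σ[ s ∈ (ℕ → Carrier) ] Σ[ μC ∈ Carrier ]
                ((1 ≤ l) × (m ≡ p *ℕ l)
                × (∀ i → i < m → InSub l (s i))
                × InSub l μC × (μC ≢ 0#)
                × ConjugateTo G (GroupB m l s μC))

  Qf : ℕ → (ℕ → Carrier) → Carrier → Carrier → Carrier
  Qf m s μB x = - tr m (μB * x * lin m s x)

  GroupC : ℕ → ℕ → (ℕ → Carrier) → Carrier → Semilinear → Set
  GroupC m l s μB g = Σ[ a ∈ Carrier ] Σ[ b ∈ Carrier ] Σ[ c ∈ Carrier ] Σ[ k ∈ ℕ ]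
                        ((ι k ≡ half * Qf m s μB c + tr m (μB * b))
                        × g ≈ˢ mkS (E a b c (lin m s c)) (l *ℕ k))

  CaseC : ℕ → (Semilinear → Set) → Set
  CaseC m G = Σ[ l ∈ ℕ ] Σ[ s ∈ (ℕ → Carrier) ] Σ[ μB ∈ Carrier ]
                ((m ≡ p *ℕ l)
                × InSub l μB × (μB ≢ 0#)
                × (∀ i → i < m → InSub l (s i))
                × (∀ i → 1 ≤ i → i < m →
                     μB * s i - frob i (s (m ∸ i)) * frob i μB ≡ 0#)
                × ConjugateTo G (GroupC m l s μB))

  -- Construction D  (g = frob l, g₁ = g^3, so g₁^k = frob (3*l*k))
  GroupK : ℕ → ℕ → (ℕ → Carrier) → Carrier → Carrier → Carrier → Semilinear → Set
  GroupK m l s μB μC α g =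
    Σ[ a ∈ Carrier ] Σ[ b ∈ Carrier ] Σ[ c ∈ Carrier ] Σ[ k ∈ ℕ ]
      ((tr m (μC * c) ≡ 0#)
      × (ι k ≡ half * Qf m s μB c + tr m (α * c + μB * b))
      × g ≈ˢ mkS (E a b c (lin m s c)) (3 *ℕ l *ℕ k))

  GroupD : ℕ → ℕ → (ℕ → Carrier) → Carrier → Carrier → Carrier → Carrier → Semilinear → Set
  GroupD m l s μB μC α tC =
    Generated (λ g → GroupK m l s μB μC α g
                     ⊎ g ≈ˢ mkS (E 0# 0# tC (lin m s tC)) l)

  CaseD : ℕ → (Semilinear → Set) → Set
  CaseD m G = Σ[ l ∈ ℕ ] Σ[ u ∈ Carrier ] Σ[ tC ∈ Carrier ] Σ[ μB ∈ Carrier ]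
              Σ[ s ∈ (ℕ → Carrier) ] Σ[ α ∈ Carrier ] Σ[ λ₀ ∈ Carrier ]
      (let μC = u - frob l u
           λC = tr m (μC * tC) in
        (p ≡ 3) × (m ≡ 9 *ℕ l)
      × InSub (3 *ℕ l) u × InSub l μC × (μC ≢ 0#)
      × (tC ≢ 0#) × (λC ≢ 0#)
      × InSub l μB × (μB ≢ 0#)
      × (∀ i → i < m → InSub l (s i))
      × (∀ i → 1 ≤ i → i < m →
           - (μB * s i) + frob i (s (m ∸ i)) * frob i μB
             ≡ μC * frob i u - u * frob i μC)
      × InSub (3 *ℕ l) α × InSub 1 λ₀
      × (frob l α - α ≡ λC * u + λ₀ * μC)
      × ConjugateTo G (GroupD m l s μB μC α tC))

  ConjugateToConstruction : ℕ → (Semilinear → Set) → Set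
  ConjugateToConstruction m G = CaseA m G ⊎ CaseB m G ⊎ CaseC m G ⊎ CaseD m G

{-# OPTIONS --safe #-}
module Submission where

-- A regular group G has q³ elements, so orbit counting modulo p gives a nonzero vector of P^⊥ / P fixed by G;
-- after a change of basis G is triangular.  Since q³ ≡ 1 modulo q - 1, averaging over the points makes the cocycle
-- of diagonal entries a coboundary, and a diagonal conjugation turns every element into some (E(a,b,c,t), φ^j),
-- where φ generates the group of field automorphisms that occur; let P be the order of φ, a power of p.
--
-- The operator N = φ - 1 is nilpotent, with exactly N^P = 0 and ker N^j = im N^(P-j).  Nilpotency shows that t = 0 and
-- j = 0 on the elements (a,0,0), so only the pairs (b,c) matter.  The identity 1 + φ + ... + φ^(p-1) = N^(p-1) bounds
-- the quotients for b alone and for c modulo b: each has order 1 or p.  Solving an equation N² w = d and conjugating by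
-- E(0,0,0,w) makes t an additive φ-equivariant function S(c).  The exponent j is then, up to a quadratic correction,
-- additive, hence a trace form.  The orders (1,1), (1,p), (p,1) and (p,p) lead to Constructions A, B, C and D;
-- in the last case the p-th power of an element inducing φ forces p = 3 together with the relations of D.

open import Algebra.Bundles using (CommutativeRing; RawRing)
open import Algebra.Solver.Ring.AlmostCommutativeRing using (fromCommutativeRing; _-Raw-AlmostCommutative⟶_)
open import Algebra.Structures using (IsCommutativeMonoid; IsCommutativeRing)
open import Data.Empty using (⊥-elim; ⊥)
open import Data.Fin using (Fin) renaming (zero to f0; suc to fs)
open import Data.Integer using (ℤ; -[1+_]) renaming (+_ to pos)
open import Data.List using (List; []; _∷_; length; map; filter; cartesianProduct; replicate; upTo)
open import Data.List.Membership.Propositional using (_∈_)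
open import Data.List.Membership.Propositional.Properties using (∈-filter⁺; ∈-filter⁻; ∈-map⁺; ∈-map⁻; ∈-cartesianProduct⁺; ∈-upTo⁻)
open import Data.List.Membership.Propositional.Properties.WithK using (unique∧set⇒bag)
open import Data.List.Properties using (length-++; length-map; length-upTo; length-replicate)
open import Data.List.Relation.Binary.BagAndSetEquality using (∼bag⇒↭)
open import Data.List.Relation.Binary.Permutation.Propositional using (_↭_) renaming (refl to ↭refl; prep to ↭prep; swap to ↭swap; trans to ↭trans)
open import Data.List.Relation.Binary.Permutation.Propositional.Properties using (↭-length)
open import Data.List.Relation.Unary.All using (All; []; _∷_) renaming (lookup to All-lookup)
open import Data.List.Relation.Unary.AllPairs using ([]; _∷_)
open import Data.List.Relation.Unary.Any using (Any; here; there; any?; satisfied)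
open import Data.List.Relation.Unary.Unique.Propositional using (Unique)
open import Data.List.Relation.Unary.Unique.Propositional.Properties using (upTo⁺) renaming (map⁺ to Unique-map⁺; filter⁺ to Unique-filter⁺; cartesianProduct⁺ to Unique-×)
open import Data.Maybe using (Maybe; just; nothing)
open import Data.Nat using (ℕ; zero; suc; _≤_; _<_; z≤n; s≤s; _^_; _∸_; NonZero; _%_; _/_; _!) renaming (_+_ to _+ℕ_; _*_ to _*ℕ_)
open import Data.Nat.Combinatorics using (nCk≡n!/k![n-k]!; k>n⇒nCk≡0; nCn≡1; nCk+nC[k+1]≡[n+1]C[k+1]; k![n∸k]!∣n!) renaming (_C_ to _choose_)
open import Data.Nat.Coprimality using (prime⇒coprime; coprime-Bézout)
open import Data.Nat.DivMod using (m≡m%n+[m/n]*n; m%n<n; m/n*n≡m; %-distribˡ-+; %-distribˡ-*; [m+kn]%n≡m%n; m<n⇒m%n≡m; n%n≡0; m*n/n≡m)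
open import Data.Nat.Divisibility using (_∣_; divides; ∣m∣n⇒∣m+n; ∣⇒≤; _∣?_; m%n≡0⇒n∣m; m∣m*n; n∣m⇒m%n≡0; ∣1⇒≡1; *-cancelˡ-∣; *-monoʳ-∣; ∣m+n∣m⇒∣n; ∣-refl; ∣n⇒∣m*n; *-cancelʳ-∣)
open import Data.Nat.GCD using (module Bézout)
open import Data.Nat.Primality using (Prime; euclidsLemma; prime⇒nonZero; prime⇒nonTrivial; prime⇒irreducible; ¬prime[1])
open import Data.Nat.Properties using (_!*_!≢0)
open import Data.Nat.Solver using (module +-*-Solver)
open import Data.Product using (∃; _×_; _,_; proj₁; proj₂; Σ-syntax)
open import Data.Sum using (_⊎_; inj₁; inj₂)
open import Defs
open import Function.Bundles using (mk⇔)
open import Relation.Binary.Definitions using (DecidableEquality)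
open import Relation.Binary.PropositionalEquality using (_≡_; _≢_; refl; sym; trans; cong; cong₂; subst; module ≡-Reasoning; subst₂)
open import Relation.Nullary using (¬_; Dec; yes; no)
open import Relation.Nullary.Decidable using (map′; ¬?)
import Algebra.Properties.Ring
import Algebra.Solver.Ring
import Data.Integer as ℤ
import Data.Integer.Properties as ℤₚ
import Data.List.Relation.Unary.All as All
import Data.Nat.Properties as ℕₚ

-- The obstacle is a twist: a product applies σ_j, with j the label of the second factor, to the
-- coordinates of the first, so neither the label nor t is additive in (b , c). Two devices undo it.
-- A set V of attained coordinates is a φ-stable additive subgroup, and V + N F = F forces V = F;
-- this fills subgroups that are only visible modulo N F. And a function constant on φ-orbits does
-- not see σ_j, so twisted additivity becomes additivity.
--
-- Oddness of p serves for the divisions by 2 and for N^(p-1) F to lie inside N² F. The prime 3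
-- comes from the powers of a generator g in the (p,p) case: the β-part of g^k, corrected by its
-- quadratic term, is a linear term in k plus a multiple of (k+1) k (k-1) / 12. At k = p this
-- vanishes once 12 is invertible. The remaining part of the label of g^p is a multiple of a
-- functional that kills N F, evaluated at N^(p-3) t, hence zero for p > 3. Yet that label is 1.
--
-- After the matrix reduction everything is stated for a relation on labels, so that conjugations
-- become changes of coordinates.

-- Finite types, commutative folds and re-indexing.

record Finite (A : Set) : Set where
  field
    list     : List A
    complete : ∀ x → x ∈ list
    unique   : Unique list

module _ {A : Set} where

  -- Decidable equality is not part of the data of a finite field. Absence of repetitions supplies
  -- it: two members are equal exactly when their positions coincide.
  members-≟ : ∀ {xs : List A} → Unique xs → ∀ {x y} → x ∈ xs → y ∈ xs → Dec (x ≡ y)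
  members-≟ _         (here refl) (here refl) = yes refl
  members-≟ (px ∷ _)  (here refl) (there q)   = no (All-lookup px q)
  members-≟ (px ∷ _)  (there q)   (here refl) = no (λ e → All-lookup px q (sym e))
  members-≟ (_ ∷ u)   (there r)   (there q)   = members-≟ u r q

  finite-≟ : Finite A → DecidableEquality A
  finite-≟ fin x y = members-≟ unique (complete x) (complete y)
    where open Finite fin

  finite-∃? : Finite A → {P : A → Set} → (∀ x → Dec (P x)) → Dec (∃ P)
  finite-∃? fin P? = map′ satisfied (λ (x , px) → Data.List.Relation.Unary.Any.map (λ { refl → px }) (complete x)) (any? P? list)
    where open Finite fin

  finite-∀⊎∃ : Finite A → {P Q : A → Set} → (∀ x → P x ⊎ Q x) → (∀ x → P x) ⊎ (∃ Q)
  finite-∀⊎∃ fin {P} {Q} f = go list (λ x x∉ → ⊥-elim (x∉ (complete x)))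
    where
    open Finite fin
    -- Invariant: `P` is already known off the part of the list that is still to be scanned.
    go : (xs : List A) → (∀ x → ¬ (x ∈ xs) → P x) → (∀ x → P x) ⊎ (∃ Q)
    go []       h = inj₁ (λ x → h x (λ ()))
    go (y ∷ ys) h with f y
    ... | inj₂ q = inj₂ (y , q)
    ... | inj₁ r = go ys λ x x∉ → case x x∉
      where
      case : ∀ x → ¬ (x ∈ ys) → P x
      case x x∉ with finite-≟ fin x y
      ... | yes refl = r
      ... | no x≢y   = h x λ { (here e) → x≢y e ; (there q) → x∉ q }

  unique-↭ : ∀ {xs ys : List A} → Unique xs → Unique ys →
             (∀ {x} → x ∈ xs → x ∈ ys) → (∀ {x} → x ∈ ys → x ∈ xs) → xs ↭ ys
  unique-↭ u v f g = ∼bag⇒↭ (unique∧set⇒bag u v (mk⇔ f g))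

  bijection-↭ : (fin : Finite A) (f g : A → A) → (∀ x → f (g x) ≡ x) → (∀ x → g (f x) ≡ x) →
                map f (Finite.list fin) ↭ Finite.list fin
  bijection-↭ fin f g fg gf = unique-↭ (Unique-map⁺ inj unique) unique (λ {x} _ → complete x)
    (λ {x} _ → subst (_∈ map f list) (fg x) (∈-map⁺ f (complete (g x))))
    where
    open Finite fin
    inj : ∀ {x y} → f x ≡ f y → x ≡ y
    inj {x} {y} e = trans (sym (gf x)) (trans (cong g e) (gf y))

finite-× : ∀ {A B : Set} → Finite A → Finite B → Finite (A × B)
finite-× fa fb = record
  { list     = cartesianProduct (Finite.list fa) (Finite.list fb)
  ; complete = λ (x , y) → ∈-cartesianProduct⁺ (Finite.complete fa x) (Finite.complete fb y)
  ; unique   = Unique-× (Finite.unique fa) (Finite.unique fb) }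

finite-×-length : ∀ {A B : Set} (fa : Finite A) (fb : Finite B) →
  length (Finite.list (finite-× fa fb)) ≡ length (Finite.list fa) *ℕ length (Finite.list fb)
finite-×-length {A} {B} fa fb = go (Finite.list fa)
  where
  ys = Finite.list fb
  go : ∀ (xs : List A) → length (cartesianProduct xs ys) ≡ length xs *ℕ length ys
  go []       = refl
  go (x ∷ xs) = trans (length-++ (map (x ,_) ys)) (cong₂ _+ℕ_ (length-map (x ,_) ys) (go xs))

module Fold {C : Set} {_∙_ : C → C → C} {ε : C} (isCM : IsCommutativeMonoid _≡_ _∙_ ε) where
  open IsCommutativeMonoid isCM using (assoc; comm; identityˡ; identityʳ)

  interchange : ∀ a b c d → (a ∙ b) ∙ (c ∙ d) ≡ (a ∙ c) ∙ (b ∙ d)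
  interchange a b c d = begin
    (a ∙ b) ∙ (c ∙ d) ≡⟨ assoc a b (c ∙ d) ⟩
    a ∙ (b ∙ (c ∙ d)) ≡⟨ cong (a ∙_) (trans (sym (assoc b c d)) (trans (cong (_∙ d) (comm b c)) (assoc c b d))) ⟩
    a ∙ (c ∙ (b ∙ d)) ≡⟨ assoc a c (b ∙ d) ⟨
    (a ∙ c) ∙ (b ∙ d) ∎
    where open ≡-Reasoning

  module _ {A : Set} where
    fold : (A → C) → List A → C
    fold f []       = ε
    fold f (x ∷ xs) = f x ∙ fold f xs

    fold-↭ : ∀ (f : A → C) {xs ys} → xs ↭ ys → fold f xs ≡ fold f ys
    fold-↭ f ↭refl           = refl
    fold-↭ f (↭prep x r)     = cong (f x ∙_) (fold-↭ f r)
    fold-↭ f (↭swap x y r)   = trans (sym (assoc _ _ _)) (trans (cong₂ _∙_ (comm _ _) (fold-↭ f r)) (assoc _ _ _))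
    fold-↭ f (↭trans r s)    = trans (fold-↭ f r) (fold-↭ f s)

    fold-cong : ∀ {f g : A → C} xs → (∀ {x} → x ∈ xs → f x ≡ g x) → fold f xs ≡ fold g xs
    fold-cong []       h = refl
    fold-cong (x ∷ xs) h = cong₂ _∙_ (h (here refl)) (fold-cong xs (λ q → h (there q)))

    fold-∙ : ∀ (f g : A → C) xs → fold (λ x → f x ∙ g x) xs ≡ fold f xs ∙ fold g xs
    fold-∙ f g []       = sym (identityˡ ε)
    fold-∙ f g (x ∷ xs) = trans (cong ((f x ∙ g x) ∙_) (fold-∙ f g xs)) (interchange _ _ _ _)

    fold-ε : ∀ (xs : List A) → fold (λ _ → ε) xs ≡ ε
    fold-ε []       = refl
    fold-ε (x ∷ xs) = trans (identityˡ _) (fold-ε xs)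

    fold-map : ∀ (f : A → C) (g : A → A) xs → fold f (map g xs) ≡ fold (λ x → f (g x)) xs
    fold-map f g []       = refl
    fold-map f g (x ∷ xs) = cong (f (g x) ∙_) (fold-map f g xs)

    -- Every averaging argument rests on this: translation in a group, or multiplication by a unit,
    -- only permutes the enumeration.
    fold-bijection : (fin : Finite A) (f : A → C) (g h : A → A) → (∀ x → g (h x) ≡ x) → (∀ x → h (g x) ≡ x) →
      fold (λ x → f (g x)) (Finite.list fin) ≡ fold f (Finite.list fin)
    fold-bijection fin f g h gh hg = trans (sym (fold-map f g (Finite.list fin))) (fold-↭ f (bijection-↭ fin g h gh hg))

  fold-swap : ∀ {A B : Set} (f : A → B → C) xs ys →
    fold (λ x → fold (f x) ys) xs ≡ fold (λ y → fold (λ x → f x y) xs) ys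
  fold-swap f []       ys = sym (fold-ε ys)
  fold-swap f (x ∷ xs) ys = trans (cong (fold (f x) ys ∙_) (fold-swap f xs ys)) (sym (fold-∙ (f x) _ ys))

module Sum = Fold ℕₚ.+-0-isCommutativeMonoid

sum-const : ∀ {A : Set} k (xs : List A) → Sum.fold (λ _ → k) xs ≡ length xs *ℕ k
sum-const k []       = refl
sum-const k (x ∷ xs) = cong (k +ℕ_) (sum-const k xs)

sum-ones : ∀ {A : Set} (xs : List A) → Sum.fold (λ _ → 1) xs ≡ length xs
sum-ones xs = trans (sum-const 1 xs) (ℕₚ.*-identityʳ _)

indicator : {P : Set} → Dec P → ℕ
indicator (yes _) = 1
indicator (no _)  = 0

indicator-cong : {P Q : Set} (P? : Dec P) (Q? : Dec Q) → (P → Q) → (Q → P) → indicator P? ≡ indicator Q?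
indicator-cong (yes _) (yes _) _ _ = refl
indicator-cong (no _)  (no _)  _ _ = refl
indicator-cong (yes p) (no ¬q) f _ = ⊥-elim (¬q (f p))
indicator-cong (no ¬p) (yes q) _ g = ⊥-elim (¬p (g q))

prime-power-divisor : ∀ {p} → Prime p → ∀ n {k} → k ∣ p ^ n → k ≡ 1 ⊎ p ∣ k
prime-power-divisor {p} pr zero    {k} (divides c e) = inj₁ (ℕₚ.m*n≡1⇒n≡1 c k (sym e))
prime-power-divisor {p} pr (suc n) {k} (divides c e) with euclidsLemma c k pr (divides (p ^ n) (trans (sym e) (ℕₚ.*-comm p _)))
... | inj₂ p∣k = inj₂ p∣k
... | inj₁ (divides c' refl) = prime-power-divisor pr n (divides c' (ℕₚ.*-cancelˡ-≡ _ _ p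
        (trans e (trans (cong (_*ℕ k) (ℕₚ.*-comm c' p)) (ℕₚ.*-assoc p c' k)))))
  where instance _ = prime⇒nonZero pr

-- Orbit counting for a group of prime power order.

module Orbits {I V : Set} (fin : Finite I) (_≟_ : DecidableEquality V)
  (_·_ : I → I → I) (inv : I → I) (act : I → V → V)
  (act-· : ∀ X Y v → act Y (act X v) ≡ act (X · Y) v)
  (act-inv : ∀ X v → act (inv X) (act X v) ≡ v)
  (·-invʳ : ∀ X Y → (X · Y) · inv Y ≡ X) (·-invˡ : ∀ X Y → (X · inv Y) · Y ≡ X)
  (e : I) (act-e : ∀ v → act e v ≡ v)
  {p : ℕ} (pr : Prime p) (n : ℕ) (size : length (Finite.list fin) ≡ p ^ n) where

  open Finite fin

  Orbit : V → V → Set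
  Orbit v w = ∃ λ X → act X v ≡ w

  orbit? : ∀ v w → Dec (Orbit v w)
  orbit? v w = finite-∃? fin (λ X → act X v ≟ w)

  fibre : V → V → ℕ
  fibre v w = Sum.fold (λ X → indicator (act X v ≟ w)) list

  -- Right translation by `Y` carries the stabiliser of `v` bijectively onto the elements that move
  -- `v` to `act Y v`.
  fibre-orbit : ∀ v w → Orbit v w → fibre v w ≡ fibre v v
  fibre-orbit v w (Y , refl) = trans
    (sym (Sum.fold-bijection fin (λ X → indicator (act X v ≟ act Y v)) (_· Y) (_· inv Y) (λ X → ·-invˡ X Y) (λ X → ·-invʳ X Y)))
    (Sum.fold-cong list λ {X} _ → indicator-cong _ _
      (λ q → trans (sym (act-inv Y _)) (trans (cong (act (inv Y)) (trans (act-· X Y v) q)) (act-inv Y v)))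
      (λ q → trans (sym (act-· X Y v)) (cong (act Y) q)))

  indicator-sum : ∀ {O : List V} → Unique O → ∀ {v} → v ∈ O → Sum.fold (λ w → indicator (v ≟ w)) O ≡ 1
  indicator-sum {w ∷ ws} (pw ∷ u) {v} v∈ with v ≟ w
  ... | yes refl = cong suc (trans (Sum.fold-cong ws (λ q → indicator-cong _ (no λ ()) (λ r → All-lookup pw q r) (λ ())))
                              (Sum.fold-ε {A = V} ws))
  ... | no v≢w with v∈
  ...   | here r  = ⊥-elim (v≢w r)
  ...   | there q = indicator-sum u q

  -- Double counting of the pairs (X , w) with `act X v ≡ w`: each `X` contributes one pair, each
  -- `w` in the orbit a full fibre.
  orbit-stabiliser : ∀ v {O : List V} → Unique O → (∀ w → w ∈ O → Orbit v w) → (∀ w → Orbit v w → w ∈ O) →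
    length O *ℕ fibre v v ≡ p ^ n
  orbit-stabiliser v {O} u orb mem = begin
    length O *ℕ fibre v v ≡⟨ sum-const _ O ⟨
    Sum.fold (λ _ → fibre v v) O ≡⟨ Sum.fold-cong O (λ {w} q → sym (fibre-orbit v w (orb w q))) ⟩
    Sum.fold (fibre v) O ≡⟨ Sum.fold-swap _ O list ⟩
    Sum.fold (λ X → Sum.fold (λ w → indicator (act X v ≟ w)) O) list ≡⟨ Sum.fold-cong list (λ {X} _ → indicator-sum u (mem _ (X , refl))) ⟩
    Sum.fold (λ _ → 1) list ≡⟨ sum-ones list ⟩
    length list ≡⟨ size ⟩
    p ^ n ∎
    where open ≡-Reasoning

  filter-length : ∀ {P : V → Set} (P? : ∀ v → Dec (P v)) (L : List V) →
    length L ≡ length (filter P? L) +ℕ length (filter (λ v → ¬? (P? v)) L)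
  filter-length P? []      = refl
  filter-length P? (v ∷ L) with P? v
  ... | yes _ = cong suc (filter-length P? L)
  ... | no  _ = trans (cong suc (filter-length P? L)) (sym (ℕₚ.+-suc _ _))

  -- One orbit is split off at a time. Its length divides a power of p and is not 1, since some
  -- element moves `v`. `fuel` bounds the length so that the recursion on the rest of the list is
  -- structural.
  no-fixed-points : ∀ fuel (L : List V) → length L ≤ fuel → Unique L →
    (∀ X {v} → v ∈ L → act X v ∈ L) → (∀ {v} → v ∈ L → ∃ λ X → act X v ≢ v) → p ∣ length L
  no-fixed-points fuel       []        _ _ _ _ = divides 0 refl
  no-fixed-points (suc fuel) L@(v ∷ L') (s≤s len) u stable moves =
    subst (p ∣_) (sym (filter-length (orbit? v) L)) (∣m∣n⇒∣m+n p∣O p∣R)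
    where
    O = filter (orbit? v) L
    R = filter (λ w → ¬? (orbit? v w)) L
    v∈O : v ∈ O
    v∈O = ∈-filter⁺ (orbit? v) (here refl) (e , act-e v)
    O-orb : ∀ w → w ∈ O → Orbit v w
    O-orb w q = proj₂ (∈-filter⁻ (orbit? v) {xs = L} q)
    O-mem : ∀ w → Orbit v w → w ∈ O
    O-mem w o@(X , refl) = ∈-filter⁺ (orbit? v) (stable X (here refl)) o
    p∣O : p ∣ length O
    p∣O with prime-power-divisor pr n (divides (fibre v v) (trans (sym (orbit-stabiliser v (Unique-filter⁺ (orbit? v) u) O-orb O-mem)) (ℕₚ.*-comm (length O) _)))
    ... | inj₂ d = d
    ... | inj₁ one = ⊥-elim (absurd O one v∈O (O-mem _ (proj₁ (moves (here refl)) , refl)) (proj₂ (moves (here refl))))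
      where
      absurd : ∀ (O : List V) → length O ≡ 1 → ∀ {v w} → v ∈ O → w ∈ O → ¬ (w ≢ v)
      absurd (x ∷ []) _ (here refl) (here refl) ne = ne refl
    R≤ : length R ≤ fuel
    R≤ = ℕₚ.≤-trans (ℕₚ.+-cancelˡ-≤ 1 _ _ (ℕₚ.≤-trans (ℕₚ.+-monoˡ-≤ (length R) (O≥1 O v∈O))
           (ℕₚ.≤-reflexive (sym (filter-length (orbit? v) L))))) len
      where
      O≥1 : ∀ (O : List V) {v} → v ∈ O → 1 ≤ length O
      O≥1 (_ ∷ _) _ = s≤s z≤n
    R-stable : ∀ X {w} → w ∈ R → act X w ∈ R
    R-stable X {w} q with ∈-filter⁻ (λ w → ¬? (orbit? v w)) {xs = L} q
    ... | w∈L , ¬o = ∈-filter⁺ (λ w → ¬? (orbit? v w)) (stable X w∈L) λ (Y , r) → ¬o (Y · inv X ,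
            trans (sym (act-· Y (inv X) v)) (trans (cong (act (inv X)) r) (act-inv X w)))
    p∣R : p ∣ length R
    p∣R = no-fixed-points fuel R R≤ (Unique-filter⁺ (λ w → ¬? (orbit? v w)) u) R-stable
            (λ q → moves (proj₁ (∈-filter⁻ (λ w → ¬? (orbit? v w)) {xs = L} q)))

-- Iterates, divisibility of binomial coefficients and cyclic generators.

iter : ∀ {A : Set} → ℕ → (A → A) → A → A
iter zero    f x = x
iter (suc n) f x = f (iter n f x)

iter-suc : ∀ {A : Set} n (f : A → A) x → iter n f (f x) ≡ f (iter n f x)
iter-suc zero    f x = refl
iter-suc (suc n) f x = cong f (iter-suc n f x)

iter-+ : ∀ {A : Set} m n (f : A → A) x → iter (m +ℕ n) f x ≡ iter m f (iter n f x)
iter-+ zero    n f x = refl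
iter-+ (suc m) n f x = cong f (iter-+ m n f x)

iter-* : ∀ {A : Set} m n (f : A → A) x → iter (m *ℕ n) f x ≡ iter m (iter n f) x
iter-* zero    n f x = refl
iter-* (suc m) n f x = trans (iter-+ n (m *ℕ n) f x) (cong (iter n f) (iter-* m n f x))

iter-cong : ∀ {A : Set} n {f g : A → A} → (∀ x → f x ≡ g x) → ∀ x → iter n f x ≡ iter n g x
iter-cong zero    h x = refl
iter-cong (suc n) {f} {g} h x = trans (h _) (cong g (iter-cong n h x))

prime∣!⇒≤ : ∀ {p} → Prime p → ∀ n → p ∣ n ! → p ≤ n
prime∣!⇒≤ {p} pr zero    d = ⊥-elim (Data.Nat.Primality.¬prime[1] (subst Prime (∣1⇒≡1 d) pr))
prime∣!⇒≤ {p} pr (suc n) d with euclidsLemma (suc n) (n !) pr d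
... | inj₁ d' = ∣⇒≤ d'
... | inj₂ d' = ℕₚ.m≤n⇒m≤1+n (prime∣!⇒≤ pr n d')

prime∣C : ∀ {p} → Prime p → ∀ {k} → 0 < k → k < p → p ∣ p choose k
prime∣C {p@(suc p-1)} pr {k} 0<k k<p with euclidsLemma (p choose k) (k ! *ℕ (p ∸ k) !) pr
    (subst (p ∣_) (sym eq) (m∣m*n (p-1 !)))
  where
  instance _ = k !* (p ∸ k) !≢0
  eq : (p choose k) *ℕ (k ! *ℕ (p ∸ k) !) ≡ p !
  eq = trans (cong (_*ℕ (k ! *ℕ (p ∸ k) !)) (nCk≡n!/k![n-k]! (ℕₚ.<⇒≤ k<p))) (m/n*n≡m (k![n∸k]!∣n! (ℕₚ.<⇒≤ k<p)))
... | inj₁ d = d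
... | inj₂ d with euclidsLemma (k !) ((p ∸ k) !) pr d
...   | inj₁ d' = ⊥-elim (ℕₚ.<⇒≱ k<p (prime∣!⇒≤ pr k d'))
...   | inj₂ d' = ⊥-elim (ℕₚ.<⇒≱ (ℕₚ.∸-monoʳ-< {p} 0<k (ℕₚ.<⇒≤ k<p)) (prime∣!⇒≤ pr (p ∸ k) d'))

-- A subset of ℤ/P closed under addition is generated by its least positive residue D.
module CyclicGenerator {I : Set} (fin : Finite I) (κ : I → ℕ) (P : ℕ) {{_ : NonZero P}}
  (zero-attained : ∃ λ x → κ x % P ≡ 0) (sum-attained : ∀ x y → ∃ λ z → κ z % P ≡ (κ x +ℕ κ y) % P) where

  Attained : ℕ → Set
  Attained k = ∃ λ x → κ x % P ≡ k % P

  attained? : ∀ k → Dec (Attained k)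
  attained? k = finite-∃? fin (λ x → κ x % P ℕₚ.≟ k % P)

  attained-+ : ∀ {i j} → Attained i → Attained j → Attained (i +ℕ j)
  attained-+ {i} {j} (x , ex) (y , ey) = let (z , ez) = sum-attained x y in z ,
    trans ez (trans (%-distribˡ-+ (κ x) (κ y) P) (trans (cong₂ (λ a b → (a +ℕ b) % P) ex ey) (sym (%-distribˡ-+ i j P))))

  attained-* : ∀ {i} k → Attained i → Attained (k *ℕ i)
  attained-* zero    a = let (x , e) = zero-attained in x , trans e (sym (n∣m⇒m%n≡0 0 P (divides 0 refl)))
  attained-* (suc k) a = attained-+ a (attained-* k a)

  least : ∀ k → 1 ≤ k → Attained k → ∃ λ D → 1 ≤ D × D ≤ k × Attained D × (∀ r → 1 ≤ r → r < D → ¬ Attained r)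
  least k 1≤k ak = search k (k ∸ 1) (trans (ℕₚ.+-comm (k ∸ 1) 1) (ℕₚ.m+[n∸m]≡n 1≤k)) ak (λ r 1≤r r<1 → ⊥-elim (ℕₚ.<⇒≱ r<1 1≤r))
    where
    -- The numbers 1 to `d` have been rejected, and `fuel` further failures lead to `k` itself,
    -- which is attained.
    search : ∀ k fuel {d} → fuel +ℕ suc d ≡ k → Attained k → (∀ r → 1 ≤ r → r < suc d → ¬ Attained r) →
      ∃ λ D → 1 ≤ D × D ≤ k × Attained D × (∀ r → 1 ≤ r → r < D → ¬ Attained r)
    search k zero       {d} refl ak none = suc d , s≤s z≤n , ℕₚ.≤-refl , ak , none
    search k (suc fuel) {d} e    ak none with attained? (suc d)
    ... | yes a = suc d , s≤s z≤n , subst (suc d ≤_) e (ℕₚ.m≤n+m (suc d) (suc fuel)) , a , none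
    ... | no ¬a = search k fuel (trans (ℕₚ.+-suc fuel (suc d)) e) ak λ r 1≤r r<ssd → case r 1≤r (ℕₚ.m<1+n⇒m<n∨m≡n r<ssd)
      where
      case : ∀ r → 1 ≤ r → r < suc d ⊎ r ≡ suc d → ¬ Attained r
      case r 1≤r (inj₁ r<) = none r 1≤r r<
      case r 1≤r (inj₂ refl) = ¬a

  generator : ∃ λ D → 1 ≤ D × D ∣ P × (∀ x → D ∣ κ x) × Attained D
  -- The search runs over positive numbers, so `P` is used as the representative of the residue 0.
  generator with least P (Data.Nat.>-nonZero⁻¹ P) (proj₁ zero-attained , trans (proj₂ zero-attained) (sym (n%n≡0 P)))
  ... | D , 1≤D , D≤P , aD , none = D , 1≤D , divides-attained (proj₁ zero-attained , trans (proj₂ zero-attained) (sym (n%n≡0 P))) , (λ x → divides-attained (x , refl)) , aD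
    where
    instance _ = Data.Nat.>-nonZero 1≤D
    divides-attained : ∀ {k} → Attained k → D ∣ k
    divides-attained {k} ak with k % D in eq
    ... | zero  = m%n≡0⇒n∣m k D eq
    ... | suc r = ⊥-elim (none (suc r) (s≤s z≤n) (subst (_< D) eq (m%n<n k D)) (x , trans ex residue))
      where
      q = k / D
      -- The attained residues are closed under addition only; subtracting q D modulo P is adding (P
      -- - 1) q D.
      att : Attained (k +ℕ (P ∸ 1) *ℕ q *ℕ D)
      att = attained-+ ak (attained-* ((P ∸ 1) *ℕ q) aD)
      x = proj₁ att
      ex = proj₂ att
      residue : (k +ℕ (P ∸ 1) *ℕ q *ℕ D) % P ≡ suc r % P
      residue = trans (cong (_% P) (begin
          k +ℕ (P ∸ 1) *ℕ q *ℕ D ≡⟨ cong (_+ℕ (P ∸ 1) *ℕ q *ℕ D) (trans (m≡m%n+[m/n]*n k D) (cong (_+ℕ q *ℕ D) eq)) ⟩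
          suc r +ℕ q *ℕ D +ℕ (P ∸ 1) *ℕ q *ℕ D ≡⟨ rearrange (suc r) q D (P ∸ 1) ⟩
          suc r +ℕ q *ℕ D *ℕ suc (P ∸ 1) ≡⟨ cong (λ n → suc r +ℕ q *ℕ D *ℕ n) (ℕₚ.suc-pred P) ⟩
          suc r +ℕ q *ℕ D *ℕ P ∎)) ([m+kn]%n≡m%n (suc r) (q *ℕ D) P)
        where
        open ≡-Reasoning
        rearrange : ∀ r q d n → r +ℕ q *ℕ d +ℕ n *ℕ q *ℕ d ≡ r +ℕ q *ℕ d *ℕ suc n
        rearrange = solve 4 (λ r q d n → r :+ q :* d :+ n :* q :* d := r :+ q :* d :* (con 1 :+ n)) refl
          where open +-*-Solver

prime-power-form : ∀ {p} → Prime p → ∀ n {k} → k ∣ p ^ n → ∃ λ j → k ≡ p ^ j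
prime-power-form pr zero    d = 0 , Data.Nat.Divisibility.∣1⇒≡1 d
prime-power-form {p} pr (suc n) d with prime-power-divisor pr (suc n) d
... | inj₁ one = 0 , one
... | inj₂ (divides k' refl) with prime-power-form pr n {k'} (*-cancelʳ-∣ p {{prime⇒nonZero pr}} (subst (k' *ℕ p ∣_) (ℕₚ.*-comm p (p ^ n)) d))
...   | j , refl = suc j , ℕₚ.*-comm (p ^ j) p

-- The field: ring normalisation, root counting, characteristic.

module Development (F : FiniteField) (p m : ℕ) (pr : Prime p) (card≡ : FiniteField.card F ≡ p ^ m) (m≥1 : 1 ≤ m) (p≢2 : p ≢ 2) where
  open FiniteField F public

  open IsCommutativeRing isCommutativeRing public
    using (+-assoc; +-comm; *-assoc; *-comm; +-identityˡ; +-identityʳ; *-identityˡ; *-identityʳ; -‿inverseˡ; -‿inverseʳ; distribˡ; distribʳ; zeroˡ; zeroʳ; +-isCommutativeMonoid; *-isCommutativeMonoid)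

  commutativeRing : CommutativeRing _ _
  commutativeRing = record { isCommutativeRing = isCommutativeRing }

  private
    module R = Algebra.Properties.Ring (CommutativeRing.ring commutativeRing)

    -- The separate clause for 1 makes the solver constant 1 denote `1#` itself instead of
    -- `1# + 0#`, so that goals match definitionally.
    nat : ℕ → Carrier
    nat 0             = 0#
    nat 1             = 1#
    nat (suc (suc n)) = 1# + nat (suc n)

    nat-suc : ∀ n → nat (suc n) ≡ 1# + nat n
    nat-suc zero    = sym (+-identityʳ 1#)
    nat-suc (suc n) = refl

    int : ℤ → Carrier
    int (pos n)      = nat n
    int (-[1+ n ]) = - nat (suc n)

    nat-+ : ∀ m n → nat (m +ℕ n) ≡ nat m + nat n
    nat-+ zero    n = sym (+-identityˡ _)
    nat-+ (suc m) n = trans (nat-suc (m +ℕ n)) (trans (cong (1# +_) (nat-+ m n)) (trans (sym (+-assoc _ _ _)) (cong (_+ nat n) (sym (nat-suc m)))))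

    nat-* : ∀ m n → nat (m *ℕ n) ≡ nat m * nat n
    nat-* zero    n = sym (zeroˡ _)
    nat-* (suc m) n = trans (nat-+ n (m *ℕ n)) (trans (cong₂ _+_ (sym (*-identityˡ _)) (nat-* m n))
                        (trans (sym (distribʳ _ _ _)) (cong (_* nat n) (sym (nat-suc m)))))

    cancel-common : ∀ x y z → (x + y) + - (x + z) ≡ y + - z
    cancel-common x y z = begin
      (x + y) + - (x + z) ≡⟨ cong₂ _+_ (+-comm x y) (R.-‿anti-homo-+ x z) ⟩
      (y + x) + (- z + - x) ≡⟨ +-assoc y x _ ⟩
      y + (x + (- z + - x)) ≡⟨ cong (y +_) (trans (cong (x +_) (+-comm (- z) (- x))) (trans (sym (+-assoc x (- x) (- z))) (trans (cong (_+ - z) (-‿inverseʳ x)) (+-identityˡ _)))) ⟩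
      y + - z ∎
      where open ≡-Reasoning

    int-⊖ : ∀ m n → int (m ℤ.⊖ n) ≡ nat m + - nat n
    int-⊖ m       zero    = sym (trans (cong (nat m +_) R.-0#≈0#) (+-identityʳ _))
    int-⊖ zero    (suc n) = sym (+-identityˡ _)
    int-⊖ (suc m) (suc n) = trans (cong int (ℤₚ.[1+m]⊖[1+n]≡m⊖n m n)) (trans (int-⊖ m n)
      (trans (sym (cancel-common 1# (nat m) (nat n))) (cong₂ (λ x y → x + - y) (sym (nat-suc m)) (sym (nat-suc n)))))

    int-neg : ∀ x → int (ℤ.- x) ≡ - int x
    int-neg (pos zero)   = sym R.-0#≈0#
    int-neg (pos (suc n))  = refl
    int-neg -[1+ n ]   = sym (R.-‿involutive _)

    int-+ : ∀ x y → int (x ℤ.+ y) ≡ int x + int y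
    int-+ (pos m)    (pos n)    = nat-+ m n
    int-+ (pos m)    -[1+ n ] = int-⊖ m (suc n)
    int-+ -[1+ m ] (pos n)    = trans (int-⊖ n (suc m)) (+-comm _ _)
    int-+ -[1+ m ] -[1+ n ] = trans (cong (λ k → - nat k) (sym (ℕₚ.+-suc (suc m) n)))
                                (trans (cong -_ (nat-+ (suc m) (suc n))) (trans (R.-‿anti-homo-+ _ _) (+-comm _ _)))

    int-*⁺ : ∀ m y → int ((pos m) ℤ.* y) ≡ nat m * int y
    int-*⁺ m (pos n)    = trans (cong int (sym (ℤₚ.pos-* m n))) (nat-* m n)
    int-*⁺ m -[1+ n ] = trans (cong int (sym (ℤₚ.neg-distribʳ-* (pos m) (pos (suc n))))) (trans (int-neg ((pos m) ℤ.* (pos (suc n))))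
                          (trans (cong -_ (int-*⁺ m (pos (suc n)))) (R.-‿distribʳ-* _ _)))

    int-* : ∀ x y → int (x ℤ.* y) ≡ int x * int y
    int-* (pos m)    y = int-*⁺ m y
    int-* -[1+ m ] y = trans (cong int (sym (ℤₚ.neg-distribˡ-* (pos (suc m)) y))) (trans (int-neg ((pos (suc m)) ℤ.* y))
                         (trans (cong -_ (int-*⁺ (suc m) y)) (R.-‿distribˡ-* _ _)))

    -- Integer coefficients have equality decided by computation, so the solver can cancel terms
    -- such as x - x over an abstract field.
    ℤ-rawRing : RawRing _ _
    ℤ-rawRing = record { Carrier = ℤ ; _≈_ = _≡_ ; _+_ = ℤ._+_ ; _*_ = ℤ._*_ ; -_ = ℤ.-_ ; 0# = pos 0 ; 1# = pos 1 }

    int-morphism : ℤ-rawRing -Raw-AlmostCommutative⟶ fromCommutativeRing commutativeRing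
    int-morphism = record { ⟦_⟧ = int ; +-homo = int-+ ; *-homo = int-* ; -‿homo = int-neg ; 0-homo = refl ; 1-homo = refl }

    int-≟ : ∀ x y → Maybe (int x ≡ int y)
    int-≟ x y with x ℤ.≟ y
    ... | yes e = just (cong int e)
    ... | no _  = nothing

  open Algebra.Solver.Ring ℤ-rawRing (fromCommutativeRing commutativeRing) int-morphism int-≟ public
    using (solve; _:=_; _:+_; _:*_; _:-_; :-_; con; Polynomial)

  `0 `1 : ∀ {n} → Polynomial n
  `0 = con (pos 0)
  `1 = con (pos 1)

  infixl 6 _-_
  _-_ : Carrier → Carrier → Carrier
  x - y = x + (- y)

  finiteF : Finite Carrier
  finiteF = record { list = elements ; complete = elements-complete ; unique = elements-unique }

  infix 4 _≟_
  _≟_ : DecidableEquality Carrier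
  _≟_ = finite-≟ finiteF

  -- From x ≡ y deduce a ≡ b whenever a - b is a multiple k (x - y); the side condition is a ring identity.
  combine₁ : ∀ {a b x y} k → x ≡ y → a + k * y ≡ b + k * x → a ≡ b
  combine₁ {a} {b} {x} k refl h = begin
    a ≡⟨ (solve 3 (λ a b c → a := a :+ b :* c :- b :* c) refl a k x) ⟩
    a + k * x - k * x ≡⟨ cong (_- k * x) h ⟩
    b + k * x - k * x ≡⟨ (solve 3 (λ a b c → a :+ b :* c :- b :* c := a) refl b k x) ⟩
    b ∎
    where open ≡-Reasoning

  combine₂ : ∀ {a b x y x' y'} k k' → x ≡ y → x' ≡ y' → a + k * y + k' * y' ≡ b + k * x + k' * x' → a ≡ b
  combine₂ {a} {b} {x} {y} {x'} {y'} k k' e e' h = combine₁ k e (combine₁ k' e' h)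

  combine₃ : ∀ {a b x y x' y' x'' y''} k k' k'' → x ≡ y → x' ≡ y' → x'' ≡ y'' →
    a + k * y + k' * y' + k'' * y'' ≡ b + k * x + k' * x' + k'' * x'' → a ≡ b
  combine₃ k k' k'' e e' e'' h = combine₂ k k' e e' (combine₁ k'' e'' h)

  x-y≡0⇒x≡y : ∀ {x y} → x - y ≡ 0# → x ≡ y
  x-y≡0⇒x≡y {x} {y} e = combine₁ 1# e (solve 2 (λ a b → a :+ `1 :* `0 := b :+ `1 :* (a :- b)) refl x y)

  x≡y⇒x-y≡0 : ∀ {x y} → x ≡ y → x - y ≡ 0#
  x≡y⇒x-y≡0 {x} {y} e = combine₁ 1# e (solve 2 (λ a b → a :- b :+ `1 :* b := `0 :+ `1 :* a) refl x y)

  inverseˡ : ∀ x → x ≢ 0# → x ⁻¹ * x ≡ 1#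
  inverseˡ x ne = trans (*-comm _ _) (inverseʳ x ne)

  1≢0 : 1# ≢ 0#
  1≢0 e = 0≢1 (sym e)

  *-zero-split : ∀ {x y} → x * y ≡ 0# → x ≡ 0# ⊎ y ≡ 0#
  *-zero-split {x} {y} e with x ≟ 0#
  ... | yes z = inj₁ z
  ... | no nz = inj₂ (combine₂ (x ⁻¹) (- y) e (inverseʳ x nz)
                  (solve 3 (λ a b c → a :+ b :* `0 :+ :- a :* `1 := `0 :+ b :* (c :* a) :+ :- a :* (c :* b)) refl y (x ⁻¹) x))

  *-nonzero : ∀ {x y} → x ≢ 0# → y ≢ 0# → x * y ≢ 0#
  *-nonzero nx ny e with *-zero-split e
  ... | inj₁ z = nx z
  ... | inj₂ z = ny z

  *-cancelˡ-zero : ∀ {x y} → x ≢ 0# → x * y ≡ 0# → y ≡ 0#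
  *-cancelˡ-zero nx e with *-zero-split e
  ... | inj₁ z = ⊥-elim (nx z)
  ... | inj₂ z = z

  *-cancelˡ : ∀ {x y z} → x ≢ 0# → x * y ≡ x * z → y ≡ z
  *-cancelˡ {x} {y} {z} nx e = x-y≡0⇒x≡y (*-cancelˡ-zero nx (combine₁ 1# e
    (solve 3 (λ a b c → a :* (b :- c) :+ `1 :* (a :* c) := `0 :+ `1 :* (a :* b)) refl x y z)))

  ⁻¹-nonzero : ∀ {x} → x ≢ 0# → x ⁻¹ ≢ 0#
  ⁻¹-nonzero {x} nx e = 1≢0 (trans (sym (inverseʳ x nx)) (trans (cong (x *_) e) (zeroʳ x)))

  -- monic cs x is the monic polynomial of degree (length cs) with lower coefficients cs, evaluated at x.
  monic : List Carrier → Carrier → Carrier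
  monic []       x = 1#
  monic (c ∷ cs) x = c + x * monic cs x

  -- Synthetic division by x - r. With leading coefficients left implicit the quotient is again
  -- monic, so the root bound becomes an induction on the length of the list.
  record Quotient (r : Carrier) (cs : List Carrier) (n : ℕ) : Set where
    field
      coeffs : List Carrier
      degree : length coeffs ≡ n
      factor : ∀ x → monic cs x - monic cs r ≡ (x - r) * monic coeffs x

  monic-add : ∀ r (cs ds : List Carrier) → length cs ≡ suc (length ds) →
    ∃ λ es → length es ≡ length cs × (∀ x → monic es x ≡ monic cs x + r * monic ds x)
  monic-add r (c ∷ []) [] refl = (c + r) ∷ [] , refl , λ x → (solve 3 (λ a b c → a :+ b :+ c :* `1 := a :+ c :* `1 :+ b :* `1) refl c r x)
  monic-add r (c ∷ c' ∷ cs) (d ∷ ds) e with monic-add r (c' ∷ cs) ds (ℕₚ.suc-injective e)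
  ... | es , len , h = (c + r * d) ∷ es , cong suc len , λ x → begin
    (c + r * d) + x * monic es x ≡⟨ cong (λ y → (c + r * d) + x * y) (h x) ⟩
    (c + r * d) + x * (monic (c' ∷ cs) x + r * monic ds x) ≡⟨ (solve 6 (λ a b c d e f → a :+ b :* c :+ d :* (e :+ b :* f) := a :+ d :* e :+ b :* (c :+ d :* f)) refl c r d x (monic (c' ∷ cs) x) (monic ds x)) ⟩
    (c + x * monic (c' ∷ cs) x) + r * (d + x * monic ds x) ∎
    where open ≡-Reasoning

  monic-quotient : ∀ r c cs → Quotient r (c ∷ cs) (length cs)
  monic-quotient r c [] = record { coeffs = [] ; degree = refl ; factor = λ x → (solve 3 (λ a b c → a :+ b :* `1 :- (a :+ c :* `1) := (b :- c) :* `1) refl c x r) }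
  monic-quotient r c (c' ∷ cs) with monic-quotient r c' cs
  ... | record { coeffs = ds ; degree = len ; factor = fac } with monic-add r (c' ∷ cs) ds (cong suc (sym len))
  ...   | es , len' , h = record { coeffs = es ; degree = len' ; factor = λ x →
          combine₂ r (x - r) (fac x) (sym (h x))
            (solve 7 (λ a b c d e f g → a :+ b :* c :- (a :+ d :* e) :+ d :* ((b :- d) :* f) :+ (b :- d) :* g := (b :- d) :* g :+ d :* (c :- e) :+ (b :- d) :* (c :+ d :* f)) refl c x (monic (c' ∷ cs) x) r (monic (c' ∷ cs) r) (monic ds x) (monic es x)) }

  root-bound : ∀ cs (rs : List Carrier) → Unique rs → All (λ r → monic cs r ≡ 0#) rs → length rs ≤ length cs
  root-bound cs       []       _        _        = z≤n
  root-bound []       (r ∷ rs) _        (z ∷ _)  = ⊥-elim (1≢0 z)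
  root-bound (c ∷ cs) (r ∷ rs) (ne ∷ u) (z ∷ zs) with monic-quotient r c cs
  ... | record { coeffs = ds ; degree = len ; factor = fac } = s≤s (subst (length rs ≤_) len (root-bound ds rs u (go rs ne zs)))
    where
    go : ∀ rs → All (r ≢_) rs → All (λ x → monic (c ∷ cs) x ≡ 0#) rs → All (λ x → monic ds x ≡ 0#) rs
    go []       []         []         = []
    go (x ∷ xs) (ne ∷ nes) (zx ∷ zxs) = *-cancelˡ-zero (λ e → ne (sym (x-y≡0⇒x≡y e)))
      (trans (sym (fac x)) (x≡y⇒x-y≡0 (trans zx (sym z)))) ∷ go xs nes zxs

  -- The Frobenius endomorphism

  open Theory F p hiding (_-_; gen; unit; mul; inv) public

  instance
    p-nonZero : NonZero p
    p-nonZero = prime⇒nonZero pr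
    m-nonZero : NonZero m
    m-nonZero = Data.Nat.>-nonZero m≥1

  p≥2 : 2 ≤ p
  p≥2 = Data.Nat.nonTrivial⇒n>1 p {{prime⇒nonTrivial pr}}

  module Σᶠ = Fold +-isCommutativeMonoid
  module Πᶠ = Fold *-isCommutativeMonoid

  ι-+ : ∀ i j → ι (i +ℕ j) ≡ ι i + ι j
  ι-+ zero    j = sym (+-identityˡ _)
  ι-+ (suc i) j = trans (cong (1# +_) (ι-+ i j)) (sym (+-assoc _ _ _))

  ι-* : ∀ i j → ι (i *ℕ j) ≡ ι i * ι j
  ι-* zero    j = sym (zeroˡ _)
  ι-* (suc i) j = trans (ι-+ j (i *ℕ j)) (trans (cong (ι j +_) (ι-* i j)) (solve 2 (λ a b → a :+ b :* a := (`1 :+ b) :* a) refl (ι j) (ι i)))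

  pow-nonzero : ∀ {x} n → x ≢ 0# → pow x n ≢ 0#
  pow-nonzero zero    nx = 1≢0
  pow-nonzero (suc n) nx = *-nonzero nx (pow-nonzero n nx)

  -- Translation by `1#` permutes the field. The sum of all elements therefore equals itself plus
  -- `card` copies of 1.
  ι-card : ι card ≡ 0#
  ι-card = combine₁ 1# shifted (solve 2 (λ a b → a :+ `1 :* b := `0 :+ `1 :* (a :+ b)) refl (ι card) T)
    where
    T = Σᶠ.fold (λ x → x) elements
    count : ∀ xs → Σᶠ.fold (λ _ → 1#) xs ≡ ι (length {A = Carrier} xs)
    count []       = refl
    count (x ∷ xs) = cong (1# +_) (count xs)
    shifted : ι card + T ≡ T
    shifted = begin
      ι card + T ≡⟨ cong (_+ T) (count elements) ⟨
      Σᶠ.fold (λ _ → 1#) elements + T ≡⟨ Σᶠ.fold-∙ (λ _ → 1#) (λ x → x) elements ⟨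
      Σᶠ.fold (λ x → 1# + x) elements ≡⟨ Σᶠ.fold-bijection finiteF (λ x → x) (1# +_) (λ x → x - 1#)
                                               (λ x → (solve 1 (λ a → `1 :+ (a :- `1) := a) refl x)) (λ x → (solve 1 (λ a → `1 :+ a :- `1 := a) refl x)) ⟩
      T ∎
      where open ≡-Reasoning

  ι-p : ι p ≡ 0#
  ι-p with ι p ≟ 0#
  ... | yes z = z
  ... | no nz = ⊥-elim (pow-nonzero m nz (trans (sym (ι-^ m)) (trans (cong ι (sym card≡)) ι-card)))
    where
    ι-^ : ∀ n → ι (p ^ n) ≡ pow (ι p) n
    ι-^ zero    = +-identityʳ 1#
    ι-^ (suc n) = trans (ι-* p (p ^ n)) (cong (ι p *_) (ι-^ n))

  ι-∣ : ∀ {k} → p ∣ k → ι k ≡ 0#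
  ι-∣ (divides c refl) = trans (ι-* c p) (trans (cong (ι c *_) ι-p) (zeroʳ _))

  -- Otherwise the residue of k is prime to p, and Bézout expresses 1 through two numbers that both
  -- vanish in the field.
  ι-zero : ∀ {k} → ι k ≡ 0# → p ∣ k
  ι-zero {k} e with k % p in eq
  ... | zero  = m%n≡0⇒n∣m k p eq
  ... | suc r = ⊥-elim (absurd (coprime-Bézout (prime⇒coprime pr (subst (_< p) eq (m%n<n k p)))))
    where
    ι-r : ι (suc r) ≡ 0#
    ι-r = begin
      ι (suc r) ≡⟨ +-identityʳ _ ⟨
      ι (suc r) + 0# ≡⟨ cong₂ _+_ (cong ι (sym eq)) (sym (ι-∣ {k / p *ℕ p} (divides (k / p) refl))) ⟩
      ι (k % p) + ι (k / p *ℕ p) ≡⟨ ι-+ (k % p) _ ⟨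
      ι (k % p +ℕ k / p *ℕ p) ≡⟨ cong ι (m≡m%n+[m/n]*n k p) ⟨
      ι k ≡⟨ e ⟩
      0# ∎
      where open ≡-Reasoning
    mult : ∀ c {n} → ι n ≡ 0# → ι (c *ℕ n) ≡ 0#
    mult c {n} z = trans (ι-* c n) (trans (cong (ι c *_) z) (zeroʳ _))
    absurd : Bézout.Identity 1 p (suc r) → ⊥
    absurd (Bézout.+- x y q) = 1≢0 (begin
      1# ≡⟨ +-identityʳ 1# ⟨
      1# + 0# ≡⟨ cong (1# +_) (mult y ι-r) ⟨
      ι (1 +ℕ y *ℕ suc r) ≡⟨ cong ι q ⟩
      ι (x *ℕ p) ≡⟨ mult x ι-p ⟩
      0# ∎)
      where open ≡-Reasoning
    absurd (Bézout.-+ x y q) = 1≢0 (begin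
      1# ≡⟨ +-identityʳ 1# ⟨
      1# + 0# ≡⟨ cong (1# +_) (mult x ι-p) ⟨
      ι (1 +ℕ x *ℕ p) ≡⟨ cong ι q ⟩
      ι (y *ℕ suc r) ≡⟨ mult y ι-r ⟩
      0# ∎)
      where open ≡-Reasoning

  private
    ordered : ∀ {i j} → i ≤ j → j < p → ι i ≡ ι j → i ≡ j
    ordered {i} {j} i≤j j<p e with j ∸ i in eq
    ... | zero  = ℕₚ.≤-antisym i≤j (ℕₚ.m∸n≡0⇒m≤n eq)
    ... | suc d = ⊥-elim (ℕₚ.<⇒≱ (ℕₚ.≤-<-trans (ℕₚ.m∸n≤m j i) j<p) (subst (p ≤_) (sym eq) (∣⇒≤ (ι-zero
            (combine₁ (- 1#) (trans e (trans (cong ι (trans (sym (ℕₚ.m+[n∸m]≡n i≤j)) (cong (i +ℕ_) eq))) (ι-+ i (suc d))))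
              (solve 2 (λ a b → a :+ :- `1 :* (b :+ a) := `0 :+ :- `1 :* b) refl (ι (suc d)) (ι i)))))))

  ι-injective : ∀ {i j} → i < p → j < p → ι i ≡ ι j → i ≡ j
  ι-injective {i} {j} i<p j<p e with ℕₚ.≤-total i j
  ... | inj₁ i≤j = ordered i≤j j<p e
  ... | inj₂ j≤i = sym (ordered j≤i i<p (sym e))

  ι-% : ∀ k → ι (k % p) ≡ ι k
  ι-% k = sym (trans (cong ι (m≡m%n+[m/n]*n k p)) (trans (ι-+ (k % p) _)
            (trans (cong (ι (k % p) +_) (ι-∣ {k / p *ℕ p} (divides (k / p) refl))) (+-identityʳ _))))

  ι-cong-% : ∀ {i j} → ι i ≡ ι j → i % p ≡ j % p
  ι-cong-% {i} {j} e = ι-injective (m%n<n i p) (m%n<n j p) (trans (ι-% i) (trans e (sym (ι-% j))))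

  sum-cong : ∀ n {f g : ℕ → Carrier} → (∀ i → i < n → f i ≡ g i) → sumBelow n f ≡ sumBelow n g
  sum-cong zero    h = refl
  sum-cong (suc n) h = cong₂ _+_ (sum-cong n (λ i i<n → h i (ℕₚ.m<n⇒m<1+n i<n))) (h n ℕₚ.≤-refl)

  sum-+ : ∀ n (f g : ℕ → Carrier) → sumBelow n (λ i → f i + g i) ≡ sumBelow n f + sumBelow n g
  sum-+ zero    f g = sym (+-identityˡ 0#)
  sum-+ (suc n) f g = trans (cong (_+ (f n + g n)) (sum-+ n f g))
    (solve 4 (λ a b c d → a :+ b :+ (c :+ d) := a :+ c :+ (b :+ d)) refl (sumBelow n f) (sumBelow n g) (f n) (g n))

  sum-* : ∀ n c (f : ℕ → Carrier) → sumBelow n (λ i → c * f i) ≡ c * sumBelow n f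
  sum-* zero    c f = sym (zeroʳ c)
  sum-* (suc n) c f = trans (cong (_+ c * f n) (sum-* n c f)) (sym (distribˡ c _ _))

  sum-zero : ∀ n {f : ℕ → Carrier} → (∀ i → i < n → f i ≡ 0#) → sumBelow n f ≡ 0#
  sum-zero zero    h = refl
  sum-zero (suc n) h = trans (cong₂ _+_ (sum-zero n (λ i i<n → h i (ℕₚ.m<n⇒m<1+n i<n))) (h n ℕₚ.≤-refl)) (+-identityˡ 0#)

  sum-front : ∀ n (f : ℕ → Carrier) → sumBelow (suc n) f ≡ f 0 + sumBelow n (λ i → f (suc i))
  sum-front zero    f = trans (+-identityˡ _) (sym (+-identityʳ _))
  sum-front (suc n) f = trans (cong (_+ f (suc n)) (sum-front n f)) (+-assoc _ _ _)

  Additive : (Carrier → Carrier) → Set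
  Additive f = ∀ x y → f (x + y) ≡ f x + f y

  module AdditiveMap {f : Carrier → Carrier} (f-+ : Additive f) where
    map-0 : f 0# ≡ 0#
    map-0 = combine₁ (- 1#) (trans (cong f (sym (+-identityˡ 0#))) (f-+ 0# 0#)) (solve 1 (λ a → a :+ :- `1 :* (a :+ a) := `0 :+ :- `1 :* a) refl (f 0#))

    map-neg : ∀ x → f (- x) ≡ - f x
    map-neg x = combine₁ 1# (trans (sym (f-+ (- x) x)) (trans (cong f (-‿inverseˡ x)) map-0))
      (solve 2 (λ a b → a :+ `1 :* `0 := :- b :+ `1 :* (a :+ b)) refl (f (- x)) (f x))

    map-- : ∀ x y → f (x - y) ≡ f x - f y
    map-- x y = trans (f-+ x (- y)) (cong (f x +_) (map-neg y))

    map-sum : ∀ n (g : ℕ → Carrier) → f (sumBelow n g) ≡ sumBelow n (λ i → f (g i))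
    map-sum zero    g = map-0
    map-sum (suc n) g = trans (f-+ _ _) (cong (_+ f (g n)) (map-sum n g))

    map-ι : ∀ n x → f (ι n * x) ≡ ι n * f x
    map-ι zero    x = trans (cong f (zeroˡ x)) (trans map-0 (sym (zeroˡ _)))
    map-ι (suc n) x = trans (cong f (solve 2 (λ a b → (`1 :+ a) :* b := b :+ a :* b) refl (ι n) x)) (trans (f-+ x (ι n * x))
      (trans (cong (f x +_) (map-ι n x)) (solve 2 (λ a b → a :+ b :* a := (`1 :+ b) :* a) refl (f x) (ι n))))

    iter-additive : ∀ n → Additive (iter n f)
    iter-additive zero    x y = refl
    iter-additive (suc n) x y = trans (cong f (iter-additive n x y)) (f-+ _ _)

  -- The coordinate of an n-th power: repeated multiplication by an element that acts as φ adds up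
  -- the first n conjugates of its coordinate.
  orbitSum : ℕ → (Carrier → Carrier) → Carrier → Carrier
  orbitSum n φ x = sumBelow n (λ i → iter i φ x)

  -- With φ = 1 + N the binomial theorem gives 1 + φ + ... + φ^(p-1) = N^(p-1) and φ^p = 1 + N^p in characteristic p.
  module Unipotent (N : Carrier → Carrier) (N-+ : Additive N) (φ : Carrier → Carrier) (φ≡ : ∀ x → φ x ≡ x + N x) where
    open AdditiveMap N-+

    iter-orbitSum : ∀ n x → iter n φ x ≡ x + N (orbitSum n φ x)
    iter-orbitSum zero    x = sym (trans (cong (x +_) map-0) (+-identityʳ x))
    iter-orbitSum (suc n) x = begin
      φ (iter n φ x) ≡⟨ φ≡ _ ⟩
      iter n φ x + N (iter n φ x) ≡⟨ cong (_+ N (iter n φ x)) (iter-orbitSum n x) ⟩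
      x + N (orbitSum n φ x) + N (iter n φ x) ≡⟨ +-assoc _ _ _ ⟩
      x + (N (orbitSum n φ x) + N (iter n φ x)) ≡⟨ cong (x +_) (N-+ _ _) ⟨
      x + N (orbitSum n φ x + iter n φ x) ∎
      where open ≡-Reasoning

    -- The sum is padded to a fixed length `K`, the surplus binomials being zero, so that Pascal's
    -- rule applies term by term in the induction on `n`.
    expansion : ∀ K n → n ≤ K → ∀ x → orbitSum n φ x ≡ sumBelow K (λ j → ι (n choose suc j) * iter j N x)
    expansion K zero    _    x = sym (sum-zero K (λ j _ → zeroˡ _))
    expansion K (suc n) n<K  x = begin
      orbitSum n φ x + iter n φ x ≡⟨ cong (orbitSum n φ x +_) (iter-orbitSum n x) ⟩
      orbitSum n φ x + (x + N (orbitSum n φ x)) ≡⟨ cong₂ (λ y z → y + (x + z)) ih (trans (cong N ih) (trans (map-sum K _) (sum-cong K λ j _ → map-ι (n choose suc j) (iter j N x)))) ⟩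
      sumBelow K A + (x + sumBelow K (λ j → B (suc j))) ≡⟨ cong (λ y → sumBelow K A + (y + sumBelow K (λ j → B (suc j)))) (solve 1 (λ a → a := (`1 :+ `0) :* a) refl x) ⟩
      sumBelow K A + (B 0 + sumBelow K (λ j → B (suc j))) ≡⟨ cong (sumBelow K A +_) (sum-front K B) ⟨
      sumBelow K A + (sumBelow K B + B K) ≡⟨ cong (λ y → sumBelow K A + (sumBelow K B + ι y * iter K N x)) (k>n⇒nCk≡0 n<K) ⟩
      sumBelow K A + (sumBelow K B + 0# * iter K N x) ≡⟨ (solve 3 (λ a b c → a :+ (b :+ `0 :* c) := a :+ b) refl (sumBelow K A) (sumBelow K B) (iter K N x)) ⟩
      sumBelow K A + sumBelow K B ≡⟨ sum-+ K A B ⟨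
      sumBelow K (λ j → A j + B j) ≡⟨ sum-cong K (λ j _ → pascal j) ⟩
      sumBelow K (λ j → ι (suc n choose suc j) * iter j N x) ∎
      where
      open ≡-Reasoning
      A B : ℕ → Carrier
      A j = ι (n choose suc j) * iter j N x
      B j = ι (n choose j) * iter j N x
      ih = expansion K n (ℕₚ.<⇒≤ n<K) x
      pascal : ∀ j → A j + B j ≡ ι (suc n choose suc j) * iter j N x
      pascal j = trans (solve 3 (λ a b c → a :* b :+ c :* b := (c :+ a) :* b) refl (ι (n choose suc j)) (iter j N x) (ι (n choose j)))
        (cong (_* iter j N x) (trans (sym (ι-+ (n choose j) (n choose suc j))) (cong ι (nCk+nC[k+1]≡[n+1]C[k+1] n j))))

    orbitSum-p : ∀ x → orbitSum p φ x ≡ iter (p ∸ 1) N x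
    orbitSum-p x = trans (expansion p p ℕₚ.≤-refl x) (last p refl)
      where
      last : ∀ n → n ≡ p → sumBelow n (λ j → ι (p choose suc j) * iter j N x) ≡ iter (n ∸ 1) N x
      last zero    e = ⊥-elim (ℕₚ.<⇒≱ p≥2 (subst (_≤ 1) e z≤n))
      last (suc n) e = trans (cong₂ _+_
          (sum-zero n λ j j<n → trans (cong (_* iter j N x) (ι-∣ (prime∣C pr (s≤s z≤n) (subst (suc j <_) e (s≤s j<n))))) (zeroˡ _))
          (cong (λ k → ι k * iter n N x) (trans (cong (p choose_) e) (nCn≡1 p))))
        (solve 1 (λ a → `0 :+ (`1 :+ `0) :* a := a) refl (iter n N x))

    iter-p : ∀ x → iter p φ x ≡ x + iter p N x
    iter-p x = trans (iter-orbitSum p x) (cong (x +_) (trans (cong N (orbitSum-p x)) (cong (λ n → iter n N x) (ℕₚ.suc-pred p))))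

  pow-* : ∀ x y n → pow (x * y) n ≡ pow x n * pow y n
  pow-* x y zero    = sym (*-identityˡ 1#)
  pow-* x y (suc n) = trans (cong (x * y *_) (pow-* x y n)) (solve 4 (λ a b c d → a :* b :* (c :* d) := a :* c :* (b :* d)) refl x y (pow x n) (pow y n))

  pow-+ : ∀ x i j → pow x (i +ℕ j) ≡ pow x i * pow x j
  pow-+ x zero    j = sym (*-identityˡ _)
  pow-+ x (suc i) j = trans (cong (x *_) (pow-+ x i j)) (sym (*-assoc _ _ _))

  pow-^ : ∀ x i j → pow x (i *ℕ j) ≡ pow (pow x j) i
  pow-^ x zero    j = refl
  pow-^ x (suc i) j = trans (pow-+ x j (i *ℕ j)) (cong (pow x j *_) (pow-^ x i j))

  pow-1 : ∀ n → pow 1# n ≡ 1#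
  pow-1 zero    = refl
  pow-1 (suc n) = trans (*-identityˡ _) (pow-1 n)

  private
    pow-0 : pow 0# p ≡ 0#
    pow-0 = trans (cong (pow 0#) (sym (ℕₚ.suc-pred p))) (zeroˡ _)

    -- The operator identity (1 + N)^p = 1 + N^p for N = multiplication by x, applied to 1.
    pow-1+ : ∀ x → pow (1# + x) p ≡ 1# + pow x p
    pow-1+ x = trans (sym (iter-mul (1# + x) p)) (trans (U.iter-p 1#) (cong (1# +_) (iter-mul x p)))
      where
      module U = Unipotent (x *_) (distribˡ x) ((1# + x) *_) (λ y → (solve 2 (λ a b → (`1 :+ a) :* b := b :+ a :* b) refl x y))
      iter-mul : ∀ y n → iter n (y *_) 1# ≡ pow y n
      iter-mul y zero    = refl
      iter-mul y (suc n) = cong (y *_) (iter-mul y n)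

    pow-p-+ : Additive (λ x → pow x p)
    pow-p-+ x y with y ≟ 0#
    ... | yes refl = trans (cong (λ z → pow z p) (+-identityʳ x)) (sym (trans (cong (pow x p +_) pow-0) (+-identityʳ _)))
    ... | no ny = begin
      pow (x + y) p ≡⟨ cong (λ z → pow z p) (combine₁ (- x) (inverseʳ y ny) (solve 3 (λ a b c → a :+ b :+ :- a :* `1 := b :* (`1 :+ a :* c) :+ :- a :* (b :* c)) refl x y (y ⁻¹))) ⟩
      pow (y * (1# + x * y ⁻¹)) p ≡⟨ pow-* y _ p ⟩
      pow y p * pow (1# + x * y ⁻¹) p ≡⟨ cong (pow y p *_) (pow-1+ _) ⟩
      pow y p * (1# + pow (x * y ⁻¹) p) ≡⟨ distribˡ _ _ _ ⟩
      pow y p * 1# + pow y p * pow (x * y ⁻¹) p ≡⟨ cong₂ _+_ (*-identityʳ _) (trans (sym (pow-* y _ p)) (cong (λ z → pow z p)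
                                                   (combine₁ x (inverseʳ y ny) (solve 3 (λ a b c → a :* (b :* c) :+ b :* `1 := b :+ b :* (a :* c)) refl y x (y ⁻¹))))) ⟩
      pow y p + pow x p ≡⟨ +-comm _ _ ⟩
      pow x p + pow y p ∎
      where open ≡-Reasoning

  frob-+ : ∀ e → Additive (frob e)
  frob-+ zero    x y = refl
  frob-+ (suc e) x y = trans (cong (λ z → pow z p) (frob-+ e x y)) (pow-p-+ _ _)

  module frobM (e : ℕ) = AdditiveMap (frob-+ e)
  open frobM public using () renaming (map-0 to frob-0; map-neg to frob-neg; map-- to frob--; map-sum to frob-sum)

  frob-* : ∀ e x y → frob e (x * y) ≡ frob e x * frob e y
  frob-* zero    x y = refl
  frob-* (suc e) x y = trans (cong (λ z → pow z p) (frob-* e x y)) (pow-* _ _ p)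

  frob-1 : ∀ e → frob e 1# ≡ 1#
  frob-1 zero    = refl
  frob-1 (suc e) = trans (cong (λ z → pow z p) (frob-1 e)) (pow-1 p)

  frob-comp : ∀ i j x → frob (i +ℕ j) x ≡ frob i (frob j x)
  frob-comp zero    j x = refl
  frob-comp (suc i) j x = cong (λ z → pow z p) (frob-comp i j x)

  frob-comm : ∀ i j x → frob i (frob j x) ≡ frob j (frob i x)
  frob-comm i j x = trans (sym (frob-comp i j x)) (trans (cong (λ k → frob k x) (ℕₚ.+-comm i j)) (frob-comp j i x))

  frob-pow : ∀ e x → frob e x ≡ pow x (p ^ e)
  frob-pow zero    x = sym (*-identityʳ x)
  frob-pow (suc e) x = trans (cong (λ z → pow z p) (frob-pow e x)) (sym (pow-^ x p (p ^ e)))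

  frob-nonzero : ∀ e {x} → x ≢ 0# → frob e x ≢ 0#
  frob-nonzero e {x} nx z = pow-nonzero (p ^ e) nx (trans (sym (frob-pow e x)) z)

  frob-injective : ∀ e {x y} → frob e x ≡ frob e y → x ≡ y
  frob-injective e {x} {y} h with x - y ≟ 0#
  ... | yes z = x-y≡0⇒x≡y z
  ... | no nz = ⊥-elim (frob-nonzero e nz (trans (frob-- e x y) (x≡y⇒x-y≡0 h)))

  frob-⁻¹ : ∀ e x → x ≢ 0# → frob e (x ⁻¹) ≡ (frob e x) ⁻¹
  frob-⁻¹ e x nx = *-cancelˡ (frob-nonzero e nx) (trans (sym (frob-* e x _)) (trans (cong (frob e) (inverseʳ x nx))
    (trans (frob-1 e) (sym (inverseʳ _ (frob-nonzero e nx))))))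

  -- The product argument over the nonzero elements, carried out over the whole enumeration: `f`
  -- puts 1 in place of 0, and the constant x is split as g · g' so that `g'` holds the single
  -- factor belonging to 0. The product of `g` is then 1 and that of `g'` is x.
  fermat : ∀ x → pow x card ≡ x
  fermat x with x ≟ 0#
  ... | yes refl = trans (cong (pow 0#) card≡) (zero-pow (p ^ m) {{ℕₚ.m^n≢0 p m}})
    where
    zero-pow : ∀ n .{{_ : NonZero n}} → pow 0# n ≡ 0#
    zero-pow (suc n) = zeroˡ _
  ... | no nx = trans (sym (const elements)) (trans (Πᶠ.fold-cong elements (λ {y} _ → split y))
          (trans (Πᶠ.fold-∙ g g' elements) (trans (cong₂ _*_ Πg Πg') (*-identityˡ x))))
    where
    if0 : ∀ {y} → Dec (y ≡ 0#) → Carrier → Carrier → Carrier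
    if0 (yes _) u v = u
    if0 (no _)  u v = v
    f g g' : Carrier → Carrier
    f y  = if0 (y ≟ 0#) 1# y
    g y  = if0 (y ≟ 0#) 1# x
    g' y = if0 (y ≟ 0#) x 1#
    const : ∀ (ys : List Carrier) → Πᶠ.fold (λ _ → x) ys ≡ pow x (length ys)
    const []       = refl
    const (y ∷ ys) = cong (x *_) (const ys)
    split : ∀ y → x ≡ g y * g' y
    split y with y ≟ 0#
    ... | yes _ = sym (*-identityˡ x)
    ... | no _  = sym (*-identityʳ x)
    scaled : ∀ y → f (x * y) ≡ g y * f y
    scaled y with y ≟ 0# | x * y ≟ 0#
    ... | yes _    | yes _  = sym (*-identityˡ 1#)
    ... | yes refl | no nz  = ⊥-elim (nz (zeroʳ x))
    ... | no ny    | yes z  = ⊥-elim (*-nonzero nx ny z)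
    ... | no _     | no _   = refl
    f-nonzero : ∀ y → f y ≢ 0#
    f-nonzero y with y ≟ 0#
    ... | yes _ = 1≢0
    ... | no ny = ny
    Πf-nonzero : ∀ ys → Πᶠ.fold f ys ≢ 0#
    Πf-nonzero []       = 1≢0
    Πf-nonzero (y ∷ ys) = *-nonzero (f-nonzero y) (Πf-nonzero ys)
    Πg : Πᶠ.fold g elements ≡ 1#
    Πg = *-cancelˡ (Πf-nonzero elements) (begin
      Πᶠ.fold f elements * Πᶠ.fold g elements ≡⟨ *-comm _ _ ⟩
      Πᶠ.fold g elements * Πᶠ.fold f elements ≡⟨ Πᶠ.fold-∙ g f elements ⟨
      Πᶠ.fold (λ y → g y * f y) elements ≡⟨ Πᶠ.fold-cong elements (λ {y} _ → scaled y) ⟨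
      Πᶠ.fold (λ y → f (x * y)) elements ≡⟨ Πᶠ.fold-bijection finiteF f (x *_) (x ⁻¹ *_)
                                                    (λ y → combine₁ y (inverseʳ x nx) (solve 3 (λ a b c → a :* (b :* c) :+ c :* `1 := c :+ c :* (a :* b)) refl x (x ⁻¹) y))
                                                    (λ y → combine₁ y (inverseʳ x nx) (solve 3 (λ a b c → a :* (b :* c) :+ c :* `1 := c :+ c :* (b :* a)) refl (x ⁻¹) x y)) ⟩
      Πᶠ.fold f elements ≡⟨ *-identityʳ _ ⟨
      Πᶠ.fold f elements * 1# ∎)
      where open ≡-Reasoning
    Πg'-absent : ∀ ys → All (0# ≢_) ys → Πᶠ.fold g' ys ≡ 1#
    Πg'-absent []       []         = refl
    Πg'-absent (y ∷ ys) (ny ∷ nys) with y ≟ 0#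
    ... | yes refl = ⊥-elim (ny refl)
    ... | no _     = trans (*-identityˡ _) (Πg'-absent ys nys)
    Πg'-present : ∀ {ys} → Unique ys → 0# ∈ ys → Πᶠ.fold g' ys ≡ x
    Πg'-present {y ∷ ys} (ny ∷ u) q with y ≟ 0#
    ... | yes refl = trans (cong (x *_) (Πg'-absent ys ny)) (*-identityʳ x)
    ... | no nz with q
    ...   | here e   = ⊥-elim (nz (sym e))
    ...   | there q' = trans (*-identityˡ _) (Πg'-present u q')
    Πg' : Πᶠ.fold g' elements ≡ x
    Πg' = Πg'-present elements-unique (elements-complete 0#)

  frob-m : ∀ x → frob m x ≡ x
  frob-m x = trans (frob-pow m x) (trans (cong (pow x) (sym card≡)) (fermat x))

  frob-multiple : ∀ c x → frob (c *ℕ m) x ≡ x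
  frob-multiple zero    x = refl
  frob-multiple (suc c) x = trans (frob-comp m (c *ℕ m) x) (trans (frob-m _) (frob-multiple c x))

  infix 4 _≋_
  _≋_ : ℕ → ℕ → Set
  i ≋ j = ∀ x → frob i x ≡ frob j x

  frob-∣ : ∀ {k} → m ∣ k → k ≋ 0
  frob-∣ (divides c refl) = frob-multiple c

  pow-fixed-bound : ∀ n → 2 ≤ n → (rs : List Carrier) → Unique rs → All (λ r → pow r n ≡ r) rs → length rs ≤ n
  pow-fixed-bound (suc (suc n)) _ rs u fix = subst (length rs ≤_) (cong (λ k → suc (suc k)) (length-replicate n))
    (root-bound cs rs u (All.map (λ {r} e → trans (eval r) (x≡y⇒x-y≡0 e)) fix))
    where
    -- The lower coefficients of X^(n+2) - X.
    cs = 0# ∷ - 1# ∷ replicate n 0#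
    powers : ∀ k x → monic (replicate k 0#) x ≡ pow x k
    powers zero    x = refl
    powers (suc k) x = trans (+-identityˡ _) (cong (x *_) (powers k x))
    eval : ∀ x → monic cs x ≡ pow x (suc (suc n)) - x
    eval x = trans (cong (λ y → 0# + x * (- 1# + x * y)) (powers n x)) (solve 2 (λ a b → `0 :+ a :* (:- `1 :+ a :* b) := a :* (a :* b) :- a) refl x (pow x n))
  pow-fixed-bound (suc zero) (s≤s ())

  abstract
    -- The p elements `ι n` already are roots of X^p - X; a further root would make p + 1.
    prime-field : ∀ z → pow z p ≡ z → ∃ λ n → n < p × z ≡ ι n
    prime-field z fix with any-ι
      where
      any-ι : (∀ n → n < p → z ≢ ι n) ⊎ ∃ λ n → n < p × z ≡ ι n
      any-ι = search p ℕₚ.≤-refl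
        where
        search : ∀ k → k ≤ p → (∀ n → n < k → z ≢ ι n) ⊎ ∃ λ n → n < p × z ≡ ι n
        search zero    _   = inj₁ λ n ()
        search (suc k) k<p with z ≟ ι k | search k (ℕₚ.<⇒≤ k<p)
        ... | yes e | _      = inj₂ (k , k<p , e)
        ... | no _  | inj₂ r = inj₂ r
        ... | no ne | inj₁ h = inj₁ λ n n<sk → case n (ℕₚ.m<1+n⇒m<n∨m≡n n<sk)
          where
          case : ∀ n → n < k ⊎ n ≡ k → z ≢ ι n
          case n (inj₁ n<k)  = h n n<k
          case n (inj₂ refl) = ne
    ... | inj₂ r = r
    ... | inj₁ h = ⊥-elim (ℕₚ.1+n≰n (subst (_≤ p) (cong suc (trans (length-map ι (upTo p)) (length-upTo p)))
            (pow-fixed-bound p p≥2 (z ∷ map ι (upTo p)) (All.tabulate fresh ∷ ι-unique) (fix ∷ All.tabulate ι-fixed))))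
      where
      fresh : ∀ {y} → y ∈ map ι (upTo p) → z ≢ y
      fresh q with ∈-map⁻ ι q
      ... | n , n∈ , refl = h n (∈-upTo⁻ n∈)
      ι-fixed : ∀ {y} → y ∈ map ι (upTo p) → pow y p ≡ y
      ι-fixed q with ∈-map⁻ ι q
      ... | n , n∈ , refl = pow-ι n
        where
        pow-ι : ∀ n → pow (ι n) p ≡ ι n
        pow-ι zero    = frob-0 1
        pow-ι (suc n) = trans (frob-+ 1 1# (ι n)) (cong₂ _+_ (frob-1 1) (pow-ι n))
      ι-unique : Unique (map ι (upTo p))
      ι-unique = go (upTo p) (upTo⁺ p) (λ q → ∈-upTo⁻ q)
        where
        go : ∀ ns → Unique ns → (∀ {n} → n ∈ ns → n < p) → Unique (map ι ns)
        go []       _        _  = []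
        go (n ∷ ns) (ne ∷ u) lt = All.tabulate (λ q → distinct q) ∷ go ns u (λ q → lt (there q))
          where
          distinct : ∀ {y} → y ∈ map ι ns → ι n ≢ y
          distinct q e with ∈-map⁻ ι q
          ... | k , k∈ , refl = All.lookup ne k∈ (ι-injective (lt (here refl)) (lt (there k∈)) e)

  frob-ι : ∀ e n → frob e (ι n) ≡ ι n
  frob-ι e zero    = frob-0 e
  frob-ι e (suc n) = trans (frob-+ e 1# (ι n)) (cong₂ _+_ (frob-1 e) (frob-ι e n))

  frob-order : ∀ {k} → 0 < k → k ≋ 0 → m ≤ k
  frob-order {k} 0<k h with m ℕₚ.≤? k
  ... | yes m≤k = m≤k
  ... | no  m≰k = ⊥-elim (ℕₚ.<⇒≱ (ℕₚ.^-monoʳ-< p p≥2 (ℕₚ.≰⇒> m≰k)) (subst (_≤ p ^ k) card≡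
          (pow-fixed-bound (p ^ k) (ℕₚ.≤-trans p≥2 (subst (_≤ p ^ k) (ℕₚ.^-identityʳ p) (ℕₚ.^-monoʳ-≤ p 0<k))) elements elements-unique
            (All.tabulate λ {r} _ → trans (sym (frob-pow k r)) (h r)))))

  frob-% : ∀ k → k ≋ k % m
  frob-% k x = trans (cong (λ n → frob n x) (m≡m%n+[m/n]*n k m)) (trans (frob-comp (k % m) _ x) (cong (frob (k % m)) (frob-multiple (k / m) x)))

  frob-period : ∀ {k} → k ≋ 0 → m ∣ k
  frob-period {k} h with k % m in eq
  ... | zero  = m%n≡0⇒n∣m k m eq
  ... | suc r = ⊥-elim (ℕₚ.<⇒≱ (subst (_< m) eq (m%n<n k m)) (frob-order (s≤s z≤n)
                  (λ x → trans (cong (λ n → frob n x) (sym eq)) (trans (sym (frob-% k x)) (h x)))))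

  frob-iter : ∀ l j x → frob (l *ℕ j) x ≡ iter j (frob l) x
  frob-iter l zero    x = cong (λ n → frob n x) (ℕₚ.*-zeroʳ l)
  frob-iter l (suc j) x = trans (cong (λ n → frob n x) (ℕₚ.*-suc l j)) (trans (frob-comp l (l *ℕ j) x) (cong (frob l) (frob-iter l j x)))

  -- Trace forms and linearized polynomials

  Distinct : ℕ → (ℕ → ℕ) → Set
  Distinct n e = ∀ i j → i < j → j < n → ¬ (e i ≋ e j)

  -- Artin's argument: evaluating at y x and subtracting `frob (e n) y` times the relation at x
  -- removes the last term. Since the automorphisms differ, some y makes the factor of a given
  -- remaining term nonzero.
  independence : ∀ n (e : ℕ → ℕ) → Distinct n e → (s : ℕ → Carrier) →
    (∀ x → sumBelow n (λ i → s i * frob (e i) x) ≡ 0#) → ∀ i → i < n → s i ≡ 0#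
  independence (suc n) e dist s h = conclude
    where
    reduced : ∀ y x → sumBelow n (λ i → s i * (frob (e i) y - frob (e n) y) * frob (e i) x) ≡ 0#
    reduced y x = begin
      sumBelow n (λ i → s i * (frob (e i) y - frob (e n) y) * frob (e i) x)
        ≡⟨ sum-cong n (λ i _ → trans (solve 4 (λ a b c d → a :* (b :- c) :* d := a :* (b :* d) :+ :- c :* (a :* d)) refl (s i) (frob (e i) y) (frob (e n) y) (frob (e i) x))
             (cong (λ z → s i * z + (- frob (e n) y) * (s i * frob (e i) x)) (sym (frob-* (e i) y x)))) ⟩
      sumBelow n (λ i → s i * frob (e i) (y * x) + (- frob (e n) y) * (s i * frob (e i) x))
        ≡⟨ trans (sum-+ n _ _) (cong (A +_) (sum-* n (- frob (e n) y) _)) ⟩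
      A + (- frob (e n) y) * B
        ≡⟨ combine₃ 1# (- frob (e n) y) (- s n) (h (y * x)) (h x) (frob-* (e n) y x)
             (solve 6 (λ a b c d e f → a :+ :- b :* c :+ `1 :* `0 :+ :- b :* `0 :+ :- d :* (b :* e) := `0 :+ `1 :* (a :+ d :* f) :+ :- b :* (c :+ d :* e) :+ :- d :* f) refl A (frob (e n) y) B (s n) (frob (e n) x) (frob (e n) (y * x))) ⟩
      0# ∎
      where
      open ≡-Reasoning
      A = sumBelow n (λ i → s i * frob (e i) (y * x))
      B = sumBelow n (λ i → s i * frob (e i) x)
    lower : ∀ i → i < n → s i ≡ 0#
    lower i i<n with s i ≟ 0#
    ... | yes z = z
    ... | no nz = ⊥-elim (dist i n i<n ℕₚ.≤-refl λ y → x-y≡0⇒x≡y (*-cancelˡ-zero nz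
            (independence n e (λ a b a<b b<n → dist a b a<b (ℕₚ.m<n⇒m<1+n b<n)) (λ i → s i * (frob (e i) y - frob (e n) y)) (reduced y) i i<n)))
    conclude : ∀ i → i < suc n → s i ≡ 0#
    conclude i i<sn with ℕₚ.m<1+n⇒m<n∨m≡n i<sn
    ... | inj₁ i<n  = lower i i<n
    ... | inj₂ refl = trans (sym (trans (cong (s n *_) (frob-1 (e n))) (*-identityʳ _)))
            (combine₂ 1# (- 1#) (h 1#) (sum-zero n {λ i → s i * frob (e i) 1#} (λ i i<n → trans (cong (_* frob (e i) 1#)
                (lower i i<n)) (zeroˡ _)))
              (solve 3 (λ a b c → a :* b :+ `1 :* `0 :+ :- `1 :* `0 := `0 :+ `1 :* (c :+ a :* b) :+ :- `1 :* c) refl (s n) (frob (e n) 1#) (sumBelow n (λ i → s i * frob (e i) 1#))))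

  frob-distinct : ∀ {i j} → i < j → j < m → ¬ (i ≋ j)
  frob-distinct {i} {j} i<j j<m h = ℕₚ.<⇒≱ (ℕₚ.≤-<-trans (ℕₚ.m∸n≤m j i) j<m) (frob-order (ℕₚ.m<n⇒0<n∸m i<j)
    λ x → frob-injective i (trans (sym (frob-comp i (j ∸ i) x)) (trans (cong (λ k → frob k x) (ℕₚ.m+[n∸m]≡n (ℕₚ.<⇒≤ i<j))) (sym (h x)))))

  frob-surjective : ∀ l y → ∃ λ x → frob l x ≡ y
  frob-surjective l y = frob (l *ℕ (m ∸ 1)) y , trans (sym (frob-comp l _ y)) (trans (cong (λ k → frob k y)
    (trans (sym (ℕₚ.*-suc l (m ∸ 1))) (cong (l *ℕ_) (ℕₚ.suc-pred m)))) (frob-multiple l y))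

  lin-independent : ∀ s → (∀ x → lin m s x ≡ 0#) → ∀ i → i < m → s i ≡ 0#
  lin-independent = independence m (λ i → i) (λ i j → frob-distinct)

  lin-unique : ∀ s s' → (∀ x → lin m s x ≡ lin m s' x) → ∀ i → i < m → s i ≡ s' i
  lin-unique s s' h i i<m = x-y≡0⇒x≡y (lin-independent (λ i → s i - s' i) diff i i<m)
    where
    diff : ∀ x → lin m (λ i → s i - s' i) x ≡ 0#
    diff x = begin
      lin m (λ i → s i - s' i) x ≡⟨ sum-cong m (λ i _ → (solve 3 (λ a b c → (a :- b) :* c := a :* c :+ :- `1 :* (b :* c)) refl (s i) (s' i) (frob i x))) ⟩
      sumBelow m (λ i → s i * frob i x + (- 1#) * (s' i * frob i x)) ≡⟨ trans (sum-+ m _ _) (cong (lin m s x +_) (sum-* m (- 1#) _)) ⟩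
      lin m s x + (- 1#) * lin m s' x ≡⟨ combine₁ 1# (h x) (solve 2 (λ a b → a :+ :- `1 :* b :+ `1 :* b := `0 :+ `1 :* a) refl (lin m s x) (lin m s' x)) ⟩
      0# ∎
      where open ≡-Reasoning

  Linearized : (Carrier → Carrier) → Set
  Linearized f = ∃ λ s → ∀ x → f x ≡ lin m s x

  lin-additive : ∀ s → Additive (lin m s)
  lin-additive s x y = trans (sum-cong m (λ i _ → trans (cong (s i *_) (frob-+ i x y)) (distribˡ _ _ _))) (sum-+ m _ _)

  linearized-additive : ∀ {f} → Linearized f → Additive f
  linearized-additive (s , h) x y = trans (h _) (trans (lin-additive s x y) (sym (cong₂ _+_ (h x) (h y))))

  -- Coefficients of the p-th power of a linearized polynomial. They move up by one place, and the
  -- top one wraps round to place 0 because `frob m` is the identity.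
  shift : (ℕ → Carrier) → ℕ → Carrier
  shift s zero    = pow (s (m ∸ 1)) p
  shift s (suc i) = pow (s i) p

  lin-shift : ∀ s x → pow (lin m s x) p ≡ lin m (shift s) x
  lin-shift s x = go m refl
    where
    go : ∀ n → n ≡ m → pow (lin n s x) p ≡ lin n (shift s) x
    go zero    e = ⊥-elim (ℕₚ.<⇒≱ m≥1 (subst (_≤ 0) e z≤n))
    go (suc n) e = begin
      frob 1 (lin (suc n) s x) ≡⟨ frob-sum 1 (suc n) _ ⟩
      sumBelow (suc n) (λ i → frob 1 (s i * frob i x)) ≡⟨ sum-cong (suc n) (λ i _ → frob-* 1 (s i) (frob i x)) ⟩
      sumBelow n (λ i → pow (s i) p * frob (suc i) x) + pow (s n) p * frob (suc n) x ≡⟨ +-comm _ _ ⟩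
      pow (s n) p * frob (suc n) x + sumBelow n (λ i → pow (s i) p * frob (suc i) x) ≡⟨ cong₂ (λ k z → pow (s k) p * z + sumBelow n (λ i → pow (s i) p * frob (suc i) x)) (cong (_∸ 1) e) (trans (cong (λ k → frob k x) e) (frob-m x)) ⟩
      shift s 0 * frob 0 x + sumBelow n (λ i → shift s (suc i) * frob (suc i) x) ≡⟨ sum-front n (λ i → shift s i * frob i x) ⟨
      lin (suc n) (shift s) x ∎
      where open ≡-Reasoning

  linearized-pow : ∀ {f} → Linearized f → Linearized (λ x → pow (f x) p)
  linearized-pow (s , h) = shift s , λ x → trans (cong (λ z → pow z p) (h x)) (lin-shift s x)

  linearized-combination : ∀ {f g} c → Linearized f → Linearized g → Linearized (λ x → f x + c * g x)
  linearized-combination c (s , h) (t , k) = (λ i → s i + c * t i) , λ x → trans (cong₂ (λ y z → y + c * z) (h x) (k x))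
    (sym (trans (sum-cong m (λ i _ → (solve 4 (λ a b c d → (a :+ b :* c) :* d := a :* d :+ b :* (c :* d)) refl (s i) c (t i) (frob i x))))
      (trans (sum-+ m _ _) (cong (lin m s x +_) (sum-* m c _)))))

  linearized-id : Linearized (λ x → x)
  linearized-id = δ , λ x → sym (go m refl x)
    where
    δ : ℕ → Carrier
    δ zero    = 1#
    δ (suc _) = 0#
    go : ∀ n → n ≡ m → ∀ x → lin n δ x ≡ x
    go zero    e x = ⊥-elim (ℕₚ.<⇒≱ m≥1 (subst (_≤ 0) e z≤n))
    go (suc n) e x = trans (sum-front n _) (trans (cong (1# * x +_) (sum-zero n {λ i → 0# * frob (suc i) x} λ i _ → zeroˡ _)) (solve 1 (λ a → `1 :* a :+ `0 := a) refl x))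

  linearized-0 : Linearized (λ _ → 0#)
  linearized-0 = (λ _ → 0#) , λ x → sym (sum-zero m λ i _ → zeroˡ _)

  -- Newton interpolation: enlarging the kernel of L by e turns L into L^p - L(e)^(p-1) L, whose zeros
  -- are the x with L(x) / L(e) in the prime field.
  private module Newton {f : Carrier → Carrier} (f-+ : Additive f) where
    -- `N` interpolates `f` on the kernel of `L`, and this kernel contains the elements processed so
    -- far. Once the whole field has been processed, `N` is `f`.
    record State (es : List Carrier) : Set where
      field
        L N    : Carrier → Carrier
        linL   : Linearized L
        linN   : Linearized N
        agree  : ∀ x → L x ≡ 0# → f x ≡ N x
        kernel : ∀ {e} → e ∈ es → L e ≡ 0#
    ratio-fixed : ∀ Le Lx k → Le ≢ 0# → pow Le p ≡ Le * k → pow Lx p + (- k) * Lx ≡ 0# → pow (Lx * Le ⁻¹) p ≡ Lx * Le ⁻¹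
    ratio-fixed Le Lx k nz pow-suc h = *-cancelˡ (frob-nonzero 1 nz) (begin
      pow Le p * pow (Lx * Le ⁻¹) p ≡⟨ pow-* Le _ p ⟨
      pow (Le * (Lx * Le ⁻¹)) p ≡⟨ cong (λ z → pow z p) (combine₁ Lx (inverseʳ Le nz) (solve 3 (λ a b c → a :* (b :* c) :+ b :* `1 := b :+ b :* (a :* c)) refl Le Lx (Le ⁻¹))) ⟩
      pow Lx p ≡⟨ combine₂ 1# (- (k * Lx)) h (inverseʳ Le nz) (solve 5 (λ a b c d e → a :+ `1 :* `0 :+ :- (b :* c) :* `1 := d :* b :* (c :* e) :+ `1 :* (a :+ :- b :* c) :+ :- (b :* c) :* (d :* e)) refl (pow Lx p) k Lx Le (Le ⁻¹)) ⟩
      (Le * k) * (Lx * Le ⁻¹) ≡⟨ cong (_* (Lx * Le ⁻¹)) pow-suc ⟨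
      pow Le p * (Lx * Le ⁻¹) ∎)
      where open ≡-Reasoning

    interpolate : ∀ {L N} → Linearized L → Linearized N → (∀ x → L x ≡ 0# → f x ≡ N x) → ∀ e k → L e ≢ 0# → pow (L e) p ≡ L e * k →
      ∀ x → pow (L x) p + (- k) * L x ≡ 0# → f x ≡ N x + (f e - N e) * (L e) ⁻¹ * L x
    interpolate {L} {N} linL linN agree e k nz pow-suc x h = finish (prime-field (L x * (L e) ⁻¹) (ratio-fixed (L e) (L x) k nz pow-suc h))
      where
      module LM = AdditiveMap (linearized-additive linL)
      module NM = AdditiveMap (linearized-additive linN)
      module FM = AdditiveMap f-+
      algebra : ∀ fx Nx n Ne fe Le' Lx → fx - n * fe ≡ Nx - n * Ne → Lx * Le' ≡ n → fx ≡ Nx + (fe - Ne) * Le' * Lx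
      algebra fx Nx n Ne fe Le' Lx r q = combine₂ 1# (- (fe - Ne)) r q
        (solve 7 (λ a b c d e f g → a :+ `1 :* (b :- c :* d) :+ :- (e :- d) :* c := b :+ (e :- d) :* f :* g :+ `1 :* (a :- c :* e) :+ :- (e :- d) :* (g :* f)) refl fx Nx n Ne fe Le' Lx)
      -- If L x = n L e, then x - n e lies in the kernel of `L`, where `f` and `N` already agree.
      zero-there : ∀ n → L x * (L e) ⁻¹ ≡ ι n → L (x - ι n * e) ≡ 0#
      zero-there n q = trans (LM.map-- x (ι n * e)) (trans (cong (λ z → L x - z) (LM.map-ι n e))
        (combine₂ (L e) (- L x) q (inverseʳ (L e) nz) (solve 4 (λ a b c d → a :- b :* c :+ c :* b :+ :- a :* `1 := `0 :+ c :* (a :* d) :+ :- a :* (c :* d)) refl (L x) (ι n) (L e) ((L e) ⁻¹))))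
      finish : (∃ λ n → n < p × L x * (L e) ⁻¹ ≡ ι n) → f x ≡ N x + (f e - N e) * (L e) ⁻¹ * L x
      finish (n , _ , q) = algebra (f x) (N x) (ι n) (N e) (f e) ((L e) ⁻¹) (L x)
        (trans (sym (trans (FM.map-- x (ι n * e)) (cong (λ z → f x - z) (FM.map-ι n e))))
          (trans (agree _ (zero-there n q)) (trans (NM.map-- x (ι n * e)) (cong (λ z → N x - z) (NM.map-ι n e))))) q

    step : ∀ e {es} → State es → State (e ∷ es)
    step e {es} st with State.L st e ≟ 0#
    ... | yes z = record { L = L ; N = N ; linL = linL ; linN = linN ; agree = agree ; kernel = λ { (here refl) → z ; (there q) → kernel q } }
      where open State st
    ... | no nz = record
      { L = λ x → pow (L x) p + (- k) * L x
      ; N = λ x → N x + (f e - N e) * (L e) ⁻¹ * L x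
      ; linL = linearized-combination (- k) (linearized-pow linL) linL
      ; linN = linearized-combination _ linN linL
      ; agree = interpolate linL linN agree e k nz pow-suc
      ; kernel = λ { (here refl) → trans (cong (_+ (- k) * L e) pow-suc) (vanish (L e) k)
                   ; (there q) → trans (cong (λ y → pow y p + (- k) * y) (kernel q)) (trans (cong (_+ (- k) * 0#) (frob-0 1)) (vanish₀ k)) } }
      where
      open State st
      k = pow (L e) (p ∸ 1)
      pow-suc : pow (L e) p ≡ L e * k
      pow-suc = cong (pow (L e)) (sym (ℕₚ.suc-pred p))
      vanish : ∀ y k → y * k + (- k) * y ≡ 0#
      vanish y k = (solve 2 (λ a b → a :* b :+ :- b :* a := `0) refl y k)
      vanish₀ : ∀ k → 0# + (- k) * 0# ≡ 0#
      vanish₀ k = (solve 1 (λ a → `0 :+ :- a :* `0 := `0) refl k)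

    loop : ∀ es → State es
    loop [] = record { L = λ x → x ; N = λ _ → 0# ; linL = linearized-id ; linN = linearized-0 ; agree = λ { x refl → AdditiveMap.map-0 f-+ } ; kernel = λ () }
    loop (e ∷ es) = step e (loop es)

  additive-linearized : ∀ {f} → Additive f → Linearized f
  additive-linearized f-+ = proj₁ linN , λ x → trans (agree x (kernel (elements-complete x))) (proj₂ linN x)
    where
    open Newton f-+
    open State (loop elements)

  -- Commuting with `frob l`, which is surjective, means that conjugating the coefficients does not
  -- change the map; coefficients of reduced polynomials are unique.
  lin-equivariant : ∀ l s → (∀ x → lin m s (frob l x) ≡ frob l (lin m s x)) → ∀ i → i < m → InSub l (s i)
  lin-equivariant l s h i i<m = sym (lin-unique s (λ i → frob l (s i)) same i i<m)
    where
    same : ∀ y → lin m s y ≡ lin m (λ i → frob l (s i)) y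
    same y with frob-surjective l y
    ... | x , refl = trans (h x) (trans (frob-sum l m _) (sum-cong m (λ i _ → trans (frob-* l (s i) (frob i x)) (cong (frob l (s i) *_) (frob-comm l i x)))))

  tr-additive : Additive (tr m)
  tr-additive x y = trans (sum-cong m (λ i _ → frob-+ i x y)) (sum-+ m _ _)

  module trM = AdditiveMap tr-additive

  tr-frob₁ : ∀ x → tr m (frob 1 x) ≡ tr m x
  tr-frob₁ x = combine₁ 1# (sum-front m (λ i → frob i x)) (begin
    tr m (frob 1 x) + 1# * (x + sumBelow m (λ i → frob (suc i) x)) ≡⟨ cong (λ y → y + 1# * (x + S)) shifted ⟩
    S + 1# * (x + S) ≡⟨ cong (λ y → S + 1# * (y + S)) (frob-m x) ⟨
    S + 1# * (frob m x + S) ≡⟨ eq ⟩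
    tr m x + 1# * (tr m x + frob m x) ∎)
    where
    open ≡-Reasoning
    S = sumBelow m (λ i → frob (suc i) x)
    shifted : tr m (frob 1 x) ≡ S
    shifted = sum-cong m (λ i _ → trans (sym (frob-comp i 1 x)) (cong (λ k → frob k x) (ℕₚ.+-comm i 1)))
    eq : S + 1# * (frob m x + S) ≡ tr m x + 1# * (tr m x + frob m x)
    eq = combine₁ (- (1# + 1#)) (trans (sum-front m (λ i → frob i x)) (cong (_+ S) (sym (frob-m x))))
      (solve 3 (λ a b c → a :+ `1 :* (b :+ a) :+ :- (`1 :+ `1) :* (b :+ a) := c :+ `1 :* (c :+ b) :+ :- (`1 :+ `1) :* (c :+ b)) refl S (frob m x) (tr m x))

  tr-frob : ∀ l x → tr m (frob l x) ≡ tr m x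
  tr-frob zero    x = refl
  tr-frob (suc l) x = trans (tr-frob₁ (frob l x)) (tr-frob l x)

  tr-fixed : ∀ x → pow (tr m x) p ≡ tr m x
  tr-fixed x = trans (frob-sum 1 m _) (trans (sum-cong m (λ i _ → frob-comm 1 i x)) (tr-frob₁ x))

  tr-prime : ∀ x → ∃ λ n → n < p × tr m x ≡ ι n
  tr-prime x = prime-field (tr m x) (tr-fixed x)

  frob-prime : ∀ e {t} → pow t p ≡ t → frob e t ≡ t
  frob-prime zero    h = refl
  frob-prime (suc e) h = trans (cong (λ z → pow z p) (frob-prime e h)) h

  tr-scalar : ∀ t x → pow t p ≡ t → tr m (t * x) ≡ t * tr m x
  tr-scalar t x h = trans (sum-cong m (λ i _ → trans (frob-* i t x) (cong (_* frob i x) (frob-prime i h)))) (sum-* m t _)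

  tr-nondegenerate : ∀ y → (∀ c → tr m (c * y) ≡ 0#) → y ≡ 0#
  tr-nondegenerate y h = lin-independent (λ i → frob i y) (λ c → trans (sum-cong m (λ i _ → trans (*-comm _ _) (sym (frob-* i c y)))) (h c)) 0 m≥1

  tr-injective : ∀ y z → (∀ c → tr m (y * c) ≡ tr m (z * c)) → y ≡ z
  tr-injective y z h = x-y≡0⇒x≡y (tr-nondegenerate (y - z) λ c → trans (cong (tr m) (solve 3 (λ a b c → a :* (b :- c) := b :* a :- c :* a) refl c y z))
    (trans (trM.map-- _ _) (x≡y⇒x-y≡0 (h c))))

  -- A linearized polynomial equal to its own p-th power has coefficients invariant under the cyclic
  -- `shift`, hence `s i` is the i-th Frobenius conjugate of `s 0`.
  functional-trace : ∀ {f} → Additive f → (∀ x → pow (f x) p ≡ f x) → ∃ λ μ → ∀ x → f x ≡ tr m (μ * x)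
  functional-trace {f} f-+ fix with additive-linearized f-+
  ... | s , h = s 0 , λ x → trans (h x) (sum-cong m (λ i i<m → trans (cong (_* frob i x) (powers i i<m)) (sym (frob-* i (s 0) x))))
    where
    powers : ∀ i → i < m → s i ≡ frob i (s 0)
    powers zero    _    = refl
    powers (suc i) si<m = trans (lin-unique s (shift s) (λ x → trans (sym (h x)) (trans (sym (fix x)) (trans (cong (λ z → pow z p) (h x)) (lin-shift s x)))) (suc i) si<m)
                            (cong (λ z → pow z p) (powers i (ℕₚ.<⇒≤ si<m)))

  tr-invariant : ∀ l μ → (∀ x → tr m (μ * frob l x) ≡ tr m (μ * x)) → InSub l μ
  tr-invariant l μ h = sym (tr-injective μ (frob l μ) λ y → go y (frob-surjective l y))
    where
    go : ∀ y → (∃ λ x → frob l x ≡ y) → tr m (μ * y) ≡ tr m (frob l μ * y)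
    go y (x , refl) = trans (h x) (trans (sym (tr-frob l (μ * x))) (cong (tr m) (frob-* l μ x)))

  tr-adjoint : ∀ i → i ≤ m → ∀ w c → tr m (w * frob i c) ≡ tr m (c * frob (m ∸ i) w)
  tr-adjoint i i≤m w c = trans (sym (tr-frob (m ∸ i) _)) (cong (tr m) (trans (frob-* (m ∸ i) w (frob i c)) (trans (*-comm _ _)
    (cong (_* frob (m ∸ i) w) (trans (sym (frob-comp (m ∸ i) i c)) (trans (cong (λ k → frob k c) (ℕₚ.m∸n+n≡m i≤m)) (frob-m c)))))))

  sum-reverse : ∀ n (g : ℕ → Carrier) → sumBelow n (λ i → g (n ∸ i)) + g 0 ≡ sumBelow n g + g n
  sum-reverse zero    g = refl
  sum-reverse (suc n) g = trans (cong (_+ g 0) (sum-front n (λ i → g (suc n ∸ i)))) (trans (+-assoc _ _ _)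
    (trans (cong (g (suc n) +_) (sum-reverse n g)) (+-comm _ _)))

  -- Trace adjoints free the variable c, nondegeneracy of the trace removes it, and what remains is
  -- a linearized polynomial in z that vanishes identically. Its coefficients give the relations
  -- demanded in Constructions C (with γ = υ = 0) and D.
  bilinear-coefficients : ∀ s μ γ υ →
    (∀ c z → tr m (μ * (c * lin m s z - z * lin m s c)) ≡ tr m (γ * c) * tr m (υ * z) - tr m (γ * z) * tr m (υ * c)) →
    ∀ i → 1 ≤ i → i < m → μ * s i - frob i (μ * s (m ∸ i)) ≡ γ * frob i υ - υ * frob i γ
  bilinear-coefficients s μ γ υ h i@(suc _) _ i<m = combine₁ 1# (lin-independent k vanish i i<m)
      (solve 7 (λ a b c d e f g → a :* b :- c :+ `1 :* `0 := d :* e :- f :* g :+ `1 :* (a :* b :- c :- d :* e :+ f :* g :+ `0)) refl μ (s i) (frob i (μ * s (m ∸ i))) γ (frob i υ) υ (frob i γ))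
    where
    -- Reversing the index sends 0 to m, outside the range of summation. This term replaces `s m` by
    -- `s 0` and touches the coefficient at 0 only.
    extra : ℕ → Carrier
    extra zero    = μ * s m - μ * s 0
    extra (suc _) = 0#
    k k' : ℕ → Carrier
    k' i = μ * s i - frob i (μ * s (m ∸ i)) - γ * frob i υ + υ * frob i γ
    k i = k' i + extra i
    g : Carrier → ℕ → Carrier
    g z i = frob i (μ * s (m ∸ i) * z)
    adjoint : ∀ z c → tr m (μ * (z * lin m s c)) ≡ tr m (c * (sumBelow m (g z) + μ * s 0 * z - μ * s m * z))
    adjoint z c = begin
      tr m (μ * (z * lin m s c)) ≡⟨ cong (tr m) (trans (sym (*-assoc μ z _)) (sym (sum-* m (μ * z) _))) ⟩
      tr m (sumBelow m (λ i → μ * z * (s i * frob i c))) ≡⟨ trM.map-sum m _ ⟩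
      sumBelow m (λ i → tr m (μ * z * (s i * frob i c))) ≡⟨ sum-cong m (λ i i<m → trans (cong (tr m) (solve 4 (λ a b c d → a :* b :* (c :* d) := a :* c :* b :* d) refl μ z (s i) (frob i c)))
                                                                      (trans (tr-adjoint i (ℕₚ.<⇒≤ i<m) _ c) (cong (λ j → tr m (c * frob (m ∸ i) (μ * s j * z))) (sym (ℕₚ.m∸[m∸n]≡n (ℕₚ.<⇒≤ i<m)))))) ⟩
      sumBelow m (λ i → tr m (c * g z (m ∸ i))) ≡⟨ trans (sym (trM.map-sum m _)) (cong (tr m) (sum-* m c _)) ⟩
      tr m (c * sumBelow m (λ i → g z (m ∸ i))) ≡⟨ cong (λ y → tr m (c * y)) (combine₂ 1# 1# (sum-reverse m (g z)) (trans (frob-m _) (cong (λ j → μ * s j * z) (ℕₚ.n∸n≡0 m)))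
           (solve 7 (λ a b c d e f g → a :+ `1 :* (b :+ c) :+ `1 :* (d :* e :* f) := b :+ d :* e :* f :- d :* g :* f :+ `1 :* (a :+ d :* g :* f) :+ `1 :* c) refl R S (g z m) μ (s 0) z (s m))) ⟩
      tr m (c * (S + μ * s 0 * z - μ * s m * z)) ∎
      where
      open ≡-Reasoning
      R = sumBelow m (λ i → g z (m ∸ i))
      S = sumBelow m (g z)
    pairing : ∀ z → μ * lin m s z - (sumBelow m (g z) + μ * s 0 * z - μ * s m * z) - γ * tr m (υ * z) + υ * tr m (γ * z) ≡ 0#
    pairing z = tr-nondegenerate _ λ c → begin
      tr m (c * (μ * Sz - (S + a - b) - γ * tυ + υ * tγ)) ≡⟨ cong (tr m) (solve 10 (λ a b c d e f g h i j → a :* (b :* c :- (d :+ e :- f) :- g :* h :+ i :* j) := b :* (a :* c) :- a :* (d :+ e :- f) :- h :* (g :* a) :+ j :* (i :* a)) refl c μ Sz S a b γ tυ υ tγ) ⟩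
      tr m (μ * (c * Sz) - c * (S + a - b) - tυ * (γ * c) + tγ * (υ * c)) ≡⟨ trans (tr-additive _ _) (cong (_+ tr m (tγ * (υ * c))) (trans (trM.map-- _ _) (cong (_- tr m (tυ * (γ * c))) (trM.map-- _ _)))) ⟩
      tr m (μ * (c * Sz)) - tr m (c * (S + a - b)) - tr m (tυ * (γ * c)) + tr m (tγ * (υ * c)) ≡⟨ cong₂ (λ y w → tr m (μ * (c * Sz)) - tr m (c * (S + a - b)) - y + w) (tr-scalar tυ _ (tr-fixed _)) (tr-scalar tγ _ (tr-fixed _)) ⟩
      tr m (μ * (c * Sz)) - tr m (c * (S + a - b)) - tυ * tr m (γ * c) + tγ * tr m (υ * c) ≡⟨ cong (λ y → tr m (μ * (c * Sz)) - y - tυ * tr m (γ * c) + tγ * tr m (υ * c)) (adjoint z c) ⟨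
      tr m (μ * (c * Sz)) - tr m (μ * (z * lin m s c)) - tυ * tr m (γ * c) + tγ * tr m (υ * c) ≡⟨ combine₁ 1# (trans (sym (trM.map-- (μ * (c * Sz)) (μ * (z * lin m s c)))) (trans (cong (tr m) (solve 5 (λ a b c d e → a :* (b :* c) :- a :* (d :* e) := a :* (b :* c :- d :* e)) refl μ c Sz z (lin m s c))) (h c z)))
            (solve 6 (λ a b c d e f → a :- b :- c :* d :+ e :* f :+ `1 :* (d :* c :- e :* f) := `0 :+ `1 :* (a :- b)) refl (tr m (μ * (c * Sz))) (tr m (μ * (z * lin m s c))) tυ (tr m (γ * c)) tγ (tr m (υ * c))) ⟩
      0# ∎
      where
      open ≡-Reasoning
      Sz = lin m s z
      S = sumBelow m (g z)
      a = μ * s 0 * z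
      b = μ * s m * z
      tυ = tr m (υ * z)
      tγ = tr m (γ * z)
    extra-sum : ∀ z → lin m extra z ≡ (μ * s m - μ * s 0) * z
    extra-sum z = go m m≥1
      where
      go : ∀ n → 1 ≤ n → lin n extra z ≡ (μ * s m - μ * s 0) * z
      go (suc n) _ = trans (sum-front n _) (trans (cong ((μ * s m - μ * s 0) * z +_) (sum-zero n {λ i → 0# * frob (suc i) z} λ i _ → zeroˡ _)) (+-identityʳ _))
    vanish : ∀ z → lin m k z ≡ 0#
    vanish z = begin
      lin m k z
        ≡⟨ sum-cong m (λ i _ → (solve 9 (λ a b c d e f g h i → (a :* b :- c :- d :* e :+ f :* g :+ h) :* i := a :* (b :* i) :+ :- `1 :* (c :* i) :+ :- d :* (e :* i) :+ f :* (g :* i) :+ h :* i) refl μ (s i) (frob i (μ * s (m ∸ i))) γ (frob i υ) υ (frob i γ) (extra i) (frob i z))) ⟩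
      sumBelow m (λ i → μ * (s i * frob i z) + (- 1#) * (frob i (μ * s (m ∸ i)) * frob i z) + (- γ) * (frob i υ * frob i z) + υ * (frob i γ * frob i z) + extra i * frob i z)
        ≡⟨ trans (sum-+ m _ _) (cong (_+ lin m extra z) (trans (sum-+ m _ _) (cong₂ _+_ (trans (sum-+ m _ _) (cong₂ _+_ (trans (sum-+ m _ _) (cong₂ _+_ (sum-* m μ _) (sum-* m (- 1#) _))) (sum-* m (- γ) _))) (sum-* m υ _)))) ⟩
      μ * Sz + (- 1#) * sumBelow m (λ i → frob i (μ * s (m ∸ i)) * frob i z) + (- γ) * sumBelow m (λ i → frob i υ * frob i z) + υ * sumBelow m (λ i → frob i γ * frob i z) + lin m extra z
        ≡⟨ cong₂ _+_ (cong₂ _+_ (cong₂ (λ y w → μ * Sz + (- 1#) * y + (- γ) * w) (prods (λ i → μ * s (m ∸ i))) (prods (λ _ → υ))) (cong (υ *_) (prods (λ _ → γ)))) (extra-sum z) ⟩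
      μ * Sz + (- 1#) * S + (- γ) * tυ + υ * tγ + (μ * s m - μ * s 0) * z
        ≡⟨ trans (solve 10 (λ a b c d e f g h i j → a :* b :+ :- `1 :* c :+ :- d :* e :+ f :* g :+ (a :* h :- a :* i) :* j := a :* b :- (c :+ a :* i :* j :- a :* h :* j) :- d :* e :+ f :* g) refl μ Sz S γ tυ υ tγ (s m) (s 0) z) (pairing z) ⟩
      0# ∎
      where
      open ≡-Reasoning
      Sz = lin m s z
      S = sumBelow m (g z)
      tυ = tr m (υ * z)
      tγ = tr m (γ * z)
      prods : ∀ (w : ℕ → Carrier) → sumBelow m (λ i → frob i (w i) * frob i z) ≡ sumBelow m (λ i → frob i (w i * z))
      prods w = sum-cong m (λ i _ → sym (frob-* i (w i) z))

  -- Nilpotent operators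

  p≥3 : 3 ≤ p
  p≥3 = ℕₚ.≤∧≢⇒< p≥2 (λ e → p≢2 (sym e))

  module Operator (l : ℕ) where
    σ : ℕ → Carrier → Carrier
    σ j = frob (l *ℕ j)

    σ-0 : ∀ x → σ 0 x ≡ x
    σ-0 = frob-iter l 0

    σ-1 : ∀ x → σ 1 x ≡ frob l x
    σ-1 x = cong (λ k → frob k x) (ℕₚ.*-identityʳ l)

    σ-+ : ∀ i j x → σ (i +ℕ j) x ≡ σ i (σ j x)
    σ-+ i j x = trans (cong (λ k → frob k x) (ℕₚ.*-distribˡ-+ l i j)) (frob-comp (l *ℕ i) (l *ℕ j) x)

    N : Carrier → Carrier
    N x = frob l x - x

    N-+ : Additive N
    N-+ x y = trans (cong (_- (x + y)) (frob-+ l x y)) (solve 4 (λ a b c d → a :+ b :- (c :+ d) := a :- c :+ (b :- d)) refl (frob l x) (frob l y) x y)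

    module NM = AdditiveMap N-+
    module NI (k : ℕ) = AdditiveMap (NM.iter-additive k)

    frob≡1+N : ∀ x → frob l x ≡ x + N x
    frob≡1+N x = (solve 2 (λ a b → a := b :+ (a :- b)) refl (frob l x) x)

    open Unipotent N N-+ (frob l) frob≡1+N public using (iter-orbitSum; orbitSum-p)

    frob-N : ∀ e x → frob e (N x) ≡ N (frob e x)
    frob-N e x = trans (frob-- e _ _) (cong (_- frob e x) (frob-comm e l x))

    frob-iterN : ∀ e k x → frob e (iter k N x) ≡ iter k N (frob e x)
    frob-iterN e zero    x = refl
    frob-iterN e (suc k) x = trans (frob-N e _) (cong N (frob-iterN e k x))

    -- Repeated use of (1 + N)^p = 1 + N^p: the induction step applies `Unipotent` to N^(p^K) in
    -- place of N.
    N-nilpotent : ∀ K x → iter (p ^ K) N x ≡ σ (p ^ K) x - x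
    N-nilpotent zero    x = cong (_- x) (sym (σ-1 x))
    N-nilpotent (suc K) x = combine₁ (- 1#) (U.iter-p x) (trans (cong (λ y → y + (- 1#) * (x + iter p (iter (p ^ K) N) x)) (iter-* p (p ^ K) N x))
        (trans (solve 3 (λ a b c → a :+ :- `1 :* (b :+ a) := c :- b :+ :- `1 :* c) refl (iter p (iter (p ^ K) N) x) x (iter p (σ (p ^ K)) x))
          (cong (λ y → y - x + (- 1#) * iter p (σ (p ^ K)) x) (sym iterσ))))
      where
      module U = Unipotent (iter (p ^ K) N) (NM.iter-additive (p ^ K)) (σ (p ^ K)) (λ y → trans (solve 2 (λ a b → a := b :+ (a :- b)) refl (σ (p ^ K) y) y) (cong (y +_) (sym (N-nilpotent K y))))
      iterσ : σ (p ^ suc K) x ≡ iter p (σ (p ^ K)) x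
      iterσ = trans (cong (λ k → frob k x) (trans (cong (l *ℕ_) (ℕₚ.*-comm p (p ^ K))) (sym (ℕₚ.*-assoc l (p ^ K) p)))) (frob-iter (l *ℕ p ^ K) p x)

    orbitSum-+ : ∀ i j x → orbitSum (i +ℕ j) (frob l) x ≡ σ i (orbitSum j (frob l) x) + orbitSum i (frob l) x
    orbitSum-+ i zero    x = trans (cong (λ k → orbitSum k (frob l) x) (ℕₚ.+-identityʳ i)) (sym (trans (cong (_+ orbitSum i (frob l) x) (frob-0 (l *ℕ i))) (+-identityˡ _)))
    orbitSum-+ i (suc j) x = begin
      orbitSum (i +ℕ suc j) (frob l) x ≡⟨ cong (λ k → orbitSum k (frob l) x) (ℕₚ.+-suc i j) ⟩
      orbitSum (i +ℕ j) (frob l) x + iter (i +ℕ j) (frob l) x ≡⟨ cong₂ _+_ (orbitSum-+ i j x) (trans (iter-+ i j (frob l) x) (sym (frob-iter l i _))) ⟩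
      σ i (orbitSum j (frob l) x) + orbitSum i (frob l) x + σ i (iter j (frob l) x) ≡⟨ swap-last _ _ _ ⟩
      σ i (orbitSum j (frob l) x) + σ i (iter j (frob l) x) + orbitSum i (frob l) x ≡⟨ cong (_+ orbitSum i (frob l) x) (frob-+ (l *ℕ i) _ _) ⟨
      σ i (orbitSum (suc j) (frob l) x) + orbitSum i (frob l) x ∎
      where
      open ≡-Reasoning
      swap-last : ∀ x y z → x + y + z ≡ x + z + y
      swap-last x y z = (solve 3 (λ a b c → a :+ b :+ c := a :+ c :+ b) refl x y z)

    orbitSum-fixed : ∀ n {x} → frob l x ≡ x → orbitSum n (frob l) x ≡ ι n * x
    orbitSum-fixed zero    fix = sym (zeroˡ _)
    orbitSum-fixed (suc n) {x} fix = trans (cong₂ _+_ (orbitSum-fixed n fix) (iter-fixed n)) (solve 2 (λ a b → a :* b :+ b := (`1 :+ a) :* b) refl (ι n) x)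
      where
      iter-fixed : ∀ n → iter n (frob l) x ≡ x
      iter-fixed zero    = refl
      iter-fixed (suc n) = trans (cong (frob l) (iter-fixed n)) fix

    -- φ is the identity modulo N F, so there the sum consists of n copies of x.
    orbitSum-N : ∀ n x → ∃ λ y → orbitSum n (frob l) x ≡ ι n * x + N y
    orbitSum-N zero    x = 0# , trans (solve 1 (λ a → `0 := `0 :* a :+ `0) refl x) (cong (0# * x +_) (sym NM.map-0))
    orbitSum-N (suc n) x with orbitSum-N n x
    ... | y , e = y + orbitSum n (frob l) x , trans (cong₂ _+_ e (iter-orbitSum n x))
            (trans (regroup _ _ _ _) (cong ((1# + ι n) * x +_) (sym (N-+ y _))))
      where
      regroup : ∀ k x u v → k * x + u + (x + v) ≡ (1# + k) * x + (u + v)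
      regroup k x u v = (solve 4 (λ a b c d → a :* b :+ c :+ (b :+ d) := (`1 :+ a) :* b :+ (c :+ d)) refl k x u v)

    record Stable (V : Carrier → Set) : Set where
      field
        V-0   : V 0#
        V-+   : ∀ {x y} → V x → V y → V (x + y)
        V-neg : ∀ {x} → V x → V (- x)
        V-φ   : ∀ {x} → V x → V (frob l x)

      V-- : ∀ {x y} → V x → V y → V (x - y)
      V-- vx vy = V-+ vx (V-neg vy)

      V-N : ∀ {x} → V x → V (N x)
      V-N vx = V-- (V-φ vx) vx

      V-iterN : ∀ k {x} → V x → V (iter k N x)
      V-iterN zero    vx = vx
      V-iterN (suc k) vx = V-N (V-iterN k vx)

      V-ι : ∀ n {x} → V x → V (ι n * x)
      V-ι zero    {x} vx = subst V (sym (zeroˡ x)) V-0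
      V-ι (suc n) {x} vx = subst V (solve 2 (λ a b → a :+ b :* a := (`1 :+ b) :* a) refl x (ι n)) (V-+ vx (V-ι n vx))

      V-σ : ∀ j {x} → V x → V (σ j x)
      V-σ zero    {x} vx = subst V (sym (σ-0 x)) vx
      V-σ (suc j) {x} vx = subst V (sym (frob-iter l (suc j) x)) (V-φ (subst V (frob-iter l j x) (V-σ j vx)))

    module Nilpotent (n : ℕ) (nil : ∀ x → iter n N x ≡ 0#) where

      -- Nakayama's lemma for N: iterating V + N F = F pushes the error into N^n F, which is zero.
      exhausts : ∀ {V} → Stable V → (∀ w → ∃ λ y → V (w - N y)) → ∀ w → V w
      exhausts {V} st h w with go n w
        where
        open Stable st
        go : ∀ k w → ∃ λ y → V (w - iter k N y)
        go zero    w = w , subst V (sym (-‿inverseʳ w)) V-0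
        go (suc k) w with go k w
        ... | y , v with h y
        ...   | y' , v' = y' , subst V (trans (cong (w - iter k N y +_) (NI.map-- k y (N y')))
                    (trans (cong (λ z → w - iter k N y + (iter k N y - z)) (iter-suc k N y')) (telescope w (iter k N y) (N (iter k N y')))))
                    (V-+ v (V-iterN k v'))
          where
          telescope : ∀ a b c → a - b + (b - c) ≡ a - c
          telescope a b c = (solve 3 (λ a b c → a :- b :+ (b :- c) := a :- c) refl a b c)
      ... | y , v = subst V (trans (cong (λ z → w - z) (nil y)) (solve 1 (λ a → a :- `0 := a) refl w)) v

      -- An index k prime to p puts b into N F + V, whence V = F; indices divisible by p give N F ⊆ N² F + V.
      crossed-cyclic : ∀ {V} → Stable V → ∀ b → (∀ x → ∃ λ k → V (x - orbitSum k (frob l) b)) → ∀ x → V (N x)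
      crossed-cyclic {V} st b h x with go n x
        where
        open Stable st
        everything : (∃ λ y → V (b - N y)) → ∀ w → V w
        everything (y , v) = exhausts st λ w → let (k , vk) = h w ; (z , e) = orbitSum-N k b in
          ι k * y + z , subst V (begin
            w - orbitSum k (frob l) b + ι k * (b - N y) ≡⟨ cong (λ u → w - u + ι k * (b - N y)) e ⟩
            w - (ι k * b + N z) + ι k * (b - N y) ≡⟨ simplify w (ι k) b (N z) (N y) ⟩
            w - (ι k * N y + N z) ≡⟨ cong (λ u → w - u) (trans (cong (_+ N z) (sym (NM.map-ι k y))) (sym (N-+ _ z))) ⟩
            w - N (ι k * y + z) ∎) (V-+ vk (V-ι k v))
          where
          open ≡-Reasoning
          simplify : ∀ w k b u v → w - (k * b + u) + k * (b - v) ≡ w - (k * v + u)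
          simplify w k b u v = (solve 5 (λ a b c d e → a :- (b :* c :+ d) :+ b :* (c :- e) := a :- (b :* e :+ d)) refl w k b u v)
        -- The p-term sum is N^(p-1) b, and p ≥ 3 places it in N² F; this is where p = 2 would fail.
        multiple : ∀ c → ∃ λ y → orbitSum (c *ℕ p) (frob l) b ≡ N (N y)
        multiple zero    = 0# , sym (trans (cong N NM.map-0) NM.map-0)
        multiple (suc c) with multiple c
        ... | y , e = σ p y + iter (p ∸ 3) N b , (begin
            orbitSum (p +ℕ c *ℕ p) (frob l) b ≡⟨ orbitSum-+ p (c *ℕ p) b ⟩
            σ p (orbitSum (c *ℕ p) (frob l) b) + orbitSum p (frob l) b ≡⟨ cong₂ _+_ (trans (cong (σ p) e) (frob-iterN (l *ℕ p) 2 y)) (trans (orbitSum-p b) (cong (λ k → iter k N b) p-split)) ⟩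
            N (N (σ p y)) + N (N (iter (p ∸ 3) N b)) ≡⟨ NM.iter-additive 2 _ _ ⟨
            N (N (σ p y + iter (p ∸ 3) N b)) ∎)
          where
          open ≡-Reasoning
          p-split : p ∸ 1 ≡ suc (suc (p ∸ 3))
          p-split = trans (cong (_∸ 1) (sym (ℕₚ.m+[n∸m]≡n p≥3))) refl
        decide : ∀ x → (∀ w → V w) ⊎ ∃ λ y → V (N x - N (N y))
        decide x with h (N x)
        ... | k , v with p ∣? k
        ...   | yes (divides c refl) with multiple c
        ...     | y , e = inj₂ (y , subst (λ z → V (N x - z)) e v)
        decide x | k , v | no p∤k = inj₁ (everything (prime-to-p (prime-field ((ι k) ⁻¹) fixed) (orbitSum-N k b)))
          where
          open ≡-Reasoning
          ιk≢0 : ι k ≢ 0#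
          ιk≢0 z = p∤k (ι-zero z)
          fixed : pow ((ι k) ⁻¹) p ≡ (ι k) ⁻¹
          fixed = trans (frob-⁻¹ 1 (ι k) ιk≢0) (cong _⁻¹ (frob-ι 1 k))
          rearr : ∀ j k b u v → - (j * (u - (k * b + v))) + b * 1# ≡ b - j * (u - v) + b * (k * j)
          rearr j k b u v = (solve 5 (λ a b c d e → :- (a :* (b :- (c :* d :+ e))) :+ d :* `1 := d :- a :* (b :- e) :+ d :* (c :* a)) refl j u k b v)
          prime-to-p : (∃ λ j → j < p × (ι k) ⁻¹ ≡ ι j) → (∃ λ z → orbitSum k (frob l) b ≡ ι k * b + N z) → ∃ λ y → V (b - N y)
          prime-to-p (j , _ , ej) (z , e) = ι j * (x - z) , subst V (begin
            - (ι j * (N x - orbitSum k (frob l) b)) ≡⟨ cong (λ u → - (ι j * (N x - u))) e ⟩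
            - (ι j * (N x - (ι k * b + N z))) ≡⟨ combine₁ b (trans (cong (ι k *_) (sym ej)) (inverseʳ (ι k) ιk≢0)) (rearr (ι j) (ι k) b (N x) (N z)) ⟩
            b - ι j * (N x - N z) ≡⟨ cong (λ u → b - u) (trans (cong (ι j *_) (sym (NM.map-- x z))) (sym (NM.map-ι j (x - z)))) ⟩
            b - N (ι j * (x - z)) ∎) (V-neg (V-ι j v))
        -- Unless V is everything, iterating `decide` pushes the remainder of N x modulo V into ever
        -- higher powers of N.
        go : ∀ k x → (∀ w → V w) ⊎ ∃ λ y → V (N x - iter k N (N y))
        go zero    x = inj₂ (x , subst V (sym (-‿inverseʳ _)) V-0)
        go (suc k) x with go k x
        ... | inj₁ all = inj₁ all
        ... | inj₂ (y , v) with decide y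
        ...   | inj₁ all = inj₁ all
        ...   | inj₂ (y' , v') = inj₂ (y' , subst V (trans (cong (N x - iter k N (N y) +_) (NI.map-- k (N y) (N (N y'))))
                    (trans (cong (λ z → N x - iter k N (N y) + (iter k N (N y) - z)) (iter-suc k N (N y'))) (telescope (N x) (iter k N (N y)) (N (iter k N (N y'))))))
                    (V-+ v (V-iterN k v')))
          where
          telescope : ∀ a b c → a - b + (b - c) ≡ a - c
          telescope a b c = (solve 3 (λ a b c → a :- b :+ (b :- c) := a :- c) refl a b c)
      ... | inj₁ all     = all (N x)
      ... | inj₂ (y , v) = subst V (trans (cong (λ z → N x - z) (nil (N y))) (solve 1 (λ a → a :- `0 := a) refl (N x))) v
        where open Stable st

      -- The last nonzero term of x, N x, N² x, ... is fixed by φ.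
      fixed-vector : ∀ {W : Carrier → Set} → (∀ {x} → W x → W (N x)) → ∀ {x} → W x → x ≢ 0# → ∃ λ y → W y × y ≢ 0# × frob l y ≡ y
      fixed-vector {W} W-N {x} wx nx = go n x wx nx (nil x)
        where
        go : ∀ k x → W x → x ≢ 0# → iter k N x ≡ 0# → ∃ λ y → W y × y ≢ 0# × frob l y ≡ y
        go zero    x wx nx e = ⊥-elim (nx e)
        go (suc k) x wx nx e with N x ≟ 0#
        ... | yes z = x , wx , nx , x-y≡0⇒x≡y z
        ... | no nz = go k (N x) (W-N wx) nz (trans (iter-suc k N x) e)

    -- F is free over the group algebra of the Galois group of order P, so the kernel of N^j is the image of N^(P-j).
    module Exact (P : ℕ) (m≡ : m ≡ l *ℕ P) (nil : ∀ x → iter P N x ≡ 0#) where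

      P≥1 : 1 ≤ P
      P≥1 = ℕₚ.n≢0⇒n>0 λ e → ℕₚ.<⇒≱ m≥1 (ℕₚ.≤-reflexive (trans m≡ (trans (cong (l *ℕ_) e) (ℕₚ.*-zeroʳ l))))

      l≥1 : 1 ≤ l
      l≥1 = ℕₚ.n≢0⇒n>0 λ e → ℕₚ.<⇒≱ m≥1 (ℕₚ.≤-reflexive (trans m≡ (cong (_*ℕ P) e)))

      instance
        l-nonZero : NonZero l
        l-nonZero = Data.Nat.>-nonZero l≥1

      iterN-monic : ∀ k → Σ[ s ∈ (ℕ → Carrier) ] ∀ x → iter k N x ≡ sumBelow k (λ i → s i * σ i x) + σ k x
      iterN-monic zero    = (λ _ → 0#) , λ x → trans (sym (σ-0 x)) (sym (+-identityˡ _))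
      iterN-monic (suc k) with iterN-monic k
      ... | s , h = s' , λ x → begin
          N (iter k N x) ≡⟨ sym (iter-suc k N x) ⟩
          iter k N (N x) ≡⟨ NI.map-- k (frob l x) x ⟩
          iter k N (frob l x) - iter k N x ≡⟨ cong₂ _-_ (trans (h (frob l x)) (cong₂ _+_ (sum-cong k (λ i _ → cong (s i *_) (up i x))) (up k x))) (h x) ⟩
          A x + σ (suc k) x - (B x + σ k x) ≡⟨ (solve 4 (λ a b c d → a :+ b :- (c :+ d) := a :- c :- d :+ b) refl (A x) (σ (suc k) x) (B x) (σ k x)) ⟩
          (A x - B x - σ k x) + σ (suc k) x ≡⟨ cong (_+ σ (suc k) x) (sym (expand x)) ⟩
          sumBelow (suc k) (λ i → s' i * σ i x) + σ (suc k) x ∎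
        where
        open ≡-Reasoning
        up : ∀ i x → σ i (frob l x) ≡ σ (suc i) x
        up i x = trans (frob-comm (l *ℕ i) l x) (trans (sym (frob-comp l (l *ℕ i) x)) (cong (λ k → frob k x) (sym (ℕₚ.*-suc l i))))
        A B : Carrier → Carrier
        A x = sumBelow k (λ i → s i * σ (suc i) x)
        B x = sumBelow k (λ i → s i * σ i x)
        below : ℕ → Carrier
        below zero    = 0#
        below (suc i) = s i
        -- The coefficients of N^k with the leading 1 restored at place `k`; multiplication by φ - 1
        -- subtracts them from their shift `below`.
        s° : ℕ → Carrier
        s° i with i ℕₚ.≟ k
        ... | yes _ = 1#
        ... | no _  = s i
        s°-k : s° k ≡ 1#
        s°-k with k ℕₚ.≟ k
        ... | yes _ = refl
        ... | no ne = ⊥-elim (ne refl)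
        s°-< : ∀ i → i < k → s° i ≡ s i
        s°-< i i<k with i ℕₚ.≟ k
        ... | yes refl = ⊥-elim (ℕₚ.<-irrefl refl i<k)
        ... | no _     = refl
        s' : ℕ → Carrier
        s' i = below i - s° i
        expand : ∀ x → sumBelow (suc k) (λ i → s' i * σ i x) ≡ A x - B x - σ k x
        expand x = begin
          sumBelow (suc k) (λ i → s' i * σ i x) ≡⟨ sum-cong (suc k) (λ i _ → (solve 3 (λ a b c → (a :- b) :* c := a :* c :+ :- `1 :* (b :* c)) refl (below i) (s° i) (σ i x))) ⟩
          sumBelow (suc k) (λ i → below i * σ i x + (- 1#) * (s° i * σ i x)) ≡⟨ trans (sum-+ (suc k) _ _) (cong₂ _+_ (sum-front k _) (sum-* (suc k) (- 1#) _)) ⟩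
          (0# * σ 0 x + A x) + (- 1#) * (sumBelow k (λ i → s° i * σ i x) + s° k * σ k x) ≡⟨ cong₂ (λ y z → (0# * σ 0 x + A x) + (- 1#) * (y + z * σ k x)) (sum-cong k (λ i i<k → cong (_* σ i x) (s°-< i i<k))) s°-k ⟩
          (0# * σ 0 x + A x) + (- 1#) * (B x + 1# * σ k x) ≡⟨ (solve 4 (λ a b c d → `0 :* a :+ b :+ :- `1 :* (c :+ `1 :* d) := b :- c :- d) refl (σ 0 x) (A x) (B x) (σ k x)) ⟩
          A x - B x - σ k x ∎

      -- N^(P-1) is a monic polynomial of degree P - 1 in φ, and the automorphisms 1, φ, ...,
      -- φ^(P-1) are linearly independent.
      iterN-nonzero : ∃ λ x → iter (P ∸ 1) N x ≢ 0#
      iterN-nonzero with finite-∃? finiteF (λ x → ¬? (iter (P ∸ 1) N x ≟ 0#))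
      ... | yes r = r
      ... | no none with iterN-monic (P ∸ 1)
      ...   | s , h = ⊥-elim (1≢0 (trans (sym s°-top) (independence P (λ i → l *ℕ i) distinct s° vanish (P ∸ 1) (subst (P ∸ 1 <_) (ℕₚ.suc-pred P {{Data.Nat.>-nonZero P≥1}}) ℕₚ.≤-refl))))
        where
        s° : ℕ → Carrier
        s° i with i ℕₚ.≟ (P ∸ 1)
        ... | yes _ = 1#
        ... | no _  = s i
        s°-top : s° (P ∸ 1) ≡ 1#
        s°-top with (P ∸ 1) ℕₚ.≟ (P ∸ 1)
        ... | yes _ = refl
        ... | no ne = ⊥-elim (ne refl)
        s°-< : ∀ i → i < P ∸ 1 → s° i ≡ s i
        s°-< i i<k with i ℕₚ.≟ (P ∸ 1)
        ... | yes refl = ⊥-elim (ℕₚ.<-irrefl refl i<k)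
        ... | no _     = refl
        distinct : Distinct P (λ i → l *ℕ i)
        distinct i j i<j j<P = frob-distinct (ℕₚ.*-monoʳ-< l i<j) (subst (l *ℕ j <_) (sym m≡) (ℕₚ.*-monoʳ-< l j<P))
        zero-all : ∀ x → iter (P ∸ 1) N x ≡ 0#
        zero-all x with iter (P ∸ 1) N x ≟ 0#
        ... | yes z = z
        ... | no nz = ⊥-elim (none (x , nz))
        vanish : ∀ x → sumBelow P (λ i → s° i * σ i x) ≡ 0#
        vanish x = trans (cong (λ n → sumBelow n (λ i → s° i * σ i x)) (sym (ℕₚ.suc-pred P {{Data.Nat.>-nonZero P≥1}})))
          (trans (cong₂ _+_ (sum-cong (P ∸ 1) (λ i i<k → cong (_* σ i x) (s°-< i i<k))) (trans (cong (_* σ (P ∸ 1) x) s°-top) (*-identityˡ _)))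
            (trans (sym (h x)) (zero-all x)))

      N-scale : ∀ {r} → frob l r ≡ r → ∀ k x → iter k N (r * x) ≡ r * iter k N x
      N-scale {r} fix zero    x = refl
      N-scale {r} fix (suc k) x = trans (cong N (N-scale fix k x)) (trans (cong (_- r * y) (trans (frob-* l r y) (cong (_* frob l y) fix)))
                                    (solve 3 (λ a b c → a :* b :- a :* c := a :* (b :- c)) refl r (frob l y) y))
        where y = iter k N x

      -- Induction on j. The element r = N^j d is fixed by φ, and so is q = N^(P-1) x ≠ 0; the fixed
      -- scalar r / q pulls through N, so N^k ((r / q) x) has the same image under N^j as d. The
      -- difference is killed by N^j and the induction hypothesis applies with k + 1.
      kernel-image : ∀ j k → j +ℕ k ≡ P → ∀ d → iter j N d ≡ 0# → ∃ λ y → iter k N y ≡ d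
      kernel-image zero    k e d h = 0# , trans (NI.map-0 k) (sym h)
      kernel-image (suc j) k e d h with iterN-nonzero
      ... | x , nz = y + r' * x , (begin
          iter k N (y + r' * x) ≡⟨ NM.iter-additive k y _ ⟩
          iter k N y + iter k N (r' * x) ≡⟨ cong (_+ iter k N (r' * x)) (trans (iter-suc k N y') ey) ⟩
          d - iter k N (r' * x) + iter k N (r' * x) ≡⟨ cancel d _ ⟩
          d ∎)
        where
        open ≡-Reasoning
        cancel : ∀ d z → d - z + z ≡ d
        cancel d z = (solve 2 (λ a b → a :- b :+ b := a) refl d z)
        q = iter (P ∸ 1) N x
        r = iter j N d
        r' = r * q ⁻¹
        q-fixed : frob l q ≡ q
        q-fixed = x-y≡0⇒x≡y (trans (cong (λ n → iter n N x) (ℕₚ.suc-pred P {{Data.Nat.>-nonZero P≥1}})) (nil x))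
        r'-fixed : frob l r' ≡ r'
        r'-fixed = trans (frob-* l r (q ⁻¹)) (cong₂ _*_ (x-y≡0⇒x≡y h) (trans (frob-⁻¹ l q nz) (cong _⁻¹ q-fixed)))
        j+k : j +ℕ k ≡ P ∸ 1
        j+k = cong (_∸ 1) e
        rest : iter j N (d - iter k N (r' * x)) ≡ 0#
        rest = begin
          iter j N (d - iter k N (r' * x)) ≡⟨ NI.map-- j d _ ⟩
          r - iter j N (iter k N (r' * x)) ≡⟨ cong (λ z → r - z) (trans (sym (iter-+ j k N _)) (trans (cong (λ n → iter n N (r' * x)) j+k) (N-scale r'-fixed (P ∸ 1) x))) ⟩
          r - r * q ⁻¹ * q ≡⟨ combine₁ (- r) (inverseʳ q nz) (solve 3 (λ a b c → a :- a :* b :* c :+ :- a :* `1 := `0 :+ :- a :* (c :* b)) refl r (q ⁻¹) q) ⟩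
          0# ∎
        ih = kernel-image j (suc k) (trans (ℕₚ.+-suc j k) e) _ rest
        y' = proj₁ ih
        y = N y'
        ey : N (iter k N y') ≡ d - iter k N (r' * x)
        ey = proj₂ ih

  -- Systems of labelled elements

  two≢0 : 1# + 1# ≢ 0#
  two≢0 e = ℕₚ.<⇒≱ p≥3 (∣⇒≤ (ι-zero {2} (trans (solve 0 (`1 :+ (`1 :+ `0) := `1 :+ `1) refl) e)))

  half-double : ∀ x → half * x + half * x ≡ x
  half-double x = combine₁ x (inverseˡ (ι 2) (λ e → two≢0 (trans (solve 0 (`1 :+ `1 := `1 :+ (`1 :+ `0)) refl) e)))
    (solve 2 (λ a b → a :* b :+ a :* b :+ b :* `1 := b :+ b :* (a :* (`1 :+ (`1 :+ `0)))) refl half x)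

  -- (a , b , c , t , j) stands for the semilinear map (E(a,b,c,t), φ^j) with φ = frob l.
  record System (l : ℕ) (El : Carrier → Carrier → Carrier → Carrier → ℕ → Set) : Set where
    open Operator l
    field
      mul    : ∀ {a b c t i x y z u j} → El a b c t i → El x y z u j →
               El (σ j a + x - σ j b * z + σ j c * (y - z * u)) (σ j b + y + σ j c * u) (σ j c + z) (σ j t + u) (i +ℕ j)
      total  : ∀ a b c → Σ[ t ∈ Carrier ] Σ[ j ∈ ℕ ] El a b c t j
      unique : ∀ {a b c t t' i i'} → El a b c t i → El a b c t' i' → t ≡ t' × (∀ x → σ i x ≡ σ i' x)
      resp   : ∀ {a b c t i i'} → (∀ x → σ i x ≡ σ i' x) → El a b c t i → El a b c t i'
      div    : ∀ {a b c t i a' b' c' t' i'} → El a b c t i → El a' b' c' t' i' →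
               Σ[ x ∈ Carrier ] Σ[ y ∈ Carrier ] Σ[ z ∈ Carrier ] Σ[ u ∈ Carrier ] Σ[ j ∈ ℕ ]
                 (El x y z u j × a' ≡ σ j a + x - σ j b * z + σ j c * (y - z * u) × b' ≡ σ j b + y + σ j c * u
                 × c' ≡ σ j c + z × t' ≡ σ j t + u × (∀ v → σ (i +ℕ j) v ≡ σ i' v))
      gen    : Σ[ a ∈ Carrier ] Σ[ b ∈ Carrier ] Σ[ c ∈ Carrier ] Σ[ t ∈ Carrier ] El a b c t 1

  -- The quotient by the central-looking coordinate a, legitimate once all (a,0,0) are known to
  -- occur with t = 0 and j = 0. `flat` retains the vanishing of t that is established on the way.
  record System₂ (l : ℕ) (E : Carrier → Carrier → Carrier → ℕ → Set) : Set where
    open Operator l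
    field
      mul    : ∀ {b c t i y z u j} → E b c t i → E y z u j → E (σ j b + y + σ j c * u) (σ j c + z) (σ j t + u) (i +ℕ j)
      total  : ∀ b c → Σ[ t ∈ Carrier ] Σ[ j ∈ ℕ ] E b c t j
      unique : ∀ {b c t t' i i'} → E b c t i → E b c t' i' → t ≡ t' × (∀ x → σ i x ≡ σ i' x)
      resp   : ∀ {b c t i i'} → (∀ x → σ i x ≡ σ i' x) → E b c t i → E b c t i'
      div    : ∀ {b c t i b' c' t' i'} → E b c t i → E b' c' t' i' →
               Σ[ y ∈ Carrier ] Σ[ z ∈ Carrier ] Σ[ u ∈ Carrier ] Σ[ j ∈ ℕ ]
                 (E y z u j × b' ≡ σ j b + y + σ j c * u × c' ≡ σ j c + z × t' ≡ σ j t + u × (∀ v → σ (i +ℕ j) v ≡ σ i' v))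
      gen    : Σ[ b ∈ Carrier ] Σ[ c ∈ Carrier ] Σ[ t ∈ Carrier ] E b c t 1
      flat   : ∀ {b t} → E b 0# t 0 → t ≡ 0#

  module Reduction (l : ℕ) {El : Carrier → Carrier → Carrier → Carrier → ℕ → Set} (sys : System l El)
    (n : ℕ) (nil : ∀ x → iter n (Operator.N l) x ≡ 0#) where
    open Operator l
    open Nilpotent n nil
    open System sys

    ≡El : ∀ {a b c t a' b' c' t' j} → a ≡ a' → b ≡ b' → c ≡ c' → t ≡ t' → El a b c t j → El a' b' c' t' j
    ≡El refl refl refl refl e = e

    σ-cancel : ∀ i j → (∀ v → σ (i +ℕ j) v ≡ σ i v) → ∀ v → σ j v ≡ v
    σ-cancel i j h v = frob-injective (l *ℕ i) (trans (sym (σ-+ i j v)) (h v))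

    σ-id-0 : ∀ {j} → (∀ v → σ j v ≡ v) → ∀ v → σ j v ≡ σ 0 v
    σ-id-0 h v = trans (h v) (sym (σ-0 v))

    σ-fixed : ∀ j {x} → frob l x ≡ x → σ j x ≡ x
    σ-fixed j {x} fix = trans (frob-iter l j x) (go j)
      where
      go : ∀ j → iter j (frob l) x ≡ x
      go zero    = refl
      go (suc j) = trans (cong (frob l) (go j)) fix

    opaque
      unit : El 0# 0# 0# 0# 0
      unit with total 0# 0# 0#
      ... | t , i , g with div g g
      ...   | x , y , z , u , j , w , ea , eb , ec , et , ej = resp (σ-id-0 jid) (≡El x≡0 y≡0 z≡0 u≡0 w)
        where
        jid : ∀ v → σ j v ≡ v
        jid = σ-cancel i j ej
        z≡0 : z ≡ 0#
        z≡0 = trans (sym (trans (cong (_+ z) (jid 0#)) (+-identityˡ z))) (sym ec)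
        u≡0 : u ≡ 0#
        u≡0 = combine₂ (- 1#) (- 1#) et (jid t) (solve 3 (λ a b c → a :+ :- `1 :* (b :+ a) :+ :- `1 :* c := `0 :+ :- `1 :* c :+ :- `1 :* b) refl u (σ j t) t)
        y≡0 : y ≡ 0#
        y≡0 = combine₂ (- 1#) (- (1# + u)) eb (jid 0#) (solve 3 (λ a b c → a :+ :- `1 :* (b :+ a :+ b :* c) :+ :- (`1 :+ c) :* `0 := `0 :+ :- `1 :* `0 :+ :- (`1 :+ c) :* b) refl y (σ j 0#) u)
        x≡0 : x ≡ 0#
        x≡0 = combine₂ (- 1#) (- (1# - z + (y - z * u))) ea (jid 0#)
          (solve 5 (λ a b c d e → a :+ :- `1 :* (b :+ a :- b :* c :+ b :* (d :- c :* e)) :+ :- (`1 :- c :+ (d :- c :* e)) :* `0 := `0 :+ :- `1 :* `0 :+ :- (`1 :- c :+ (d :- c :* e)) :* b) refl x (σ j 0#) z y u)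

    M : Carrier → Carrier → Carrier → Set
    M a b t = El a b 0# t 0

    opaque
      M-+ : ∀ {a b t x y u} → M a b t → M x y u → M (a + x) (b + y) (t + u)
      M-+ {a} {b} {t} {x} {y} {u} g h = ≡El
        (trans (cong₂ (λ b' c' → σ 0 a + x - b' * 0# + c' * (y - 0# * u)) refl (σ-0 0#)) (trans (cong (λ a' → a' + x - σ 0 b * 0# + 0# * (y - 0# * u)) (σ-0 a))
          (solve 5 (λ a b c d e → a :+ b :- c :* `0 :+ `0 :* (d :- `0 :* e) := a :+ b) refl a x (σ 0 b) y u)))
        (trans (cong₂ (λ b' c' → b' + y + c' * u) (σ-0 b) (σ-0 0#)) (solve 3 (λ a b c → a :+ b :+ `0 :* c := a :+ b) refl b y u))
        (trans (cong (_+ 0#) (σ-0 0#)) (+-identityˡ 0#)) (cong (_+ u) (σ-0 t)) (mul g h)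

    opaque
      -- Apart from σ_j, conjugation by an element with third coordinate z shifts b by -z τ and a by
      -- -2 b z + z² τ. These shifts are what lets a nonzero τ or b generate whole coordinate
      -- subgroups.
      M-conjugate : ∀ {a b τ x y z u j} → M a b τ → El x y z u j →
        M (σ j a - (1# + 1#) * (σ j b * z) + z * z * σ j τ) (σ j b - z * σ j τ) (σ j τ)
      M-conjugate {a} {b} {τ} {x} {y} {z} {u} {j} g h with div h (mul g h)
      ... | x' , y' , z' , u' , j' , w , ea , eb , ec , et , ej = resp (σ-id-0 jid) (≡El x'≡ y'≡ z'≡ u'≡ w)
        where
        jid : ∀ v → σ j' v ≡ v
        jid = σ-cancel j j' ej
        z'≡ : z' ≡ 0#
        z'≡ = combine₃ (- 1#) (- 1#) 1# ec (jid z) (frob-0 (l *ℕ j)) (solve 4 (λ a b c d → a :+ :- `1 :* (b :+ a) :+ :- `1 :* c :+ `1 :* `0 := `0 :+ :- `1 :* (d :+ c) :+ :- `1 :* b :+ `1 :* d) refl z' (σ j' z) z (σ j 0#))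
        u'≡ : u' ≡ σ j τ
        u'≡ = combine₂ (- 1#) (- 1#) et (jid u) (solve 4 (λ a b c d → a :+ :- `1 :* (b :+ a) :+ :- `1 :* c := d :+ :- `1 :* (d :+ c) :+ :- `1 :* b) refl u' (σ j' u) u (σ j τ))
        y'≡ : y' ≡ σ j b - z * σ j τ
        y'≡ = combine₁ (- 1#) (trans (cong (λ c → σ j b + y + c * u) (sym (frob-0 (l *ℕ j)))) (trans eb (cong₂ (λ p q → p + y' + q) (jid y) (cong₂ _*_ (jid z) u'≡))))
          (solve 6 (λ a b c d e f → a :+ :- `1 :* (b :+ a :+ c :* d) := e :- c :* d :+ :- `1 :* (e :+ b :+ `0 :* f)) refl y' y z (σ j τ) (σ j b) u)
        x'≡ : x' ≡ σ j a - (1# + 1#) * (σ j b * z) + z * z * σ j τ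
        x'≡ = combine₁ (- 1#) (trans (cong (λ c → σ j a + x - σ j b * z + c * (y - z * u)) (sym (frob-0 (l *ℕ j)))) (trans ea
            (trans (cong₂ (λ p q → p + x' - q * z' + σ j' z * (y' - z' * u')) (jid x) (jid y)) (trans (cong₂ (λ p q → x + x' - y * p + q * (y' - p * u')) z'≡ (jid z)) (cong (λ q → x + x' - y * 0# + z * (q - 0# * u')) y'≡)))))
          (solve 9 (λ a b c d e f g h i → a :+ :- `1 :* (b :+ a :- c :* `0 :+ d :* (e :- d :* f :- `0 :* g)) := h :- (`1 :+ `1) :* (e :* d) :+ d :* d :* f :+ :- `1 :* (h :+ b :- e :* d :+ `0 :* (c :- d :* i))) refl x' x y z (σ j b) (σ j τ) u' (σ j a) u)

    opaque
      M-neg : ∀ {a b τ} → M a b τ → M (- a) (- b) (- τ)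
      M-neg {a} {b} {τ} g with div g unit
      ... | x , y , z , u , j , w , ea , eb , ec , et , ej = resp (σ-id-0 jid) (≡El x≡ y≡ z≡ u≡ w)
        where
        jid : ∀ v → σ j v ≡ v
        jid v = trans (ej v) (σ-0 v)
        z≡ : z ≡ 0#
        z≡ = sym (trans ec (trans (cong (_+ z) (jid 0#)) (+-identityˡ z)))
        u≡ : u ≡ - τ
        u≡ = combine₂ (- 1#) (- 1#) et (jid τ) (solve 3 (λ a b c → a :+ :- `1 :* (b :+ a) :+ :- `1 :* c := :- c :+ :- `1 :* `0 :+ :- `1 :* b) refl u (σ j τ) τ)
        y≡ : y ≡ - b
        y≡ = combine₁ (- 1#) (trans eb (cong₂ (λ p q → p + y + q * u) (jid b) (jid 0#))) (solve 3 (λ a b c → a :+ :- `1 :* (b :+ a :+ `0 :* c) := :- b :+ :- `1 :* `0) refl y b u)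
        x≡ : x ≡ - a
        x≡ = combine₁ (- 1#) (trans ea (trans (cong₂ (λ p q → p + x - q * z + σ j 0# * (y - z * u)) (jid a) (jid b)) (cong₂ (λ p q → a + x - b * p + q * (y - p * u)) z≡ (jid 0#))))
          (solve 5 (λ a b c d e → a :+ :- `1 :* (b :+ a :- c :* `0 :+ `0 :* (d :- `0 :* e)) := :- b :+ :- `1 :* `0) refl x a b y u)

    opaque
      M-- : ∀ {a b t x y u} → M a b t → M x y u → M (a - x) (b - y) (t - u)
      M-- g h = M-+ g (M-neg h)

    opaque
      ≡M : ∀ {a b t a' b' t'} → a ≡ a' → b ≡ b' → t ≡ t' → M a b t → M a' b' t'
      ≡M ea eb et = ≡El ea eb refl et

    A₁ B₁ : Carrier → Set
    A₁ w = M w 0# 0#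
    B₁ w = ∃ λ a → M a w 0#

    opaque
      A₁-stable : Stable A₁
      A₁-stable = record
        { V-0 = unit
        ; V-+ = λ g h → ≡M refl (+-identityˡ 0#) (+-identityˡ 0#) (M-+ g h)
        ; V-neg = λ g → ≡M refl (solve 0 (:- `0 := `0) refl) (solve 0 (:- `0 := `0) refl) (M-neg g)
        ; V-φ = λ {w} g → let (_ , _ , z , _ , h) = gen in ≡M
            (trans (cong₂ (λ p q → σ 1 w - (1# + 1#) * (p * z) + z * z * q) (frob-0 (l *ℕ 1)) (frob-0 (l *ℕ 1)))
              (trans (cong (λ p → p - (1# + 1#) * (0# * z) + z * z * 0#) (σ-1 w)) (solve 2 (λ a b → a :- (`1 :+ `1) :* (`0 :* b) :+ b :* b :* `0 := a) refl (frob l w) z)))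
            (trans (cong₂ (λ p q → p - z * q) (frob-0 (l *ℕ 1)) (frob-0 (l *ℕ 1))) (solve 1 (λ a → `0 :- a :* `0 := `0) refl z))
            (frob-0 (l *ℕ 1)) (M-conjugate g h) }

    opaque
      B₁-stable : Stable B₁
      B₁-stable = record
        { V-0 = 0# , unit
        ; V-+ = λ (a , g) (x , h) → _ , ≡M refl refl (+-identityˡ 0#) (M-+ g h)
        ; V-neg = λ (a , g) → _ , ≡M refl refl (solve 0 (:- `0 := `0) refl) (M-neg g)
        ; V-φ = λ {w} (a , g) → let (_ , _ , z , _ , h) = gen in _ , ≡M refl
            (trans (cong₂ (λ p q → p - z * q) (σ-1 w) (frob-0 (l *ℕ 1))) (solve 2 (λ a b → a :- b :* `0 := a) refl (frob l w) z))
            (frob-0 (l *ℕ 1)) (M-conjugate g h) }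

    opaque
      σ-orbitSum : ∀ j x → σ j x ≡ x + N (orbitSum j (frob l) x)
      σ-orbitSum j x = trans (frob-iter l j x) (iter-orbitSum j x)

    opaque
      -- Since b is fixed by φ, the difference between a conjugate and the element itself has first
      -- coordinate -2 b z modulo N F, with z at will. So A₁ + N F = F, and `exhausts` applies.
      A₁-full : ∀ {a b} → M a b 0# → frob l b ≡ b → b ≢ 0# → ∀ w → A₁ w
      A₁-full {a} {b} g fix nb = exhausts A₁-stable λ w →
        -- The solution of -2 b z = w.
        let z = - (half * w * b ⁻¹)
            (u , j , h) = total 0# 0# z
            o = orbitSum j (frob l) a in
        - o , ≡M
          (begin
            σ j a - (1# + 1#) * (σ j b * z) + z * z * σ j 0# - a ≡⟨ cong₂ (λ p q → p - (1# + 1#) * (q * z) + z * z * σ j 0# - a) (σ-orbitSum j a) (σ-fixed j fix) ⟩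
            a + N o - (1# + 1#) * (b * z) + z * z * σ j 0# - a ≡⟨ cong (λ q → a + N o - (1# + 1#) * (b * z) + z * z * q - a) (frob-0 (l *ℕ j)) ⟩
            a + N o - (1# + 1#) * (b * z) + z * z * 0# - a ≡⟨ combine₂ (half * w + half * w) 1# (inverseʳ b nb) (half-double w) (ring₁ a (N o) half w b (b ⁻¹)) ⟩
            w - (- N o) ≡⟨ cong (λ q → w - q) (NM.map-neg o) ⟨
            w - N (- o) ∎)
          (trans (cong₂ (λ p q → p - z * q - b) (σ-fixed j fix) (frob-0 (l *ℕ j))) (ring₂ b z))
          (trans (cong (_- 0#) (frob-0 (l *ℕ j))) (solve 0 (`0 :- `0 := `0) refl))
          (M-- (M-conjugate g h) g)
        where
        open ≡-Reasoning
        ring₁ : ∀ a o h w b b' → a + o - (1# + 1#) * (b * (- (h * w * b'))) + (- (h * w * b')) * (- (h * w * b')) * 0# - a + (h * w + h * w) * 1# + 1# * w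
          ≡ w - (- o) + (h * w + h * w) * (b * b') + 1# * (h * w + h * w)
        ring₁ a o h w b b' = (solve 6 (λ a b c d e f → a :+ b :- (`1 :+ `1) :* (c :* :- (d :* e :* f)) :+ :- (d :* e :* f) :* :- (d :* e :* f) :* `0 :- a :+ (d :* e :+ d :* e) :* `1 :+ `1 :* e := e :- :- b :+ (d :* e :+ d :* e) :* (c :* f) :+ `1 :* (d :* e :+ d :* e)) refl a o b h w b')
        ring₂ : ∀ b z → b - z * 0# - b ≡ 0#
        ring₂ b z = (solve 2 (λ a b → a :- b :* `0 :- a := `0) refl b z)

    opaque
      -- A nonzero τ can be replaced by one fixed by φ. Conjugation then fills `B₁`, and through it
      -- `A₁`, so the same (a , b , 0) also occurs with t = 0; uniqueness of t is violated.
      M-flat : ∀ {a b τ} → M a b τ → τ ≡ 0#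
      M-flat {a} {b} {τ} g with τ ≟ 0#
      ... | yes z = z
      ... | no nz with fixed-vector {W = λ τ → ∃ λ a → ∃ λ b → M a b τ} W-N (a , b , g) nz
        where
        W-N : ∀ {τ} → (∃ λ a → ∃ λ b → M a b τ) → ∃ λ a → ∃ λ b → M a b (N τ)
        W-N {τ} (a , b , g) = let (_ , _ , _ , _ , h) = gen in
          _ , _ , ≡M refl refl (cong (_- τ) (σ-1 τ)) (M-- (M-conjugate g h) g)
      ... | τ' , (a' , b' , g') , nτ , fix = ⊥-elim (nτ (proj₁ (unique g' all)))
        where
        open ≡-Reasoning
        ring₃ : ∀ b o τ τ' w → b + o - (- (w * τ')) * τ - b + w * 1# ≡ w - (- o) + w * (τ * τ')
        ring₃ b o τ τ' w = (solve 5 (λ a b c d e → a :+ b :- :- (c :* d) :* e :- a :+ c :* `1 := c :- :- b :+ c :* (e :* d)) refl b o w τ' τ)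
        B-full : ∀ w → B₁ w
        B-full = exhausts B₁-stable λ w →
          let z = - (w * τ' ⁻¹)
              (u , j , h) = total 0# 0# z
              o = orbitSum j (frob l) b' in
          - o , _ , ≡M refl
            (begin
              σ j b' - z * σ j τ' - b' ≡⟨ cong₂ (λ p q → p - z * q - b') (σ-orbitSum j b') (σ-fixed j fix) ⟩
              b' + N o - z * τ' - b' ≡⟨ combine₁ w (inverseʳ τ' nτ) (ring₃ b' (N o) τ' (τ' ⁻¹) w) ⟩
              w - (- N o) ≡⟨ cong (λ q → w - q) (NM.map-neg o) ⟨
              w - N (- o) ∎)
            (trans (cong (_- τ') (σ-fixed j fix)) (-‿inverseʳ τ'))
            (M-- (M-conjugate g' h) g')
        all : M a' b' 0#
        all = let (x , h) = B-full b' in ≡M (solve 2 (λ a b → a :- b :+ b := a) refl a' x) (+-identityˡ b') (+-identityˡ 0#)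
                (M-+ (A₁-full (proj₂ (B-full 1#)) (frob-1 l) 1≢0 (a' - x)) h)

    opaque
      -- The start is b = 1, which every σ fixes. If its label acts trivially, `M-flat` finishes;
      -- otherwise comparing both products with an element over (0 , y , 0) yields y - σ_i y,
      -- nonzero for a suitable y.
      B₁-nonzero : ∃ λ b → B₁ b × b ≢ 0#
      B₁-nonzero with total 0# 1# 0#
      ... | t , i , g with finite-∃? finiteF (λ y → ¬? (σ i y ≟ y))
      ...   | no none = 1# , (0# , flatten (resp (σ-id-0 iid) g)) , 1≢0
        where
        iid : ∀ v → σ i v ≡ v
        iid v with σ i v ≟ v
        ... | yes e = e
        ... | no ne = ⊥-elim (none (v , ne))
        flatten : ∀ {a b τ} → M a b τ → M a b 0#
        flatten h = ≡M refl refl (M-flat h) h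
      ...   | yes (y , ne) with total 0# y 0#
      ...     | u , j , h with div (mul h g) (mul g h)
      ...       | x' , y' , z' , u' , j' , w , ea , eb , ec , et , ej = y - σ i y , (x' , ≡M refl y'≡ (M-flat w') w') , λ e → ne (sym (x-y≡0⇒x≡y e))
        where
        jid : ∀ v → σ j' v ≡ v
        jid = σ-cancel (j +ℕ i) j' (λ v → trans (ej v) (cong (λ k → σ k v) (ℕₚ.+-comm i j)))
        c≡0 : ∀ k → σ k 0# + 0# ≡ 0#
        c≡0 k = trans (+-identityʳ _) (frob-0 (l *ℕ k))
        z'≡ : z' ≡ 0#
        z'≡ = sym (trans (sym (c≡0 j)) (trans ec (trans (cong (_+ z') (trans (jid _) (c≡0 i))) (+-identityˡ z'))))
        w' : M x' y' u'
        w' = resp (σ-id-0 jid) (≡El refl refl z'≡ refl w)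
        y'≡ : y' ≡ y - σ i y
        y'≡ = combine₂ (- 1#) 1# (trans eb (cong₂ (λ p q → p + y' + q * u') (trans (jid _) (cong (λ q → σ i y + 1# + q * t) (frob-0 (l *ℕ i)))) (trans (jid _) (c≡0 i))))
            (trans (cong (λ q → σ j 1# + y + q * u) (frob-0 (l *ℕ j))) (cong (λ q → q + y + 0# * u) (frob-1 (l *ℕ j))))
          (solve 8 (λ a b c d e f g h → a :+ :- `1 :* (b :+ `1 :+ `0 :* c :+ a :+ `0 :* d) :+ `1 :* (`1 :+ e :+ `0 :* f) := e :- b :+ :- `1 :* (g :+ e :+ h :* f) :+ `1 :* (g :+ e :+ h :* f)) refl y' (σ i y) t u' y u (σ j 1#) (σ j 0#))

    opaque
      A-full : ∀ a → M a 0# 0#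
      A-full with B₁-nonzero
      ... | b , bb , nb with fixed-vector (Stable.V-N B₁-stable) bb nb
      ...   | b' , (a' , g) , nb' , fix = A₁-full g fix nb'

    opaque
      El-free : ∀ {a b c t j} a' → El a b c t j → El a' b c t j
      El-free {a} {b} {c} {t} {j} a' g with frob-surjective (l *ℕ j) (a' - a)
      ... | w , e = ≡El
        (trans (cong₂ (λ p q → σ j w + a - p * c + q * (b - c * t)) (frob-0 (l *ℕ j)) (frob-0 (l *ℕ j)))
          (combine₁ 1# e (solve 6 (λ a b c d e f → a :+ b :- `0 :* c :+ `0 :* (d :- c :* e) :+ `1 :* (f :- b) := f :+ `1 :* a) refl (σ j w) a c b t a')))
        (trans (cong₂ (λ p q → p + b + q * t) (frob-0 (l *ℕ j)) (frob-0 (l *ℕ j))) (solve 2 (λ a b → `0 :+ a :+ `0 :* b := a) refl b t))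
        (trans (cong (_+ c) (frob-0 (l *ℕ j))) (+-identityˡ c))
        (trans (cong (_+ t) (frob-0 (l *ℕ j))) (+-identityˡ t))
        (mul (A-full w) g)

    system₂ : System₂ l (El 0#)
    system₂ = record
      { mul = λ g h → El-free 0# (mul g h)
      ; total = total 0#
      ; unique = unique
      ; resp = resp
      ; div = λ g h → let (x , y , z , u , j , w , ea , eb , ec , et , ej) = div g h in y , z , u , j , El-free 0# w , eb , ec , et , ej
      ; gen = let (a , b , c , t , g) = gen in b , c , t , El-free 0# g
      ; flat = M-flat }

  module Facts (l P : ℕ) (m≡ : m ≡ l *ℕ P) (K : ℕ) (P∣ : P ∣ p ^ K)
    {E : Carrier → Carrier → Carrier → ℕ → Set} (sys : System₂ l E) where
    open Operator l public
    open System₂ sys public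

    l-positive : 1 ≤ l
    l-positive = ℕₚ.n≢0⇒n>0 λ e → ℕₚ.<⇒≱ m≥1 (ℕₚ.≤-reflexive (trans m≡ (cong (_*ℕ P) e)))

    P-positive : 1 ≤ P
    P-positive = ℕₚ.n≢0⇒n>0 λ e → ℕₚ.<⇒≱ m≥1 (ℕₚ.≤-reflexive (trans m≡ (trans (cong (l *ℕ_) e) (ℕₚ.*-zeroʳ l))))

    instance
      l-nonzero : NonZero l
      l-nonzero = Data.Nat.>-nonZero l-positive
      P-nonzero : NonZero P
      P-nonzero = Data.Nat.>-nonZero P-positive

    σ-∣ : ∀ {k} → P ∣ k → ∀ v → σ k v ≡ v
    σ-∣ {k} d = frob-∣ (subst (_∣ l *ℕ k) (sym m≡) (*-monoʳ-∣ l d))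

    σ-period : ∀ {k} → (∀ v → σ k v ≡ v) → P ∣ k
    σ-period {k} h = *-cancelˡ-∣ l (subst (_∣ l *ℕ k) m≡ (frob-period h))

    %-σ : ∀ {i j} → i % P ≡ j % P → ∀ v → σ i v ≡ σ j v
    %-σ {i} {j} e v = trans (reduce i) (trans (cong (λ k → σ k v) e) (sym (reduce j)))
      where
      reduce : ∀ i → σ i v ≡ σ (i % P) v
      reduce i = trans (cong (λ k → σ k v) (m≡m%n+[m/n]*n i P)) (trans (σ-+ (i % P) _ v) (cong (σ (i % P)) (σ-∣ (divides (i / P) refl) v)))

    nil : ∀ x → iter (p ^ K) N x ≡ 0#
    nil x = trans (N-nilpotent K x) (x≡y⇒x-y≡0 (σ-∣ P∣ x))

    open Nilpotent (p ^ K) nil public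

    ≡E : ∀ {b c t b' c' t' j} → b ≡ b' → c ≡ c' → t ≡ t' → E b c t j → E b' c' t' j
    ≡E refl refl refl e = e

    σ-cancel : ∀ i j → (∀ v → σ (i +ℕ j) v ≡ σ i v) → ∀ v → σ j v ≡ v
    σ-cancel i j h v = frob-injective (l *ℕ i) (trans (sym (σ-+ i j v)) (h v))

    σ-inverse : ∀ j → ∃ λ k → ∀ v → σ (k +ℕ j) v ≡ v
    σ-inverse j = j *ℕ (P ∸ 1) , σ-∣ (divides j (trans (ℕₚ.+-comm _ j) (trans (sym (ℕₚ.*-suc j (P ∸ 1))) (cong (j *ℕ_) (ℕₚ.suc-pred P)))))

    σ-id-0 : ∀ {j} → (∀ v → σ j v ≡ v) → ∀ v → σ j v ≡ σ 0 v
    σ-id-0 h v = trans (h v) (sym (σ-0 v))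

    σ-fixed : ∀ j {x} → frob l x ≡ x → σ j x ≡ x
    σ-fixed j {x} fix = trans (frob-iter l j x) (go j)
      where
      go : ∀ j → iter j (frob l) x ≡ x
      go zero    = refl
      go (suc j) = trans (cong (frob l) (go j)) fix

    opaque
      unit : E 0# 0# 0# 0
      unit with total 0# 0#
      ... | t , i , g with div g g
      ...   | y , z , u , j , w , eb , ec , et , ej = resp (σ-id-0 jid) (≡E y≡0 z≡0 u≡0 w)
        where
        jid : ∀ v → σ j v ≡ v
        jid = σ-cancel i j ej
        z≡0 : z ≡ 0#
        z≡0 = trans (sym (trans (cong (_+ z) (jid 0#)) (+-identityˡ z))) (sym ec)
        u≡0 : u ≡ 0#
        u≡0 = combine₂ (- 1#) (- 1#) et (jid t) (solve 3 (λ a b c → a :+ :- `1 :* (b :+ a) :+ :- `1 :* c := `0 :+ :- `1 :* c :+ :- `1 :* b) refl u (σ j t) t)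
        y≡0 : y ≡ 0#
        y≡0 = combine₂ (- 1#) (- (1# + u)) eb (jid 0#) (solve 3 (λ a b c → a :+ :- `1 :* (b :+ a :+ b :* c) :+ :- (`1 :+ c) :* `0 := `0 :+ :- `1 :* `0 :+ :- (`1 :+ c) :* b) refl y (σ j 0#) u)

    opaque
      mul₀ : ∀ {b c t i y z u} → E b c t i → E y z u 0 → E (b + y + c * u) (c + z) (t + u) i
      mul₀ {b} {c} {t} {i} {y} {z} {u} g h = resp (λ v → cong (λ k → σ k v) (ℕₚ.+-identityʳ i))
        (≡E (cong₂ (λ p q → p + y + q * u) (σ-0 b) (σ-0 c)) (cong (_+ z) (σ-0 c)) (cong (_+ u) (σ-0 t)) (mul g h))

    opaque
      conjugate : ∀ {b z t x y u j} → E b z t 0 → E x y u j → E (σ j b + σ j z * u - y * σ j t) (σ j z) (σ j t) 0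
      conjugate {b} {z} {t} {x} {y} {u} {j} g h with div h (mul g h)
      ... | x' , z' , u' , j' , w , eb , ec , et , ej = resp (σ-id-0 jid) (≡E x'≡ z'≡ u'≡ w)
        where
        jid : ∀ v → σ j' v ≡ v
        jid = σ-cancel j j' ej
        z'≡ : z' ≡ σ j z
        z'≡ = combine₂ (- 1#) (- 1#) ec (jid y) (solve 4 (λ a b c d → a :+ :- `1 :* (b :+ a) :+ :- `1 :* c := d :+ :- `1 :* (d :+ c) :+ :- `1 :* b) refl z' (σ j' y) y (σ j z))
        u'≡ : u' ≡ σ j t
        u'≡ = combine₂ (- 1#) (- 1#) et (jid u) (solve 4 (λ a b c d → a :+ :- `1 :* (b :+ a) :+ :- `1 :* c := d :+ :- `1 :* (d :+ c) :+ :- `1 :* b) refl u' (σ j' u) u (σ j t))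
        x'≡ : x' ≡ σ j b + σ j z * u - y * σ j t
        x'≡ = combine₁ (- 1#) (trans eb (cong₂ (λ p q → p + x' + q) (jid x) (cong₂ _*_ (jid y) u'≡)))
          (solve 7 (λ a b c d e f g → a :+ :- `1 :* (b :+ a :+ c :* d) := e :+ f :* g :- c :* d :+ :- `1 :* (e :+ b :+ f :* g)) refl x' x y (σ j t) (σ j b) (σ j z) u)

    opaque
      inverse₀ : ∀ {b z t} → E b z t 0 → ∃ λ b' → E b' (- z) (- t) 0
      inverse₀ {b} {z} {t} g with div g unit
      ... | x' , z' , u' , j' , w , eb , ec , et , ej = x' , resp (σ-id-0 jid) (≡E refl z'≡ u'≡ w)
        where
        jid : ∀ v → σ j' v ≡ v
        jid v = trans (ej v) (σ-0 v)
        z'≡ : z' ≡ - z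
        z'≡ = combine₂ (- 1#) (- 1#) ec (jid z) (solve 3 (λ a b c → a :+ :- `1 :* (b :+ a) :+ :- `1 :* c := :- c :+ :- `1 :* `0 :+ :- `1 :* b) refl z' (σ j' z) z)
        u'≡ : u' ≡ - t
        u'≡ = combine₂ (- 1#) (- 1#) et (jid t) (solve 3 (λ a b c → a :+ :- `1 :* (b :+ a) :+ :- `1 :* c := :- c :+ :- `1 :* `0 :+ :- `1 :* b) refl u' (σ j' t) t)

    opaque
      power : ∀ {b c t i} → E b c t i → ∀ k → ∃ λ bₖ → E bₖ (orbitSum k (frob (l *ℕ i)) c) (orbitSum k (frob (l *ℕ i)) t) (i *ℕ k)
      power {i = i} g zero = 0# , subst (E 0# 0# 0#) (sym (ℕₚ.*-zeroʳ i)) unit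
      power {b} {c} {t} {i} g (suc k) with power g k
      ... | bₖ , h = _ , subst (E _ _ _) (sym (ℕₚ.*-suc i k)) (≡E refl (swap c) (swap t) (mul g h))
        where
        swap : ∀ c → σ (i *ℕ k) c + orbitSum k (frob (l *ℕ i)) c ≡ orbitSum (suc k) (frob (l *ℕ i)) c
        swap c = trans (+-comm _ _) (cong (orbitSum k (frob (l *ℕ i)) c +_) (trans (cong (λ n → frob n c) (sym (ℕₚ.*-assoc l i k))) (frob-iter (l *ℕ i) k c)))

    opaque
      -- With c = 0 the cross term of the multiplication law disappears, so the b-coordinate of a
      -- power is an orbit sum too.
      power₀ : ∀ {b t i} → E b 0# t i → ∀ k → E (orbitSum k (frob (l *ℕ i)) b) 0# (orbitSum k (frob (l *ℕ i)) t) (i *ℕ k)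
      power₀ {i = i} g zero = subst (E 0# 0# 0#) (sym (ℕₚ.*-zeroʳ i)) unit
      power₀ {b} {t} {i} g (suc k) = subst (E _ _ _) (sym (ℕₚ.*-suc i k)) (≡E
          (trans (trans (cong (λ q → σ (i *ℕ k) b + orbitSum k (frob (l *ℕ i)) b + q * orbitSum k (frob (l *ℕ i)) t) (frob-0 (l *ℕ (i *ℕ k))))
            (trans (cong (σ (i *ℕ k) b + orbitSum k (frob (l *ℕ i)) b +_) (zeroˡ _)) (+-identityʳ _))) (swap b))
          (trans (+-identityʳ _) (frob-0 (l *ℕ (i *ℕ k)))) (swap t) (mul g (power₀ g k)))
        where
        swap : ∀ c → σ (i *ℕ k) c + orbitSum k (frob (l *ℕ i)) c ≡ orbitSum (suc k) (frob (l *ℕ i)) c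
        swap c = trans (+-comm _ _) (cong (orbitSum k (frob (l *ℕ i)) c +_) (trans (cong (λ n → frob n c) (sym (ℕₚ.*-assoc l i k))) (frob-iter (l *ℕ i) k c)))

    B₀ Z₀ : Carrier → Set
    B₀ b = E b 0# 0# 0
    Z₀ z = ∃ λ b → ∃ λ t → E b z t 0

    opaque
      B₀-stable : Stable B₀
      B₀-stable = record
        { V-0 = unit
        ; V-+ = λ {x} {y} g h → ≡E (trans (cong (x + y +_) (zeroˡ 0#)) (+-identityʳ _)) (+-identityˡ 0#) (+-identityˡ 0#) (mul₀ g h)
        ; V-neg = λ {x} g → let (y , z , u , j , w , eb , ec , et , ej) = div g unit
                                jid = λ v → trans (ej v) (σ-0 v) in
            resp (σ-id-0 jid) (≡E
              (combine₂ (- 1#) 0# (trans eb (cong₂ (λ p q → p + y + q * u) (jid x) (jid 0#))) refl (solve 3 (λ a b c → a :+ :- `1 :* (b :+ a :+ `0 :* c) :+ `0 :* `0 := :- b :+ :- `1 :* `0 :+ `0 :* `0) refl y x u))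
              (sym (trans ec (trans (cong (_+ z) (jid 0#)) (+-identityˡ z))))
              (sym (trans et (trans (cong (_+ u) (jid 0#)) (+-identityˡ u)))) w)
        ; V-φ = λ {x} g → let (b , c , t , h) = gen in ≡E
            (trans (cong₂ (λ p q → p + q * t - c * σ 1 0#) (σ-1 x) (frob-0 (l *ℕ 1))) (trans (cong (λ q → frob l x + 0# * t - c * q) (frob-0 (l *ℕ 1))) (solve 3 (λ a b c → a :+ `0 :* b :- c :* `0 := a) refl (frob l x) t c)))
            (frob-0 (l *ℕ 1)) (frob-0 (l *ℕ 1)) (conjugate g h) }

    opaque
      Z₀-stable : Stable Z₀
      Z₀-stable = record
        { V-0 = _ , _ , unit
        ; V-+ = λ (_ , _ , g) (_ , _ , h) → _ , _ , mul₀ g h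
        ; V-neg = λ (_ , _ , g) → let (b , h) = inverse₀ g in b , _ , h
        ; V-φ = λ {x} (_ , _ , g) → let (b , c , t , h) = gen in _ , _ , ≡E refl (σ-1 x) refl (conjugate g h) }

    opaque
      -- An element over x with label k is compared with the k-th power of the generator; the
      -- quotient has trivial label.
      Z₀-crossed : ∀ {b c t} → E b c t 1 → ∀ x → ∃ λ k → Z₀ (x - orbitSum k (frob l) c)
      Z₀-crossed {b} {c} {t} g x with total 0# x
      ... | u , k , h with power g k
      ...   | bₖ , gₖ with div gₖ h
      ...     | y' , z' , u' , j' , w , eb , ec , et , ej = k , y' , u' , resp (σ-id-0 jid) (≡E refl z'≡ refl w)
        where
        jid : ∀ v → σ j' v ≡ v
        jid = σ-cancel (1 *ℕ k) j' (λ v → trans (ej v) (cong (λ n → σ n v) (sym (ℕₚ.*-identityˡ k))))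
        z'≡ : z' ≡ x - orbitSum k (frob l) c
        z'≡ = combine₁ (- 1#) (trans ec (cong (_+ z') (trans (jid _) (cong (λ n → orbitSum k (frob n) c) (ℕₚ.*-identityʳ l)))))
          (solve 3 (λ a b c → a :+ :- `1 :* (b :+ a) := c :- b :+ :- `1 :* c) refl z' (orbitSum k (frob l) c) x)

    opaque
      Z₀-N : ∀ x → Z₀ (N x)
      Z₀-N = let (b , c , t , g) = gen in crossed-cyclic Z₀-stable c (Z₀-crossed g)

    -- Vertical elements are those with c = 0. Their labels form the subgroup of ℤ/P generated by
    -- `D`; the overview's two orders are P / D and D.
    record Vertical (D : ℕ) : Set where
      field
        D∣P  : D ∣ P
        genD : ∃ λ b → ∃ λ t → E b 0# t D
        divD : ∀ {b t j} → E b 0# t j → D ∣ j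

    ∣-residue : ∀ {D i j} → D ∣ P → i % P ≡ j % P → D ∣ i → D ∣ j
    ∣-residue {D} {i} {j} D∣P e D∣i = subst (D ∣_) (sym (m≡m%n+[m/n]*n j P)) (∣m∣n⇒∣m+n (subst (D ∣_) e
      (∣m+n∣m⇒∣n (subst (D ∣_) (trans (m≡m%n+[m/n]*n i P) (ℕₚ.+-comm (i % P) _)) D∣i) (∣n⇒∣m*n (i / P) D∣P))) (∣n⇒∣m*n (j / P) D∣P))

    σ-residue : ∀ {i j} → (∀ v → σ i v ≡ σ j v) → i % P ≡ j % P
    σ-residue {i} {j} h with σ-inverse j
    ... | k , kj = begin
        i % P ≡⟨ shift-residue i (σ-period kj) ⟨
        (i +ℕ (k +ℕ j)) % P ≡⟨ cong (_% P) (reorder i k j) ⟩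
        (j +ℕ (k +ℕ i)) % P ≡⟨ shift-residue j (σ-period (λ v → trans (σ-+ k i v) (trans (cong (σ k) (h v)) (trans (sym (σ-+ k j v)) (kj v))))) ⟩
        j % P ∎
      where
      open ≡-Reasoning
      reorder : ∀ i k j → i +ℕ (k +ℕ j) ≡ j +ℕ (k +ℕ i)
      reorder = +-*-Solver.solve 3 (λ i k j → i +-*-Solver.:+ (k +-*-Solver.:+ j) +-*-Solver.:= j +-*-Solver.:+ (k +-*-Solver.:+ i)) refl
      shift-residue : ∀ i {d} → P ∣ d → (i +ℕ d) % P ≡ i % P
      shift-residue i (divides c refl) = [m+kn]%n≡m%n i c P

    private
      κ : Carrier → ℕ
      κ b = proj₁ (proj₂ (total b 0#))

      κ-el : ∀ b → E b 0# (proj₁ (total b 0#)) (κ b)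
      κ-el b = proj₂ (proj₂ (total b 0#))

      κ-% : ∀ {b t j} → E b 0# t j → κ b % P ≡ j % P
      κ-% {b} g = σ-residue (proj₂ (unique (κ-el b) g))

      κ-mul : ∀ x y → E (σ (κ y) x + y) 0# (σ (κ y) (proj₁ (total x 0#)) + proj₁ (total y 0#)) (κ x +ℕ κ y)
      κ-mul x y = ≡E (trans (cong (σ (κ y) x + y +_) (trans (cong (_* _) (frob-0 (l *ℕ κ y))) (zeroˡ _))) (+-identityʳ _))
        (trans (+-identityʳ _) (frob-0 (l *ℕ κ y))) refl (mul (κ-el x) (κ-el y))

      module CG = CyclicGenerator finiteF κ P (0# , trans (κ-% unit) (n∣m⇒m%n≡0 0 P (divides 0 refl))) (λ x y → σ (κ y) x + y , κ-% (κ-mul x y))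

    opaque
      vertical : ∃ λ D → 1 ≤ D × Vertical D
      vertical = let (D , 1≤D , D∣P , D∣κ , (x , ex)) = CG.generator in D , 1≤D , record
          { D∣P  = D∣P
          ; genD = x , _ , resp (%-σ ex) (κ-el x)
          ; divD = λ {b} g → ∣-residue D∣P (κ-% g) (D∣κ b) }

    module VerticalFacts {D : ℕ} (vert : Vertical D) where
      open Vertical vert public
      module OD = Operator (l *ℕ D)

      D-nil : ∀ x → iter (p ^ K) OD.N x ≡ 0#
      D-nil x = trans (OD.N-nilpotent K x) (x≡y⇒x-y≡0 (trans (cong (λ k → frob k x) (ℕₚ.*-assoc l D (p ^ K))) (σ-∣ (∣n⇒∣m*n D P∣) x)))

      opaque
        B₀-D-stable : OD.Stable B₀
        B₀-D-stable = record { V-0 = V-0 ; V-+ = V-+ ; V-neg = V-neg ; V-φ = V-σ D }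
          where open Stable B₀-stable

      opaque
        B₀-crossed : ∀ {b t} → E b 0# t D → ∀ x → ∃ λ k → B₀ (x - orbitSum k (frob (l *ℕ D)) b)
        B₀-crossed {b} {t} g x with total x 0#
        ... | u , j , h with divD h
        ...   | divides k e with div (power₀ g k) h
        ...     | y' , z' , u' , j' , w , eb , ec , et , ej = k , ≡E y'≡ refl (flat w') w'
          where
          jid : ∀ v → σ j' v ≡ v
          jid = σ-cancel (D *ℕ k) j' (λ v → trans (ej v) (cong (λ n → σ n v) (trans e (ℕₚ.*-comm k D))))
          z'≡ : z' ≡ 0#
          z'≡ = sym (trans ec (trans (cong (_+ z') (jid 0#)) (+-identityˡ z')))
          w' : E y' 0# u' 0
          w' = resp (σ-id-0 jid) (≡E refl z'≡ refl w)
          o : Carrier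
          o = orbitSum k (frob (l *ℕ D)) b
          y'≡ : y' ≡ x - o
          y'≡ = combine₁ (- 1#) (trans eb (cong₂ (λ p q → p + y' + q * u') (jid o) (jid 0#)))
            (solve 4 (λ a b c d → a :+ :- `1 :* (b :+ a :+ `0 :* c) := d :- b :+ :- `1 :* d) refl y' o u' x)

      opaque
        B₀-N : ∀ x → B₀ (OD.N x)
        B₀-N = let (b , t , g) = genD in OD.Nilpotent.crossed-cyclic (p ^ K) D-nil B₀-D-stable b (B₀-crossed g)

      opaque
        -- The p-th power of a vertical generator has its b-coordinate in (φ^D - 1) F, which `B₀`
        -- contains. By uniqueness its label D p acts trivially.
        P∣Dp : P ∣ D *ℕ p
        P∣Dp with genD
        ... | b , t , g with OD.orbitSum-N p b
        ...   | y , e = σ-period (λ v → trans (proj₂ (unique (power₀ g p) (≡E (sym eq) refl refl (B₀-N y))) v) (σ-0 v))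
          where
          eq : orbitSum p (frob (l *ℕ D)) b ≡ OD.N y
          eq = trans e (trans (cong (λ k → k * b + OD.N y) ι-p) (trans (cong (_+ OD.N y) (zeroˡ b)) (+-identityˡ _)))

      opaque
        -- The p-th power of an element of label 1 has its c-coordinate in N F, inside `Z₀`.
        -- Cancelling it by an element of trivial label leaves a vertical element of label p.
        D∣p : D ∣ p
        D∣p with gen
        ... | b , c , t , g with orbitSum-N p c | power g p
        ...   | y , e | bₚ , gₚ with Z₀-N y
        ...     | b' , t' , h with inverse₀ h
        ...       | b'' , h' = subst (D ∣_) (ℕₚ.*-identityˡ p) (divD (≡E refl (trans (cong (_- N y) c≡) (-‿inverseʳ (N y))) refl (mul₀ gₚ h')))
          where
          c≡ : orbitSum p (frob (l *ℕ 1)) c ≡ N y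
          c≡ = trans (cong (λ n → orbitSum p (frob n) c) (ℕₚ.*-identityʳ l)) (trans e (trans (cong (λ k → k * c + N y) ι-p) (trans (cong (_+ N y) (zeroˡ c)) (+-identityˡ _))))

      opaque
        straight-from : ∀ {b₀} → E b₀ 0# 0# D → ∀ {b t j} → E b 0# t j → t ≡ 0#
        straight-from g₀ {b} {t} {j} g with divD g
        ... | divides k ek with div (power₀ g₀ k) g
        ...   | y , z , u , j' , h , eb , ec , et , ej = trans et (trans (cong₂ _+_ (trans (jid _) (trans (OD.orbitSum-fixed k (frob-0 (l *ℕ D))) (zeroʳ _)))
              (flat (resp (σ-id-0 jid) (≡E refl (sym (trans ec (trans (cong (_+ z) (jid 0#)) (+-identityˡ z)))) refl h)))) (+-identityˡ 0#))
          where
          jid : ∀ v → σ j' v ≡ v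
          jid = σ-cancel (D *ℕ k) j' (λ v → trans (ej v) (cong (λ n → σ n v) (trans ek (ℕₚ.*-comm k D))))

  -- Normalisation of t

  -- Conjugation by E(0,0,0,w).
  twist : ℕ → Carrier → (Carrier → Carrier → Carrier → ℕ → Set) → Carrier → Carrier → Carrier → ℕ → Set
  twist l w E b c t j = E (b - c * w) c (t - w + Operator.σ l j w) j

  module _ (l : ℕ) {E : Carrier → Carrier → Carrier → ℕ → Set} (sys : System₂ l E) (w : Carrier) where
    open Operator l
    private module S = System₂ sys

    private
      ≡E : ∀ {b c t b' c' t' j} → b ≡ b' → c ≡ c' → t ≡ t' → E b c t j → E b' c' t' j
      ≡E refl refl refl e = e

      b-law : ∀ j b c y z u → σ j (b - c * w) + (y - z * w) + σ j c * (u - w + σ j w) ≡ σ j b + y + σ j c * u - (σ j c + z) * w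
      b-law j b c y z u = trans (cong (λ q → q + (y - z * w) + σ j c * (u - w + σ j w)) (trans (frob-- (l *ℕ j) b (c * w)) (cong (λ q → σ j b - q) (frob-* (l *ℕ j) c w))))
        (solve 7 (λ a b c d e f g → a :- b :* c :+ (d :- e :* f) :+ b :* (g :- f :+ c) := a :+ d :+ b :* g :- (b :+ e) :* f) refl (σ j b) (σ j c) (σ j w) y z w u)

      t-law : ∀ i j t u → σ j (t - w + σ i w) + (u - w + σ j w) ≡ σ j t + u - w + σ (i +ℕ j) w
      t-law i j t u = trans (cong (_+ (u - w + σ j w)) (trans (frob-+ (l *ℕ j) (t - w) _) (cong₂ _+_ (frob-- (l *ℕ j) t w) (trans (frob-comm (l *ℕ j) (l *ℕ i) w) (sym (σ-+ i j w))))))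
        (solve 5 (λ a b c d e → a :- b :+ c :+ (d :- e :+ b) := a :+ d :- e :+ c) refl (σ j t) (σ j w) (σ (i +ℕ j) w) u w)

      retwist : ∀ t j → t + w - σ j w - w + σ j w ≡ t
      retwist t j = (solve 3 (λ a b c → a :+ b :- c :- b :+ c := a) refl t w (σ j w))

    twist-el : ∀ {b c t j} → E b c t j → twist l w E (b + c * w) c (t + w - σ j w) j
    twist-el {b} {c} {t} {j} g = ≡E (solve 3 (λ a b c → a := a :+ b :* c :- b :* c) refl b c w) refl (sym (retwist t j)) g

    opaque
      twist-system : System₂ l (twist l w E)
      twist-system = record
        { mul = λ {b} {c} {t} {i} {y} {z} {u} {j} g h → ≡E (b-law j b c y z u) refl (t-law i j t u) (S.mul g h)
        ; total = λ b c → let (t , j , g) = S.total (b - c * w) c in t + w - σ j w , j , ≡E refl refl (sym (retwist t j)) g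
        ; unique = λ {b} {c} {t} {t'} {i} {i'} g h → let (e , ej) = S.unique g h in
            combine₂ 1# (- 1#) e (ej w) (solve 5 (λ a b c d e → a :+ `1 :* (b :- c :+ d) :+ :- `1 :* d := b :+ `1 :* (a :- c :+ e) :+ :- `1 :* e) refl t t' w (σ i' w) (σ i w)) , ej
        ; resp = λ {b} {c} {t} h g → ≡E refl refl (cong (t - w +_) (h w)) (S.resp h g)
        ; div = λ {b} {c} {t} {i} {b'} {c'} {t'} {i'} g h → let (y , z , u , j , k , eb , ec , et , ej) = S.div g h in
            y + z * w , z , u + w - σ j w , j , ≡E (solve 3 (λ a b c → a := a :+ b :* c :- b :* c) refl y z w) refl (sym (retwist u j)) k
            , combine₃ 1# 1# w (trans eb (cong (λ q → σ j (b - c * w) + q + σ j c * u) (solve 3 (λ a b c → a := a :+ b :* c :- b :* c) refl y z w))) (b-law j b c (y + z * w) z (u + w - σ j w)) ec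
                (ring₁ b' c' w (σ j (b - c * w)) y z (σ j c) u (σ j w) (σ j b))
            , ec
            , combine₃ 1# 1# 1# et (t-law i j t (u + w - σ j w)) (ej w) (ring₂ t' w (σ i' w) (σ j (t - w + σ i w)) u (σ j w) (σ j t) (σ (i +ℕ j) w))
            , ej
        ; gen = let (b , c , t , g) = S.gen in _ , _ , _ , twist-el g
        ; flat = λ {b} {t} g → combine₂ 1# (- 1#) (S.flat (≡E (solve 2 (λ a b → a :- `0 :* b := a) refl b w) refl refl g)) (σ-0 w) (solve 3 (λ a b c → a :+ `1 :* `0 :+ :- `1 :* b := `0 :+ `1 :* (a :- b :+ c) :+ :- `1 :* c) refl t w (σ 0 w)) }
        where
        ring₁ : ∀ b' c' w σbcw y z σc u σw σb →
          b' + 1# * (σbcw + (y + z * w - z * w) + σc * u) + 1# * (σb + (y + z * w) + σc * (u + w - σw) - (σc + z) * w) + w * (σc + z)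
          ≡ σb + (y + z * w) + σc * (u + w - σw) + 1# * (b' - c' * w) + 1# * (σbcw + (y + z * w - z * w) + σc * (u + w - σw - w + σw)) + w * c'
        ring₁ b' c' w σbcw y z σc u σw σb = (solve 10 (λ a b c d e f g h i j → a :+ `1 :* (b :+ (c :+ d :* e :- d :* e) :+ f :* g) :+ `1 :* (h :+ (c :+ d :* e) :+ f :* (g :+ e :- i) :- (f :+ d) :* e) :+ e :* (f :+ d) := h :+ (c :+ d :* e) :+ f :* (g :+ e :- i) :+ `1 :* (a :- j :* e) :+ `1 :* (b :+ (c :+ d :* e :- d :* e) :+ f :* (g :+ e :- i :- e :+ i)) :+ e :* j) refl b' σbcw y z w σc u σb σw c')
        ring₂ : ∀ t' w σi'w σtw u σw σt σijw →
          t' + 1# * (σtw + u) + 1# * (σt + (u + w - σw) - w + σijw) + 1# * σi'w ≡ σt + (u + w - σw) + 1# * (t' - w + σi'w) + 1# * (σtw + (u + w - σw - w + σw)) + 1# * σijw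
        ring₂ t' w σi'w σtw u σw σt σijw = (solve 8 (λ a b c d e f g h → a :+ `1 :* (b :+ c) :+ `1 :* (d :+ (c :+ e :- f) :- e :+ g) :+ `1 :* h := d :+ (c :+ e :- f) :+ `1 :* (a :- e :+ h) :+ `1 :* (b :+ (c :+ e :- f :- e :+ f)) :+ `1 :* g) refl t' σtw u σt w σw σijw σi'w)

  twist-twist : ∀ l (E : Carrier → Carrier → Carrier → ℕ → Set) w v {b c t j} → twist l v (twist l w E) b c t j → twist l (w + v) E b c t j
  twist-twist l E w v {b} {c} {t} {j} = subst₂ (λ b' t' → E b' c t' j) (solve 4 (λ a b c d → a :- b :* c :- b :* d := a :- b :* (d :+ c)) refl b c v w)
      (trans (solve 5 (λ a b c d e → a :- b :+ c :- d :+ e := a :- (d :+ b) :+ (e :+ c)) refl t v (σ j v) w (σ j w)) (cong (t - (w + v) +_) (sym (frob-+ (l *ℕ j) w v))))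
    where open Operator l

  twist-untwist : ∀ l (E : Carrier → Carrier → Carrier → ℕ → Set) w v {b c t j} → twist l (w + v) E b c t j → twist l v (twist l w E) b c t j
  twist-untwist l E w v {b} {c} {t} {j} = subst₂ (λ b' t' → E b' c t' j) (solve 4 (λ a b c d → a :- b :* (c :+ d) := a :- b :* d :- b :* c) refl b c w v)
      (trans (cong (t - (w + v) +_) (frob-+ (l *ℕ j) w v)) (solve 5 (λ a b c d e → a :- (b :+ c) :+ (d :+ e) := a :- c :+ e :- b :+ d) refl t w v (σ j w) (σ j v)))
    where open Operator l

  record Graph (l : ℕ) (E : Carrier → Carrier → Carrier → ℕ → Set) (S : Carrier → Carrier) : Set where
    field
      graph : ∀ {b c t j} → E b c t j → t ≡ S c
      S-+   : Additive S
      S-φ   : ∀ x → S (frob l x) ≡ frob l (S x)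

  module Normal (l P : ℕ) (m≡ : m ≡ l *ℕ P) (K : ℕ) (P∣ : P ∣ p ^ K) where

    module Straight {E : Carrier → Carrier → Carrier → ℕ → Set} (sys : System₂ l E)
      (straight : ∀ {b t j} → E b 0# t j → t ≡ 0#) where
      open Facts l P m≡ K P∣ sys

      S : Carrier → Carrier
      S c = proj₁ (total 0# c)

      opaque
        -- Multiplying an element over (0 , c) on the left by a vertical one, where t = 0, moves b
        -- to any prescribed value and keeps t.
        graph : ∀ {b c t j} → E b c t j → t ≡ S c
        graph {b} {c} {t} {j} g with total 0# c
        ... | s , j' , g' with frob-surjective (l *ℕ j') b
        ...   | y , ey with total y 0#
        ...     | u , i , h = proj₁ (unique g (≡E
            (trans (cong (λ q → σ j' y + 0# + q * s) (frob-0 (l *ℕ j'))) (trans (solve 2 (λ a b → a :+ `0 :+ `0 :* b := a) refl (σ j' y) s) ey))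
            (trans (cong (_+ c) (frob-0 (l *ℕ j'))) (+-identityˡ c))
            (trans (cong (_+ s) (trans (cong (σ j') (straight h)) (frob-0 (l *ℕ j')))) (+-identityˡ s)) (mul h g')))

      opaque
        S-mul : ∀ c {y z u j} → E y z u j → S (σ j c + z) ≡ σ j (S c) + S z
        S-mul c {j = j} g = trans (sym (graph (mul (proj₂ (proj₂ (total 0# c))) g))) (cong (σ j (S c) +_) (graph g))

      opaque
        S-0 : S 0# ≡ 0#
        S-0 = sym (graph unit)

      opaque
        S-Z : ∀ c {z} → Z₀ z → S (c + z) ≡ S c + S z
        S-Z c {z} (_ , _ , g) = trans (cong (λ q → S (q + z)) (sym (σ-0 c))) (trans (S-mul c g) (cong (_+ S z) (σ-0 (S c))))

      opaque
        S-φZ : ∀ {z} → Z₀ z → S (frob l z) ≡ frob l (S z)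
        S-φZ {z} (_ , t , g) = let (_ , _ , _ , h) = gen in
          trans (cong S (sym (σ-1 z))) (trans (sym (graph (conjugate g h))) (trans (σ-1 t) (cong (frob l) (graph g))))

      opaque
        S-neg : ∀ {z} → Z₀ z → S (- z) ≡ - S z
        S-neg {z} v = combine₁ 1# (trans (sym (S-Z z (Stable.V-neg Z₀-stable v))) (trans (cong S (-‿inverseʳ z)) S-0))
          (solve 2 (λ a b → a :+ `1 :* `0 := :- b :+ `1 :* (b :+ a)) refl (S (- z)) (S z))

      opaque
        S-NZ : ∀ {z} → Z₀ z → S (N z) ≡ N (S z)
        S-NZ {z} v = trans (S-Z (frob l z) (Stable.V-neg Z₀-stable v)) (cong₂ _+_ (S-φZ v) (S-neg v))

      opaque
        S-iterNZ : ∀ k {z} → Z₀ z → S (iter k N z) ≡ iter k N (S z)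
        S-iterNZ zero    v = refl
        S-iterNZ (suc k) v = trans (S-NZ (Stable.V-iterN Z₀-stable k v)) (cong N (S-iterNZ k v))

      opaque
        iterφ-Z : ∀ k {z} → Z₀ z → Z₀ (iter k (frob l) z) × S (iter k (frob l) z) ≡ iter k (frob l) (S z)
        iterφ-Z zero    v = v , refl
        iterφ-Z (suc k) v = let (v' , e) = iterφ-Z k v in Stable.V-φ Z₀-stable v' , trans (S-φZ v') (cong (frob l) e)

      opaque
        S-orbitSumZ : ∀ k {z} → Z₀ z → S (orbitSum k (frob l) z) ≡ orbitSum k (frob l) (S z)
        S-orbitSumZ zero    v = S-0
        S-orbitSumZ (suc k) v = let (v' , e) = iterφ-Z k v in trans (S-Z _ v') (cong₂ _+_ (S-orbitSumZ k v) e)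

      opaque
        S-orbitSum : ∀ {b c t} → E b c t 1 → ∀ k → S (orbitSum k (frob l) c) ≡ orbitSum k (frob l) t
        S-orbitSum {c = c} {t} g k = let (_ , h) = power g k in
          trans (cong (λ n → S (orbitSum k (frob n) c)) (sym (ℕₚ.*-identityʳ l))) (trans (sym (graph h)) (cong (λ n → orbitSum k (frob n) t) (ℕₚ.*-identityʳ l)))

      opaque
        N-orbitSum : ∀ k x → N (orbitSum k (frob l) x) ≡ orbitSum k (frob l) (N x)
        N-orbitSum k x = trans (NM.map-sum k _) (sum-cong k (λ i _ → N-iter i))
          where
          N-iter : ∀ i → N (iter i (frob l) x) ≡ iter i (frob l) (N x)
          N-iter i = trans (cong N (sym (frob-iter l i x))) (trans (sym (frob-N (l *ℕ i) x)) (frob-iter l i (N x)))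

      opaque
        -- Every x is an orbit sum of c plus an element of `Z₀`. On `Z₀` conjugation shows that S
        -- commutes with φ; on orbit sums the single equation N t = S (N c) is enough.
        S-equivariant : ∀ {b c t} → E b c t 1 → N t ≡ S (N c) → ∀ x → S (frob l x) ≡ frob l (S x)
        S-equivariant {b} {c} {t} g e x with Z₀-crossed g x
        ... | k , v = begin
            S (frob l x) ≡⟨ cong S (trans (cong (frob l) (sym x≡)) (trans (frob-+ l o z) (trans (cong (_+ frob l z) (frob≡1+N o)) (+-assoc _ _ _)))) ⟩
            S (o + (N o + frob l z)) ≡⟨ S-Z o (V-+ (Z₀-N o) (V-φ v)) ⟩
            S o + S (N o + frob l z) ≡⟨ cong (S o +_) (trans (S-Z (N o) (V-φ v)) (cong₂ _+_ SNo (S-φZ v))) ⟩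
            S o + (N (S o) + frob l (S z)) ≡⟨ +-assoc _ _ _ ⟨
            S o + N (S o) + frob l (S z) ≡⟨ cong (_+ frob l (S z)) (frob≡1+N (S o)) ⟨
            frob l (S o) + frob l (S z) ≡⟨ frob-+ l _ _ ⟨
            frob l (S o + S z) ≡⟨ cong (frob l) (trans (sym (S-Z o v)) (cong S x≡)) ⟩
            frob l (S x) ∎
          where
          open ≡-Reasoning
          open Stable Z₀-stable
          o z : Carrier
          o = orbitSum k (frob l) c
          z = x - o
          x≡ : o + z ≡ x
          x≡ = (solve 2 (λ a b → a :+ (b :- a) := b) refl o x)
          SNo : S (N o) ≡ N (S o)
          SNo = trans (cong S (N-orbitSum k c)) (trans (S-orbitSumZ k (Z₀-N c)) (trans (cong (orbitSum k (frob l)) (sym e))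
                  (trans (sym (N-orbitSum k t)) (cong N (sym (S-orbitSum g k))))))

      opaque
        -- Once S commutes with every σ_j, the twist in `S-mul` can be moved inside S, and
        -- surjectivity of σ_j turns the law into additivity.
        equivariant-graph : (∀ x → S (frob l x) ≡ frob l (S x)) → Graph l E S
        equivariant-graph S-φ = record { graph = graph ; S-+ = S-+ ; S-φ = S-φ }
          where
          S-σ : ∀ j x → S (σ j x) ≡ σ j (S x)
          S-σ j x = trans (cong S (frob-iter l j x)) (trans (go j) (sym (frob-iter l j (S x))))
            where
            go : ∀ j → S (iter j (frob l) x) ≡ iter j (frob l) (S x)
            go zero    = refl
            go (suc j) = trans (S-φ _) (cong (frob l) (go j))
          S-+ : ∀ x y → S (x + y) ≡ S x + S y
          S-+ x y = go (proj₂ (proj₂ (total 0# y)))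
            where
            go : ∀ {u j} → E 0# y u j → S (x + y) ≡ S x + S y
            go {u} {j} g with frob-surjective (l *ℕ j) x
            ... | x' , refl = trans (S-mul x' g) (cong (_+ S y) (sym (S-σ j x')))

    twist-vertical : ∀ {E} (sys : System₂ l E) w {D} → Facts.Vertical l P m≡ K P∣ sys D → Facts.Vertical l P m≡ K P∣ (twist-system l sys w) D
    twist-vertical {E} sys w {D} vert = record
      { D∣P = D∣P
      ; genD = let (b , t , g) = genD in b + 0# * w , _ , twist-el l sys w g
      ; divD = λ g → divD g }
      where open Facts.Vertical vert

    module Straighten {E : Carrier → Carrier → Carrier → ℕ → Set} (sys : System₂ l E) {D : ℕ}
      (vert : Facts.Vertical l P m≡ K P∣ sys D) where
      open Facts l P m≡ K P∣ sys
      open VerticalFacts vert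

      instance
        D-nonzero : NonZero D
        D-nonzero = Data.Nat.≢-nonZero λ e → ℕₚ.<⇒≱ p≥2 (ℕₚ.≤-trans (ℕₚ.≤-reflexive (Data.Nat.Divisibility.0∣⇒≡0 (subst (_∣ p) e D∣p))) z≤n)

      P-cases : P ≡ D ⊎ P ≡ D *ℕ p
      P-cases with D∣P
      ... | divides e refl with prime⇒irreducible pr (*-cancelˡ-∣ D (subst (_∣ D *ℕ p) (ℕₚ.*-comm e D) P∣Dp))
      ...   | inj₁ refl = inj₁ (ℕₚ.*-identityˡ D)
      ...   | inj₂ refl = inj₂ (ℕₚ.*-comm p D)

      opaque
        -- Additive Hilbert 90 for φ^D. If P = D p, the p-th power of the element has trivial label,
        -- so `flat` makes the trace (φ^D - 1)^(p-1) t vanish and `kernel-image` solves for w. If P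
        -- = D, the label is already trivial and t = 0.
        coboundary : ∀ {b t} → E b 0# t D → ∃ λ w → t ≡ σ D w - w
        coboundary {b} {t} g with P-cases
        ... | inj₁ refl = 0# , trans (flat (resp (σ-id-0 (σ-∣ Data.Nat.Divisibility.∣-refl)) g)) (sym (trans (cong (_- 0#) (frob-0 (l *ℕ D))) (-‿inverseʳ 0#)))
        ... | inj₂ refl = let (w , e) = kernel-image (p ∸ 1) 1 (trans (ℕₚ.+-comm (p ∸ 1) 1) (ℕₚ.suc-pred p)) t trace-zero in w , sym e
          where
          nil-p : ∀ x → iter p OD.N x ≡ 0#
          nil-p x = trans (cong (λ n → iter n OD.N x) (sym (ℕₚ.^-identityʳ p))) (trans (OD.N-nilpotent 1 x) (x≡y⇒x-y≡0
            (trans (cong (λ k → frob k x) (trans (cong (l *ℕ D *ℕ_) (ℕₚ.^-identityʳ p)) (trans (ℕₚ.*-assoc l D p) (sym m≡)))) (frob-m x))))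
          open OD.Exact p (trans m≡ (sym (ℕₚ.*-assoc l D p))) nil-p using (kernel-image)
          trace-zero : iter (p ∸ 1) OD.N t ≡ 0#
          trace-zero = trans (sym (OD.orbitSum-p t)) (flat (resp (σ-id-0 (σ-∣ Data.Nat.Divisibility.∣-refl)) (power₀ g p)))

      opaque
        straighten : ∃ λ w → ∀ {b t j} → twist l w E b 0# t j → t ≡ 0#
        straighten = let (b₀ , t₀ , g₀) = genD ; (w , e) = coboundary g₀ in
          w , Facts.VerticalFacts.straight-from l P m≡ K P∣ (twist-system l sys w) (twist-vertical sys w vert)
                (≡E (solve 2 (λ a b → a := a :- `0 :* b) refl b₀ w) refl (trans e (solve 2 (λ a b → a :- b := `0 :- b :+ a) refl (σ D w) w)) g₀)

    -- The defect d = N t₁ - S(N c₁) of a generator is killed by N^(p-2), hence of the form N² w with w fixed by φ^p.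
    module Equivary {E : Carrier → Carrier → Carrier → ℕ → Set} (sys : System₂ l E) {D : ℕ}
      (vert : Facts.Vertical l P m≡ K P∣ sys D) (straight : ∀ {b t j} → E b 0# t j → t ≡ 0#) where
      open Facts l P m≡ K P∣ sys
      open VerticalFacts vert
      open Straight sys straight

      P-power : ∃ λ k → P ≡ p ^ k
      P-power = prime-power-form pr K P∣

      nil-P : ∀ x → iter P N x ≡ 0#
      nil-P x = let (k , e) = P-power in trans (cong (λ n → iter n N x) e) (trans (N-nilpotent k x) (x≡y⇒x-y≡0
        (trans (cong (λ n → σ n x) (sym e)) (σ-∣ Data.Nat.Divisibility.∣-refl x))))

      opaque
        defect : ∀ {b c t} → E b c t 1 → p ≤ P → ∃ λ w → N t - S (N c) ≡ N (N w) × σ p w ≡ w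
        defect {b} {c} {t} g p≤P = w , sym ey , x-y≡0⇒x≡y (trans (sym (trans (cong (λ n → iter n N w) (sym (ℕₚ.^-identityʳ p))) (trans (N-nilpotent 1 w) (cong (λ n → σ n w - w) (ℕₚ.^-identityʳ p)))))
            (trans (sym (iter-+ p (P ∸ p) N y)) (trans (cong (λ n → iter n N y) (ℕₚ.m+[n∸m]≡n p≤P)) (nil-P y))))
          where
          open Exact P m≡ nil-P using (kernel-image)
          d : Carrier
          d = N t - S (N c)
          -- N^(p-1) is the sum of p conjugates, and S carries that sum of c to that of t because
          -- both are coordinates of the p-th power of the generator.
          vanish : iter (p ∸ 2) N d ≡ 0#
          vanish = begin
            iter (p ∸ 2) N d ≡⟨ NI.map-- (p ∸ 2) (N t) (S (N c)) ⟩
            iter (p ∸ 2) N (N t) - iter (p ∸ 2) N (S (N c)) ≡⟨ cong₂ _-_ (trans (iter-suc (p ∸ 2) N t) (cong (λ n → iter n N t) p-1)) (sym (S-iterNZ (p ∸ 2) (Z₀-N c))) ⟩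
            iter (p ∸ 1) N t - S (iter (p ∸ 2) N (N c)) ≡⟨ cong (λ q → iter (p ∸ 1) N t - S q) (trans (iter-suc (p ∸ 2) N c) (cong (λ n → iter n N c) p-1)) ⟩
            iter (p ∸ 1) N t - S (iter (p ∸ 1) N c) ≡⟨ cong₂ (λ q r → q - S r) (sym (orbitSum-p t)) (sym (orbitSum-p c)) ⟩
            orbitSum p (frob l) t - S (orbitSum p (frob l) c) ≡⟨ x≡y⇒x-y≡0 (sym (S-orbitSum g p)) ⟩
            0# ∎
            where
            open ≡-Reasoning
            p-1 : suc (p ∸ 2) ≡ p ∸ 1
            p-1 = cong (_∸ 1) (ℕₚ.m+[n∸m]≡n p≥2)
          ker : ∃ λ y → iter (suc (suc (P ∸ p))) N y ≡ d
          ker = kernel-image (p ∸ 2) (suc (suc (P ∸ p))) (trans (trans (ℕₚ.+-suc _ _) (cong suc (ℕₚ.+-suc _ _))) (trans (cong (_+ℕ (P ∸ p)) (ℕₚ.m+[n∸m]≡n p≥2)) (ℕₚ.m+[n∸m]≡n p≤P))) d vanish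
          y w : Carrier
          y = proj₁ ker
          -- With this exponent N² w = d, while N^p w = N^P y = 0 says that φ^p fixes w.
          w = iter (P ∸ p) N y
          ey : N (N w) ≡ d
          ey = proj₂ ker

      opaque
        equivary : ∃ λ w → Σ[ S ∈ (Carrier → Carrier) ] Graph l (twist l w E) S
        equivary with prime⇒irreducible pr D∣p
        -- Here D = 1: some vertical element has label 1. It serves as the generator, with c = t = 0
        -- and hence no defect.
        ... | inj₁ refl = 0# , T.S , T.equivariant-graph (T.S-equivariant g (trans (cong N t≡0) (trans NM.map-0 (sym (trans (cong T.S NM.map-0) T.S-0)))))
          where
          straight' : ∀ {b t j} → twist l 0# E b 0# t j → t ≡ 0#
          straight' {b} {t} {j} h = combine₂ 1# (- 1#) (straight (≡E (solve 1 (λ a → a :- `0 :* `0 := a) refl b) refl refl h)) (frob-0 (l *ℕ j)) (solve 2 (λ a b → a :+ `1 :* `0 :+ :- `1 :* `0 := `0 :+ `1 :* (a :- `0 :+ b) :+ :- `1 :* b) refl t (σ j 0#))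
          module T = Straight (twist-system l sys 0#) straight'
          g : twist l 0# E (proj₁ genD + 0# * 0#) 0# (proj₁ (proj₂ genD) + 0# - σ 1 0#) 1
          g = twist-el l sys 0# (proj₂ (proj₂ genD))
          t≡0 : proj₁ (proj₂ genD) + 0# - σ 1 0# ≡ 0#
          t≡0 = straight' g
        ... | inj₂ refl with gen
        ...   | b₁ , c₁ , t₁ , g₁ with defect g₁ (∣⇒≤ D∣P)
        ...     | w , e , fix = w , T.S , T.equivariant-graph (T.S-equivariant (twist-el l sys w g₁) (begin
                N (t₁ + w - σ 1 w) ≡⟨ cong N (trans (cong (λ q → t₁ + w - q) (σ-1 w)) (solve 3 (λ a b c → a :+ b :- c := a :- (c :- b)) refl t₁ w (frob l w))) ⟩
                N (t₁ - N w) ≡⟨ NM.map-- t₁ (N w) ⟩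
                N t₁ - N (N w) ≡⟨ combine₁ 1# e (solve 3 (λ a b c → a :- b :+ `1 :* b := c :+ `1 :* (a :- c)) refl (N t₁) (N (N w)) (S (N c₁))) ⟩
                S (N c₁) ≡⟨ same (Z₀-N c₁) ⟩
                T.S (N c₁) ∎))
          where
          open ≡-Reasoning
          straight' : ∀ {b t j} → twist l w E b 0# t j → t ≡ 0#
          straight' {b} {t} {j} h = combine₂ 1# (- 1#) (straight h) (multiple (divD h)) (solve 3 (λ a b c → a :+ `1 :* `0 :+ :- `1 :* b := `0 :+ `1 :* (a :- b :+ c) :+ :- `1 :* c) refl t w (σ j w))
            where
            -- Vertical labels are multiples of D = p and σ_p fixes w, so the twist does not spoil t
            -- = 0 on vertical elements.
            multiple : ∀ {j} → p ∣ j → σ j w ≡ w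
            multiple (divides k refl) = trans (cong (λ n → frob n w) (trans (cong (l *ℕ_) (ℕₚ.*-comm k p)) (sym (ℕₚ.*-assoc l p k)))) (trans (frob-iter (l *ℕ p) k w) (go k))
              where
              go : ∀ k → iter k (frob (l *ℕ p)) w ≡ w
              go zero    = refl
              go (suc k) = trans (cong (frob (l *ℕ p)) (go k)) fix
          module T = Straight (twist-system l sys w) straight'
          -- Over `Z₀` the label is trivial and the twist leaves t alone, so the defect computed
          -- with the old S is cancelled for the new one.
          same : ∀ {z} → Z₀ z → S z ≡ T.S z
          same (b , t , h) = trans (sym (graph h)) (trans (combine₁ 1# (σ-0 w) (solve 3 (λ a b c → a :+ `1 :* b := a :+ b :- c :+ `1 :* c) refl t w (σ 0 w))) (T.graph (twist-el l sys w h)))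

    opaque
      normalise : ∀ {E} (sys : System₂ l E) → ∃ λ w → Σ[ S ∈ (Carrier → Carrier) ] Graph l (twist l w E) S
      normalise {E} sys = w + v , S , record { graph = λ g → graph (twist-untwist l E w v g) ; S-+ = S-+ ; S-φ = S-φ }
        where
        D : ℕ
        D = proj₁ (Facts.vertical l P m≡ K P∣ sys)
        vert : Facts.Vertical l P m≡ K P∣ sys D
        vert = proj₂ (proj₂ (Facts.vertical l P m≡ K P∣ sys))
        st : ∃ λ w → ∀ {b t j} → twist l w E b 0# t j → t ≡ 0#
        st = Straighten.straighten sys vert
        w : Carrier
        w = proj₁ st
        eq : ∃ λ v → Σ[ S ∈ (Carrier → Carrier) ] Graph l (twist l v (twist l w E)) S
        eq = Equivary.equivary (twist-system l sys w) (twist-vertical sys w vert) (proj₂ st)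
        v : Carrier
        v = proj₁ eq
        S : Carrier → Carrier
        S = proj₁ (proj₂ eq)
        open Graph (proj₂ (proj₂ eq))

  -- Constructions A, B and C

  Rel : Set₁
  Rel = Carrier → Carrier → Carrier → ℕ → Set

  -- The constructions are expressed as conditions on the relation of labels, in both directions.
  -- The passage to conjugate subgroups then takes place once, at the end.
  FormA : ℕ → Rel → Set
  FormA l E = Σ[ s ∈ (ℕ → Carrier) ]
    ((∀ {b c t j} → E b c t j → t ≡ lin m s c × (∀ x → Operator.σ l j x ≡ x)) × (∀ b c → E b c (lin m s c) 0))

  FormB : ℕ → Rel → Set
  FormB l E = Σ[ s ∈ (ℕ → Carrier) ] Σ[ μC ∈ Carrier ]
    ((m ≡ p *ℕ l) × (∀ i → i < m → InSub l (s i)) × InSub l μC × (μC ≢ 0#)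
    × (∀ {b c t j} → E b c t j → t ≡ lin m s c × ι j ≡ tr m (μC * c))
    × (∀ b c k → ι k ≡ tr m (μC * c) → E b c (lin m s c) k))

  FormC : ℕ → Rel → Set
  FormC l E = Σ[ s ∈ (ℕ → Carrier) ] Σ[ μB ∈ Carrier ]
    ((m ≡ p *ℕ l) × InSub l μB × (μB ≢ 0#) × (∀ i → i < m → InSub l (s i))
    × (∀ i → 1 ≤ i → i < m → μB * s i - frob i (s (m ∸ i)) * frob i μB ≡ 0#)
    × (∀ {b c t j} → E b c t j → t ≡ lin m s c × ι j ≡ half * Qf m s μB c + tr m (μB * b))
    × (∀ b c k → ι k ≡ half * Qf m s μB c + tr m (μB * b) → E b c (lin m s c) k))

  half-fixed : pow half p ≡ half
  half-fixed = trans (frob-⁻¹ 1 (ι 2) (λ e → two≢0 (trans (solve 0 (`1 :+ `1 := `1 :+ (`1 :+ `0)) refl) e))) (cong _⁻¹ (frob-ι 1 2))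

  fixed-+ : ∀ {x y} → pow x p ≡ x → pow y p ≡ y → pow (x + y) p ≡ x + y
  fixed-+ {x} {y} ex ey = trans (frob-+ 1 x y) (cong₂ _+_ ex ey)

  fixed-* : ∀ {x y} → pow x p ≡ x → pow y p ≡ y → pow (x * y) p ≡ x * y
  fixed-* {x} {y} ex ey = trans (frob-* 1 x y) (cong₂ _*_ ex ey)

  fixed-neg : ∀ {x} → pow x p ≡ x → pow (- x) p ≡ - x
  fixed-neg {x} ex = trans (frob-neg 1 x) (cong -_ ex)

  module Labelled (l P : ℕ) (m≡ : m ≡ l *ℕ P) (K : ℕ) (P∣ : P ∣ p ^ K)
    {E : Rel} (sys : System₂ l E) {S : Carrier → Carrier} (gr : Graph l E S) where
    open Facts l P m≡ K P∣ sys public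
    open Graph gr public
    module SM = AdditiveMap S-+

    S-σ : ∀ j x → S (σ j x) ≡ σ j (S x)
    S-σ j x = trans (cong S (frob-iter l j x)) (trans (go j) (sym (frob-iter l j (S x))))
      where
      go : ∀ j → S (iter j (frob l) x) ≡ iter j (frob l) (S x)
      go zero    = refl
      go (suc j) = trans (S-φ _) (cong (frob l) (go j))

    E₃ : Carrier → Carrier → ℕ → Set
    E₃ b c j = E b c (S c) j

    S-coeffs : Σ[ s ∈ (ℕ → Carrier) ] ((∀ x → S x ≡ lin m s x) × (∀ i → i < m → InSub l (s i)))
    S-coeffs = let (s , h) = additive-linearized S-+ in
      s , h , lin-equivariant l s (λ x → trans (sym (h (frob l x))) (trans (S-φ x) (cong (frob l) (h x))))

    opaque
      ≡E₃ : ∀ {b c b' c' j} → b ≡ b' → c ≡ c' → E₃ b c j → E₃ b' c' j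
      ≡E₃ refl refl g = g

    opaque
      to₃ : ∀ {b c t j} → E b c t j → E₃ b c j
      to₃ g = ≡E refl refl (graph g) g

    opaque
      total₃ : ∀ b c → ∃ λ j → E₃ b c j
      total₃ b c = let (t , j , g) = total b c in j , to₃ g

    opaque
      mul₃ : ∀ {b c i y z j} → E₃ b c i → E₃ y z j → E₃ (σ j b + y + σ j c * S z) (σ j c + z) (i +ℕ j)
      mul₃ g h = to₃ (mul g h)

    opaque
      mul₃₀ : ∀ {b c i y z} → E₃ b c i → E₃ y z 0 → E₃ (b + y + c * S z) (c + z) i
      mul₃₀ g h = to₃ (mul₀ g h)

    opaque
      unique₃ : ∀ {b c i j} → E₃ b c i → E₃ b c j → i % P ≡ j % P
      unique₃ g h = σ-residue (proj₂ (unique g h))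

    opaque
      resp₃ : ∀ {b c i j} → i % P ≡ j % P → E₃ b c i → E₃ b c j
      resp₃ e g = resp (%-σ e) g

    opaque
      Z₃-N : ∀ x → ∃ λ b → E₃ b (N x) 0
      Z₃-N x = let (b , _ , g) = Z₀-N x in b , to₃ g

    opaque
      mul₃-vertical : ∀ {b i y z j} → E₃ b 0# i → E₃ y z j → E₃ (σ j b + y) z (i +ℕ j)
      mul₃-vertical {b} {i} {y} {z} {j} g h = ≡E₃ (trans (cong (λ q → σ j b + y + q * S z) (frob-0 (l *ℕ j))) (solve 3 (λ a b c → a :+ b :+ `0 :* c := a :+ b) refl (σ j b) y (S z)))
        (trans (cong (_+ z) (frob-0 (l *ℕ j))) (+-identityˡ z)) (mul₃ g h)

    opaque
      mul₃-by-vertical : ∀ {b c i y j} → E₃ b c i → E₃ y 0# j → E₃ (σ j b + y) (σ j c) (i +ℕ j)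
      mul₃-by-vertical {b} {c} {i} {y} {j} g h = ≡E₃ (trans (cong (λ q → σ j b + y + σ j c * q) SM.map-0) (solve 3 (λ a b c → a :+ b :+ c :* `0 := a :+ b) refl (σ j b) y (σ j c)))
        (+-identityʳ _) (mul₃ g h)

    opaque
      invariant-σ : ∀ {f : Carrier → Carrier} → (∀ x → f (frob l x) ≡ f x) → ∀ j x → f (σ j x) ≡ f x
      invariant-σ {f} inv j x = trans (cong f (frob-iter l j x)) (iterate j)
        where
        iterate : ∀ j → f (iter j (frob l) x) ≡ f x
        iterate zero    = refl
        iterate (suc j) = trans (inv _) (iterate j)

    opaque
      -- A φ-invariant f does not distinguish x from σ_j x, so the twist in the hypothesis
      -- disappears.
      additive-from-twisted : ∀ {f : Carrier → Carrier} → (∀ x → f (frob l x) ≡ f x) →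
          (∀ y → ∃ λ j → ∀ x → f (σ j x + y) ≡ f x + f y) → Additive f
      additive-from-twisted {f} inv h x y with h y
      ... | j , hj with frob-surjective (l *ℕ j) x
      ...   | x' , refl = trans (hj x') (cong (_+ f y) (sym (invariant-σ inv j x')))

    caseA : P ≡ 1 → FormA l E
    caseA refl = let (s , S≡ , _) = S-coeffs in s , (λ {_} {c} {_} {j} g → trans (graph g) (S≡ c) , σ-∣ (divides j (sym (ℕₚ.*-identityʳ j))))
      , λ b c → let (j , g) = total₃ b c in ≡E refl refl (S≡ c) (resp (σ-id-0 (σ-∣ (divides j (sym (ℕₚ.*-identityʳ j))))) g)

    module Mod-p (p∣P : p ∣ P) where

      opaque
        residue-ι : ∀ {i j} → i % P ≡ j % P → ι i ≡ ι j
        residue-ι {i} {j} e = trans (reduce i) (trans (cong ι e) (sym (reduce j)))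
          where
          reduce : ∀ i → ι i ≡ ι (i % P)
          reduce i = trans (cong ι (m≡m%n+[m/n]*n i P)) (trans (ι-+ (i % P) _) (trans (cong (ι (i % P) +_) (ι-∣ (∣n⇒∣m*n (i / P) p∣P))) (+-identityʳ _)))

      opaque
        -- The label modulo p, placed in the prime field so that trace duality applies to it.
        χ : Carrier → Carrier → Carrier
        χ b c = ι (proj₁ (total₃ b c))
        χ-el : ∀ {b c j} → E₃ b c j → χ b c ≡ ι j
        χ-el {b} {c} {j} g = residue-ι (unique₃ (proj₂ (total₃ b c)) g)
        χ-fixed : ∀ b c → pow (χ b c) p ≡ χ b c
        χ-fixed b c = frob-ι 1 (proj₁ (total₃ b c))

      opaque
        χ-mul : ∀ b c {y z j} → E₃ y z j → χ (σ j b + y + σ j c * S z) (σ j c + z) ≡ χ b c + χ y z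
        χ-mul b c {j = j} g = let (i , h) = total₃ b c in trans (χ-el (mul₃ h g)) (trans (ι-+ i j) (cong₂ _+_ (sym (χ-el h)) (sym (χ-el g))))

      opaque
        χ-vertical : ∀ b {y z j} → E₃ y z j → χ (σ j b + y) z ≡ χ b 0# + χ y z
        χ-vertical b {j = j} g = let (i , h) = total₃ b 0# in trans (χ-el (mul₃-vertical h g)) (trans (ι-+ i j) (cong₂ _+_ (sym (χ-el h)) (sym (χ-el g))))

      opaque
        χ-by-vertical : ∀ b c {y j} → E₃ y 0# j → χ (σ j b + y) (σ j c) ≡ χ b c + χ y 0#
        χ-by-vertical b c {j = j} g = let (i , h) = total₃ b c in trans (χ-el (mul₃-by-vertical h g)) (trans (ι-+ i j) (cong₂ _+_ (sym (χ-el h)) (sym (χ-el g))))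


      module Horizontal (vertical-p : ∀ {b j} → E₃ b 0# j → p ∣ j) where
        opaque
          χ-vertical-0 : ∀ b → χ b 0# ≡ 0#
          χ-vertical-0 b = let (j , g) = total₃ b 0# in trans (χ-el g) (ι-∣ (vertical-p g))

        opaque
          χ-free : ∀ b c → χ b c ≡ χ 0# c
          χ-free b c with total₃ 0# c
          ... | j , g with frob-surjective (l *ℕ j) b
          ...   | y , refl = trans (cong (λ q → χ q c) (sym (+-identityʳ _))) (trans (χ-vertical y g) (trans (cong (_+ χ 0# c) (χ-vertical-0 y)) (+-identityˡ _)))

        opaque
          -- Some element over N x has trivial label; multiplying by it turns x into φ x and keeps
          -- the label.
          χ-φ : ∀ x → χ 0# (frob l x) ≡ χ 0# x
          χ-φ x with Z₃-N x
          ... | b , g with total₃ 0# x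
          ...   | i , h = trans (sym (χ-free _ (frob l x))) (trans (χ-el (≡E₃ refl (sym (frob≡1+N x)) (mul₃₀ h g))) (sym (χ-el h)))

        opaque
          χ-additive : Additive (χ 0#)
          χ-additive = additive-from-twisted χ-φ λ y → let (j , g) = total₃ 0# y in j , λ x → trans (sym (χ-free _ _)) (χ-mul 0# x g)

        opaque
          func : ∃ λ μ → ∀ x → χ 0# x ≡ tr m (μ * x)
          func = functional-trace χ-additive (χ-fixed 0#)

        μC : Carrier
        μC = proj₁ func

        χ≡ : ∀ x → χ 0# x ≡ tr m (μC * x)
        χ≡ = proj₂ func

        opaque
          μC-sub : InSub l μC
          μC-sub = tr-invariant l μC (λ x → trans (sym (χ≡ (frob l x))) (trans (χ-φ x) (χ≡ x)))

        opaque
          χ-gen : ∀ {b c} → E₃ b c 1 → χ 0# c ≡ 1#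
          χ-gen {b} {c} g = trans (sym (χ-free b c)) (trans (χ-el g) (+-identityʳ 1#))

        opaque
          μC≢0 : μC ≢ 0#
          μC≢0 e = let (_ , c , _ , g) = gen in 1≢0 (trans (sym (χ-gen (to₃ g))) (trans (χ≡ c)
            (trans (cong (λ q → tr m (q * c)) e) (trans (cong (tr m) (zeroˡ c)) trM.map-0))))

    module Order-p (P≡ : P ≡ p) where
      open Mod-p (subst (p ∣_) (sym P≡) ∣-refl) public

      opaque
        el-χ : ∀ {b c j} → ι j ≡ χ b c → E₃ b c j
        el-χ {b} {c} {j} e = let (i , g) = total₃ b c in resp₃ (toP P≡ (ι-cong-% (sym (trans e (χ-el g))))) g
          where
          toP : ∀ {P i j} {{_ : NonZero P}} → P ≡ p → i % p ≡ j % p → i % P ≡ j % P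
          toP refl e = e

      opaque
        caseB : (∀ {b j} → E₃ b 0# j → p ∣ j) → FormB l E
        caseB vertical-p = s , μC , trans m≡ (trans (cong (l *ℕ_) P≡) (ℕₚ.*-comm l p)) , s-sub , μC-sub , μC≢0
          , (λ {b} {c} g → trans (graph g) (S≡ c) , trans (sym (χ-el (to₃ g))) (trans (χ-free b c) (χ≡ c)))
          , (λ b c k e → ≡E refl refl (S≡ c) (el-χ (trans e (trans (sym (χ≡ c)) (sym (χ-free b c))))))
          where
          open Horizontal vertical-p
          s : ℕ → Carrier
          s = proj₁ S-coeffs
          S≡ : ∀ x → S x ≡ lin m s x
          S≡ = proj₁ (proj₂ S-coeffs)
          s-sub : ∀ i → i < m → InSub l (s i)
          s-sub = proj₂ (proj₂ S-coeffs)

      module CaseC {b₀ : Carrier} (g₀ : E₃ b₀ 0# 1) (B-N : ∀ x → E₃ (N x) 0# 0) where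
        -- By `δ-law` the function δ fails to be additive by the bilinear term -β (c S z). Half its
        -- diagonal is added back in `δ₀`.
        β δ δ₀ : Carrier → Carrier
        β b = χ b 0#
        δ c = χ 0# c
        δ₀ c = δ c + half * β (c * S c)

        opaque
          β-φ : ∀ x → β (frob l x) ≡ β x
          β-φ x = let (i , h) = total₃ x 0# in trans (χ-el (≡E₃ (trans (cong (λ q → x + N x + 0# * q) SM.map-0)
            (trans (solve 2 (λ a b → a :+ (b :- a) :+ `0 :* `0 := b) refl x (frob l x)) refl)) (+-identityˡ 0#) (mul₃₀ h (B-N x)))) (sym (χ-el h))

        opaque
          β-+ : Additive β
          β-+ = additive-from-twisted β-φ λ y → let (j , g) = total₃ y 0# in j , λ x → χ-vertical x g

        opaque
          χ-split : ∀ b c → χ b c ≡ β b + δ c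
          χ-split b c with total₃ 0# c
          ... | j , g with frob-surjective (l *ℕ j) b
          ...   | y , refl = trans (cong (λ q → χ q c) (sym (+-identityʳ _))) (trans (χ-vertical y g) (cong (_+ δ c) (sym (invariant-σ β-φ j y))))

        opaque
          β-1 : β b₀ ≡ 1#
          β-1 = trans (χ-el g₀) (+-identityʳ 1#)

        opaque
          -- Right multiplication by the vertical element over b₀, of label 1, applies φ to c and
          -- adds β b₀ to the label, on either way of computing it.
          δ-φ : ∀ c → δ (frob l c) ≡ δ c
          δ-φ c = combine₂ 1# (- 1#) (trans (cong₂ _+_ refl (cong δ (sym (σ-1 c)))) (trans (sym (χ-split b₀ (σ 1 c)))
              (trans (cong (λ q → χ q (σ 1 c)) (sym (trans (cong (_+ b₀) (frob-0 (l *ℕ 1))) (+-identityˡ b₀)))) (χ-by-vertical 0# c g₀)))) (refl {x = 0#})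
            (solve 3 (λ a b c → a :+ `1 :* (b :+ c) :+ :- `1 :* `0 := b :+ `1 :* (c :+ a) :+ :- `1 :* `0) refl (δ (frob l c)) (δ c) (β b₀))

        opaque
          δ-law : ∀ c z → β (c * S z) + δ (c + z) ≡ δ c + δ z
          δ-law c z with total₃ 0# z
          ... | j , g with frob-surjective (l *ℕ j) c
          ...   | x , refl = trans (sym (χ-split _ _)) (trans (cong (λ q → χ q (σ j x + z)) (sym (trans (cong (λ q → q + 0# + σ j x * S z) (frob-0 (l *ℕ j))) (solve 2 (λ a b → `0 :+ `0 :+ a :* b := a :* b) refl (σ j x) (S z)))))
                    (trans (χ-mul 0# x g) (cong (_+ δ z) (sym (invariant-σ δ-φ j x)))))

        opaque
          -- In `δ-law` everything except this term is symmetric in c and z.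
          β-symmetric : ∀ c z → β (c * S z) ≡ β (z * S c)
          β-symmetric c z = combine₂ 1# (- 1#) (δ-law c z) (trans (cong (β (z * S c) +_) (cong δ (+-comm c z))) (δ-law z c))
            (solve 5 (λ a b c d e → a :+ `1 :* (b :+ c) :+ :- `1 :* (c :+ b) := d :+ `1 :* (a :+ e) :+ :- `1 :* (d :+ e)) refl (β (c * S z)) (δ c) (δ z) (β (z * S c)) (δ (c + z)))

        opaque
          δ₀-+ : Additive δ₀
          δ₀-+ c z = trans (cong (λ q → δ (c + z) + half * q) expand) (combine₃ 1# half (β (c * S z)) (δ-law c z) (β-symmetric z c) (half-double 1#)
              (ring₁ (δ (c + z)) half (β (c * S c)) (β (c * S z)) (β (z * S c)) (β (z * S z)) (δ c) (δ z)))
            where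
            expand : β ((c + z) * S (c + z)) ≡ β (c * S c) + β (c * S z) + (β (z * S c) + β (z * S z))
            expand = trans (cong β (trans (cong ((c + z) *_) (S-+ c z)) (solve 4 (λ a b c d → (a :+ b) :* (c :+ d) := a :* c :+ a :* d :+ (b :* c :+ b :* d)) refl c z (S c) (S z))))
              (trans (β-+ _ _) (cong₂ _+_ (β-+ _ _) (β-+ _ _)))
            ring₁ : ∀ d h cc cz zc zz dc dz → d + h * (cc + cz + (zc + zz)) + 1# * (dc + dz) + h * cz + cz * 1# ≡ dc + h * cc + (dz + h * zz) + 1# * (cz + d) + h * zc + cz * (h * 1# + h * 1#)
            ring₁ d h cc cz zc zz dc dz = (solve 8 (λ a b c d e f g h → a :+ b :* (c :+ d :+ (e :+ f)) :+ `1 :* (g :+ h) :+ b :* d :+ d :* `1 := g :+ b :* c :+ (h :+ b :* f) :+ `1 :* (d :+ a) :+ b :* e :+ d :* (b :* `1 :+ b :* `1)) refl d h cc cz zc zz dc dz)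

        opaque
          δ₀-fixed : ∀ c → pow (δ₀ c) p ≡ δ₀ c
          δ₀-fixed c = fixed-+ (χ-fixed 0# c) (fixed-* half-fixed (χ-fixed (c * S c) 0#))

        opaque
          δ₀-φ : ∀ c → δ₀ (frob l c) ≡ δ₀ c
          δ₀-φ c = cong₂ (λ q r → q + half * r) (δ-φ c) (trans (cong β (trans (cong (frob l c *_) (S-φ c)) (sym (frob-* l c (S c))))) (β-φ _))

        opaque
          -- The additive remainder δ₀ = tr (ν c) is absorbed by one more twist: b becomes b - c v,
          -- and v = ν / μB makes tr (μB c v) cancel it. As v is fixed by φ, the values of t do not
          -- change.
          caseC : ∃ λ v → FormC l (twist l v E)
          caseC = v , s , μB , trans m≡ (trans (cong (l *ℕ_) P≡) (ℕₚ.*-comm l p)) , μB-sub , μB≢0 , s-sub , coeffs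
              , (λ {b} {c} {t} {j} g → trans (combine₁ (- 1#) (σ-fixed j v-sub) (solve 3 (λ a b c → a :+ :- `1 :* b := a :- b :+ c :+ :- `1 :* c) refl t v (σ j v))) (trans (graph g) (S≡ c))
                  , trans (sym (χ-el (to₃ g))) (label b c))
              , (λ b c k e → ≡E refl refl (trans (S≡ c) (combine₁ (- 1#) (σ-fixed k v-sub) (solve 3 (λ a b c → a :+ :- `1 :* b := a :- b :+ c :+ :- `1 :* c) refl (lin m s c) v (σ k v)))) (el-χ (trans e (sym (label b c)))))
            where
            s : ℕ → Carrier
            s = proj₁ S-coeffs
            S≡ : ∀ x → S x ≡ lin m s x
            S≡ = proj₁ (proj₂ S-coeffs)
            s-sub : ∀ i → i < m → InSub l (s i)
            s-sub = proj₂ (proj₂ S-coeffs)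
            func-β : ∃ λ μ → ∀ x → β x ≡ tr m (μ * x)
            func-β = functional-trace β-+ (λ x → χ-fixed x 0#)
            func-δ : ∃ λ μ → ∀ x → δ₀ x ≡ tr m (μ * x)
            func-δ = functional-trace δ₀-+ δ₀-fixed
            μB ν v : Carrier
            μB = proj₁ func-β
            ν = proj₁ func-δ
            v = ν * μB ⁻¹
            β≡ : ∀ x → β x ≡ tr m (μB * x)
            β≡ = proj₂ func-β
            δ≡ : ∀ x → δ₀ x ≡ tr m (ν * x)
            δ≡ = proj₂ func-δ
            μB-sub : InSub l μB
            μB-sub = tr-invariant l μB (λ x → trans (sym (β≡ (frob l x))) (trans (β-φ x) (β≡ x)))
            ν-sub : InSub l ν
            ν-sub = tr-invariant l ν (λ x → trans (sym (δ≡ (frob l x))) (trans (δ₀-φ x) (δ≡ x)))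
            μB≢0 : μB ≢ 0#
            μB≢0 e = 1≢0 (trans (sym β-1) (trans (β≡ b₀) (trans (cong (λ q → tr m (q * b₀)) e) (trans (cong (tr m) (zeroˡ b₀)) trM.map-0))))
            v-sub : frob l v ≡ v
            v-sub = trans (frob-* l ν (μB ⁻¹)) (cong₂ _*_ ν-sub (trans (frob-⁻¹ l μB μB≢0) (cong _⁻¹ μB-sub)))
            coeffs : ∀ i → 1 ≤ i → i < m → μB * s i - frob i (s (m ∸ i)) * frob i μB ≡ 0#
            coeffs i 1≤i i<m = trans (cong (λ q → μB * s i - q) (trans (*-comm _ _) (sym (frob-* i μB (s (m ∸ i)))))) (trans (bilinear-coefficients s μB 0# 0# bilinear i 1≤i i<m) (solve 1 (λ a → `0 :* a :- `0 :* a := `0) refl (frob i 0#)))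
              where
              tr-0 : ∀ c → tr m (0# * c) ≡ 0#
              tr-0 c = trans (cong (tr m) (zeroˡ c)) trM.map-0
              bilinear : ∀ c z → tr m (μB * (c * lin m s z - z * lin m s c)) ≡ tr m (0# * c) * tr m (0# * z) - tr m (0# * z) * tr m (0# * c)
              bilinear c z = trans (trans (cong (tr m) (solve 5 (λ a b c d e → a :* (b :* c :- d :* e) := a :* (b :* c) :- a :* (d :* e)) refl μB c (lin m s z) z (lin m s c))) (trans (trM.map-- _ _)
                  (x≡y⇒x-y≡0 (trans (cong (λ q → tr m (μB * (c * q))) (sym (S≡ z))) (trans (sym (β≡ _)) (trans (β-symmetric c z) (trans (β≡ _) (cong (λ q → tr m (μB * (z * q))) (S≡ c)))))))))
                (sym (trans (cong₂ (λ q r → q * r - r * q) (tr-0 c) (tr-0 z)) (solve 0 (`0 :* `0 :- `0 :* `0 := `0) refl)))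
            label : ∀ b c → χ (b - c * v) c ≡ half * Qf m s μB c + tr m (μB * b)
            label b c = trans (χ-split _ c) (trans (cong (_+ δ c) (trans (β≡ _) (trans (cong (tr m) (solve 4 (λ a b c d → a :* (b :- c :* d) := a :* b :- a :* (c :* d)) refl μB b c v)) (trM.map-- _ _))))
              (combine₃ 1# half 1# (δ≡ c) (sym Q≡) (cong (tr m) ν≡) (ring₂ (tr m (μB * b)) (tr m (μB * (c * v))) (δ c) half (Qf m s μB c) (β (c * S c)) (tr m (ν * c)))))
              where
              ν≡ : ν * c ≡ μB * (c * v)
              ν≡ = combine₁ (- (ν * c)) (inverseʳ μB μB≢0) (solve 4 (λ a b c d → a :* b :+ :- (a :* b) :* `1 := c :* (b :* (a :* d)) :+ :- (a :* b) :* (c :* d)) refl ν c μB (μB ⁻¹))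
              Q≡ : Qf m s μB c ≡ - β (c * S c)
              Q≡ = cong -_ (trans (cong (tr m) (trans (cong (λ q → μB * c * q) (sym (S≡ c))) (*-assoc _ _ _))) (sym (β≡ (c * S c))))
              ring₂ : ∀ tb tcv d h q bc tn → tb - tcv + d + 1# * tn + h * q + 1# * tcv ≡ h * q + tb + 1# * (d + h * bc) + h * (- bc) + 1# * tn
              ring₂ tb tcv d h q bc tn = (solve 7 (λ a b c d e f g → a :- b :+ c :+ `1 :* d :+ e :* f :+ `1 :* b := e :* f :+ a :+ `1 :* (c :+ e :* g) :+ e :* :- g :+ `1 :* d) refl tb tcv d tn h q bc)

  -- Construction D

  private instance
    pp-nonZero : NonZero (p *ℕ p)
    pp-nonZero = ℕₚ.m*n≢0 p p

  multiple-residue : ∀ q → (q *ℕ p) % (p *ℕ p) ≡ (q % p) *ℕ p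
  multiple-residue q = trans (cong (_% (p *ℕ p)) (trans (cong (_*ℕ p) (m≡m%n+[m/n]*n q p)) (trans (ℕₚ.*-distribʳ-+ p (q % p) _) (cong (q % p *ℕ p +ℕ_) (ℕₚ.*-assoc (q / p) p p)))))
    (trans ([m+kn]%n≡m%n (q % p *ℕ p) (q / p) (p *ℕ p)) (m<n⇒m%n≡m (ℕₚ.*-monoˡ-< p (m%n<n q p))))

  multiple-residue⁻¹ : ∀ q k → (q *ℕ p) % (p *ℕ p) ≡ (k *ℕ p) % (p *ℕ p) → q % p ≡ k % p
  multiple-residue⁻¹ q k e = ℕₚ.*-cancelʳ-≡ (q % p) (k % p) p (trans (sym (multiple-residue q)) (trans e (multiple-residue k)))

  -- Numerals for the power formula below. For odd p, twelve is a unit unless p = 3.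
  three six twelve : Carrier
  three = 1# + 1# + 1#
  six = three + three
  twelve = six + six

  -- `μC` is a separate argument because it first arises as a trace form and is identified with u -
  -- φ u later. The element t_C is a c-coordinate of a generator, so λ_C = 1, and the equation for α
  -- carries u without a factor.
  FormD-at : ℕ → Rel → (u tC μB : Carrier) → (ℕ → Carrier) → (α λ₀ μC : Carrier) → Set
  FormD-at l E u tC μB s α λ₀ μC =
      (p ≡ 3) × (m ≡ 9 *ℕ l) × InSub (3 *ℕ l) u × InSub l μC × (μC ≢ 0#) × (tC ≢ 0#) × (tr m (μC * tC) ≡ 1#)
    × InSub l μB × (μB ≢ 0#) × (∀ i → i < m → InSub l (s i))
    × (∀ i → 1 ≤ i → i < m → - (μB * s i) + frob i (s (m ∸ i)) * frob i μB ≡ μC * frob i u - u * frob i μC)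
    × InSub (3 *ℕ l) α × InSub 1 λ₀ × (frob l α - α ≡ u + λ₀ * μC)
    × (∀ {b c t j} → E b c t j → t ≡ lin m s c × ι j ≡ tr m (μC * c))
    × (∀ {b c t j} → E b c t j → tr m (μC * c) ≡ 0# → ∃ λ k → (∀ x → Operator.σ l j x ≡ Operator.σ l (3 *ℕ k) x) × ι k ≡ half * Qf m s μB c + tr m (α * c + μB * b))
    × (∀ b c k → tr m (μC * c) ≡ 0# → ι k ≡ half * Qf m s μB c + tr m (α * c + μB * b) → E b c (lin m s c) (3 *ℕ k))
    × E 0# tC (lin m s tC) 1

  FormD : ℕ → Rel → Set
  FormD l E = Σ[ u ∈ Carrier ] Σ[ tC ∈ Carrier ] Σ[ μB ∈ Carrier ] Σ[ s ∈ (ℕ → Carrier) ] Σ[ α ∈ Carrier ] Σ[ λ₀ ∈ Carrier ]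
    FormD-at l E u tC μB s α λ₀ (u - frob l u)

  module Order-p² (l P : ℕ) (m≡ : m ≡ l *ℕ P) (K : ℕ) (P∣ : P ∣ p ^ K)
    {E : Rel} (sys : System₂ l E) {S : Carrier → Carrier} (gr : Graph l E S) (P≡ : P ≡ p *ℕ p)
    (vertical-p : ∀ {b t j} → E b 0# t j → p ∣ j)
    {b₀ t₀ : Carrier} (g₀' : E b₀ 0# t₀ p) (B-N' : ∀ x → E (frob (l *ℕ p) x - x) 0# 0# 0) where
    open Labelled l P m≡ K P∣ sys gr public
    open Mod-p (subst (p ∣_) (sym P≡) (m∣m*n p)) public
    open Horizontal vertical-p public

    private
      toP : ∀ {i j} → i % (p *ℕ p) ≡ j % (p *ℕ p) → i % P ≡ j % P
      toP = go P≡
        where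
        go : ∀ {P i j} {{_ : NonZero P}} → P ≡ p *ℕ p → i % (p *ℕ p) ≡ j % (p *ℕ p) → i % P ≡ j % P
        go refl e = e
      fromP : ∀ {i j} → i % P ≡ j % P → i % (p *ℕ p) ≡ j % (p *ℕ p)
      fromP = go P≡
        where
        go : ∀ {P i j} {{_ : NonZero P}} → P ≡ p *ℕ p → i % P ≡ j % P → i % (p *ℕ p) ≡ j % (p *ℕ p)
        go refl e = e

    InK : Carrier → Set
    InK c = χ 0# c ≡ 0#

    g₀ : E₃ b₀ 0# p
    g₀ = to₃ g₀'

    B-N : ∀ x → E₃ (frob (l *ℕ p) x - x) 0# 0
    B-N x = to₃ (B-N' x)

    module χM = AdditiveMap χ-additive

    opaque
      InK-φ : ∀ {c} → InK c → InK (frob l c)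
      InK-φ {c} k = trans (χ-φ c) k

    opaque
      InK-N : ∀ c → InK (N c)
      InK-N c = trans (χM.map-- _ _) (x≡y⇒x-y≡0 (χ-φ c))

    opaque
      InK-0 : InK 0#
      InK-0 = χM.map-0

    opaque
      InK-+ : ∀ {c z} → InK c → InK z → InK (c + z)
      InK-+ {c} {z} kc kz = trans (χ-additive c z) (trans (cong₂ _+_ kc kz) (+-identityˡ 0#))

    opaque
      elK : ∀ {c} → InK c → ∀ b → ∃ λ k → E₃ b c (p *ℕ k)
      elK {c} kc b with total₃ b c
      ... | j , g with ι-zero {j} (trans (sym (χ-el g)) (trans (χ-free b c) kc))
      ...   | divides q refl = q , subst (E₃ b c) (ℕₚ.*-comm q p) g

    opaque
      -- Over the kernel of χ labels are multiples of p; ψ is the quotient by p, well defined modulo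
      -- p because P = p².
      ψ : Carrier → Carrier → Carrier
      ψ b c = ι (proj₁ (total₃ b c) / p)
      ψ-el : ∀ {b c k} → E₃ b c (p *ℕ k) → ψ b c ≡ ι k
      ψ-el {b} {c} {k} g = go (proj₁ (total₃ b c)) (fromP (unique₃ (proj₂ (total₃ b c)) g))
          (∣-residue (subst (p ∣_) (sym P≡) (m∣m*n p)) (unique₃ g (proj₂ (total₃ b c))) (m∣m*n k))
        where
        go : ∀ j → j % (p *ℕ p) ≡ (p *ℕ k) % (p *ℕ p) → p ∣ j → ι (j / p) ≡ ι k
        go j e (divides q refl) = trans (cong ι (m*n/n≡m q p)) (trans (sym (ι-% q)) (trans (cong ι (multiple-residue⁻¹ q k (trans e (cong (_% (p *ℕ p)) (ℕₚ.*-comm p k))))) (ι-% k)))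
      ψ-fixed : ∀ b c → pow (ψ b c) p ≡ ψ b c
      ψ-fixed b c = frob-ι 1 (proj₁ (total₃ b c) / p)

    opaque
      el-ψ : ∀ {b c k} → InK c → ι k ≡ ψ b c → E₃ b c (p *ℕ k)
      el-ψ {b} {c} {k} kc e = let (q , g) = elK kc b in resp₃ (toP (trans (cong (_% (p *ℕ p)) (ℕₚ.*-comm p q)) (trans (multiple-residue q)
        (trans (cong (_*ℕ p) (ι-cong-% (sym (trans e (ψ-el g))))) (trans (sym (multiple-residue k)) (cong (_% (p *ℕ p)) (ℕₚ.*-comm k p))))))) g

    opaque
      ψ-sum : ∀ {b c k y z j b' c'} → E₃ b c (p *ℕ k) → E₃ y z (p *ℕ j) → E₃ b' c' (p *ℕ k +ℕ p *ℕ j) → ψ b' c' ≡ ψ b c + ψ y z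
      ψ-sum {k = k} {j = j} g h f = trans (ψ-el (subst (E₃ _ _) (sym (ℕₚ.*-distribˡ-+ p k j)) f)) (trans (ι-+ k j) (cong₂ _+_ (sym (ψ-el g)) (sym (ψ-el h))))

    opaque
      ψ-mul : ∀ b {c} → InK c → ∀ {y z k} → E₃ y z (p *ℕ k) → ψ (σ (p *ℕ k) b + y + σ (p *ℕ k) c * S z) (σ (p *ℕ k) c + z) ≡ ψ b c + ψ y z
      ψ-mul b {c} kc g = let (_ , h) = elK kc b in ψ-sum h g (mul₃ h g)

    opaque
      ψ-vertical : ∀ b {y z k} → E₃ y z (p *ℕ k) → ψ (σ (p *ℕ k) b + y) z ≡ ψ b 0# + ψ y z
      ψ-vertical b g = let (_ , h) = elK InK-0 b in ψ-sum h g (mul₃-vertical h g)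

    opaque
      ψ-by-vertical : ∀ b {c} → InK c → ∀ {y k} → E₃ y 0# (p *ℕ k) → ψ (σ (p *ℕ k) b + y) (σ (p *ℕ k) c) ≡ ψ b c + ψ y 0#
      ψ-by-vertical b kc g = let (_ , h) = elK kc b in ψ-sum h g (mul₃-by-vertical h g)

    opaque
      invariant-R : ∀ {f : Carrier → Carrier} → (∀ x → f (frob (l *ℕ p) x) ≡ f x) → ∀ k x → f (σ (p *ℕ k) x) ≡ f x
      invariant-R {f} inv k x = trans (cong f (trans (cong (λ n → frob n x) (sym (ℕₚ.*-assoc l p k))) (frob-iter (l *ℕ p) k x))) (iterate k)
        where
        iterate : ∀ k → f (iter k (frob (l *ℕ p)) x) ≡ f x
        iterate zero    = refl
        iterate (suc k) = trans (inv _) (iterate k)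

    opaque
      g₀₁ : E₃ b₀ 0# (p *ℕ 1)
      g₀₁ = subst (E₃ b₀ 0#) (sym (ℕₚ.*-identityʳ p)) g₀

    opaque
      zero-index : ∀ {b c} → E₃ b c 0 → E₃ b c (p *ℕ 0)
      zero-index {b} {c} = subst (E₃ b c) (sym (ℕₚ.*-zeroʳ p))

    β δ δ₀ : Carrier → Carrier
    β b = ψ b 0#
    δ c = ψ 0# c
    δ₀ c = δ c + half * β (c * S c)

    opaque
      β-R : ∀ x → β (frob (l *ℕ p) x) ≡ β x
      β-R x = let (i , h) = elK InK-0 x in trans (ψ-el (≡E₃ (trans (cong (λ q → x + (frob (l *ℕ p) x - x) + 0# * q) SM.map-0)
        (solve 2 (λ a b → a :+ (b :- a) :+ `0 :* `0 := b) refl x (frob (l *ℕ p) x))) (+-identityˡ 0#) (mul₃₀ h (B-N x)))) (sym (ψ-el h))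

    opaque
      β-+ : Additive β
      β-+ x y with elK InK-0 y
      ... | k , g with frob-surjective (l *ℕ (p *ℕ k)) x
      ...   | x' , refl = trans (ψ-vertical x' g) (cong (_+ β y) (sym (invariant-R β-R k x')))

    opaque
      β-1 : β b₀ ≡ 1#
      β-1 = trans (ψ-el g₀₁) (+-identityʳ 1#)

    module βM = AdditiveMap β-+

    opaque
      β-prime : ∀ x → ∃ λ n → n < p × β x ≡ ι n
      β-prime x = prime-field (β x) (ψ-fixed x 0#)

      -- φ acts on F / ker β ≅ 𝔽ₚ as a scalar whose p-th power is 1.
      β-φ : ∀ x → β (frob l x) ≡ β x
      β-φ x = trans (scalar x) (trans (cong (_* β x) one) (*-identityˡ _))
        where
        κ : Carrier
        κ = β (frob l b₀)
        kernel-φ : ∀ x → β x ≡ 0# → β (frob l x) ≡ 0#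
        kernel-φ x e = ψ-el (zero-index (to₃ (Stable.V-φ B₀-stable (≡E refl refl SM.map-0 (subst (E₃ x 0#) (ℕₚ.*-zeroʳ p) (el-ψ InK-0 (sym e)))))))
        scalar : ∀ x → β (frob l x) ≡ κ * β x
        scalar x with β-prime x
        ... | n , _ , e = trans (combine₁ 1# (trans (sym (trans (cong β (frob-- l x (ι n * b₀))) (trans (βM.map-- _ _) (cong (λ q → β (frob l x) - q) (trans (cong β (trans (frob-* l (ι n) b₀) (cong (_* frob l b₀) (frob-ι l n)))) (βM.map-ι n _))))))
              (kernel-φ (x - ι n * b₀) (trans (βM.map-- x (ι n * b₀)) (trans (cong₂ (λ q r → q - r) e (trans (βM.map-ι n b₀) (cong (ι n *_) β-1))) (solve 1 (λ a → a :- a :* `1 := `0) refl (ι n))))))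
            (solve 3 (λ a b c → a :+ `1 :* `0 := b :* c :+ `1 :* (a :- c :* b)) refl (β (frob l x)) κ (ι n))) (cong (κ *_) (sym e))
        iterate : ∀ k → β (iter k (frob l) b₀) ≡ pow κ k
        iterate zero    = β-1
        iterate (suc k) = trans (scalar _) (cong (κ *_) (iterate k))
        one : κ ≡ 1#
        one = trans (sym (ψ-fixed (frob l b₀) 0#)) (trans (sym (iterate p)) (trans (cong β (sym (frob-iter l p b₀))) (trans (β-R b₀) β-1)))

    opaque
      ψ-split : ∀ b {c} → InK c → ψ b c ≡ β b + δ c
      ψ-split b {c} kc with elK kc 0#
      ... | k , g with frob-surjective (l *ℕ (p *ℕ k)) b
      ...   | y , refl = trans (cong (λ q → ψ q c) (sym (+-identityʳ _))) (trans (ψ-vertical y g) (cong (_+ δ c) (sym (invariant-R β-R k y))))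

    opaque
      InK-σ : ∀ j {c} → InK c → InK (σ j c)
      InK-σ j {c} kc = trans (invariant-σ χ-φ j c) kc

    opaque
      δ-R : ∀ {c} → InK c → δ (frob (l *ℕ p) c) ≡ δ c
      δ-R {c} kc = combine₁ 1# (trans (sym (ψ-split b₀ (InK-σ p kc))) (trans (cong₂ (λ n q → ψ q (frob (l *ℕ n) c)) (sym (ℕₚ.*-identityʳ p)) (sym (trans (cong (_+ b₀) (frob-0 (l *ℕ (p *ℕ 1)))) (+-identityˡ b₀)))) (ψ-by-vertical 0# kc g₀₁)))
        (solve 3 (λ a b c → a :+ `1 :* (b :+ c) := b :+ `1 :* (c :+ a)) refl (δ (frob (l *ℕ p) c)) (δ c) (β b₀))

    opaque
      δ-σ : ∀ k {c} → InK c → δ (σ (p *ℕ k) c) ≡ δ c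
      δ-σ k {c} kc = trans (cong δ (trans (cong (λ n → frob n c) (sym (ℕₚ.*-assoc l p k))) (frob-iter (l *ℕ p) k c))) (proj₂ (iterate k))
        where
        iterate : ∀ k → InK (iter k (frob (l *ℕ p)) c) × δ (iter k (frob (l *ℕ p)) c) ≡ δ c
        iterate zero    = kc , refl
        iterate (suc k) = let (kk , e) = iterate k in InK-σ p kk , trans (δ-R kk) e

    opaque
      InK-σ⁻¹ : ∀ j {c} → InK (σ j c) → InK c
      InK-σ⁻¹ j {c} kc = trans (sym (invariant-σ χ-φ j c)) kc

    opaque
      δ-law : ∀ {c z} → InK c → InK z → β (c * S z) + δ (c + z) ≡ δ c + δ z
      δ-law {c} {z} kc kz with elK kz 0#
      ... | k , g with frob-surjective (l *ℕ (p *ℕ k)) c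
      ...   | x , refl = trans (sym (ψ-split _ (InK-+ kc kz))) (trans (cong (λ q → ψ q (σ (p *ℕ k) x + z)) (sym (trans (cong (λ q → q + 0# + σ (p *ℕ k) x * S z) (frob-0 (l *ℕ (p *ℕ k)))) (solve 2 (λ a b → `0 :+ `0 :+ a :* b := a :* b) refl (σ (p *ℕ k) x) (S z)))))
                (trans (ψ-mul 0# (InK-σ⁻¹ (p *ℕ k) kc) g) (cong (_+ δ z) (sym (δ-σ k (InK-σ⁻¹ (p *ℕ k) kc))))))

    opaque
      β-symmetric : ∀ {c z} → InK c → InK z → β (c * S z) ≡ β (z * S c)
      β-symmetric {c} {z} kc kz = combine₂ 1# (- 1#) (δ-law kc kz) (trans (cong (β (z * S c) +_) (cong δ (+-comm c z))) (δ-law kz kc))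
        (solve 5 (λ a b c d e → a :+ `1 :* (b :+ c) :+ :- `1 :* (c :+ b) := d :+ `1 :* (a :+ e) :+ :- `1 :* (d :+ e)) refl (β (c * S z)) (δ c) (δ z) (β (z * S c)) (δ (c + z)))

    opaque
      β-expand : ∀ c z → β ((c + z) * S (c + z)) ≡ β (c * S c) + β (c * S z) + (β (z * S c) + β (z * S z))
      β-expand c z = trans (cong β (trans (cong ((c + z) *_) (S-+ c z)) (solve 4 (λ a b c d → (a :+ b) :* (c :+ d) := a :* c :+ a :* d :+ (b :* c :+ b :* d)) refl c z (S c) (S z))))
        (trans (β-+ _ _) (cong₂ _+_ (β-+ _ _) (β-+ _ _)))

    opaque
      δ₀-+ : ∀ {c z} → InK c → InK z → δ₀ (c + z) ≡ δ₀ c + δ₀ z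
      δ₀-+ {c} {z} kc kz = trans (cong (λ q → δ (c + z) + half * q) (β-expand c z)) (combine₃ 1# half (β (c * S z)) (δ-law kc kz) (β-symmetric kz kc) (half-double 1#)
          (ring₁ (δ (c + z)) half (β (c * S c)) (β (c * S z)) (β (z * S c)) (β (z * S z)) (δ c) (δ z)))
        where
        ring₁ : ∀ d h cc cz zc zz dc dz → d + h * (cc + cz + (zc + zz)) + 1# * (dc + dz) + h * cz + cz * 1# ≡ dc + h * cc + (dz + h * zz) + 1# * (cz + d) + h * zc + cz * (h * 1# + h * 1#)
        ring₁ d h cc cz zc zz dc dz = (solve 8 (λ a b c d e f g h → a :+ b :* (c :+ d :+ (e :+ f)) :+ `1 :* (g :+ h) :+ b :* d :+ d :* `1 := g :+ b :* c :+ (h :+ b :* f) :+ `1 :* (d :+ a) :+ b :* e :+ d :* (b :* `1 :+ b :* `1)) refl d h cc cz zc zz dc dz)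

    opaque
      δ₀-fixed : ∀ c → pow (δ₀ c) p ≡ δ₀ c
      δ₀-fixed c = fixed-+ (ψ-fixed 0# c) (fixed-* half-fixed (ψ-fixed (c * S c) 0#))

    opaque
      β-func : ∃ λ μ → ∀ x → β x ≡ tr m (μ * x)
      β-func = functional-trace β-+ (λ x → ψ-fixed x 0#)

    μB : Carrier
    μB = proj₁ β-func

    β≡ : ∀ x → β x ≡ tr m (μB * x)
    β≡ = proj₂ β-func

    opaque
      μB-sub : InSub l μB
      μB-sub = tr-invariant l μB (λ x → trans (sym (β≡ (frob l x))) (trans (β-φ x) (β≡ x)))

    opaque
      μB≢0 : μB ≢ 0#
      μB≢0 e = 1≢0 (trans (sym β-1) (trans (β≡ b₀) (trans (cong (λ q → tr m (q * b₀)) e) (trans (cong (tr m) (zeroˡ b₀)) trM.map-0))))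

    opaque
      -- Prepares a twist by w that brings the generator to b = 0. Being fixed by φ, w does not
      -- disturb t. The vertical correction needed to reach b = -t w must have trivial label, which
      -- amounts to β (t w) = -β b₁.
      shift-generator : ∃ λ w → frob l w ≡ w × ∃ λ t → E₃ (- (t * w)) t 1
      shift-generator with gen
      ... | b₁ , t , _ , g = w , w-sub , t ,
            (≡E₃ (trans (cong (_+ b₁) (trans (σ-1 y) ey)) (solve 3 (λ a b c → :- (a :* b) :- c :+ c := :- (a :* b)) refl t w b₁)) refl (mul₃-vertical g-y (to₃ g)))
        where
        r w : Carrier
        r = - β b₁
        -- Chosen so that β (t w) = tr (μB t w) = r tr (μC t) = r, the last step because a generator
        -- has χ = 1.
        w = r * μC * μB ⁻¹
        r-sub : frob l r ≡ r
        r-sub = frob-prime l (fixed-neg (ψ-fixed b₁ 0#))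
        w-sub : frob l w ≡ w
        w-sub = trans (frob-* l (r * μC) _) (cong₂ _*_ (trans (frob-* l r μC) (cong₂ _*_ r-sub μC-sub)) (trans (frob-⁻¹ l μB μB≢0) (cong _⁻¹ μB-sub)))
        y : Carrier
        y = proj₁ (frob-surjective l (- (t * w) - b₁))
        ey : frob l y ≡ - (t * w) - b₁
        ey = proj₂ (frob-surjective l (- (t * w) - b₁))
        βtw : β (t * w) ≡ r
        βtw = trans (β≡ _) (trans (cong (tr m) (combine₁ (t * r * μC) (inverseʳ μB μB≢0) (solve 5 (λ a b c d e → a :* (b :* (c :* d :* e)) :+ b :* c :* d :* `1 := c :* (d :* b) :+ b :* c :* d :* (a :* e)) refl μB t r μC (μB ⁻¹))))
          (trans (tr-scalar r (μC * t) (fixed-neg (ψ-fixed b₁ 0#))) (trans (cong (r *_) (trans (sym (χ≡ t)) (χ-gen (to₃ g)))) (*-identityʳ r))))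
        β-y : β y ≡ 0#
        β-y = trans (sym (β-φ y)) (trans (cong β ey) (trans (βM.map-- _ _) (trans (cong (_- β b₁) (trans (βM.map-neg _) (cong -_ βtw))) (solve 1 (λ a → :- (:- a) :- a := `0) refl (β b₁)))))
        g-y : E₃ y 0# 0
        g-y = subst (E₃ y 0#) (ℕₚ.*-zeroʳ p) (el-ψ InK-0 (sym β-y))

    module Generator (t : Carrier) (g₁ : E₃ 0# t 1) where
      B : Carrier → Carrier → Carrier
      B c z = β (c * S z - z * S c)

      ρ f₂ : Carrier → Carrier
      ρ = B t
      f₂ c = half * β (c * S c)

      ϰ : Carrier → Carrier
      ϰ = χ 0#

      opaque
        ϰ-t : ϰ t ≡ 1#
        ϰ-t = χ-gen g₁

      opaque
        B≡ : ∀ c z → B c z ≡ β (c * S z) - β (z * S c)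
        B≡ c z = βM.map-- _ _

      opaque
        B-+ʳ : ∀ c z z' → B c (z + z') ≡ B c z + B c z'
        B-+ʳ c z z' = trans (cong β (trans (cong (λ q → c * q - (z + z') * S c) (S-+ z z')) (solve 6 (λ a b c d e f → a :* (b :+ c) :- (d :+ e) :* f := a :* b :- d :* f :+ (a :* c :- e :* f)) refl c (S z) (S z') z z' (S c)))) (β-+ _ _)

      opaque
        B-anti : ∀ c z → B c z ≡ - B z c
        B-anti c z = trans (cong β (solve 4 (λ a b c d → a :* b :- c :* d := :- (c :* d :- a :* b)) refl c (S z) z (S c))) (βM.map-neg _)

      opaque
        B-ιʳ : ∀ n c z → B c (ι n * z) ≡ ι n * B c z
        B-ιʳ n c z = AdditiveMap.map-ι {f = B c} (B-+ʳ c) n z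

      opaque
        B-K : ∀ {c z} → InK c → InK z → B c z ≡ 0#
        B-K {c} {z} kc kz = trans (B≡ c z) (x≡y⇒x-y≡0 (β-symmetric kc kz))

      opaque
        B-self : ∀ c → B c c ≡ 0#
        B-self c = trans (B≡ c c) (-‿inverseʳ _)

      opaque
        χ-prime : ∀ c → ∃ λ n → n < p × ϰ c ≡ ι n
        χ-prime c = prime-field (ϰ c) (χ-fixed 0# c)

      opaque
        project-K : ∀ c → InK (c - ϰ c * t)
        project-K c with χ-prime c
        ... | n , _ , e = trans (χM.map-- c (ϰ c * t)) (trans (cong (λ q → ϰ c - ϰ (q * t)) e) (trans (cong (λ q → ϰ c - q) (trans (χM.map-ι n t) (cong (ι n *_) ϰ-t))) (trans (cong (_- ι n * 1#) e) (solve 1 (λ a → a :- a :* `1 := `0) refl (ι n)))))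

      opaque
        B-scaleʳ : ∀ c c' z → B c (ϰ c' * z) ≡ ϰ c' * B c z
        B-scaleʳ c c' z with χ-prime c'
        ... | n , _ , e = trans (cong (λ q → B c (q * z)) e) (trans (B-ιʳ n c z) (cong (_* B c z) (sym e)))

      opaque
        ρ-project : ∀ c → B t (c - ϰ c * t) ≡ ρ c
        ρ-project c = trans (AdditiveMap.map-- {f = B t} (B-+ʳ t) c _) (trans (cong (λ q → ρ c - q) (trans (B-scaleʳ t c t) (cong (ϰ c *_) (B-self t)))) (solve 2 (λ a b → a :- b :* `0 := a) refl (ρ c) (ϰ c)))

      opaque
        B-K-right : ∀ c {z} → InK z → B c z ≡ ϰ c * ρ z
        B-K-right c {z} kz = trans (B-anti c z) (trans (cong (λ q → - B z q) (solve 3 (λ a b c → a := a :- b :* c :+ b :* c) refl c (ϰ c) t)) (trans (cong -_ (trans (B-+ʳ z _ _) (cong₂ _+_ (B-K kz (project-K c)) (trans (B-scaleʳ z c t) (cong (ϰ c *_) (B-anti z t))))))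
          (solve 2 (λ a b → :- (`0 :+ a :* :- b) := a :* b) refl (ϰ c) (B t z))))

      opaque
        -- An alternating form that vanishes on the hyperplane ker χ has rank at most two: splitting
        -- both arguments along t and this hyperplane leaves only values of ρ = B t.
        B-formula : ∀ c z → B c z ≡ ϰ c * ρ z - ϰ z * ρ c
        B-formula c z = trans (cong (B c) (solve 3 (λ a b c → a := a :- b :* c :+ b :* c) refl z (ϰ z) t)) (trans (B-+ʳ c _ _) (trans (cong₂ _+_
            (trans (B-K-right c (project-K z)) (cong (ϰ c *_) (ρ-project z))) (trans (B-scaleʳ c z t) (cong (ϰ z *_) (B-anti c t)))) (solve 4 (λ a b c d → a :* b :+ c :* :- d := a :* b :- c :* d) refl (ϰ c) (ρ z) (ϰ z) (ρ c))))

      opaque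
        β-φ-product : ∀ c z → β (frob l c * S (frob l z)) ≡ β (c * S z)
        β-φ-product c z = trans (cong β (trans (cong (frob l c *_) (S-φ z)) (sym (frob-* l c (S z))))) (β-φ _)

      opaque
        B-φ : ∀ c z → B (frob l c) (frob l z) ≡ B c z
        B-φ c z = trans (B≡ _ _) (trans (cong₂ _-_ (β-φ-product c z) (β-φ-product z c)) (sym (B≡ c z)))

      λ' : Carrier
      λ' = ρ (frob l t)

      opaque
        -- B is φ-invariant; `B-formula` is expanded at (φ t , φ z), with χ (φ t) = 1.
        ρ-φ : ∀ z → ρ (frob l z) ≡ ρ z + ϰ z * λ'
        ρ-φ z = combine₁ (- 1#) (trans (sym (B-φ t z)) (trans (B-formula (frob l t) (frob l z)) (cong₂ (λ q r → q * ρ (frob l z) - r * λ') (trans (χ-φ t) ϰ-t) (χ-φ z))))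
          (solve 4 (λ a b c d → a :+ :- `1 :* (`1 :* a :- b :* c) := d :+ b :* c :+ :- `1 :* d) refl (ρ (frob l z)) (ϰ z) λ' (ρ z))

      opaque
        ρ-+ : Additive ρ
        ρ-+ = B-+ʳ t

      opaque
        ρ-N : ∀ z → ρ (N z) ≡ ϰ z * λ'
        ρ-N z = trans (AdditiveMap.map-- {f = ρ} ρ-+ _ _) (trans (cong (_- ρ z) (ρ-φ z)) (solve 3 (λ a b c → a :+ b :* c :- a := b :* c) refl (ρ z) (ϰ z) λ'))

      opaque
        -- A multiple of b₀ is used as b so that β b cancels δ c. The resulting element has trivial
        -- label, which conjugation preserves.
        kill-index : ∀ {c} → InK c → ∃ λ b → E₃ b c 0 × β b ≡ - δ c
        kill-index {c} kc with prime-field (- δ c) (fixed-neg (ψ-fixed 0# c))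
        ... | n , _ , e = ι n * b₀ , subst (E₃ _ c) (ℕₚ.*-zeroʳ p) (el-ψ kc (sym (trans (ψ-split _ kc) (trans (cong (_+ δ c) βb) (-‿inverseˡ _))))) , βb
          where
          βb : β (ι n * b₀) ≡ - δ c
          βb = trans (βM.map-ι n b₀) (trans (cong (ι n *_) β-1) (trans (*-identityʳ _) (sym e)))

      opaque
        -- An element of trivial label over c is conjugated by the generator. The label remains
        -- trivial, and the two cross terms of the conjugated b-coordinate combine to ρ (φ c).
        δ₀-φ : ∀ {c} → InK c → δ₀ (frob l c) ≡ δ₀ c + ρ (frob l c)
        δ₀-φ {c} kc with kill-index kc
        ... | b , g , βb = trans (cong (λ q → δ (frob l c) + half * q) (β-φ-product c c)) (combine₂ 1# (- 1#) conj (B≡ t (frob l c))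
            (ring₁ (δ (frob l c)) (half * β (c * S c)) (δ c) (β (frob l c * S t)) (β (t * S (frob l c))) (ρ (frob l c))))
          where
          ring₁ : ∀ d h dc x y r → d + h + 1# * 0# + (- 1#) * (y - x) ≡ dc + h + r + 1# * (- dc + x - y + d) + (- 1#) * r
          ring₁ d h dc x y r = (solve 6 (λ a b c d e f → a :+ b :+ `1 :* `0 :+ :- `1 :* (c :- d) := e :+ b :+ f :+ `1 :* (:- e :+ d :- c :+ a) :+ :- `1 :* f) refl d h y x dc r)
          g' : E₃ (frob l b + frob l c * S t - t * S (frob l c)) (frob l c) 0
          g' = ≡E₃ (trans (cong₂ (λ q r → q + r * S t - t * σ 1 (S c)) (σ-1 b) (σ-1 c)) (cong (λ q → frob l b + frob l c * S t - t * q) (trans (σ-1 (S c)) (sym (S-φ c))))) (σ-1 c) (to₃ (conjugate g g₁))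
          conj : - δ c + β (frob l c * S t) - β (t * S (frob l c)) + δ (frob l c) ≡ 0#
          conj = trans (cong (_+ δ (frob l c)) (sym (trans (βM.map-- _ _) (cong (_- β (t * S (frob l c))) (trans (β-+ _ _) (cong (_+ β (frob l c * S t)) (trans (β-φ b) βb)))))))
            (trans (sym (ψ-split _ (InK-φ kc))) (ψ-el (zero-index g')))

      opaque
        δ₀-N : ∀ {c} → InK c → δ₀ (N c) ≡ ρ c
        δ₀-N {c} kc = combine₃ 1# 1# 1# (trans (sym (δ₀-+ kc (InK-N c))) (trans (cong δ₀ (sym (frob≡1+N c))) (δ₀-φ kc))) (trans (ρ-φ c) (cong (λ q → ρ c + q * λ') kc)) (refl {x = 0#})
          (solve 5 (λ a b c d e → a :+ `1 :* (b :+ c) :+ `1 :* (d :+ `0 :* e) :+ `1 :* `0 := d :+ `1 :* (b :+ a) :+ `1 :* c :+ `1 :* `0) refl (δ₀ (N c)) (δ₀ c) (ρ (frob l c)) (ρ c) λ')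

      z y : ℕ → Carrier
      z k = orbitSum k (frob l) t
      y zero    = 0#
      y (suc k) = y k + iter k (frob l) t * S (z k)

      -- `y k` and `z k` are the b- and c-coordinates of the k-th power of the generator. At k = p,
      -- where z lies in ker χ, the value ψ of that power is this plus δ₀ (z p).
      Fₖ : ℕ → Carrier
      Fₖ k = β (y k) - half * β (z k * S (z k))

      opaque
        power-el : ∀ k → E₃ (y k) (z k) k
        power-el zero    = to₃ unit
        power-el (suc k) = ≡E₃ (trans (cong₂ (λ q r → q + y k + r * S (z k)) (frob-0 (l *ℕ k)) (frob-iter l k t)) (solve 3 (λ a b c → `0 :+ a :+ b :* c := a :+ b :* c) refl (y k) (iter k (frob l) t) (S (z k))))
          (trans (cong (_+ z k) (frob-iter l k t)) (+-comm _ _)) (mul₃ g₁ (power-el k))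

      opaque
        ϰ-iter : ∀ k → ϰ (iter k (frob l) t) ≡ 1#
        ϰ-iter zero    = ϰ-t
        ϰ-iter (suc k) = trans (χ-φ _) (ϰ-iter k)

      opaque
        ρ-iter : ∀ k → ρ (iter k (frob l) t) ≡ ι k * λ'
        ρ-iter zero    = trans (B-self t) (sym (zeroˡ _))
        ρ-iter (suc k) = trans (ρ-φ _) (trans (cong₂ (λ q r → q + r * λ') (ρ-iter k) (ϰ-iter k)) (solve 2 (λ a b → a :* b :+ `1 :* b := (`1 :+ a) :* b) refl (ι k) λ'))

      opaque
        ϰ-z : ∀ k → ϰ (z k) ≡ ι k
        ϰ-z zero    = χM.map-0
        ϰ-z (suc k) = trans (χ-additive _ _) (trans (cong₂ _+_ (ϰ-z k) (ϰ-iter k)) (+-comm _ _))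

      opaque
        ρ-z-suc : ∀ k → ρ (z (suc k)) ≡ ρ (z k) + ι k * λ'
        ρ-z-suc k = trans (ρ-+ _ _) (cong (ρ (z k) +_) (ρ-iter k))

      opaque
        ρ-z-0 : ρ (z 0) ≡ 0#
        ρ-z-0 = AdditiveMap.map-0 {f = ρ} ρ-+

      opaque
        β-iter-product : ∀ k → β (iter k (frob l) t * S (iter k (frob l) t)) ≡ β (t * S t)
        β-iter-product zero    = refl
        β-iter-product (suc k) = trans (β-φ-product _ _) (β-iter-product k)

      opaque
        F-suc : ∀ k → Fₖ (suc k) ≡ Fₖ k - half * β (t * S t) + half * (ρ (z k) - ι k * (ι k * λ'))
        F-suc k = trans (cong₂ (λ q r → q - half * r) (β-+ _ _) (trans (β-expand (z k) a) (cong (λ q → β (z k * S (z k)) + β (z k * S a) + (β (a * S (z k)) + q)) (β-iter-product k))))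
            (combine₂ half (- β (a * S (z k))) (trans (sym (B≡ a (z k))) (trans (B-formula a (z k)) (cong₂ (λ q r → q * ρ (z k) - r) (ϰ-iter k) (cong₂ _*_ (ϰ-z k) (ρ-iter k))))) (half-double 1#)
              (ring₂ (β (y k)) (β (a * S (z k))) half (β (z k * S (z k))) (β (z k * S a)) (β (t * S t)) (ρ (z k)) (ι k) λ'))
          where
          a : Carrier
          a = iter k (frob l) t
          ring₂ : ∀ by az h zz za tt r k L → by + az - h * (zz + za + (az + tt)) + h * (1# * r - k * (k * L)) + (- az) * 1#
            ≡ by - h * zz - h * tt + h * (r - k * (k * L)) + h * (az - za) + (- az) * (h * 1# + h * 1#)
          ring₂ by az h zz za tt r k L = (solve 9 (λ a b c d e f g h i → a :+ b :- c :* (d :+ e :+ (b :+ f)) :+ c :* (`1 :* g :- h :* (h :* i)) :+ :- b :* `1 := a :- c :* d :- c :* f :+ c :* (g :- h :* (h :* i)) :+ c :* (b :- e) :+ :- b :* (c :* `1 :+ c :* `1)) refl by az h zz za tt r k L)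

      opaque
        F-0 : Fₖ 0 ≡ 0#
        F-0 = trans (cong₂ (λ q r → q - half * r) βM.map-0 (trans (cong β (zeroˡ _)) βM.map-0)) (solve 1 (λ a → `0 :- a :* `0 := `0) refl half)

      opaque
        ρ-z-closed : ∀ k → (1# + 1#) * ρ (z k) ≡ λ' * (ι k * (ι k - 1#))
        ρ-z-closed zero    = trans (cong ((1# + 1#) *_) ρ-z-0) (solve 1 (λ a → (`1 :+ `1) :* `0 := a :* (`0 :* (`0 :- `1))) refl λ')
        ρ-z-closed (suc k) = combine₂ (1# + 1#) 1# (ρ-z-suc k) (ρ-z-closed k) (ring₃ (ρ (z (suc k))) (ρ (z k)) (ι k) λ')
          where
          ring₃ : ∀ r' r k L → (1# + 1#) * r' + (1# + 1#) * (r + k * L) + 1# * (L * (k * (k - 1#))) ≡ L * ((1# + k) * ((1# + k) - 1#)) + (1# + 1#) * r' + 1# * ((1# + 1#) * r)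
          ring₃ r' r k L = (solve 4 (λ a b c d → (`1 :+ `1) :* a :+ (`1 :+ `1) :* (b :+ c :* d) :+ `1 :* (d :* (c :* (c :- `1))) := d :* ((`1 :+ c) :* (`1 :+ c :- `1)) :+ (`1 :+ `1) :* a :+ `1 :* ((`1 :+ `1) :* b)) refl r' r k L)

      opaque
        -- Summation of `F-suc` with ρ (z k) = λ' k (k-1) / 2. The factor 12 clears the
        -- denominators, and each term has a factor k, so the right side vanishes at k = p.
        F-closed : ∀ k → twelve * Fₖ k ≡ - (twelve * (ι k * (half * β (t * S t)))) - λ' * ((ι k + 1#) * (ι k * (ι k - 1#)))
        F-closed zero    = trans (cong (twelve *_) F-0) (solve 4 (λ a b c d → a :* `0 := :- (a :* (`0 :* (b :* c))) :- d :* ((`0 :+ `1) :* (`0 :* (`0 :- `1)))) refl twelve half (β (t * S t)) λ')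
        F-closed (suc k) = combine₂ twelve 1# (F-suc k) (F-closed k) (combine₂ six three (half-double X) (ρ-z-closed k) (ring₄ (Fₖ (suc k)) (Fₖ k) half (β (t * S t)) (ρ (z k)) (ι k) λ'))
          where
          X : Carrier
          X = ρ (z k) - ι k * (ι k * λ')
          ring₄ : ∀ f' f h tt r k L → (((1# + 1# + 1#) + (1# + 1# + 1#)) + ((1# + 1# + 1#) + (1# + 1# + 1#))) * f' + (((1# + 1# + 1#) + (1# + 1# + 1#)) + ((1# + 1# + 1#) + (1# + 1# + 1#))) * (f - h * tt + h * (r - k * (k * L))) + 1# * (- ((((1# + 1# + 1#) + (1# + 1# + 1#)) + ((1# + 1# + 1#) + (1# + 1# + 1#))) * (k * (h * tt))) - L * ((k + 1#) * (k * (k - 1#)))) + ((1# + 1# + 1#) + (1# + 1# + 1#)) * (r - k * (k * L)) + (1# + 1# + 1#) * (L * (k * (k - 1#))) ≡ - ((((1# + 1# + 1#) + (1# + 1# + 1#)) + ((1# + 1# + 1#) + (1# + 1# + 1#))) * ((1# + k) * (h * tt))) - L * (((1# + k) + 1#) * ((1# + k) * ((1# + k) - 1#))) + (((1# + 1# + 1#) + (1# + 1# + 1#)) + ((1# + 1# + 1#) + (1# + 1# + 1#))) * f' + 1# * ((((1# + 1# + 1#) + (1# + 1# + 1#)) + ((1# + 1# + 1#) + (1# + 1# + 1#))) * f) + ((1# + 1# + 1#) + (1# + 1# + 1#)) * (h * (r - k * (k * L)) + h * (r - k * (k * L))) + (1# + 1# + 1#) * ((1# + 1#) * r)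
          ring₄ f' f h tt r k L = (solve 7 (λ a b c d e f g → (`1 :+ `1 :+ `1 :+ (`1 :+ `1 :+ `1) :+ (`1 :+ `1 :+ `1 :+ (`1 :+ `1 :+ `1))) :* a :+ (`1 :+ `1 :+ `1 :+ (`1 :+ `1 :+ `1) :+ (`1 :+ `1 :+ `1 :+ (`1 :+ `1 :+ `1))) :* (b :- c :* d :+ c :* (e :- f :* (f :* g))) :+ `1 :* (:- ((`1 :+ `1 :+ `1 :+ (`1 :+ `1 :+ `1) :+ (`1 :+ `1 :+ `1 :+ (`1 :+ `1 :+ `1))) :* (f :* (c :* d))) :- g :* ((f :+ `1) :* (f :* (f :- `1)))) :+ (`1 :+ `1 :+ `1 :+ (`1 :+ `1 :+ `1)) :* (e :- f :* (f :* g)) :+ (`1 :+ `1 :+ `1) :* (g :* (f :* (f :- `1))) := :- ((`1 :+ `1 :+ `1 :+ (`1 :+ `1 :+ `1) :+ (`1 :+ `1 :+ `1 :+ (`1 :+ `1 :+ `1))) :* ((`1 :+ f) :* (c :* d))) :- g :* ((`1 :+ f :+ `1) :* ((`1 :+ f) :* (`1 :+ f :- `1))) :+ (`1 :+ `1 :+ `1 :+ (`1 :+ `1 :+ `1) :+ (`1 :+ `1 :+ `1 :+ (`1 :+ `1 :+ `1))) :* a :+ `1 :* ((`1 :+ `1 :+ `1 :+ (`1 :+ `1 :+ `1) :+ (`1 :+ `1 :+ `1 :+ (`1 :+ `1 :+ `1))) :* b) :+ (`1 :+ `1 :+ `1 :+ (`1 :+ `1 :+ `1)) :* (c :* (e :-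 f :* (f :* g)) :+ c :* (e :- f :* (f :* g))) :+ (`1 :+ `1 :+ `1) :* ((`1 :+ `1) :* e)) refl f' f h tt r k L)

      opaque
        z-p : z p ≡ N (N (iter (p ∸ 3) N t))
        z-p = trans (orbitSum-p t) (cong (λ n → iter n N t) (cong (_∸ 1) (sym (ℕₚ.m+[n∸m]≡n p≥3))))

      opaque
        -- The p-th power of an element of label 1 has label p, that is ψ = 1.
        total-label : Fₖ p + δ₀ (z p) ≡ 1#
        total-label = trans (solve 4 (λ a b c d → a :- b :* c :+ (d :+ b :* c) := a :+ d) refl (β (y p)) half (β (z p * S (z p))) (δ (z p)))
          (trans (sym (ψ-split (y p) (trans (ϰ-z p) ι-p))) (trans (ψ-el (subst (E₃ (y p) (z p)) (sym (ℕₚ.*-identityʳ p)) (power-el p))) (+-identityʳ 1#)))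

      opaque
        δ₀-z : δ₀ (z p) ≡ ϰ (iter (p ∸ 3) N t) * λ'
        δ₀-z = trans (cong δ₀ z-p) (trans (δ₀-N (InK-N _)) (ρ-N _))

      opaque
        -- For p > 3 the number 12 is invertible, so Fₖ p = 0; and δ₀ (z p) = χ (N^(p-3) t) λ' = 0
        -- because χ kills N F. Their sum would have to be 1.
        p≡3 : p ≡ 3
        p≡3 with p ℕₚ.≟ 3
        ... | yes e = e
        ... | no ne = ⊥-elim (1≢0 (trans (sym total-label) (trans (cong₂ _+_ F-p δ₀-zero) (+-identityˡ 0#))))
          where
          three≢0 : three ≢ 0#
          three≢0 e = ne (ℕₚ.≤-antisym (∣⇒≤ (ι-zero {3} (trans (solve 0 (`1 :+ (`1 :+ (`1 :+ `0)) := `1 :+ `1 :+ `1) refl) e))) p≥3)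
          twelve≢0 : twelve ≢ 0#
          twelve≢0 e = *-nonzero (*-nonzero two≢0 two≢0) three≢0 (trans (solve 0 ((`1 :+ `1) :* (`1 :+ `1) :* (`1 :+ `1 :+ `1) := `1 :+ `1 :+ `1 :+ (`1 :+ `1 :+ `1) :+ (`1 :+ `1 :+ `1 :+ (`1 :+ `1 :+ `1))) refl) e)
          F-p : Fₖ p ≡ 0#
          F-p = *-cancelˡ-zero twelve≢0 (trans (F-closed p) (trans (cong (λ k → - (twelve * (k * (half * β (t * S t)))) - λ' * ((k + 1#) * (k * (k - 1#)))) ι-p)
            (solve 4 (λ a b c d → :- (a :* (`0 :* (b :* c))) :- d :* ((`0 :+ `1) :* (`0 :* (`0 :- `1))) := `0) refl twelve half (β (t * S t)) λ')))
          p>3 : p ∸ 3 ≡ suc (p ∸ 4)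
          p>3 = cong (_∸ 3) (sym (ℕₚ.m+[n∸m]≡n (ℕₚ.≤∧≢⇒< p≥3 (λ e → ne (sym e)))))
          δ₀-zero : δ₀ (z p) ≡ 0#
          δ₀-zero = trans δ₀-z (trans (cong (λ n → ϰ (iter n N t) * λ') p>3) (trans (cong (_* λ') (InK-N _)) (zeroˡ _)))

      opaque
        char-3 : three ≡ 0#
        char-3 = trans (solve 0 (`1 :+ `1 :+ `1 := `1 :+ (`1 :+ (`1 :+ `0))) refl) (trans (cong ι (sym p≡3)) ι-p)

      opaque
        -- In characteristic 3 the closed formula reads 0 = 0, so the recursion is unrolled three
        -- times.
        F-3 : Fₖ 3 ≡ λ'
        F-3 = begin
          Fₖ 3 ≡⟨ trans (F-suc 2) (cong (λ q → q - h + half * (ρ (z 2) - ι 2 * (ι 2 * λ'))) (trans (F-suc 1) (cong (λ q → q - h + half * (ρ (z 1) - ι 1 * (ι 1 * λ'))) (trans (F-suc 0) (cong (λ q → q - h + half * (ρ (z 0) - ι 0 * (ι 0 * λ'))) F-0))))) ⟩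
          0# - h + half * (ρ (z 0) - ι 0 * (ι 0 * λ')) - h + half * (ρ (z 1) - ι 1 * (ι 1 * λ')) - h + half * (ρ (z 2) - ι 2 * (ι 2 * λ'))
                                                                                                        ≡⟨ cong₂ (λ q r → q - h + half * r) (cong₂ (λ q r → 0# - h + half * (q - ι 0 * (ι 0 * λ')) - h + half * (r - ι 1 * (ι 1 * λ'))) ρ-z-0 r₁) (cong (_- ι 2 * (ι 2 * λ')) r₂) ⟩
          0# - h + half * (0# - ι 0 * (ι 0 * λ')) - h + half * (0# - ι 1 * (ι 1 * λ')) - h + half * (λ' - ι 2 * (ι 2 * λ'))
                                                                                                        ≡⟨ combine₂ (- (h + λ')) (- (1# + 1#)) char-3 (half-double λ') (ring₅ h half λ') ⟩
          λ' ∎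
          where
          open ≡-Reasoning
          h : Carrier
          h = half * β (t * S t)
          r₁ : ρ (z 1) ≡ 0#
          r₁ = trans (ρ-z-suc 0) (trans (cong (_+ 0# * λ') ρ-z-0) (solve 1 (λ a → `0 :+ `0 :* a := `0) refl λ'))
          r₂ : ρ (z 2) ≡ λ'
          r₂ = trans (ρ-z-suc 1) (trans (cong (_+ (1# + 0#) * λ') r₁) (solve 1 (λ a → `0 :+ (`1 :+ `0) :* a := a) refl λ'))
          ring₅ : ∀ h a L → 0# - h + a * (0# - 0# * (0# * L)) - h + a * (0# - (1# + 0#) * ((1# + 0#) * L)) - h + a * (L - (1# + (1# + 0#)) * ((1# + (1# + 0#)) * L)) + (- (h + L)) * 0# + (- (1# + 1#)) * L
            ≡ L + (- (h + L)) * (1# + 1# + 1#) + (- (1# + 1#)) * (a * L + a * L)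
          ring₅ h a L = (solve 3 (λ a b c → `0 :- a :+ b :* (`0 :- `0 :* (`0 :* c)) :- a :+ b :* (`0 :- (`1 :+ `0) :* ((`1 :+ `0) :* c)) :- a :+ b :* (c :- (`1 :+ (`1 :+ `0)) :* ((`1 :+ (`1 :+ `0)) :* c)) :+ :- (a :+ c) :* `0 :+ :- (`1 :+ `1) :* c := c :+ :- (a :+ c) :* (`1 :+ `1 :+ `1) :+ :- (`1 :+ `1) :* (b :* c :+ b :* c)) refl h a L)

      opaque
        -- Both summands of `total-label` equal λ', and 2 λ' = 1 in characteristic 3.
        λ'≡-1 : λ' ≡ - 1#
        λ'≡-1 = combine₂ λ' (- 1#) char-3 (trans (sym (cong₂ _+_ (trans (cong Fₖ p≡3) F-3) (trans δ₀-z (trans (cong (λ n → ϰ (iter (n ∸ 3) N t) * λ') p≡3) (trans (cong (_* λ') ϰ-t) (*-identityˡ _)))))) total-label)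
          (solve 1 (λ a → a :+ a :* `0 :+ :- `1 :* `1 := :- `1 :+ a :* (`1 :+ `1 :+ `1) :+ :- `1 :* (a :+ a)) refl λ')

      opaque
        ρ-func : ∃ λ μ → ∀ x → ρ x ≡ tr m (μ * x)
        ρ-func = functional-trace ρ-+ (λ x → ψ-fixed (t * S x - x * S t) 0#)

      opaque
        -- δ₀ is additive on ker χ only. Precomposing with the projection along t extends it to the
        -- whole field, which trace duality requires.
        δ₀'-func : ∃ λ μ → ∀ x → δ₀ (x - ϰ x * t) ≡ tr m (μ * x)
        δ₀'-func = functional-trace additive (λ x → δ₀-fixed _)
          where
          additive : Additive (λ x → δ₀ (x - ϰ x * t))
          additive x y = trans (cong δ₀ (trans (cong (λ q → x + y - q * t) (χ-additive x y)) (solve 5 (λ a b c d e → a :+ b :- (c :+ d) :* e := a :- c :* e :+ (b :- d :* e)) refl x y (ϰ x) (ϰ y) t))) (δ₀-+ (project-K x) (project-K y))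

      u' u α : Carrier
      u' = proj₁ ρ-func
      u = - u'
      α = proj₁ δ₀'-func

      ρ≡ : ∀ x → ρ x ≡ tr m (u' * x)
      ρ≡ = proj₂ ρ-func

      α≡ : ∀ x → δ₀ (x - ϰ x * t) ≡ tr m (α * x)
      α≡ = proj₂ δ₀'-func

      opaque
        δ₀-K : ∀ {c} → InK c → δ₀ c ≡ tr m (α * c)
        δ₀-K {c} kc = trans (cong δ₀ (sym (trans (cong (λ q → c - q * t) kc) (solve 2 (λ a b → a :- `0 :* b := a) refl c t)))) (α≡ c)

      opaque
        tr-shift : ∀ x c → tr m (x * c) ≡ tr m (frob l x * frob l c)
        tr-shift x c = trans (sym (tr-frob l _)) (cong (tr m) (frob-* l x c))

      opaque
        identify : ∀ x y → (∀ c → tr m (x * frob l c) ≡ tr m (y * frob l c)) → x ≡ y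
        identify x y h = tr-injective x y λ d → go d (frob-surjective l d)
          where
          go : ∀ d → (∃ λ c → frob l c ≡ d) → tr m (x * d) ≡ tr m (y * d)
          go d (c , refl) = h c

      opaque
        -- The trace dual of `ρ-φ`: with λ' = -1 it reads χ c = ρ c - ρ (φ c). The sign in u = -u'
        -- is chosen to match this.
        μC≡ : μC ≡ u - frob l u
        μC≡ = trans (identify μC (frob l u' - u') λ c → begin
            tr m (μC * frob l c) ≡⟨ χ≡ (frob l c) ⟨
            ϰ (frob l c) ≡⟨ χ-φ c ⟩
            ϰ c ≡⟨ combine₂ 1# (ϰ c) (ρ-φ c) λ'≡-1 (solve 4 (λ a b c d → a :+ `1 :* (b :+ a :* c) :+ a :* :- `1 := b :- d :+ `1 :* d :+ a :* c) refl (ϰ c) (ρ c) λ' (ρ (frob l c))) ⟩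
            ρ c - ρ (frob l c) ≡⟨ cong₂ _-_ (trans (ρ≡ c) (tr-shift u' c)) (ρ≡ (frob l c)) ⟩
            tr m (frob l u' * frob l c) - tr m (u' * frob l c) ≡⟨ trM.map-- _ _ ⟨
            tr m (frob l u' * frob l c - u' * frob l c) ≡⟨ cong (tr m) (solve 3 (λ a b c → a :* b :- c :* b := (a :- c) :* b) refl (frob l u') (frob l c) u') ⟩
            tr m ((frob l u' - u') * frob l c) ∎)
          (trans (solve 2 (λ a b → a :- b := :- b :- :- a) refl (frob l u') u') (cong (λ q → - u' - q) (sym (frob-neg l u'))))
          where open ≡-Reasoning

      opaque
        φu : frob l u ≡ u - μC
        φu = trans (solve 2 (λ a b → a := b :- (b :- a)) refl (frob l u) u) (cong (λ q → u - q) (sym μC≡))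

      λ₁ λ₀ : Carrier
      λ₁ = tr m (α * frob l t) - tr m (α * t) - ρ (frob l t)
      λ₀ = - λ₁

      opaque
        -- The left side is additive in c and vanishes on ker χ by `δ₀-φ`, so it is a multiple of χ;
        -- the factor is its value at t, where χ = 1.
        defect-formula : ∀ c → tr m (α * frob l c) - tr m (α * c) - ρ (frob l c) ≡ ϰ c * λ₁
        defect-formula c = trans (cong h (solve 3 (λ a b c → a := a :- b :* c :+ b :* c) refl c (ϰ c) t)) (trans (h-+ _ _) (trans (cong₂ _+_ h-K (h-scale c)) (+-identityˡ _)))
          where
          h : Carrier → Carrier
          h c = tr m (α * frob l c) - tr m (α * c) - ρ (frob l c)
          h-+ : Additive h
          h-+ x y = trans (cong₂ (λ q r → q - r - ρ (frob l (x + y))) (trans (cong (λ q → tr m (α * q)) (frob-+ l x y)) (trans (cong (tr m) (distribˡ α _ _)) (tr-additive _ _))) (trans (cong (tr m) (distribˡ α x y)) (tr-additive _ _)))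
            (trans (cong (λ q → tr m (α * frob l x) + tr m (α * frob l y) - (tr m (α * x) + tr m (α * y)) - q) (trans (cong ρ (frob-+ l x y)) (ρ-+ _ _)))
              (regroup (tr m (α * frob l x)) (tr m (α * frob l y)) (tr m (α * x)) (tr m (α * y)) (ρ (frob l x)) (ρ (frob l y))))
            where
            regroup : ∀ a b c d e f → a + b - (c + d) - (e + f) ≡ (a - c - e) + (b - d - f)
            regroup a b c d e f = (solve 6 (λ a b c d e f → a :+ b :- (c :+ d) :- (e :+ f) := a :- c :- e :+ (b :- d :- f)) refl a b c d e f)
          h-K : h (c - ϰ c * t) ≡ 0#
          h-K = let kc = project-K c in trans (cong₂ (λ q r → q - r - ρ (frob l (c - ϰ c * t))) (sym (δ₀-K (InK-φ kc))) (sym (δ₀-K kc)))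
            (trans (cong (λ q → q - δ₀ (c - ϰ c * t) - ρ (frob l (c - ϰ c * t))) (δ₀-φ kc)) (cancel (δ₀ (c - ϰ c * t)) (ρ (frob l (c - ϰ c * t)))))
            where
            cancel : ∀ a b → a + b - a - b ≡ 0#
            cancel a b = (solve 2 (λ a b → a :+ b :- a :- b := `0) refl a b)
          h-scale : ∀ c → h (ϰ c * t) ≡ ϰ c * λ₁
          h-scale c with χ-prime c
          ... | n , _ , e = trans (cong (λ q → h (q * t)) e) (trans (AdditiveMap.map-ι h-+ n t) (cong (_* λ₁) (sym e)))

      opaque
        λ₁-fixed : pow λ₁ p ≡ λ₁
        λ₁-fixed = fixed-+ (fixed-+ (tr-fixed _) (fixed-neg (tr-fixed _))) (fixed-neg (ψ-fixed (t * S (frob l t) - frob l t * S t) 0#))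

      opaque
        -- `defect-formula` read through trace duality, with u = -u' and λ₀ = -λ₁.
        φα : frob l α - α ≡ u + λ₀ * μC
        φα = combine₁ (- 1#) (identify (α - frob l α - u') (λ₁ * μC) λ c → begin
            tr m ((α - frob l α - u') * frob l c) ≡⟨ cong (tr m) (solve 4 (λ a b c d → (a :- b :- c) :* d := a :* d :- b :* d :- c :* d) refl α (frob l α) u' (frob l c)) ⟩
            tr m (α * frob l c - frob l α * frob l c - u' * frob l c) ≡⟨ trans (trM.map-- _ _) (cong (_- tr m (u' * frob l c)) (trM.map-- _ _)) ⟩
            tr m (α * frob l c) - tr m (frob l α * frob l c) - tr m (u' * frob l c) ≡⟨ cong₂ (λ q r → tr m (α * frob l c) - q - r) (sym (tr-shift α c)) (sym (ρ≡ (frob l c))) ⟩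
            tr m (α * frob l c) - tr m (α * c) - ρ (frob l c) ≡⟨ defect-formula c ⟩
            ϰ c * λ₁ ≡⟨ trans (cong (_* λ₁) (trans (sym (χ-φ c)) (χ≡ (frob l c)))) (*-comm _ _) ⟩
            λ₁ * tr m (μC * frob l c) ≡⟨ tr-scalar λ₁ _ λ₁-fixed ⟨
            tr m (λ₁ * (μC * frob l c)) ≡⟨ cong (tr m) (sym (*-assoc _ _ _)) ⟩
            tr m (λ₁ * μC * frob l c) ∎)
          (solve 5 (λ a b c d e → a :- b :+ :- `1 :* (c :* d) := :- e :+ :- c :* d :+ :- `1 :* (b :- a :- e)) refl (frob l α) α λ₁ μC u')
          where open ≡-Reasoning

      opaque
        frob-thrice : ∀ x → frob (3 *ℕ l) x ≡ frob l (frob l (frob l x))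
        frob-thrice x = trans (frob-comp l (l +ℕ (l +ℕ 0)) x) (cong (frob l) (trans (frob-comp l (l +ℕ 0) x) (cong (λ n → frob l (frob n x)) (ℕₚ.+-identityʳ l))))

      opaque
        -- Each application of φ subtracts the φ-fixed μC, and three of them subtract 3 μC = 0. For
        -- α below, the three increments likewise add up to a multiple of 3.
        u-sub : InSub (3 *ℕ l) u
        u-sub = trans (frob-thrice u) (trans (cong (λ q → frob l (frob l q)) φu) (trans (cong (frob l) step) (trans step₂
            (combine₁ (- μC) char-3 (solve 2 (λ a b → a :- b :- b :- b :+ :- b :* `0 := a :+ :- b :* (`1 :+ `1 :+ `1)) refl u μC)))))
          where
          step : frob l (u - μC) ≡ u - μC - μC
          step = trans (frob-- l u μC) (cong₂ _-_ φu μC-sub)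
          step₂ : frob l (u - μC - μC) ≡ u - μC - μC - μC
          step₂ = trans (frob-- l _ μC) (cong₂ _-_ step μC-sub)

      opaque
        α-sub : InSub (3 *ℕ l) α
        α-sub = trans (frob-thrice α) (trans (cong (λ q → frob l (frob l q)) φα') (trans (cong (frob l) step) (trans step₂
            (combine₁ (u + λ₀ * μC - μC) char-3 (solve 4 (λ a b c d → a :+ (b :+ c :* d) :+ (b :- d :+ c :* d) :+ (b :- d :- d :+ c :* d) :+ (b :+ c :* d :- d) :* `0 := a :+ (b :+ c :* d :- d) :* (`1 :+ `1 :+ `1)) refl α u λ₀ μC)))))
          where
          φα' : frob l α ≡ α + (u + λ₀ * μC)
          φα' = trans (solve 2 (λ a b → a := b :+ (a :- b)) refl (frob l α) α) (cong (α +_) φα)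
          φλμ : frob l (λ₀ * μC) ≡ λ₀ * μC
          φλμ = trans (frob-* l λ₀ μC) (cong₂ _*_ (frob-prime l (fixed-neg λ₁-fixed)) μC-sub)
          step : frob l (α + (u + λ₀ * μC)) ≡ α + (u + λ₀ * μC) + (u - μC + λ₀ * μC)
          step = trans (frob-+ l _ _) (cong₂ _+_ φα' (trans (frob-+ l _ _) (cong₂ _+_ φu φλμ)))
          step₂ : frob l (α + (u + λ₀ * μC) + (u - μC + λ₀ * μC)) ≡ α + (u + λ₀ * μC) + (u - μC + λ₀ * μC) + (u - μC - μC + λ₀ * μC)
          step₂ = trans (frob-+ l _ _) (cong₂ _+_ step (trans (frob-+ l _ _) (cong₂ _+_ (trans (frob-- l u μC) (cong₂ _-_ φu μC-sub)) φλμ)))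

      opaque
        caseD : FormD l E
        caseD = u , t , μB , s , α , λ₀ , subst (FormD-at l E u t μB s α λ₀) μC≡
            ( p≡3 , trans m≡ (trans (cong (l *ℕ_) (trans P≡ (cong₂ _*ℕ_ p≡3 p≡3))) (ℕₚ.*-comm l 9))
            , u-sub , μC-sub , μC≢0 , (λ e → 1≢0 (trans (sym ϰ-t) (trans (cong ϰ e) InK-0))) , trans (sym (χ≡ t)) ϰ-t
            , μB-sub , μB≢0 , s-sub , coeffs , α-sub , fixed-neg λ₁-fixed , φα
            , (λ {b} {c} {_} {j} g → trans (graph g) (S≡ c) , trans (sym (χ-el (to₃ g))) (trans (χ-free b c) (χ≡ c)))
            , (λ {b} {c} {_} {j} g e → let kc = trans (χ≡ c) e ; (k , h) = elK kc b in
                 k , (λ x → trans (proj₂ (unique (to₃ g) h) x) (cong (λ n → σ (n *ℕ k) x) p≡3)) , trans (sym (ψ-el h)) (label b kc))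
            , (λ b c k e e' → let kc = trans (χ≡ c) e in ≡E refl refl (S≡ c) (subst (λ n → E₃ b c (n *ℕ k)) p≡3 (el-ψ kc (trans e' (sym (label b kc))))))
            , ≡E refl refl (S≡ t) g₁ )
          where
          s : ℕ → Carrier
          s = proj₁ S-coeffs
          S≡ : ∀ x → S x ≡ lin m s x
          S≡ = proj₁ (proj₂ S-coeffs)
          s-sub : ∀ i → i < m → InSub l (s i)
          s-sub = proj₂ (proj₂ S-coeffs)
          label : ∀ b {c} → InK c → ψ b c ≡ half * Qf m s μB c + tr m (α * c + μB * b)
          label b {c} kc = trans (ψ-split b kc) (trans (cong (_+ δ c) (β≡ b)) (combine₃ 1# half (- 1#) (δ₀-K kc) (sym Q≡) (tr-additive (α * c) (μB * b))
              (ring₆ (tr m (μB * b)) (δ c) half (β (c * S c)) (tr m (α * c)) (Qf m s μB c) (tr m (α * c + μB * b)))))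
            where
            Q≡ : Qf m s μB c ≡ - β (c * S c)
            Q≡ = cong -_ (trans (cong (tr m) (trans (cong (λ q → μB * c * q) (sym (S≡ c))) (*-assoc _ _ _))) (sym (β≡ (c * S c))))
            ring₆ : ∀ tb d h bc ta q tab → tb + d + 1# * ta + h * q + (- 1#) * (ta + tb) ≡ h * q + tab + 1# * (d + h * bc) + h * (- bc) + (- 1#) * tab
            ring₆ tb d h bc ta q tab = (solve 7 (λ a b c d e f g → a :+ b :+ `1 :* c :+ d :* e :+ :- `1 :* (c :+ a) := d :* e :+ f :+ `1 :* (b :+ d :* g) :+ d :* :- g :+ :- `1 :* f) refl tb d ta h q tab bc)
          bilinear : ∀ c z → tr m (μB * (c * lin m s z - z * lin m s c)) ≡ tr m (μC * c) * tr m (u' * z) - tr m (μC * z) * tr m (u' * c)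
          bilinear c z = trans (cong₂ (λ q r → tr m (μB * (c * q - z * r))) (sym (S≡ z)) (sym (S≡ c))) (trans (sym (β≡ _)) (trans (B-formula c z)
            (cong₂ _-_ (cong₂ _*_ (χ≡ c) (ρ≡ z)) (cong₂ _*_ (χ≡ z) (ρ≡ c)))))
          coeffs : ∀ i → 1 ≤ i → i < m → - (μB * s i) + frob i (s (m ∸ i)) * frob i μB ≡ μC * frob i u - u * frob i μC
          coeffs i 1≤i i<m = trans (cong (- (μB * s i) +_) (trans (*-comm _ _) (sym (frob-* i μB (s (m ∸ i)))))) (trans (combine₁ (- 1#) (bilinear-coefficients s μB μC u' bilinear i 1≤i i<m)
              (ring₇ (μB * s i) (frob i (μB * s (m ∸ i))) μC (frob i u') u' (frob i μC))) (cong (λ q → μC * q - u * frob i μC) (sym (frob-neg i u'))))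
            where
            ring₇ : ∀ a b c d e f → - a + b + (- 1#) * (c * d - e * f) ≡ c * (- d) - (- e) * f + (- 1#) * (a - b)
            ring₇ a b c d e f = (solve 6 (λ a b c d e f → :- a :+ b :+ :- `1 :* (c :* d :- e :* f) := c :* :- d :- :- e :* f :+ :- `1 :* (a :- b)) refl a b c d e f)

  -- Collecting the four cases.

  Form : ℕ → Rel → Set
  Form l E = FormA l E ⊎ FormB l E ⊎ FormC l E ⊎ FormD l E

  module _ {l : ℕ} {E E' : Rel} (to : ∀ {b c t j} → E b c t j → E' b c t j) (from : ∀ {b c t j} → E' b c t j → E b c t j) where
    transport-form : Form l E → Form l E'
    transport-form (inj₁ (s , h , k)) = inj₁ (s , (λ g → h (from g)) , λ b c → to (k b c))
    transport-form (inj₂ (inj₁ (s , μ , a₁ , a₂ , a₃ , a₄ , h , k))) = inj₂ (inj₁ (s , μ , a₁ , a₂ , a₃ , a₄ , (λ g → h (from g)) , λ b c i e → to (k b c i e)))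
    transport-form (inj₂ (inj₂ (inj₁ (s , μ , a₁ , a₂ , a₃ , a₄ , a₅ , h , k)))) = inj₂ (inj₂ (inj₁ (s , μ , a₁ , a₂ , a₃ , a₄ , a₅ , (λ g → h (from g)) , λ b c i e → to (k b c i e))))
    transport-form (inj₂ (inj₂ (inj₂ (u , t , μ , s , α , λ₀ , a₁ , a₂ , a₃ , a₄ , a₅ , a₆ , a₇ , a₈ , a₉ , b₁ , b₂ , b₃ , b₄ , b₅ , h , k , e , g)))) =
      inj₂ (inj₂ (inj₂ (u , t , μ , s , α , λ₀ , a₁ , a₂ , a₃ , a₄ , a₅ , a₆ , a₇ , a₈ , a₉ , b₁ , b₂ , b₃ , b₄ , b₅ , (λ g → h (from g)) , (λ g → k (from g)) , (λ b c i e₁ e₂ → to (e b c i e₁ e₂)) , to g)))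

  module Classify (l P : ℕ) (m≡ : m ≡ l *ℕ P) (K : ℕ) (P∣ : P ∣ p ^ K) where
    open Normal l P m≡ K P∣

    module Normalised {E : Rel} (sys : System₂ l E) {S : Carrier → Carrier} (gr : Graph l E S) {D : ℕ} (vert : Facts.Vertical l P m≡ K P∣ sys D) where
      open Labelled l P m≡ K P∣ sys gr
      open VerticalFacts vert

      formD : D ≡ p → P ≡ p *ℕ p → ∃ λ v → FormD l (twist l v E)
      formD refl P≡ = w , Order-p².Generator.caseD l P m≡ K P∣ (twist-system l sys w) graph' P≡ divD (straight-twist (proj₂ (proj₂ genD))) (λ x → straight-twist (B₀-N x)) t g₁
        where
        shifted : ∃ λ w → frob l w ≡ w × ∃ λ t → E₃ (- (t * w)) t 1
        shifted = Order-p².shift-generator l P m≡ K P∣ sys gr P≡ divD (proj₂ (proj₂ genD)) B₀-N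
        w t : Carrier
        w = proj₁ shifted
        w-fixed : frob l w ≡ w
        w-fixed = proj₁ (proj₂ shifted)
        t = proj₁ (proj₂ (proj₂ shifted))
        untwist-t : ∀ t j → t - w + σ j w ≡ t
        untwist-t t j = combine₁ 1# (σ-fixed j w-fixed) (solve 3 (λ a b c → a :- b :+ c :+ `1 :* b := a :+ `1 :* c) refl t w (σ j w))
        graph' : Graph l (twist l w E) S
        graph' = record { graph = λ {_} {c} {t} {j} g → trans (sym (untwist-t t j)) (graph g) ; S-+ = S-+ ; S-φ = S-φ }
        straight-twist : ∀ {b t j} → E b 0# t j → twist l w E b 0# t j
        straight-twist {b} {t} {j} g = ≡E (solve 2 (λ a b → a := a :- `0 :* b) refl b w) refl (sym (untwist-t t j)) g
        g₁ : twist l w E 0# t (S t) 1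
        g₁ = ≡E (solve 2 (λ a b → :- (a :* b) := `0 :- a :* b) refl t w) refl (sym (untwist-t (S t) 1)) (proj₂ (proj₂ (proj₂ shifted)))

      formC : D ≡ 1 → P ≡ p → ∃ λ v → FormC l (twist l v E)
      formC refl P≡ = Order-p.CaseC.caseC P≡ (to₃ (proj₂ (proj₂ genD))) (λ x → ≡E₃ (cong (_- x) (σ-1 x)) refl (to₃ (B₀-N x)))

    opaque
      twist-0 : ∀ {E : Rel} {b c t j} → E b c t j → twist l 0# E b c t j
      twist-0 {E} {b} {c} {t} {j} g = subst₂ (λ b' t' → E b' c t' j) (solve 2 (λ a b → a := a :- b :* `0) refl b c) (trans (solve 1 (λ a → a := a :- `0 :+ `0) refl t) (cong (t - 0# +_) (sym (frob-0 (l *ℕ j))))) g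

    opaque
      untwist-0 : ∀ {E : Rel} {b c t j} → twist l 0# E b c t j → E b c t j
      untwist-0 {E} {b} {c} {t} {j} g = subst₂ (λ b' t' → E b' c t' j) (solve 2 (λ a b → a :- b :* `0 := a) refl b c) (trans (cong (t - 0# +_) (frob-0 (l *ℕ j))) (solve 1 (λ a → a :- `0 :+ `0 := a) refl t)) g

    opaque
      -- The clauses run through D = 1 or p and P = D or D p. The pairs (P / D , D) are (1,1),
      -- (1,p), (p,1), (p,p) in this order.
      classify-normalised : ∀ {E : Rel} (sys : System₂ l E) {S : Carrier → Carrier} (gr : Graph l E S) → ∃ λ v → Form l (twist l v E)
      classify-normalised {E} sys gr with Facts.vertical l P m≡ K P∣ sys
      ... | D , _ , vert with prime⇒irreducible pr (Facts.VerticalFacts.D∣p l P m≡ K P∣ sys vert) | Straighten.P-cases sys vert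
      ...   | inj₁ e | inj₁ e' = 0# , transport-form {E' = twist l 0# E} (twist-0 {E}) (untwist-0 {E}) (inj₁ (Labelled.caseA l P m≡ K P∣ sys gr (trans e' e)))
      ...   | inj₂ e | inj₁ e' = 0# , transport-form {E' = twist l 0# E} (twist-0 {E}) (untwist-0 {E}) (inj₂ (inj₁ (Labelled.Order-p.caseB l P m≡ K P∣ sys gr (trans e' e) (λ g → subst (_∣ _) e (Facts.Vertical.divD vert g)))))
      ...   | inj₁ e | inj₂ e' = let (v , f) = Normalised.formC sys gr vert e (trans e' (trans (cong (_*ℕ p) e) (ℕₚ.*-identityˡ p))) in v , inj₂ (inj₂ (inj₁ f))
      ...   | inj₂ e | inj₂ e' = let (v , f) = Normalised.formD sys gr vert e (trans e' (cong (_*ℕ p) e)) in v , inj₂ (inj₂ (inj₂ f))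

    opaque
      classify : ∀ {E : Rel} (sys : System₂ l E) → ∃ λ v → Form l (twist l v E)
      classify {E} sys = let (w , S , gr) = normalise sys ; (v , f) = classify-normalised (twist-system l sys w) gr in
        w + v , transport-form {E' = twist l (w + v) E} (twist-twist l E w v) (twist-untwist l E w v) f

  -- Matrices and semilinear maps

  sum4-cong : ∀ {f g : Fin 4 → Carrier} → (∀ k → f k ≡ g k) → sum4 f ≡ sum4 g
  sum4-cong h = cong₂ _+_ (cong₂ _+_ (cong₂ _+_ (h i0) (h i1)) (h i2)) (h i3)

  sum4-+ : ∀ (f g : Fin 4 → Carrier) → sum4 (λ k → f k + g k) ≡ sum4 f + sum4 g
  sum4-+ f g = (solve 8 (λ a b c d e f g h → a :+ b :+ (c :+ d) :+ (e :+ f) :+ (g :+ h) := a :+ c :+ e :+ g :+ (b :+ d :+ f :+ h)) refl (f i0) (g i0) (f i1) (g i1) (f i2) (g i2) (f i3) (g i3))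

  sum4-*ˡ : ∀ c (f : Fin 4 → Carrier) → sum4 (λ k → c * f k) ≡ c * sum4 f
  sum4-*ˡ c f = (solve 5 (λ a b c d e → a :* b :+ a :* c :+ a :* d :+ a :* e := a :* (b :+ c :+ d :+ e)) refl c (f i0) (f i1) (f i2) (f i3))

  sum4-*ʳ : ∀ c (f : Fin 4 → Carrier) → sum4 (λ k → f k * c) ≡ sum4 f * c
  sum4-*ʳ c f = (solve 5 (λ a b c d e → a :* b :+ c :* b :+ d :* b :+ e :* b := (a :+ c :+ d :+ e) :* b) refl (f i0) c (f i1) (f i2) (f i3))

  sum4-swap : ∀ (f : Fin 4 → Fin 4 → Carrier) → sum4 (λ k → sum4 (f k)) ≡ sum4 (λ l → sum4 (λ k → f k l))
  sum4-swap f = trans (sym (trans (sum4-+ (λ l → f i0 l + f i1 l + f i2 l) (f i3)) (cong (_+ sum4 (f i3)) (trans (sum4-+ (λ l → f i0 l + f i1 l) (f i2)) (cong (_+ sum4 (f i2)) (sum4-+ (f i0) (f i1))))))) refl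

  sum4-frob : ∀ e (f : Fin 4 → Carrier) → frob e (sum4 f) ≡ sum4 (λ k → frob e (f k))
  sum4-frob e f = trans (frob-+ e _ _) (cong (_+ frob e (f i3)) (trans (frob-+ e _ _) (cong (_+ frob e (f i2)) (frob-+ e _ _))))

  vecMat-assoc : ∀ (v : Vec4) (A B : Mat4) j → vecMat (vecMat v A) B j ≡ vecMat v (matMul A B) j
  vecMat-assoc v A B j = begin
    sum4 (λ k → sum4 (λ l → v l * A l k) * B k j) ≡⟨ sum4-cong (λ k → sym (sum4-*ʳ (B k j) (λ l → v l * A l k))) ⟩
    sum4 (λ k → sum4 (λ l → v l * A l k * B k j)) ≡⟨ sum4-swap (λ k l → v l * A l k * B k j) ⟩
    sum4 (λ l → sum4 (λ k → v l * A l k * B k j)) ≡⟨ sum4-cong (λ l → trans (sum4-cong (λ k → *-assoc (v l) (A l k) (B k j))) (sum4-*ˡ (v l) (λ k → A l k * B k j))) ⟩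
    sum4 (λ l → v l * sum4 (λ k → A l k * B k j)) ∎
    where open ≡-Reasoning

  matMul-assoc : ∀ (A B C : Mat4) i j → matMul (matMul A B) C i j ≡ matMul A (matMul B C) i j
  matMul-assoc A B C i = vecMat-assoc (A i) B C

  matMul-cong : ∀ {A A' B B' : Mat4} → (∀ i j → A i j ≡ A' i j) → (∀ i j → B i j ≡ B' i j) → ∀ i j → matMul A B i j ≡ matMul A' B' i j
  matMul-cong hA hB i j = sum4-cong (λ k → cong₂ _*_ (hA i k) (hB k j))

  matMul-scale : ∀ c d (A B : Mat4) i j → matMul (λ i j → c * A i j) (λ i j → d * B i j) i j ≡ (c * d) * matMul A B i j
  matMul-scale c d A B i j = trans (sum4-cong (λ k → rearrange c d (A i k) (B k j))) (sum4-*ˡ (c * d) (λ k → A i k * B k j))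
    where
    rearrange : ∀ c d a b → c * a * (d * b) ≡ c * d * (a * b)
    rearrange c d a b = (solve 4 (λ a b c d → a :* b :* (c :* d) := a :* c :* (b :* d)) refl c a d b)

  matMul-frob : ∀ e (A B : Mat4) i j → frob e (matMul A B i j) ≡ matMul (λ i j → frob e (A i j)) (λ i j → frob e (B i j)) i j
  matMul-frob e A B i j = trans (sum4-frob e (λ k → A i k * B k j)) (sum4-cong (λ k → frob-* e (A i k) (B k j)))

  cases4 : ∀ {P : Fin 4 → Set} → P i0 → P i1 → P i2 → P i3 → ∀ i → P i
  cases4 a b c d f0                = a
  cases4 a b c d (fs f0)           = b
  cases4 a b c d (fs (fs f0))      = c
  cases4 a b c d (fs (fs (fs f0))) = d

  vecMat-idˡ : ∀ (A : Mat4) i j → vecMat (idMat i) A j ≡ A i j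
  vecMat-idˡ A i j = cases4 {P = λ i → vecMat (idMat i) A j ≡ A i j}
    (solve 4 (λ a b c d → `1 :* a :+ `0 :* b :+ `0 :* c :+ `0 :* d := a) refl (A i0 j) (A i1 j) (A i2 j) (A i3 j)) (solve 4 (λ a b c d → `0 :* a :+ `1 :* b :+ `0 :* c :+ `0 :* d := b) refl (A i0 j) (A i1 j) (A i2 j) (A i3 j))
    (solve 4 (λ a b c d → `0 :* a :+ `0 :* b :+ `1 :* c :+ `0 :* d := c) refl (A i0 j) (A i1 j) (A i2 j) (A i3 j)) (solve 4 (λ a b c d → `0 :* a :+ `0 :* b :+ `0 :* c :+ `1 :* d := d) refl (A i0 j) (A i1 j) (A i2 j) (A i3 j)) i

  matMul-idˡ : ∀ (A : Mat4) i j → matMul idMat A i j ≡ A i j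
  matMul-idˡ = vecMat-idˡ

  matMul-idʳ : ∀ (A : Mat4) i j → matMul A idMat i j ≡ A i j
  matMul-idʳ A i j = cases4 {P = λ j → matMul A idMat i j ≡ A i j}
    (solve 4 (λ a b c d → a :* `1 :+ b :* `0 :+ c :* `0 :+ d :* `0 := a) refl (A i i0) (A i i1) (A i i2) (A i i3)) (solve 4 (λ a b c d → a :* `0 :+ b :* `1 :+ c :* `0 :+ d :* `0 := b) refl (A i i0) (A i i1) (A i i2) (A i i3))
    (solve 4 (λ a b c d → a :* `0 :+ b :* `0 :+ c :* `1 :+ d :* `0 := c) refl (A i i0) (A i i1) (A i i2) (A i i3)) (solve 4 (λ a b c d → a :* `0 :+ b :* `0 :+ c :* `0 :+ d :* `1 := d) refl (A i i0) (A i i1) (A i i2) (A i i3)) j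

  idMat-frob : ∀ e i j → frob e (idMat i j) ≡ idMat i j
  idMat-frob e = cases4 (cases4 (frob-1 e) (frob-0 e) (frob-0 e) (frob-0 e)) (cases4 (frob-0 e) (frob-1 e) (frob-0 e) (frob-0 e))
    (cases4 (frob-0 e) (frob-0 e) (frob-1 e) (frob-0 e)) (cases4 (frob-0 e) (frob-0 e) (frob-0 e) (frob-1 e))

  -- _≈ˢ_ as a record, so that its arguments can be inferred.
  infix 4 _≃_ _≐_
  record _≃_ (s t : Semilinear) : Set where
    constructor ⟨_⟩
    field
      ≃⇒≈ : s ≈ˢ t
  open _≃_ public

  _≐_ : Semilinear → Semilinear → Set
  s ≐ t = (∀ x → frob (aut s) x ≡ frob (aut t) x) × (∀ i j → mat s i j ≡ mat t i j)

  ≐⇒≃ : ∀ {s t} → s ≐ t → s ≃ t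
  ≐⇒≃ (e , h) = ⟨ e , 1# , 1≢0 , (λ i j → trans (h i j) (sym (*-identityˡ _))) ⟩

  ≃-refl : ∀ {s} → s ≃ s
  ≃-refl {s} = ≐⇒≃ {s} {s} ((λ _ → refl) , (λ _ _ → refl))

  ≃-sym : ∀ {s t} → s ≃ t → t ≃ s
  ≃-sym {s} {t} ⟨ e , c , nc , h ⟩ = ⟨ (λ x → sym (e x)) , c ⁻¹ , ⁻¹-nonzero nc , (λ i j →
    trans (flip c (mat t i j) nc) (cong (c ⁻¹ *_) (sym (h i j)))) ⟩
    where
    flip : ∀ c x → c ≢ 0# → x ≡ c ⁻¹ * (c * x)
    flip c x nc = combine₁ (- x) (inverseʳ c nc) (solve 3 (λ a b c → a :+ :- a :* `1 := b :* (c :* a) :+ :- a :* (c :* b)) refl x (c ⁻¹) c)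

  ≃-trans : ∀ {s t r} → s ≃ t → t ≃ r → s ≃ r
  ≃-trans ⟨ e , c , nc , h ⟩ ⟨ e' , c' , nc' , h' ⟩ = ⟨ (λ x → trans (e x) (e' x)) , c * c' , *-nonzero nc nc' , (λ i j →
    trans (h i j) (trans (cong (c *_) (h' i j)) (sym (*-assoc c c' _)))) ⟩

  ∘-cong : ∀ {s s' t t'} → s ≃ s' → t ≃ t' → (s ∘ˢ t) ≃ (s' ∘ˢ t')
  ∘-cong {s} {s'} {t} {t'} ⟨ e , c , nc , h ⟩ ⟨ e' , c' , nc' , h' ⟩ = ⟨
      (λ x → trans (frob-comp (aut s) (aut t) x) (trans (e _) (trans (cong (frob (aut s')) (e' x)) (sym (frob-comp (aut s') (aut t') x)))))
    , frob (aut t) c * c' , *-nonzero (frob-nonzero (aut t) nc) nc' , (λ i j →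
        trans (matMul-cong {λ i j → frob (aut t) (mat s i j)} {λ i j → frob (aut t) c * frob (aut t') (mat s' i j)} {mat t} {λ i j → c' * mat t' i j} (λ i k → trans (cong (frob (aut t)) (h i k)) (trans (frob-* (aut t) c _) (cong (frob (aut t) c *_) (e' _)))) h' i j)
          (matMul-scale (frob (aut t) c) c' (λ i j → frob (aut t') (mat s' i j)) (mat t') i j)) ⟩

  ∘-assoc : ∀ s t r → ((s ∘ˢ t) ∘ˢ r) ≐ (s ∘ˢ (t ∘ˢ r))
  ∘-assoc s t r = (λ x → cong (λ k → frob k x) (ℕₚ.+-assoc (aut s) (aut t) (aut r))) , λ i j →
    trans (matMul-cong {B = mat r} {B' = mat r} (matMul-frob (aut r) (λ i j → frob (aut t) (mat s i j)) (mat t)) (λ _ _ → refl) i j)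
      (trans (matMul-assoc (λ i j → frob (aut r) (frob (aut t) (mat s i j))) (λ i j → frob (aut r) (mat t i j)) (mat r) i j) (matMul-cong {λ i j → frob (aut r) (frob (aut t) (mat s i j))} {λ i j → frob (aut t +ℕ aut r) (mat s i j)} {matMul (λ i j → frob (aut r) (mat t i j)) (mat r)} {matMul (λ i j → frob (aut r) (mat t i j)) (mat r)}
        (λ i j → trans (frob-comm (aut r) (aut t) _) (sym (frob-comp (aut t) (aut r) _))) (λ _ _ → refl) i j))

  ∘-idˡ : ∀ s → (idˢ ∘ˢ s) ≐ s
  ∘-idˡ s = (λ x → refl) , λ i j → trans (matMul-cong {B = mat s} {B' = mat s} (idMat-frob (aut s)) (λ _ _ → refl) i j) (matMul-idˡ (mat s) i j)

  ∘-idʳ : ∀ s → (s ∘ˢ idˢ) ≐ s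
  ∘-idʳ s = (λ x → cong (λ k → frob k x) (ℕₚ.+-identityʳ (aut s))) , matMul-idʳ (mat s)

  -- Composition, kept opaque so that unification does not unfold it.
  opaque
    infixl 7 _⨾_
    _⨾_ : Semilinear → Semilinear → Semilinear
    s ⨾ t = s ∘ˢ t

    ⨾-≡ : ∀ s t → s ⨾ t ≡ s ∘ˢ t
    ⨾-≡ s t = refl

    ⨾-cong : ∀ {s s' t t'} → s ≃ s' → t ≃ t' → s ⨾ t ≃ s' ⨾ t'
    ⨾-cong {s} {s'} {t} {t'} = ∘-cong {s} {s'} {t} {t'}

    ⨾-assoc : ∀ s t r → (s ⨾ t) ⨾ r ≃ s ⨾ (t ⨾ r)
    ⨾-assoc s t r = ≐⇒≃ {(s ∘ˢ t) ∘ˢ r} {s ∘ˢ (t ∘ˢ r)} (∘-assoc s t r)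

    ⨾-idˡ : ∀ s → idˢ ⨾ s ≃ s
    ⨾-idˡ s = ≐⇒≃ {idˢ ∘ˢ s} {s} (∘-idˡ s)

    ⨾-idʳ : ∀ s → s ⨾ idˢ ≃ s
    ⨾-idʳ s = ≐⇒≃ {s ∘ˢ idˢ} {s} (∘-idʳ s)

  module ≃-Reasoning where
    infix  1 begin≃_
    infixr 2 _≃⟨_⟩_
    infix  3 _∎≃
    begin≃_ : ∀ {s t} → s ≃ t → s ≃ t
    begin≃ h = h
    _≃⟨_⟩_ : ∀ s {t r} → s ≃ t → t ≃ r → s ≃ r
    s ≃⟨ h ⟩ k = ≃-trans h k
    _∎≃ : ∀ s → s ≃ s
    s ∎≃ = ≃-refl

  form-cong : ∀ {x x' y y' : Vec4} → (∀ i → x i ≡ x' i) → (∀ i → y i ≡ y' i) → form x y ≡ form x' y'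
  form-cong hx hy = cong₂ _-_ (cong₂ _+_ (cong₂ _-_ (cong₂ _*_ (hx i0) (hy i3)) (cong₂ _*_ (hx i3) (hy i0))) (cong₂ _*_ (hx i1) (hy i2))) (cong₂ _*_ (hx i2) (hy i1))

  InP-∘ : ∀ {A B k l} → InPΓSpP (mkS A k) → InPΓSpP (mkS B l) → InPΓSpP (mkS (matMul A B) k)
  InP-∘ {A} {B} ((A' , rA , lA) , (λA , nA , fA) , a1 , a2 , a3) ((B' , rB , lB) , (λB , nB , fB) , b1 , b2 , b3) =
      (matMul B' A' , inverse A B A' B' rA rB , inverse B' A' B A lB lA)
    , (λB * λA , *-nonzero nB nA , λ x y → trans (form-cong {vecMat x (matMul A B)} {vecMat (vecMat x A) B} {vecMat y (matMul A B)} {vecMat (vecMat y A) B} (λ j → sym (vecMat-assoc x A B j)) (λ j → sym (vecMat-assoc y A B j)))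
        (trans (fB (vecMat x A) (vecMat y A)) (trans (cong (λB *_) (fA x y)) (sym (*-assoc λB λA _)))))
    , row B a1 a2 a3 i1 b1 , row B a1 a2 a3 i2 b2 , row B a1 a2 a3 i3 b3
    where
    row : ∀ (B : Mat4) → A i0 i1 ≡ 0# → A i0 i2 ≡ 0# → A i0 i3 ≡ 0# → ∀ j → B i0 j ≡ 0# → matMul A B i0 j ≡ 0#
    row B a1 a2 a3 j b = trans (cong₂ _+_ (cong₂ _+_ (cong₂ _+_ (cong (A i0 i0 *_) b) (cong (_* B i1 j) a1)) (cong (_* B i2 j) a2)) (cong (_* B i3 j) a3))
      (solve 4 (λ a b c d → a :* `0 :+ `0 :* b :+ `0 :* c :+ `0 :* d := `0) refl (A i0 i0) (B i1 j) (B i2 j) (B i3 j))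
    inverse : ∀ A B A' B' → (∀ i j → matMul A A' i j ≡ idMat i j) → (∀ i j → matMul B B' i j ≡ idMat i j) →
      ∀ i j → matMul (matMul A B) (matMul B' A') i j ≡ idMat i j
    inverse A B A' B' hA hB i j = begin
      matMul (matMul A B) (matMul B' A') i j ≡⟨ matMul-assoc A B (matMul B' A') i j ⟩
      matMul A (matMul B (matMul B' A')) i j ≡⟨ matMul-cong {A} {A} {matMul B (matMul B' A')} {matMul (matMul B B') A'} (λ _ _ → refl) (λ i j → sym (matMul-assoc B B' A' i j)) i j ⟩
      matMul A (matMul (matMul B B') A') i j ≡⟨ matMul-cong {A} {A} {matMul (matMul B B') A'} {A'} (λ _ _ → refl) (λ i j → trans (matMul-cong {matMul B B'} {idMat} {A'} {A'} hB (λ _ _ → refl) i j) (matMul-idˡ A' i j)) i j ⟩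
      matMul A A' i j ≡⟨ hA i j ⟩
      idMat i j ∎
      where open ≡-Reasoning

  -- The entry (0 , 0) is 1 on both sides, which forces the scalar to be 1.
  E-scalar : ∀ {a b c t a' b' c' t'} μ → (∀ i j → E a b c t i j ≡ μ * E a' b' c' t' i j) → a ≡ a' × b ≡ b' × c ≡ c' × t ≡ t'
  E-scalar {a} {b} {c} {t} {a'} {b'} {c'} {t'} μ h = unscale (h i3 i0) , unscale (h i3 i1) , unscale (h i3 i2) , unscale (h i2 i1)
    where
    unscale : ∀ {x y} → x ≡ μ * y → x ≡ y
    unscale {x} {y} e = trans e (trans (cong (_* y) (sym (trans (h i0 i0) (*-identityʳ μ)))) (*-identityˡ y))

  -- The origin of the multiplication law in `System`.
  E-product : ∀ a b c t k x y z u l → let σ = frob l in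
    (mkS (E a b c t) k ∘ˢ mkS (E x y z u) l) ≐ mkS (E (σ a + x - σ b * z + σ c * (y - z * u)) (σ b + y + σ c * u) (σ c + z) (σ t + u)) (k +ℕ l)
  E-product a b c t k x y z u l = (λ _ → refl) , cases4
      (cases4 (r4 (σ1 ⊗) (σ0 ⊗) (σ0 ⊗) (σ0 ⊗) (q₁ x (- z) (y - z * u))) (r4 (σ1 ⊗) (σ0 ⊗) (σ0 ⊗) (σ0 ⊗) (q₂ y u)) (r4 (σ1 ⊗) (σ0 ⊗) (σ0 ⊗) (σ0 ⊗) (q₃ z)) (r4 (σ1 ⊗) (σ0 ⊗) (σ0 ⊗) (σ0 ⊗) q₄))
      (cases4 (r4 (frob-neg l c ⊗) (σ1 ⊗) (σ0 ⊗) (σ0 ⊗) (solve 5 (λ a b c d e → :- a :* `1 :+ `1 :* :- b :+ `0 :* (c :- b :* d) :+ `0 :* e := :- (a :+ b)) refl (σ c) z y u x))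
              (r4 (frob-neg l c ⊗) (σ1 ⊗) (σ0 ⊗) (σ0 ⊗) (solve 3 (λ a b c → :- a :* `0 :+ `1 :* `1 :+ `0 :* b :+ `0 :* c := `1) refl (σ c) u y))
              (r4 (frob-neg l c ⊗) (σ1 ⊗) (σ0 ⊗) (σ0 ⊗) (solve 2 (λ a b → :- a :* `0 :+ `1 :* `0 :+ `0 :* `1 :+ `0 :* b := `0) refl (σ c) z))
              (r4 (frob-neg l c ⊗) (σ1 ⊗) (σ0 ⊗) (σ0 ⊗) (solve 1 (λ a → :- a :* `0 :+ `1 :* `0 :+ `0 :* `0 :+ `0 :* `1 := `0) refl (σ c))))
      (cases4 (r4 (σbct ⊗) (refl ⊗) (σ1 ⊗) (σ0 ⊗) (solve 7 (λ a b c d e f g → (a :- b :* c) :* `1 :+ c :* :- d :+ `1 :* (e :- d :* f) :+ `0 :* g := a :+ e :+ b :* f :- (b :+ d) :* (c :+ f)) refl (σ b) (σ c) (σ t) z y u x))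
              (r4 (σbct ⊗) (refl ⊗) (σ1 ⊗) (σ0 ⊗) (solve 5 (λ a b c d e → (a :- b :* c) :* `0 :+ c :* `1 :+ `1 :* d :+ `0 :* e := c :+ d) refl (σ b) (σ c) (σ t) u y))
              (r4 (σbct ⊗) (refl ⊗) (σ1 ⊗) (σ0 ⊗) (solve 4 (λ a b c d → (a :- b :* c) :* `0 :+ c :* `0 :+ `1 :* `1 :+ `0 :* d := `1) refl (σ b) (σ c) (σ t) z))
              (r4 (σbct ⊗) (refl ⊗) (σ1 ⊗) (σ0 ⊗) (solve 3 (λ a b c → (a :- b :* c) :* `0 :+ c :* `0 :+ `1 :* `0 :+ `0 :* `1 := `0) refl (σ b) (σ c) (σ t))))
      (cases4 (r4 (refl ⊗) (refl ⊗) (refl ⊗) (σ1 ⊗) (solve 7 (λ a b c d e f g → a :* `1 :+ b :* :- c :+ d :* (e :- c :* f) :+ `1 :* g := a :+ g :- b :* c :+ d :* (e :- c :* f)) refl (σ a) (σ b) z (σ c) y u x))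
              (r4 (refl ⊗) (refl ⊗) (refl ⊗) (σ1 ⊗) (solve 5 (λ a b c d e → a :* `0 :+ b :* `1 :+ c :* d :+ `1 :* e := b :+ e :+ c :* d) refl (σ a) (σ b) (σ c) u y))
              (r4 (refl ⊗) (refl ⊗) (refl ⊗) (σ1 ⊗) (solve 4 (λ a b c d → a :* `0 :+ b :* `0 :+ c :* `1 :+ `1 :* d := c :+ d) refl (σ a) (σ b) (σ c) z))
              (r4 (refl ⊗) (refl ⊗) (refl ⊗) (σ1 ⊗) (solve 3 (λ a b c → a :* `0 :+ b :* `0 :+ c :* `0 :+ `1 :* `1 := `1) refl (σ a) (σ b) (σ c))))
    where
    σ : Carrier → Carrier
    σ = frob l
    σ1 : σ 1# ≡ 1#
    σ1 = frob-1 l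
    σ0 : σ 0# ≡ 0#
    σ0 = frob-0 l
    σbct : σ (b - c * t) ≡ σ b - σ c * σ t
    σbct = trans (frob-- l b (c * t)) (cong (λ q → σ b - q) (frob-* l c t))
    _⊗ : ∀ {x y w : Carrier} → x ≡ y → x * w ≡ y * w
    _⊗ {w = w} e = cong (_* w) e
    r4 : ∀ {x y z w x' y' z' w' r : Carrier} → x ≡ x' → y ≡ y' → z ≡ z' → w ≡ w' → x' + y' + z' + w' ≡ r → x + y + z + w ≡ r
    r4 refl refl refl refl e = e
    q₁ : ∀ x z y → 1# * 1# + 0# * z + 0# * y + 0# * x ≡ 1#
    q₁ x z y = (solve 3 (λ a b c → `1 :* `1 :+ `0 :* a :+ `0 :* b :+ `0 :* c := `1) refl z y x)
    q₂ : ∀ y u → 1# * 0# + 0# * 1# + 0# * u + 0# * y ≡ 0#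
    q₂ y u = (solve 2 (λ a b → `1 :* `0 :+ `0 :* `1 :+ `0 :* a :+ `0 :* b := `0) refl u y)
    q₃ : ∀ z → 1# * 0# + 0# * 0# + 0# * 1# + 0# * z ≡ 0#
    q₃ z = (solve 1 (λ a → `1 :* `0 :+ `0 :* `0 :+ `0 :* `1 :+ `0 :* a := `0) refl z)
    q₄ : 1# * 0# + 0# * 0# + 0# * 0# + 0# * 1# ≡ 0#
    q₄ = (solve 0 (`1 :* `0 :+ `0 :* `0 :+ `0 :* `0 :+ `0 :* `1 := `0) refl)

  -- A similitude fixing P also preserves its perp, so the matrix is block triangular with a 2 by 2
  -- middle block. The fields are the form conditions on pairs of rows, with ν the multiplier.
  record Shape (A : Mat4) : Set where
    field
      a01≡0 : A i0 i1 ≡ 0#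
      a02≡0 : A i0 i2 ≡ 0#
      a03≡0 : A i0 i3 ≡ 0#
      a13≡0 : A i1 i3 ≡ 0#
      a23≡0 : A i2 i3 ≡ 0#
      ν     : Carrier
      ν≢0   : ν ≢ 0#
      diag  : A i0 i0 * A i3 i3 ≡ ν
      det   : A i1 i1 * A i2 i2 - A i1 i2 * A i2 i1 ≡ ν
      orth₁ : A i1 i0 * A i3 i3 + A i1 i1 * A i3 i2 - A i1 i2 * A i3 i1 ≡ 0#
      orth₂ : A i2 i0 * A i3 i3 + A i2 i1 * A i3 i2 - A i2 i2 * A i3 i1 ≡ 0#

  opaque
    shape : ∀ {g} → InPΓSpP g → Shape (mat g)
    shape {mkS A k} (_ , (ν , nν , f) , e1 , e2 , e3) = record
      { a01≡0 = e1 ; a02≡0 = e2 ; a03≡0 = e3 ; a13≡0 = z13 ; a23≡0 = z23 ; ν = ν ; ν≢0 = nν ; diag = diag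
      ; det = trans (trans (solve 6 (λ a b c d e f → a :* b :- c :* d := e :* `0 :- `0 :* f :+ a :* b :- c :* d) refl (A i1 i1) (A i2 i2) (A i1 i2) (A i2 i1) (A i1 i0) (A i2 i0))
          (cong₂ (λ q r → A i1 i0 * q - r * A i2 i0 + A i1 i1 * A i2 i2 - A i1 i2 * A i2 i1) (sym z23) (sym z13)))
          (trans (rowform i1 i2) (solve 1 (λ a → a :* (`0 :* `0 :- `0 :* `0 :+ `1 :* `1 :- `0 :* `0) := a) refl ν))
      ; orth₁ = trans (trans (solve 7 (λ a b c d e f g → a :* b :+ c :* d :- e :* f := a :* b :- `0 :* g :+ c :* d :- e :* f) refl (A i1 i0) (A i3 i3) (A i1 i1) (A i3 i2) (A i1 i2) (A i3 i1) (A i3 i0))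
          (cong (λ q → A i1 i0 * A i3 i3 - q * A i3 i0 + A i1 i1 * A i3 i2 - A i1 i2 * A i3 i1) (sym z13)))
          (trans (rowform i1 i3) (solve 1 (λ a → a :* (`0 :* `1 :- `0 :* `0 :+ `1 :* `0 :- `0 :* `0) := `0) refl ν))
      ; orth₂ = trans (trans (solve 7 (λ a b c d e f g → a :* b :+ c :* d :- e :* f := a :* b :- `0 :* g :+ c :* d :- e :* f) refl (A i2 i0) (A i3 i3) (A i2 i1) (A i3 i2) (A i2 i2) (A i3 i1) (A i3 i0))
          (cong (λ q → A i2 i0 * A i3 i3 - q * A i3 i0 + A i2 i1 * A i3 i2 - A i2 i2 * A i3 i1) (sym z23)))
          (trans (rowform i2 i3) (solve 1 (λ a → a :* (`0 :* `1 :- `0 :* `0 :+ `0 :* `0 :- `1 :* `0) := `0) refl ν)) }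
      where
      rowform : ∀ i j → form (A i) (A j) ≡ ν * form (idMat i) (idMat j)
      rowform i j = trans (form-cong {A i} {vecMat (idMat i) A} {A j} {vecMat (idMat j) A} (λ k → sym (vecMat-idˡ A i k)) (λ k → sym (vecMat-idˡ A j k))) (f (idMat i) (idMat j))
      first : ∀ j → form (A i0) (A j) ≡ A i0 i0 * A j i3
      first j = trans (cong₂ (λ q r → A i0 i0 * A j i3 - q * A j i0 + r * A j i2 - A i0 i2 * A j i1) e3 e1) (trans (cong (λ q → A i0 i0 * A j i3 - 0# * A j i0 + 0# * A j i2 - q * A j i1) e2)
        (solve 5 (λ a b c d e → a :* b :- `0 :* c :+ `0 :* d :- `0 :* e := a :* b) refl (A i0 i0) (A j i3) (A j i0) (A j i2) (A j i1)))
      diag : A i0 i0 * A i3 i3 ≡ ν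
      diag = trans (sym (first i3)) (trans (rowform i0 i3) (solve 1 (λ a → a :* (`1 :* `1 :- `0 :* `0 :+ `0 :* `0 :- `0 :* `0) := a) refl ν))
      a00≢0 : A i0 i0 ≢ 0#
      a00≢0 e = nν (trans (sym diag) (trans (cong (_* A i3 i3) e) (zeroˡ _)))
      z13 : A i1 i3 ≡ 0#
      z13 = *-cancelˡ-zero a00≢0 (trans (sym (first i1)) (trans (rowform i0 i1) (solve 1 (λ a → a :* (`1 :* `0 :- `0 :* `0 :+ `0 :* `0 :- `0 :* `1) := `0) refl ν)))
      z23 : A i2 i3 ≡ 0#
      z23 = *-cancelˡ-zero a00≢0 (trans (sym (first i2)) (trans (rowform i0 i2) (solve 1 (λ a → a :* (`1 :* `0 :- `0 :* `0 :+ `0 :* `1 :- `0 :* `0) := `0) refl ν)))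

  opaque
    a33≢0 : ∀ {A} → Shape A → A i3 i3 ≢ 0#
    a33≢0 {A} sh e = Shape.ν≢0 sh (trans (sym (Shape.diag sh)) (trans (cong (A i0 i0 *_) e) (zeroʳ _)))

  opaque
    -- A bottom right entry equal to 1 selects one matrix from each projective class, so equality up
    -- to a scalar becomes equality.
    ≃⇒≐ : ∀ {s t} → s ≃ t → mat s i3 i3 ≡ 1# → mat t i3 i3 ≡ 1# → s ≐ t
    ≃⇒≐ {s} {t} ⟨ e , c , _ , h ⟩ es et = e , λ i j → trans (h i j) (trans (cong (_* mat t i j) c≡1) (*-identityˡ _))
      where
      c≡1 : c ≡ 1#
      c≡1 = trans (sym (*-identityʳ c)) (trans (cong (c *_) (sym et)) (trans (sym (h i3 i3)) es))

  O : Point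
  O = 0# , 0# , 0#

  opaque
    apply-O : ∀ g i → apply g (pointVec O) i ≡ mat g i3 i
    apply-O (mkS A k) i = trans (cong₂ (λ q r → q * A i0 i + q * A i1 i + q * A i2 i + r * A i3 i) (frob-0 k) (frob-1 k)) (solve 4 (λ a b c d → `0 :* a :+ `0 :* b :+ `0 :* c :+ `1 :* d := d) refl (A i0 i) (A i1 i) (A i2 i) (A i3 i))

  finitePoint : Finite Point
  finitePoint = finite-× finiteF (finite-× finiteF finiteF)

  -- A regular group indexed by the points: fixed vector and coboundary.

  module Regular (G : Semilinear → Set) (sub : IsSubgroupPΓSpP G) (reg : RegularOnPoints G) where
    open IsSubgroupPΓSpP sub

    respects≃ : ∀ {g h} → g ≃ h → G g → G h
    respects≃ {g} {h} ⟨ e ⟩ = respects g h e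

    opaque
      -- The group element taking the origin to Y, rescaled so that its last row is exactly the
      -- vector of Y. Regularity makes `r` a bijection from the points onto the group, so points can
      -- serve as indices.
      r : Point → Semilinear
      r Y = let (g , _ , (c , _ , _)) = proj₁ (reg O Y) in mkS (λ i j → c ⁻¹ * mat g i j) (aut g)
      r-G : ∀ Y → G (r Y)
      r-G Y = let (g , Gg , (c , nc , _)) = proj₁ (reg O Y) in respects g (r Y) ((λ _ → refl) , c , nc , λ i j →
        combine₁ (- mat g i j) (inverseʳ c nc) (ring₁ (mat g i j) c (c ⁻¹))) Gg
        where
        ring₁ : ∀ a c c' → a + (- a) * 1# ≡ c * (c' * a) + (- a) * (c * c')
        ring₁ a c c' = (solve 3 (λ a b c → a :+ :- a :* `1 := b :* (c :* a) :+ :- a :* (b :* c)) refl a c c')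
      r-row : ∀ Y j → mat (r Y) i3 j ≡ pointVec Y j
      r-row Y j = let (g , _ , (c , nc , h)) = proj₁ (reg O Y) in trans (cong (c ⁻¹ *_) (trans (sym (apply-O g j)) (h j)))
        (combine₁ (pointVec Y j) (inverseʳ c nc) (ring₂ (pointVec Y j) c (c ⁻¹)))
        where
        ring₂ : ∀ y c c' → c' * (c * y) + y * 1# ≡ y + y * (c * c')
        ring₂ y c c' = (solve 3 (λ a b c → a :* (b :* c) :+ c :* `1 := c :+ c :* (b :* a)) refl c' c y)

    opaque
      r-33 : ∀ Y → mat (r Y) i3 i3 ≡ 1#
      r-33 Y = r-row Y i3

    opaque
      r-shape : ∀ Y → Shape (mat (r Y))
      r-shape Y = shape {r Y} (inGroup (r Y) (r-G Y))

    opaque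
      point : ∀ {g} → G g → ∃ λ Y → g ≃ r Y
      point {g@(mkS A k)} Gg = Y , ⟨ proj₂ (reg O Y) g (r Y) Gg (r-G Y)
          (A i3 i3 , na , λ i → trans (apply-O g i) (scaled i))
          (1# , 1≢0 , λ i → trans (apply-O (r Y) i) (trans (r-row Y i) (sym (*-identityˡ _)))) ⟩
        where
        na : A i3 i3 ≢ 0#
        na = a33≢0 (shape {g} (inGroup g Gg))
        Y : Point
        Y = A i3 i0 * (A i3 i3) ⁻¹ , A i3 i1 * (A i3 i3) ⁻¹ , A i3 i2 * (A i3 i3) ⁻¹
        rescale : ∀ a c → c ≢ 0# → a ≡ c * (a * c ⁻¹)
        rescale a c nc = combine₁ (- a) (inverseʳ c nc) (solve 3 (λ a b c → a :+ :- a :* `1 := b :* (a :* c) :+ :- a :* (b :* c)) refl a c (c ⁻¹))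
        scaled : ∀ i → A i3 i ≡ A i3 i3 * pointVec Y i
        scaled = cases4 (rescale _ _ na) (rescale _ _ na) (rescale _ _ na) (sym (*-identityʳ _))

    opaque
      r-injective : ∀ {X Y} → r X ≃ r Y → X ≡ Y
      r-injective {X} {Y} e = cong₂ _,_ (entry i0) (cong₂ _,_ (entry i1) (entry i2))
        where
        entry : ∀ j → pointVec X j ≡ pointVec Y j
        entry j = trans (sym (r-row X j)) (trans (proj₂ (≃⇒≐ {r X} {r Y} e (r-33 X) (r-33 Y)) i3 j) (r-row Y j))

    opaque
      infixl 7 _·_
      _·_ : Point → Point → Point
      X · Y = proj₁ (point (closed (r X) (r Y) (r-G X) (r-G Y)))
      ·-r : ∀ X Y → (r X ⨾ r Y) ≃ r (X · Y)
      ·-r X Y = subst (_≃ r (X · Y)) (sym (⨾-≡ (r X) (r Y))) (proj₂ (point (closed (r X) (r Y) (r-G X) (r-G Y))))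

    opaque
      inv : Point → Point
      inv Y = let (h , Gh , _) = inverses (r Y) (r-G Y) in proj₁ (point Gh)
      inv-r : ∀ Y → (r Y ⨾ r (inv Y)) ≃ idˢ
      inv-r Y = let (h , Gh , e) = inverses (r Y) (r-G Y) in ≃-trans (⨾-cong ≃-refl (≃-sym (proj₂ (point Gh)))) (subst (_≃ idˢ) (sym (⨾-≡ (r Y) h)) ⟨ e ⟩)

    opaque
      inv-l : ∀ Y → (r (inv Y) ⨾ r Y) ≃ idˢ
      inv-l Y = ≃-trans (⨾-cong ≃-refl same) (inv-r (inv Y))
        where
        open ≃-Reasoning
        same : r Y ≃ r (inv (inv Y))
        same = begin≃
          r Y ≃⟨ ≃-sym (⨾-idʳ (r Y)) ⟩
          r Y ⨾ idˢ ≃⟨ ⨾-cong ≃-refl (≃-sym (inv-r (inv Y))) ⟩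
          r Y ⨾ (r (inv Y) ⨾ r (inv (inv Y))) ≃⟨ ≃-sym (⨾-assoc _ _ _) ⟩
          (r Y ⨾ r (inv Y)) ⨾ r (inv (inv Y)) ≃⟨ ⨾-cong (inv-r Y) ≃-refl ⟩
          idˢ ⨾ r (inv (inv Y)) ≃⟨ ⨾-idˡ _ ⟩
          r (inv (inv Y)) ∎≃

    opaque
      cancelʳ : ∀ X {Y Z} → (r Y ⨾ r Z) ≃ idˢ → r ((X · Y) · Z) ≃ r X
      cancelʳ X {Y} {Z} e = begin≃
          r ((X · Y) · Z) ≃⟨ ≃-sym (·-r (X · Y) Z) ⟩
          r (X · Y) ⨾ r Z ≃⟨ ⨾-cong (≃-sym (·-r X Y)) ≃-refl ⟩
          (r X ⨾ r Y) ⨾ r Z ≃⟨ ⨾-assoc _ _ _ ⟩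
          r X ⨾ (r Y ⨾ r Z) ≃⟨ ⨾-cong ≃-refl e ⟩
          r X ⨾ idˢ ≃⟨ ⨾-idʳ _ ⟩
          r X ∎≃
        where open ≃-Reasoning

    opaque
      ·-invʳ : ∀ X Y → (X · Y) · inv Y ≡ X
      ·-invʳ X Y = r-injective (cancelʳ X (inv-r Y))

    opaque
      ·-invˡ : ∀ X Y → (X · inv Y) · Y ≡ X
      ·-invˡ X Y = r-injective (cancelʳ X (inv-l Y))

    opaque
      product-33 : ∀ X Y → mat (r X ∘ˢ r Y) i3 i3 ≡ 1#
      product-33 X Y = trans (cong₂ _+_ (cong₂ _+_ (cong₂ (λ q s → frob k (mat (r X) i3 i0) * q + frob k (mat (r X) i3 i1) * s) a03≡0 a13≡0) (cong (frob k (mat (r X) i3 i2) *_) a23≡0))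
          (cong₂ _*_ (trans (cong (frob k) (r-33 X)) (frob-1 k)) (r-33 Y)))
          (solve 3 (λ a b c → a :* `0 :+ b :* `0 :+ c :* `0 :+ `1 :* `1 := `1) refl (frob k (mat (r X) i3 i0)) (frob k (mat (r X) i3 i1)) (frob k (mat (r X) i3 i2)))
        where
        k : ℕ
        k = aut (r Y)
        open Shape (r-shape Y)

    opaque
      ·-r≐ : ∀ X Y → (r X ∘ˢ r Y) ≐ r (X · Y)
      ·-r≐ X Y = ≃⇒≐ {r X ∘ˢ r Y} {r (X · Y)} (subst (_≃ r (X · Y)) (⨾-≡ (r X) (r Y)) (·-r X Y)) (product-33 X Y) (r-33 (X · Y))

    opaque
      unit-point : ∃ λ e → r e ≐ idˢ
      unit-point = let (e , h) = point hasId in e , ≃⇒≐ {r e} {idˢ} (≃-sym h) (r-33 e) refl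

    k : Point → ℕ
    k Y = aut (r Y)

    d : Point → Carrier
    d Y = mat (r Y) i0 i0

    -- The semilinear action on the perp of P modulo P, in the two middle coordinates. The
    -- normalisation of `r` makes it an action on vectors and not merely on their classes up to
    -- scalars.
    act : Point → Carrier × Carrier → Carrier × Carrier
    act Y (v₁ , v₂) = frob (k Y) v₁ * mat (r Y) i1 i1 + frob (k Y) v₂ * mat (r Y) i2 i1
                    , frob (k Y) v₁ * mat (r Y) i1 i2 + frob (k Y) v₂ * mat (r Y) i2 i2

    opaque
      k-· : ∀ X Y x → frob (k (X · Y)) x ≡ frob (k X +ℕ k Y) x
      k-· X Y x = sym (proj₁ (·-r≐ X Y) x)

    opaque
      d-· : ∀ X Y → d (X · Y) ≡ frob (k Y) (d X) * d Y
      d-· X Y = trans (sym (proj₂ (·-r≐ X Y) i0 i0)) (trans (cong₂ _+_ (cong₂ _+_ (cong (frob (k Y) (d X) * d Y +_) (cong (_* mat (r Y) i1 i0) (zero-frob a01≡0))) (cong (_* mat (r Y) i2 i0) (zero-frob a02≡0))) (cong (_* mat (r Y) i3 i0) (zero-frob a03≡0)))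
          (solve 5 (λ a b c d e → a :* b :+ `0 :* c :+ `0 :* d :+ `0 :* e := a :* b) refl (frob (k Y) (d X)) (d Y) (mat (r Y) i1 i0) (mat (r Y) i2 i0) (mat (r Y) i3 i0)))
        where
        open Shape (r-shape X)
        zero-frob : ∀ {x} → x ≡ 0# → frob (k Y) x ≡ 0#
        zero-frob refl = frob-0 (k Y)

    opaque
      d≢0 : ∀ Y → d Y ≢ 0#
      d≢0 Y e = ν≢0 (trans (sym diag) (trans (cong (_* mat (r Y) i3 i3) e) (zeroˡ _)))
        where open Shape (r-shape Y)

    opaque
      block-· : ∀ X Y i j → mat (r X) i i3 ≡ 0# → mat (r Y) i0 j ≡ 0# → mat (r (X · Y)) i j ≡ frob (k Y) (mat (r X) i i1) * mat (r Y) i1 j + frob (k Y) (mat (r X) i i2) * mat (r Y) i2 j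
      block-· X Y i j ei ej = trans (sym (proj₂ (·-r≐ X Y) i j)) (trans (cong₂ (λ q s → frob (k Y) (mat (r X) i i0) * q + b + c + s * mat (r Y) i3 j) ej (trans (cong (frob (k Y)) ei) (frob-0 (k Y))))
          (ring₃ (frob (k Y) (mat (r X) i i0)) b c (mat (r Y) i3 j)))
        where
        b c : Carrier
        b = frob (k Y) (mat (r X) i i1) * mat (r Y) i1 j
        c = frob (k Y) (mat (r X) i i2) * mat (r Y) i2 j
        ring₃ : ∀ a b c e → a * 0# + b + c + 0# * e ≡ b + c
        ring₃ a b c e = (solve 4 (λ a b c d → a :* `0 :+ b :+ c :+ `0 :* d := b :+ c) refl a b c e)

    opaque
      act-· : ∀ X Y v → act Y (act X v) ≡ act (X · Y) v
      act-· X Y (v₁ , v₂) = cong₂ _,_ (column i1 (Shape.a01≡0 (r-shape Y))) (column i2 (Shape.a02≡0 (r-shape Y)))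
        where
        A B : Mat4
        A = mat (r X)
        B = mat (r Y)
        column : ∀ j → B i0 j ≡ 0# →
          frob (k Y) (frob (k X) v₁ * A i1 i1 + frob (k X) v₂ * A i2 i1) * B i1 j + frob (k Y) (frob (k X) v₁ * A i1 i2 + frob (k X) v₂ * A i2 i2) * B i2 j
          ≡ frob (k (X · Y)) v₁ * mat (r (X · Y)) i1 j + frob (k (X · Y)) v₂ * mat (r (X · Y)) i2 j
        column j ej = begin
          frob (k Y) (frob (k X) v₁ * A i1 i1 + frob (k X) v₂ * A i2 i1) * B i1 j + frob (k Y) (frob (k X) v₁ * A i1 i2 + frob (k X) v₂ * A i2 i2) * B i2 j
            ≡⟨ cong₂ (λ q s → q * B i1 j + s * B i2 j) (expand (A i1 i1) (A i2 i1)) (expand (A i1 i2) (A i2 i2)) ⟩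
          (w₁ * φ (A i1 i1) + w₂ * φ (A i2 i1)) * B i1 j + (w₁ * φ (A i1 i2) + w₂ * φ (A i2 i2)) * B i2 j
            ≡⟨ ring₄ w₁ w₂ (φ (A i1 i1)) (φ (A i2 i1)) (φ (A i1 i2)) (φ (A i2 i2)) (B i1 j) (B i2 j) ⟩
          w₁ * (φ (A i1 i1) * B i1 j + φ (A i1 i2) * B i2 j) + w₂ * (φ (A i2 i1) * B i1 j + φ (A i2 i2) * B i2 j)
            ≡⟨ cong₂ (λ q s → w₁ * q + w₂ * s) (sym (block-· X Y i1 j (Shape.a13≡0 (r-shape X)) ej)) (sym (block-· X Y i2 j (Shape.a23≡0 (r-shape X)) ej)) ⟩
          w₁ * mat (r (X · Y)) i1 j + w₂ * mat (r (X · Y)) i2 j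
            ≡⟨ cong₂ (λ q s → q * mat (r (X · Y)) i1 j + s * mat (r (X · Y)) i2 j) (weight v₁) (weight v₂) ⟩
          frob (k (X · Y)) v₁ * mat (r (X · Y)) i1 j + frob (k (X · Y)) v₂ * mat (r (X · Y)) i2 j ∎
          where
          open ≡-Reasoning
          φ : Carrier → Carrier
          φ = frob (k Y)
          w₁ w₂ : Carrier
          w₁ = φ (frob (k X) v₁)
          w₂ = φ (frob (k X) v₂)
          expand : ∀ a b → φ (frob (k X) v₁ * a + frob (k X) v₂ * b) ≡ w₁ * φ a + w₂ * φ b
          expand a b = trans (frob-+ (k Y) _ _) (cong₂ _+_ (frob-* (k Y) _ a) (frob-* (k Y) _ b))
          weight : ∀ v → φ (frob (k X) v) ≡ frob (k (X · Y)) v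
          weight v = trans (frob-comm (k Y) (k X) v) (trans (sym (frob-comp (k X) (k Y) v)) (sym (k-· X Y v)))
          ring₄ : ∀ w v a b c d x y → (w * a + v * b) * x + (w * c + v * d) * y ≡ w * (a * x + c * y) + v * (b * x + d * y)
          ring₄ w v a b c d x y = (solve 8 (λ a b c d e f g h → (a :* b :+ c :* d) :* e :+ (a :* f :+ c :* g) :* h := a :* (b :* e :+ f :* h) :+ c :* (d :* e :+ g :* h)) refl w a v b x c d y)

    opaque
      act-identity : ∀ Y → r Y ≐ idˢ → ∀ v → act Y v ≡ v
      act-identity Y (e , h) (v₁ , v₂) = cong₂ _,_
        (trans (cong₂ _+_ (cong₂ _*_ (e v₁) (h i1 i1)) (cong₂ _*_ (e v₂) (h i2 i1))) (solve 2 (λ a b → a :* `1 :+ b :* `0 := a) refl v₁ v₂))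
        (trans (cong₂ _+_ (cong₂ _*_ (e v₁) (h i1 i2)) (cong₂ _*_ (e v₂) (h i2 i2))) (solve 2 (λ a b → a :* `0 :+ b :* `1 := b) refl v₁ v₂))

    opaque
      act-inv : ∀ X v → act (inv X) (act X v) ≡ v
      act-inv X v = trans (act-· X (inv X) v) (act-identity (X · inv X) (≃⇒≐ {r (X · inv X)} {idˢ} (≃-trans (≃-sym (·-r X (inv X))) (inv-r X)) (r-33 (X · inv X)) refl) v)

    opaque
      points-length : length (Finite.list finitePoint) ≡ p ^ (m +ℕ (m +ℕ m))
      points-length = trans (finite-×-length finiteF (finite-× finiteF finiteF)) (trans (cong₂ _*ℕ_ card≡ (trans (finite-×-length finiteF finiteF) (trans (cong₂ _*ℕ_ card≡ card≡) (sym (ℕₚ.^-distribˡ-+-* p m m)))))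
        (sym (ℕₚ.^-distribˡ-+-* p m (m +ℕ m))))

    opaque
      -- Without a nonzero fixed vector p would divide the number q² - 1 of nonzero vectors, hence
      -- also 1.
      fixed-pair : ∃ λ v → v ≢ (0# , 0#) × (∀ Y → act Y v ≡ v)
      fixed-pair with finite-∀⊎∃ finitePair {P = λ v → v ≡ (0# , 0#) ⊎ ∃ λ Y → act Y v ≢ v} {Q = λ v → v ≢ (0# , 0#) × (∀ Y → act Y v ≡ v)} decide
        where
        finitePair : Finite (Carrier × Carrier)
        finitePair = finite-× finiteF finiteF
        _≟ₚ_ : DecidableEquality (Carrier × Carrier)
        _≟ₚ_ = finite-≟ finitePair
        decide : ∀ v → (v ≡ (0# , 0#) ⊎ ∃ λ Y → act Y v ≢ v) ⊎ (v ≢ (0# , 0#) × (∀ Y → act Y v ≡ v))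
        decide v with v ≟ₚ (0# , 0#)
        ... | yes z = inj₁ (inj₁ z)
        ... | no nz with finite-∀⊎∃ finitePoint {P = λ Y → act Y v ≡ v} {Q = λ Y → act Y v ≢ v} (λ Y → case Y (act Y v ≟ₚ v))
          where
          case : ∀ Y → Dec (act Y v ≡ v) → act Y v ≡ v ⊎ act Y v ≢ v
          case Y (yes e) = inj₁ e
          case Y (no ne) = inj₂ ne
        ...   | inj₁ fix = inj₂ (nz , fix)
        ...   | inj₂ mv  = inj₁ (inj₂ mv)
      ... | inj₂ r = r
      ... | inj₁ moving = ⊥-elim (¬prime[1] (subst Prime (∣1⇒≡1 p∣1) pr))
        where
        finitePair : Finite (Carrier × Carrier)
        finitePair = finite-× finiteF finiteF
        _≟ₚ_ : DecidableEquality (Carrier × Carrier)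
        _≟ₚ_ = finite-≟ finitePair
        pairs L : List (Carrier × Carrier)
        pairs = Finite.list finitePair
        nonzero? : ∀ v → Dec (v ≢ (0# , 0#))
        nonzero? v = ¬? (v ≟ₚ (0# , 0#))
        L = filter nonzero? pairs
        act-0 : ∀ Y → act Y (0# , 0#) ≡ (0# , 0#)
        act-0 Y = cong₂ _,_ (trans (cong (λ q → q * mat (r Y) i1 i1 + q * mat (r Y) i2 i1) (frob-0 (k Y))) (solve 2 (λ a b → `0 :* a :+ `0 :* b := `0) refl (mat (r Y) i1 i1) (mat (r Y) i2 i1)))
                            (trans (cong (λ q → q * mat (r Y) i1 i2 + q * mat (r Y) i2 i2) (frob-0 (k Y))) (solve 2 (λ a b → `0 :* a :+ `0 :* b := `0) refl (mat (r Y) i1 i2) (mat (r Y) i2 i2)))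
        stable : ∀ X {v} → v ∈ L → act X v ∈ L
        stable X {v} q = ∈-filter⁺ nonzero? (Finite.complete finitePair _) λ e → proj₂ (∈-filter⁻ nonzero? {xs = pairs} q)
          (trans (sym (act-inv X v)) (trans (cong (act (inv X)) e) (act-0 (inv X))))
        moves : ∀ {v} → v ∈ L → ∃ λ X → act X v ≢ v
        moves {v} q with moving v
        ... | inj₁ z  = ⊥-elim (proj₂ (∈-filter⁻ nonzero? {xs = pairs} q) z)
        ... | inj₂ mv = mv
        p∣L : p ∣ length L
        p∣L = Orbits.no-fixed-points finitePoint _≟ₚ_ _·_ inv act act-· act-inv ·-invʳ ·-invˡ (proj₁ unit-point) (act-identity _ (proj₂ unit-point)) pr (m +ℕ (m +ℕ m)) points-length
          (length L) L ℕₚ.≤-refl (Unique-filter⁺ nonzero? (Finite.unique finitePair)) stable moves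
        size : length L +ℕ 1 ≡ p ^ (m +ℕ m)
        size = trans (ℕₚ.+-comm (length L) 1) (trans (↭-length (unique-↭ {xs = (0# , 0#) ∷ L} {ys = pairs} (All.tabulate (λ q e → proj₂ (∈-filter⁻ nonzero? {xs = pairs} q) (sym e)) ∷ Unique-filter⁺ nonzero? (Finite.unique finitePair)) (Finite.unique finitePair)
            (λ {x} _ → Finite.complete finitePair x) (λ {x} q → member x q)))
            (trans (finite-×-length finiteF finiteF) (trans (cong₂ _*ℕ_ card≡ card≡) (sym (ℕₚ.^-distribˡ-+-* p m m)))))
          where
          member : ∀ x → x ∈ pairs → x ∈ ((0# , 0#) ∷ L)
          member x q with x ≟ₚ (0# , 0#)
          ... | yes z = here z
          ... | no nz = there (∈-filter⁺ nonzero? q nz)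
        p∣q² : p ∣ p ^ (m +ℕ m)
        p∣q² = subst (λ n → p ∣ p ^ n) (ℕₚ.suc-pred (m +ℕ m) {{Data.Nat.>-nonZero (ℕₚ.≤-trans m≥1 (ℕₚ.m≤m+n m m))}}) (m∣m*n (p ^ Data.Nat.pred (m +ℕ m)))
        p∣1 : p ∣ 1
        p∣1 = ∣m+n∣m⇒∣n (subst (p ∣_) (sym size) p∣q²) p∣L

      -- Averaging: the cocycle d is the coboundary of Δ = ∏ d(Y), because |G| = q³ is 1 modulo q - 1.
      coboundary : ∃ λ Δ → Δ ≢ 0# × (∀ Y → Δ ≡ frob (k Y) Δ * d Y)
      coboundary = Δ , nonzero pts , λ Y → begin
          Δ ≡⟨ Πᶠ.fold-bijection finitePoint d (_· Y) (_· inv Y) (λ X → ·-invˡ X Y) (λ X → ·-invʳ X Y) ⟨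
          Πᶠ.fold (λ X → d (X · Y)) pts ≡⟨ Πᶠ.fold-cong pts (λ {X} _ → d-· X Y) ⟩
          Πᶠ.fold (λ X → frob (k Y) (d X) * d Y) pts ≡⟨ Πᶠ.fold-∙ (λ X → frob (k Y) (d X)) (λ _ → d Y) pts ⟩
          Πᶠ.fold (λ X → frob (k Y) (d X)) pts * Πᶠ.fold (λ _ → d Y) pts ≡⟨ cong₂ _*_ (sym (frob-Π (k Y) pts)) (trans (const (d Y) pts) (trans (cong (pow (d Y)) points-length) (power (d Y)))) ⟩
          frob (k Y) Δ * d Y ∎
        where
        open ≡-Reasoning
        pts : List Point
        pts = Finite.list finitePoint
        Δ : Carrier
        Δ = Πᶠ.fold d pts
        nonzero : ∀ xs → Πᶠ.fold d xs ≢ 0#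
        nonzero []       = 1≢0
        nonzero (X ∷ xs) = *-nonzero (d≢0 X) (nonzero xs)
        frob-Π : ∀ e xs → frob e (Πᶠ.fold d xs) ≡ Πᶠ.fold (λ X → frob e (d X)) xs
        frob-Π e []       = frob-1 e
        frob-Π e (X ∷ xs) = trans (frob-* e (d X) _) (cong (frob e (d X) *_) (frob-Π e xs))
        const : ∀ c (xs : List Point) → Πᶠ.fold (λ _ → c) xs ≡ pow c (length xs)
        const c []       = refl
        const c (X ∷ xs) = cong (c *_) (const c xs)
        power : ∀ c → pow c (p ^ (m +ℕ (m +ℕ m))) ≡ c
        power c = trans (sym (frob-pow (m +ℕ (m +ℕ m)) c)) (trans (frob-comp m (m +ℕ m) c) (trans (frob-m _) (trans (frob-comp m m c) (trans (frob-m _) (frob-m c)))))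

    opaque
      -- Adding up the exponents over the whole group and translating by Y leaves the total
      -- unchanged as a field automorphism; what is left over is the order of the group times `k Y`.
      k-torsion : ∀ Y → p ^ (m +ℕ (m +ℕ m)) *ℕ k Y ≋ 0
      k-torsion Y x = frob-injective T (begin
          frob T (frob (p ^ (m +ℕ (m +ℕ m)) *ℕ k Y) x) ≡⟨ frob-comp T _ x ⟨
          frob (T +ℕ p ^ (m +ℕ (m +ℕ m)) *ℕ k Y) x ≡⟨ cong (λ n → frob (T +ℕ n) x) (trans (cong (_*ℕ k Y) (sym points-length)) (sym (sum-const (k Y) pts))) ⟩
          frob (T +ℕ Sum.fold (λ _ → k Y) pts) x ≡⟨ cong (λ n → frob n x) (Sum.fold-∙ k (λ _ → k Y) pts) ⟨
          frob (Sum.fold (λ X → k X +ℕ k Y) pts) x ≡⟨ frob-Σ (λ X z → sym (k-· X Y z)) pts x ⟩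
          frob (Sum.fold (λ X → k (X · Y)) pts) x ≡⟨ cong (λ n → frob n x) (Sum.fold-bijection finitePoint k (_· Y) (_· inv Y) (λ X → ·-invˡ X Y) (λ X → ·-invʳ X Y)) ⟩
          frob T x ∎)
        where
        open ≡-Reasoning
        pts : List Point
        pts = Finite.list finitePoint
        T : ℕ
        T = Sum.fold k pts
        frob-Σ : ∀ {f g : Point → ℕ} → (∀ X → f X ≋ g X) → ∀ xs → Sum.fold f xs ≋ Sum.fold g xs
        frob-Σ h []       x = refl
        frob-Σ {f} {g} h (X ∷ xs) x = trans (frob-comp (f X) _ x) (trans (h X _) (trans (cong (frob (g X)) (frob-Σ h xs x)) (sym (frob-comp (g X) _ x))))

  -- Triangular form

  -- The rows of `H⁻¹` are the new basis: Δ times the vector of P, the fixed vector v, Δ times a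
  -- complement u with det (v , u) = 1, and the origin. `H` is its inverse, with δ inverse to the
  -- parameter ε = Δ there.
  H : (v₁ v₂ u₁ u₂ δ : Carrier) → Mat4
  H v₁ v₂ u₁ u₂ δ = rows (vec4 δ 0# 0# 0#) (vec4 0# u₂ (- (δ * v₂)) 0#) (vec4 0# (- u₁) (δ * v₁) 0#) (vec4 0# 0# 0# 1#)

  H⁻¹ : (v₁ v₂ u₁ u₂ ε : Carrier) → Mat4
  H⁻¹ v₁ v₂ u₁ u₂ ε = rows (vec4 ε 0# 0# 0#) (vec4 0# v₁ v₂ 0#) (vec4 0# (u₁ * ε) (u₂ * ε) 0#) (vec4 0# 0# 0# 1#)

  complement : ∀ v₁ v₂ → (v₁ , v₂) ≢ (0# , 0#) → ∃ λ u₁ → ∃ λ u₂ → v₁ * u₂ - v₂ * u₁ ≡ 1#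
  complement v₁ v₂ ne with v₁ ≟ 0#
  ... | no n₁ = 0# , v₁ ⁻¹ , trans (solve 3 (λ a b c → a :* b :- c :* `0 := a :* b) refl v₁ (v₁ ⁻¹) v₂) (inverseʳ v₁ n₁)
  ... | yes refl = - (v₂ ⁻¹) , 0# , trans (solve 2 (λ a b → `0 :* `0 :- a :* :- b := a :* b) refl v₂ (v₂ ⁻¹)) (inverseʳ v₂ (λ { refl → ne refl }))

  opaque
    combine₄ : ∀ {a b x y x' y' z w z' w'} k k' j j' → x ≡ y → x' ≡ y' → z ≡ w → z' ≡ w' →
      a + k * y + k' * y' + j * w + j' * w' ≡ b + k * x + k' * x' + j * z + j' * z' → a ≡ b
    combine₄ k k' j j' e e' f f' h = combine₂ k k' e e' (combine₂ j j' f f' h)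

  opaque
    combine₅ : ∀ {a b x y x' y' z w z' w' s t} k k' j j' i → x ≡ y → x' ≡ y' → z ≡ w → z' ≡ w' → s ≡ t →
      a + k * y + k' * y' + j * w + j' * w' + i * t ≡ b + k * x + k' * x' + j * z + j' * z' + i * s → a ≡ b
    combine₅ k k' j j' i e e' f f' g h = combine₂ k k' e e' (combine₃ j j' i f f' g h)

  module Inverse (v₁ v₂ u₁ u₂ δ ε : Carrier) (W : v₁ * u₂ - v₂ * u₁ ≡ 1#) (DE : δ * ε ≡ 1#) where
    opaque
      H-H⁻¹ : ∀ i j → matMul (H v₁ v₂ u₁ u₂ δ) (H⁻¹ v₁ v₂ u₁ u₂ ε) i j ≡ idMat i j
      H-H⁻¹ = cases4
        (cases4 (combine₁ (1#) DE (solve 2 (λ a b → a :* b :+ `0 :* `0 :+ `0 :* `0 :+ `0 :* `0 :+ `1 :* `1 := `1 :+ `1 :* (a :* b)) refl δ ε))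
          (solve 4 (λ a b c d → a :* `0 :+ `0 :* b :+ `0 :* (c :* d) :+ `0 :* `0 := `0) refl δ v₁ u₁ ε)
          (solve 4 (λ a b c d → a :* `0 :+ `0 :* b :+ `0 :* (c :* d) :+ `0 :* `0 := `0) refl δ v₂ u₂ ε)
          (solve 1 (λ a → a :* `0 :+ `0 :* `0 :+ `0 :* `0 :+ `0 :* `1 := `0) refl δ))
        (cases4 (solve 4 (λ a b c d → `0 :* a :+ b :* `0 :+ :- (c :* d) :* `0 :+ `0 :* `0 := `0) refl ε u₂ δ v₂)
          (combine₂ (1#) (- (v₂ * u₁)) W DE (solve 6 (λ a b c d e f → `0 :* `0 :+ a :* b :+ :- (c :* d) :* (e :* f) :+ `0 :* `0 :+ `1 :* `1 :+ :- (d :* e) :* `1 := `1 :+ `1 :* (b :* a :- d :* e) :+ :- (d :* e) :* (c :* f)) refl u₂ v₁ δ v₂ u₁ ε))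
          (combine₁ (- (v₂ * u₂)) DE (solve 4 (λ a b c d → `0 :* `0 :+ a :* b :+ :- (c :* b) :* (a :* d) :+ `0 :* `0 :+ :- (b :* a) :* `1 := `0 :+ :- (b :* a) :* (c :* d)) refl u₂ v₂ δ ε))
          (solve 3 (λ a b c → `0 :* `0 :+ a :* `0 :+ :- (b :* c) :* `0 :+ `0 :* `1 := `0) refl u₂ δ v₂))
        (cases4 (solve 4 (λ a b c d → `0 :* a :+ :- b :* `0 :+ c :* d :* `0 :+ `0 :* `0 := `0) refl ε u₁ δ v₁)
          (combine₁ (v₁ * u₁) DE (solve 4 (λ a b c d → `0 :* `0 :+ :- a :* b :+ c :* b :* (a :* d) :+ `0 :* `0 :+ b :* a :* `1 := `0 :+ b :* a :* (c :* d)) refl u₁ v₁ δ ε))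
          (combine₂ (1#) (v₁ * u₂) W DE (solve 6 (λ a b c d e f → `0 :* `0 :+ :- a :* b :+ c :* d :* (e :* f) :+ `0 :* `0 :+ `1 :* `1 :+ d :* e :* `1 := `1 :+ `1 :* (d :* e :- b :* a) :+ d :* e :* (c :* f)) refl u₁ v₂ δ v₁ u₂ ε))
          (solve 3 (λ a b c → `0 :* `0 :+ :- a :* `0 :+ b :* c :* `0 :+ `0 :* `1 := `0) refl u₁ δ v₁))
        (cases4 (solve 1 (λ a → `0 :* a :+ `0 :* `0 :+ `0 :* `0 :+ `1 :* `0 := `0) refl ε)
          (solve 3 (λ a b c → `0 :* `0 :+ `0 :* a :+ `0 :* (b :* c) :+ `1 :* `0 := `0) refl v₁ u₁ ε)
          (solve 3 (λ a b c → `0 :* `0 :+ `0 :* a :+ `0 :* (b :* c) :+ `1 :* `0 := `0) refl v₂ u₂ ε)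
          (solve 0 (`0 :* `0 :+ `0 :* `0 :+ `0 :* `0 :+ `1 :* `1 := `1) refl))
      H⁻¹-H : ∀ i j → matMul (H⁻¹ v₁ v₂ u₁ u₂ ε) (H v₁ v₂ u₁ u₂ δ) i j ≡ idMat i j
      H⁻¹-H = cases4
        (cases4 (combine₁ (1#) DE (solve 2 (λ a b → a :* b :+ `0 :* `0 :+ `0 :* `0 :+ `0 :* `0 :+ `1 :* `1 := `1 :+ `1 :* (b :* a)) refl ε δ))
          (solve 3 (λ a b c → a :* `0 :+ `0 :* b :+ `0 :* :- c :+ `0 :* `0 := `0) refl ε u₂ u₁)
          (solve 4 (λ a b c d → a :* `0 :+ `0 :* :- (b :* c) :+ `0 :* (b :* d) :+ `0 :* `0 := `0) refl ε δ v₂ v₁)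
          (solve 1 (λ a → a :* `0 :+ `0 :* `0 :+ `0 :* `0 :+ `0 :* `1 := `0) refl ε))
        (cases4 (solve 3 (λ a b c → `0 :* a :+ b :* `0 :+ c :* `0 :+ `0 :* `0 := `0) refl δ v₁ v₂)
          (combine₁ (1#) W (solve 4 (λ a b c d → `0 :* `0 :+ a :* b :+ c :* :- d :+ `0 :* `0 :+ `1 :* `1 := `1 :+ `1 :* (a :* b :- c :* d)) refl v₁ u₂ v₂ u₁))
          (solve 3 (λ a b c → `0 :* `0 :+ a :* :- (b :* c) :+ c :* (b :* a) :+ `0 :* `0 := `0) refl v₁ δ v₂)
          (solve 2 (λ a b → `0 :* `0 :+ a :* `0 :+ b :* `0 :+ `0 :* `1 := `0) refl v₁ v₂))
        (cases4 (solve 4 (λ a b c d → `0 :* a :+ b :* c :* `0 :+ d :* c :* `0 :+ `0 :* `0 := `0) refl δ u₁ ε u₂)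
          (solve 3 (λ a b c → `0 :* `0 :+ a :* b :* c :+ c :* b :* :- a :+ `0 :* `0 := `0) refl u₁ ε u₂)
          (combine₂ (1#) (v₁ * u₂ - v₂ * u₁) W DE (solve 6 (λ a b c d e f → `0 :* `0 :+ a :* b :* :- (c :* d) :+ e :* b :* (c :* f) :+ `0 :* `0 :+ `1 :* `1 :+ (f :* e :- d :* a) :* `1 := `1 :+ `1 :* (f :* e :- d :* a) :+ (f :* e :- d :* a) :* (c :* b)) refl u₁ ε δ v₂ u₂ v₁))
          (solve 3 (λ a b c → `0 :* `0 :+ a :* b :* `0 :+ c :* b :* `0 :+ `0 :* `1 := `0) refl u₁ ε u₂))
        (cases4 (solve 1 (λ a → `0 :* a :+ `0 :* `0 :+ `0 :* `0 :+ `1 :* `0 := `0) refl δ)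
          (solve 2 (λ a b → `0 :* `0 :+ `0 :* a :+ `0 :* :- b :+ `1 :* `0 := `0) refl u₂ u₁)
          (solve 3 (λ a b c → `0 :* `0 :+ `0 :* :- (a :* b) :+ `0 :* (a :* c) :+ `1 :* `0 := `0) refl δ v₂ v₁)
          (solve 0 (`0 :* `0 :+ `0 :* `0 :+ `0 :* `0 :+ `1 :* `1 := `1) refl))

    δ≢0 : δ ≢ 0#
    δ≢0 e = 1≢0 (trans (sym DE) (trans (cong (_* ε) e) (zeroˡ ε)))

    opaque
      H-form : ∀ x y → form (vecMat x (H v₁ v₂ u₁ u₂ δ)) (vecMat y (H v₁ v₂ u₁ u₂ δ)) ≡ δ * form x y
      H-form x y = trans (form-cong {vecMat x (H v₁ v₂ u₁ u₂ δ)} {im x} {vecMat y (H v₁ v₂ u₁ u₂ δ)} {im y} (im-eq x) (im-eq y))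
        (combine₁ (δ * (x i1 * y i2 - x i2 * y i1)) W (form-ring (x i0) (x i1) (x i2) (x i3) (y i0) (y i1) (y i2) (y i3)))
        where
        im : Vec4 → Vec4
        im x = vec4 (δ * x i0) (x i1 * u₂ - x i2 * u₁) (δ * (x i2 * v₁ - x i1 * v₂)) (x i3)
        im-eq : ∀ x j → vecMat x (H v₁ v₂ u₁ u₂ δ) j ≡ im x j
        im-eq x = cases4 (solve 5 (λ a b c d e → a :* b :+ c :* `0 :+ d :* `0 :+ e :* `0 := b :* a) refl (x i0) δ (x i1) (x i2) (x i3)) (solve 6 (λ a b c d e f → a :* `0 :+ b :* c :+ d :* :- e :+ f :* `0 := b :* c :- d :* e) refl (x i0) (x i1) u₂ (x i2) u₁ (x i3))
          (solve 7 (λ a b c d e f g → a :* `0 :+ b :* :- (c :* d) :+ e :* (c :* f) :+ g :* `0 := c :* (e :* f :- b :* d)) refl (x i0) (x i1) δ v₂ (x i2) v₁ (x i3)) (solve 4 (λ a b c d → a :* `0 :+ b :* `0 :+ c :* `0 :+ d :* `1 := d) refl (x i0) (x i1) (x i2) (x i3))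
        form-ring : ∀ x0 x1 x2 x3 y0 y1 y2 y3 → δ * x0 * y3 - x3 * (δ * y0) + (x1 * u₂ - x2 * u₁) * (δ * (y2 * v₁ - y1 * v₂)) - δ * (x2 * v₁ - x1 * v₂) * (y1 * u₂ - y2 * u₁) + δ * (x1 * y2 - x2 * y1) * 1# ≡ δ * (x0 * y3 - x3 * y0 + x1 * y2 - x2 * y1) + δ * (x1 * y2 - x2 * y1) * (v₁ * u₂ - v₂ * u₁)
        form-ring x0 x1 x2 x3 y0 y1 y2 y3 = (solve 13 (λ a b c d e f g h i j k l m → a :* b :* c :- d :* (a :* e) :+ (f :* g :- h :* i) :* (a :* (j :* k :- l :* m)) :- a :* (h :* k :- f :* m) :* (l :* g :- j :* i) :+ a :* (f :* j :- h :* l) :* `1 := a :* (b :* c :- d :* e :+ f :* j :- h :* l) :+ a :* (f :* j :- h :* l) :* (k :* g :- m :* i)) refl δ x0 y3 x3 y0 x1 u₂ x2 u₁ y2 v₁ y1 v₂)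

    opaque
      H-InP : InPΓSpP (mkS (H v₁ v₂ u₁ u₂ δ) 0)
      H-InP = (H⁻¹ v₁ v₂ u₁ u₂ ε , H-H⁻¹ , H⁻¹-H) , (δ , δ≢0 , H-form) , refl , refl , refl

  -- A · H = σ(H) · E as an identity in independent variables, the letters sv₁, sδ, ... standing for
  -- σ-images. V1 and V2 say that v is fixed, DD is the coboundary equation, DT the determinant of
  -- the middle block, O1 and O2 orthogonality of rows; EE makes ε inverse to sδ.
  module Identity (d a10 B11 B12 a20 B21 B22 a b c v₁ v₂ u₁ u₂ δ sv₁ sv₂ su₁ su₂ sδ ε : Carrier)
    (V1 : sv₁ * B11 + sv₂ * B21 ≡ v₁) (V2 : sv₁ * B12 + sv₂ * B22 ≡ v₂)
    (W : v₁ * u₂ - v₂ * u₁ ≡ 1#) (SW : sv₁ * su₂ - sv₂ * su₁ ≡ 1#) (DT : B11 * B22 - B12 * B21 ≡ d)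
    (DD : d * δ ≡ sδ) (EE : sδ * ε ≡ 1#) (O1 : a10 * 1# + B11 * c - B12 * b ≡ 0#) (O2 : a20 * 1# + B21 * c - B22 * b ≡ 0#) where

    T t' a' b' c' : Carrier
    T = (su₁ * B11 + su₂ * B21) * u₂ - (su₁ * B12 + su₂ * B22) * u₁
    t' = ε * T
    a' = a * δ
    b' = b * u₂ - c * u₁
    c' = δ * (c * v₁ - b * v₂)

    opaque
      -- `Cij` compares the entries (i , j) of the two products in `identity`. The multipliers given
      -- to `combine₄` and `combine₅` express the difference of the two sides through the
      -- hypotheses.
      C12 : δ * (B12 * v₁ - B11 * v₂) ≡ - (sδ * sv₂)
      C12 = combine₄ (- (δ * B12)) (δ * B11) (- (δ * sv₂)) (- sv₂) V1 V2 DT DD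
        (solve 11 (λ a b c d e f g h i j k → a :* (b :* c :- d :* e) :+ :- (a :* b) :* c :+ a :* d :* e :+ :- (a :* f) :* g :+ :- f :* h := :- (h :* f) :+ :- (a :* b) :* (i :* d :+ f :* j) :+ a :* d :* (i :* b :+ f :* k) :+ :- (a :* f) :* (d :* k :- b :* j) :+ :- f :* (g :* a)) refl δ B12 v₁ B11 v₂ sv₂ d sδ sv₁ B21 B22)

    opaque
      C22 : δ * (B22 * v₁ - B21 * v₂) ≡ sδ * sv₁
      C22 = combine₄ (- (δ * B22)) (δ * B21) (δ * sv₁) (sv₁) V1 V2 DT DD
        (solve 11 (λ a b c d e f g h i j k → a :* (b :* c :- d :* e) :+ :- (a :* b) :* c :+ a :* d :* e :+ a :* f :* g :+ f :* h := h :* f :+ :- (a :* b) :* (f :* i :+ j :* d) :+ a :* d :* (f :* k :+ j :* b) :+ a :* f :* (i :* b :- k :* d) :+ f :* (g :* a)) refl δ B22 v₁ B21 v₂ sv₁ d sδ B11 sv₂ B12)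

    opaque
      C11 : (B11 * u₂ - B12 * u₁) ≡ su₂ - sδ * sv₂ * (ε * ((su₁ * B11 + su₂ * B21) * u₂ - (su₁ * B12 + su₂ * B22) * u₁))
      C11 = combine₅ (sv₂ * ((su₁ * B11 + su₂ * B21) * u₂ - (su₁ * B12 + su₂ * B22) * u₁)) (- (B11 * u₂ - B12 * u₁)) (su₂ * u₂) (- (su₂ * u₁)) (su₂) EE SW V1 V2 W
        (solve 14 (λ a b c d e f g h i j k l m n → a :* b :- c :* d :+ e :* ((f :* a :+ g :* h) :* b :- (f :* c :+ g :* i) :* d) :* `1 :+ :- (a :* b :- c :* d) :* `1 :+ g :* b :* j :+ :- (g :* d) :* k :+ g :* `1 := g :- l :* e :* (m :* ((f :* a :+ g :* h) :* b :- (f :* c :+ g :* i) :* d)) :+ e :* ((f :* a :+ g :* h) :* b :- (f :* c :+ g :* i) :* d) :* (l :* m) :+ :- (a :* b :- c :* d) :* (n :* g :- e :* f) :+ g :* b :* (n :* a :+ e :* h) :+ :- (g :* d) :* (n :* c :+ e :* i) :+ g :* (j :* b :- k :* d)) refl B11 u₂ B12 u₁ sv₂ su₁ su₂ B21 B22 v₁ v₂ sδ ε sv₁)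

    opaque
      C21 : (B21 * u₂ - B22 * u₁) ≡ - su₁ + sδ * sv₁ * (ε * ((su₁ * B11 + su₂ * B21) * u₂ - (su₁ * B12 + su₂ * B22) * u₁))
      C21 = combine₅ (- (sv₁ * ((su₁ * B11 + su₂ * B21) * u₂ - (su₁ * B12 + su₂ * B22) * u₁))) (- (B21 * u₂ - B22 * u₁)) (- (su₁ * u₂)) (su₁ * u₁) (- su₁) EE SW V1 V2 W
        (solve 14 (λ a b c d e f g h i j k l m n → a :* b :- c :* d :+ :- (e :* ((f :* g :+ h :* a) :* b :- (f :* i :+ h :* c) :* d)) :* `1 :+ :- (a :* b :- c :* d) :* `1 :+ :- (f :* b) :* j :+ f :* d :* k :+ :- f :* `1 := :- f :+ l :* e :* (m :* ((f :* g :+ h :* a) :* b :- (f :* i :+ h :* c) :* d)) :+ :- (e :* ((f :* g :+ h :* a) :* b :- (f :* i :+ h :* c) :* d)) :* (l :* m) :+ :- (a :* b :- c :* d) :* (e :* h :- n :* f) :+ :- (f :* b) :* (e :* g :+ n :* a) :+ f :* d :* (e :* i :+ n :* c) :+ :- f :* (j :* b :- k :* d)) refl B21 u₂ B22 u₁ sv₁ su₁ B11 su₂ B12 v₁ v₂ sδ ε sv₂)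

    opaque
      C10 : a10 * δ ≡ su₂ * (- (δ * (c * v₁ - b * v₂))) + (- (sδ * sv₂)) * ((b * u₂ - c * u₁) - (δ * (c * v₁ - b * v₂)) * t')
      C10 = combine₄ (- (δ * (c * v₁ - b * v₂))) ((b * u₂ - c * u₁)) (δ) (δ * (c * B11 - b * B12)) C11 C12 O1 W
        (solve 14 (λ a b c d e f g h i j k l m n → a :* b :+ :- (b :* (c :* d :- e :* f)) :* (g :- h :* i :* j) :+ (e :* k :- c :* l) :* :- (h :* i) :+ b :* `0 :+ b :* (c :* m :- e :* n) :* `1 := g :* :- (b :* (c :* d :- e :* f)) :+ :- (h :* i) :* (e :* k :- c :* l :- b :* (c :* d :- e :* f) :* j) :+ :- (b :* (c :* d :- e :* f)) :* (m :* k :- n :* l) :+ (e :* k :- c :* l) :* (b :* (n :* d :- m :* f)) :+ b :* (a :* `1 :+ m :* c :- n :* e) :+ b :* (c :* m :- e :* n) :* (d :* k :- f :* l)) refl a10 δ c v₁ b v₂ su₂ sδ sv₂ t' u₂ u₁ B11 B12)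

    opaque
      C20 : a20 * δ ≡ (- su₁) * (- (δ * (c * v₁ - b * v₂))) + sδ * sv₁ * ((b * u₂ - c * u₁) - (δ * (c * v₁ - b * v₂)) * t')
      C20 = combine₄ (- (δ * (c * v₁ - b * v₂))) ((b * u₂ - c * u₁)) (δ) (δ * (c * B21 - b * B22)) C21 C22 O2 W
        (solve 14 (λ a b c d e f g h i j k l m n → a :* b :+ :- (b :* (c :* d :- e :* f)) :* (:- g :+ h :* i :* j) :+ (e :* k :- c :* l) :* (h :* i) :+ b :* `0 :+ b :* (c :* m :- e :* n) :* `1 := :- g :* :- (b :* (c :* d :- e :* f)) :+ h :* i :* (e :* k :- c :* l :- b :* (c :* d :- e :* f) :* j) :+ :- (b :* (c :* d :- e :* f)) :* (m :* k :- n :* l) :+ (e :* k :- c :* l) :* (b :* (n :* d :- m :* f)) :+ b :* (a :* `1 :+ m :* c :- n :* e) :+ b :* (c :* m :- e :* n) :* (d :* k :- f :* l)) refl a20 δ c v₁ b v₂ su₁ sδ sv₁ t' u₂ u₁ B21 B22)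

    opaque
      identity : ∀ i j → matMul (rows (vec4 d 0# 0# 0#) (vec4 a10 B11 B12 0#) (vec4 a20 B21 B22 0#) (vec4 a b c 1#)) (H v₁ v₂ u₁ u₂ δ) i j
        ≡ matMul (rows (vec4 sδ 0# 0# 0#) (vec4 0# su₂ (- (sδ * sv₂)) 0#) (vec4 0# (- su₁) (sδ * sv₁) 0#) (vec4 0# 0# 0# 1#)) (E a' b' c' t') i j
      identity = cases4
        (cases4 (combine₁ (1#) DD (solve 11 (λ a b c d e f g h i j k → a :* b :+ `0 :* `0 :+ `0 :* `0 :+ `0 :* `0 :+ `1 :* c := c :* `1 :+ `0 :* :- (b :* (d :* e :- f :* g)) :+ `0 :* (f :* h :- d :* i :- b :* (d :* e :- f :* g) :* j) :+ `0 :* (k :* b) :+ `1 :* (a :* b)) refl d δ sδ c v₁ b v₂ u₂ u₁ t' a))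
          (solve 7 (λ a b c d e f g → a :* `0 :+ `0 :* b :+ `0 :* :- c :+ `0 :* `0 := d :* `0 :+ `0 :* `1 :+ `0 :* e :+ `0 :* (f :* b :- g :* c)) refl d u₂ u₁ sδ t' b c)
          (solve 7 (λ a b c d e f g → a :* `0 :+ `0 :* :- (b :* c) :+ `0 :* (b :* d) :+ `0 :* `0 := e :* `0 :+ `0 :* `0 :+ `0 :* `1 :+ `0 :* (b :* (f :* d :- g :* c))) refl d δ v₂ v₁ sδ c b)
          (solve 2 (λ a b → a :* `0 :+ `0 :* `0 :+ `0 :* `0 :+ `0 :* `1 := b :* `0 :+ `0 :* `0 :+ `0 :* `0 :+ `0 :* `1) refl d sδ))
        (cases4 (combine₁ (1#) C10 (solve 15 (λ a b c d e f g h i j k l m n o → a :* b :+ c :* `0 :+ d :* `0 :+ `0 :* `0 :+ `1 :* (e :* :- (b :* (f :* g :- h :* i)) :+ :- (j :* k) :* (h :* l :- f :* m :- b :* (f :* g :- h :* i) :* n)) := `0 :* `1 :+ e :* :- (b :* (f :* g :- h :* i)) :+ :- (j :* k) :* (h :* l :- f :* m :- b :* (f :* g :- h :* i) :* n) :+ `0 :* (o :* b) :+ `1 :* (a :* b)) refl a10 δ B11 B12 su₂ c v₁ b v₂ sδ sv₂ u₂ u₁ t' a))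
          (combine₁ (1#) C11 (solve 11 (λ a b c d e f g h i j k → a :* `0 :+ b :* c :+ d :* :- e :+ `0 :* `0 :+ `1 :* (f :- g :* h :* i) := `0 :* `0 :+ f :* `1 :+ :- (g :* h) :* i :+ `0 :* (j :* c :- k :* e) :+ `1 :* (b :* c :- d :* e)) refl a10 B11 u₂ B12 u₁ su₂ sδ sv₂ t' b c))
          (combine₁ (1#) C12 (solve 11 (λ a b c d e f g h i j k → a :* `0 :+ b :* :- (c :* d) :+ e :* (c :* f) :+ `0 :* `0 :+ `1 :* :- (g :* h) := `0 :* `0 :+ i :* `0 :+ :- (g :* h) :* `1 :+ `0 :* (c :* (j :* f :- k :* d)) :+ `1 :* (c :* (e :* f :- b :* d))) refl a10 B11 δ v₂ B12 v₁ sδ sv₂ su₂ c b))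
          (solve 6 (λ a b c d e f → a :* `0 :+ b :* `0 :+ c :* `0 :+ `0 :* `1 := `0 :* `0 :+ d :* `0 :+ :- (e :* f) :* `0 :+ `0 :* `1) refl a10 B11 B12 su₂ sδ sv₂))
        (cases4 (combine₁ (1#) C20 (solve 15 (λ a b c d e f g h i j k l m n o → a :* b :+ c :* `0 :+ d :* `0 :+ `0 :* `0 :+ `1 :* (:- e :* :- (b :* (f :* g :- h :* i)) :+ j :* k :* (h :* l :- f :* m :- b :* (f :* g :- h :* i) :* n)) := `0 :* `1 :+ :- e :* :- (b :* (f :* g :- h :* i)) :+ j :* k :* (h :* l :- f :* m :- b :* (f :* g :- h :* i) :* n) :+ `0 :* (o :* b) :+ `1 :* (a :* b)) refl a20 δ B21 B22 su₁ c v₁ b v₂ sδ sv₁ u₂ u₁ t' a))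
          (combine₁ (1#) C21 (solve 11 (λ a b c d e f g h i j k → a :* `0 :+ b :* c :+ d :* :- e :+ `0 :* `0 :+ `1 :* (:- f :+ g :* h :* i) := `0 :* `0 :+ :- f :* `1 :+ g :* h :* i :+ `0 :* (j :* c :- k :* e) :+ `1 :* (b :* c :- d :* e)) refl a20 B21 u₂ B22 u₁ su₁ sδ sv₁ t' b c))
          (combine₁ (1#) C22 (solve 11 (λ a b c d e f g h i j k → a :* `0 :+ b :* :- (c :* d) :+ e :* (c :* f) :+ `0 :* `0 :+ `1 :* (g :* h) := `0 :* `0 :+ :- i :* `0 :+ g :* h :* `1 :+ `0 :* (c :* (j :* f :- k :* d)) :+ `1 :* (c :* (e :* f :- b :* d))) refl a20 B21 δ v₂ B22 v₁ sδ sv₁ su₁ c b))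
          (solve 6 (λ a b c d e f → a :* `0 :+ b :* `0 :+ c :* `0 :+ `0 :* `1 := `0 :* `0 :+ :- d :* `0 :+ e :* f :* `0 :+ `0 :* `1) refl a20 B21 B22 su₁ sδ sv₁))
        (cases4 (solve 9 (λ a b c d e f g h i → a :* b :+ c :* `0 :+ d :* `0 :+ `1 :* `0 := `0 :* `1 :+ `0 :* :- (b :* (d :* e :- c :* f)) :+ `0 :* (c :* g :- d :* h :- b :* (d :* e :- c :* f) :* i) :+ `1 :* (a :* b)) refl a δ b c v₁ v₂ u₂ u₁ t')
          (solve 6 (λ a b c d e f → a :* `0 :+ b :* c :+ d :* :- e :+ `1 :* `0 := `0 :* `0 :+ `0 :* `1 :+ `0 :* f :+ `1 :* (b :* c :- d :* e)) refl a b u₂ c u₁ t')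
          (solve 6 (λ a b c d e f → a :* `0 :+ b :* :- (c :* d) :+ e :* (c :* f) :+ `1 :* `0 := `0 :* `0 :+ `0 :* `0 :+ `0 :* `1 :+ `1 :* (c :* (e :* f :- b :* d))) refl a b δ v₂ c v₁)
          (solve 3 (λ a b c → a :* `0 :+ b :* `0 :+ c :* `0 :+ `1 :* `1 := `0 :* `0 :+ `0 :* `0 :+ `0 :* `0 :+ `1 :* `1) refl a b c))

  -- Reduction to systems

  module Main (G : Semilinear → Set) (sub : IsSubgroupPΓSpP G) (reg : RegularOnPoints G) where
    open Regular G sub reg
    open IsSubgroupPΓSpP sub

    private
      v₁ v₂ u₁ u₂ Δ δ : Carrier
      v₁ = proj₁ (proj₁ fixed-pair)
      v₂ = proj₂ (proj₁ fixed-pair)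
      u₁ = proj₁ (complement v₁ v₂ (proj₁ (proj₂ fixed-pair)))
      u₂ = proj₁ (proj₂ (complement v₁ v₂ (proj₁ (proj₂ fixed-pair))))
      Δ = proj₁ coboundary
      δ = Δ ⁻¹

      W : v₁ * u₂ - v₂ * u₁ ≡ 1#
      W = proj₂ (proj₂ (complement v₁ v₂ (proj₁ (proj₂ fixed-pair))))

      Δ≢0 : Δ ≢ 0#
      Δ≢0 = proj₁ (proj₂ coboundary)

      h h⁻¹ : Semilinear
      h = mkS (H v₁ v₂ u₁ u₂ δ) 0
      h⁻¹ = mkS (H⁻¹ v₁ v₂ u₁ u₂ Δ) 0

    module HI = Inverse v₁ v₂ u₁ u₂ δ Δ W (inverseˡ Δ Δ≢0)

    ε : Carrier → Carrier → Carrier → Carrier → ℕ → Semilinear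
    ε a b c t k = mkS (E a b c t) k

    opaque
      h⁻¹-h : h⁻¹ ⨾ h ≃ idˢ
      h⁻¹-h = subst (_≃ idˢ) (sym (⨾-≡ h⁻¹ h)) (≐⇒≃ {h⁻¹ ∘ˢ h} {idˢ} ((λ _ → refl) , HI.H⁻¹-H))

    opaque
      cancelˡ : ∀ {s s⁻¹ e e'} → s⁻¹ ⨾ s ≃ idˢ → s ⨾ e ≃ s ⨾ e' → e ≃ e'
      cancelˡ {s} {s⁻¹} {e} {e'} i q = begin≃
          e ≃⟨ ≃-sym (strip e) ⟩
          s⁻¹ ⨾ (s ⨾ e) ≃⟨ ⨾-cong ≃-refl q ⟩
          s⁻¹ ⨾ (s ⨾ e') ≃⟨ strip e' ⟩
          e' ∎≃
        where
        open ≃-Reasoning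
        strip : ∀ e → s⁻¹ ⨾ (s ⨾ e) ≃ e
        strip e = ≃-trans (≃-sym (⨾-assoc s⁻¹ s e)) (≃-trans (⨾-cong i ≃-refl) (⨾-idˡ e))

    opaque
      cancelᵣ : ∀ {s s⁻¹ e e'} → s ⨾ s⁻¹ ≃ idˢ → e ⨾ s ≃ e' ⨾ s → e ≃ e'
      cancelᵣ {s} {s⁻¹} {e} {e'} i q = begin≃
          e ≃⟨ ≃-sym (strip e) ⟩
          (e ⨾ s) ⨾ s⁻¹ ≃⟨ ⨾-cong q ≃-refl ⟩
          (e' ⨾ s) ⨾ s⁻¹ ≃⟨ strip e' ⟩
          e' ∎≃
        where
        open ≃-Reasoning
        strip : ∀ e → (e ⨾ s) ⨾ s⁻¹ ≃ e
        strip e = ≃-trans (⨾-assoc e s s⁻¹) (≃-trans (⨾-cong ≃-refl i) (⨾-idʳ e))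

    opaque
      ε-components : ∀ {a b c t k a' b' c' t' k'} → ε a b c t k ≃ ε a' b' c' t' k' → (a ≡ a' × b ≡ b' × c ≡ c' × t ≡ t') × k ≋ k'
      ε-components ⟨ e , μ , _ , q ⟩ = E-scalar μ q , e

    opaque
      ε-≋ : ∀ {a b c t k k'} → k ≋ k' → ε a b c t k ≃ ε a b c t k'
      ε-≋ {a} {b} {c} {t} {k} {k'} e = ≐⇒≃ {ε a b c t k} {ε a b c t k'} (e , λ _ _ → refl)

    opaque
      closed⨾ : ∀ {g g'} → G g → G g' → G (g ⨾ g')
      closed⨾ {g} {g'} Gg Gg' = subst G (sym (⨾-≡ g g')) (closed g g' Gg Gg')

    opaque
      inverse⨾ : ∀ {g} → G g → ∃ λ g' → G g' × g ⨾ g' ≃ idˢ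
      inverse⨾ {g} Gg = let (g' , Gg' , e) = inverses g Gg in g' , Gg' , subst (_≃ idˢ) (sym (⨾-≡ g g')) ⟨ e ⟩

    El : Carrier → Carrier → Carrier → Carrier → ℕ → Set
    El a b c t k = Σ[ g ∈ Semilinear ] (G g × g ⨾ h ≃ h ⨾ ε a b c t k)

    coordA coordB coordC : Point → Carrier
    coordA (a , b , c) = a * δ
    coordB (a , b , c) = b * u₂ - c * u₁
    coordC (a , b , c) = δ * (c * v₁ - b * v₂)

    opaque
      DE : δ * Δ ≡ 1#
      DE = inverseˡ Δ Δ≢0

    opaque
      coord-injective : ∀ {X Y} → coordA X ≡ coordA Y → coordB X ≡ coordB Y → coordC X ≡ coordC Y → X ≡ Y
      coord-injective {a , b , c} {a' , b' , c'} ea eb ec = cong₂ _,_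
        (combine₂ (Δ) (- (a - a')) ea DE (solve 4 (λ a b c d → a :+ b :* (c :* d) :+ :- (a :- c) :* `1 := c :+ b :* (a :* d) :+ :- (a :- c) :* (d :* b)) refl a Δ a' δ))
        (cong₂ _,_ (combine₄ (v₁) (u₁ * Δ) (- (b - b')) (- (u₁ * ((c - c') * v₁ - (b - b') * v₂))) eb ec W DE (solve 10 (λ a b c d e f g h i j → a :+ b :* (c :* d :- e :* f) :+ f :* g :* (h :* (e :* b :- c :* i)) :+ :- (a :- c) :* `1 :+ :- (f :* ((j :- e) :* b :- (a :- c) :* i)) :* `1 := c :+ b :* (a :* d :- j :* f) :+ f :* g :* (h :* (j :* b :- a :* i)) :+ :- (a :- c) :* (b :* d :- i :* f) :+ :- (f :* ((j :- e) :* b :- (a :- c) :* i)) :* (h :* g)) refl b v₁ b' u₂ c' u₁ Δ δ v₂ c))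
                   (combine₄ (v₂) (u₂ * Δ) (- (c - c')) (- (u₂ * ((c - c') * v₁ - (b - b') * v₂))) eb ec W DE (solve 10 (λ a b c d e f g h i j → a :+ b :* (c :* d :- e :* f) :+ d :* g :* (h :* (e :* i :- c :* b)) :+ :- (a :- e) :* `1 :+ :- (d :* ((a :- e) :* i :- (j :- c) :* b)) :* `1 := e :+ b :* (j :* d :- a :* f) :+ d :* g :* (h :* (a :* i :- j :* b)) :+ :- (a :- e) :* (i :* d :- b :* f) :+ :- (d :* ((a :- e) :* i :- (j :- c) :* b)) :* (h :* g)) refl c v₂ b' u₂ c' u₁ Δ δ v₁ b)))

    opaque
      coord-surjective : ∀ a b c → ∃ λ Y → coordA Y ≡ a × coordB Y ≡ b × coordC Y ≡ c
      coord-surjective a b c = (a * Δ , v₁ * b + u₁ * (c * Δ) , v₂ * b + u₂ * (c * Δ))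
        , (combine₁ (a) DE (solve 3 (λ a b c → a :* b :* c :+ a :* `1 := a :+ a :* (c :* b)) refl a Δ δ))
        , (combine₁ (b) W (solve 7 (λ a b c d e f g → (a :* b :+ c :* (d :* e)) :* f :- (g :* b :+ f :* (d :* e)) :* c :+ b :* `1 := b :+ b :* (a :* f :- g :* c)) refl v₁ b u₁ c Δ u₂ v₂))
        , (combine₂ (c * δ * Δ) (c) W DE (solve 8 (λ a b c d e f g h → a :* ((b :* c :+ d :* (e :* f)) :* g :- (g :* c :+ h :* (e :* f)) :* b) :+ e :* a :* f :* `1 :+ e :* `1 := e :+ e :* a :* f :* (g :* d :- b :* h) :+ e :* (a :* f)) refl δ v₂ b u₂ c Δ v₁ u₁))

    module At (Y : Point) where
      private
        σ : Carrier → Carrier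
        σ = frob (k Y)
        A : Mat4
        A = mat (r Y)
        y₁ y₂ y₃ : Carrier
        y₁ = proj₁ Y
        y₂ = proj₁ (proj₂ Y)
        y₃ = proj₂ (proj₂ Y)
        open Shape (r-shape Y)

        opaque
          V1 : σ v₁ * A i1 i1 + σ v₂ * A i2 i1 ≡ v₁
          V1 = cong proj₁ (proj₂ (proj₂ fixed-pair) Y)

        opaque
          V2 : σ v₁ * A i1 i2 + σ v₂ * A i2 i2 ≡ v₂
          V2 = cong proj₂ (proj₂ (proj₂ fixed-pair) Y)

        opaque
          SW : σ v₁ * σ u₂ - σ v₂ * σ u₁ ≡ 1#
          SW = trans (sym (trans (frob-- (k Y) _ _) (cong₂ _-_ (frob-* (k Y) v₁ u₂) (frob-* (k Y) v₂ u₁)))) (trans (cong σ W) (frob-1 (k Y)))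

        opaque
          DT : A i1 i1 * A i2 i2 - A i1 i2 * A i2 i1 ≡ d Y
          DT = trans det (trans (sym diag) (trans (cong (d Y *_) (r-33 Y)) (*-identityʳ _)))

        opaque
          EE : σ δ * σ Δ ≡ 1#
          EE = trans (sym (frob-* (k Y) δ Δ)) (trans (cong σ DE) (frob-1 (k Y)))

        opaque
          DD : d Y * δ ≡ σ δ
          DD = combine₃ (- (d Y * δ)) (- (δ * σ δ)) (σ δ) EE (proj₂ (proj₂ coboundary) Y) DE (ring (d Y) δ Δ (σ δ) (σ Δ))
            where
            ring : ∀ d δ Δ sδ sΔ → d * δ + (- (d * δ)) * 1# + (- (δ * sδ)) * (sΔ * d) + sδ * 1# ≡ sδ + (- (d * δ)) * (sδ * sΔ) + (- (δ * sδ)) * Δ + sδ * (δ * Δ)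
            ring d δ Δ sδ sΔ = (solve 5 (λ a b c d e → a :* b :+ :- (a :* b) :* `1 :+ :- (b :* c) :* (d :* a) :+ c :* `1 := c :+ :- (a :* b) :* (c :* d) :+ :- (b :* c) :* e :+ c :* (b :* e)) refl d δ sδ sΔ Δ)

        opaque
          O1 : A i1 i0 * 1# + A i1 i1 * y₃ - A i1 i2 * y₂ ≡ 0#
          O1 = trans (cong₂ _-_ (cong₂ (λ q s → A i1 i0 * q + A i1 i1 * s) (sym (r-33 Y)) (sym (r-row Y i2))) (cong (A i1 i2 *_) (sym (r-row Y i1)))) orth₁

        opaque
          O2 : A i2 i0 * 1# + A i2 i1 * y₃ - A i2 i2 * y₂ ≡ 0#
          O2 = trans (cong₂ _-_ (cong₂ (λ q s → A i2 i0 * q + A i2 i1 * s) (sym (r-33 Y)) (sym (r-row Y i2))) (cong (A i2 i2 *_) (sym (r-row Y i1)))) orth₂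

        module Id = Identity (d Y) (A i1 i0) (A i1 i1) (A i1 i2) (A i2 i0) (A i2 i1) (A i2 i2) y₁ y₂ y₃
          v₁ v₂ u₁ u₂ δ (σ v₁) (σ v₂) (σ u₁) (σ u₂) (σ δ) (σ Δ) V1 V2 W SW DT DD EE O1 O2

      t-coord : Carrier
      t-coord = Id.t'

      opaque
        triangular : r Y ⨾ h ≃ h ⨾ ε (coordA Y) (coordB Y) (coordC Y) t-coord (k Y)
        triangular = subst₂ _≃_ (sym (⨾-≡ (r Y) h)) (sym (⨾-≡ h e)) (≐⇒≃ {r Y ∘ˢ h} {h ∘ˢ e}
            ((λ x → cong (λ n → frob n x) (ℕₚ.+-identityʳ (k Y))) , λ i j → trans (matMul-cong {A} {A'} {mat h} {mat h} A≡ (λ _ _ → refl) i j) (trans (Id.identity i j)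
              (matMul-cong {H'} {λ i j → σ (mat h i j)} {mat e} {mat e} H≡ (λ _ _ → refl) i j))))
          where
          e : Semilinear
          e = ε (coordA Y) (coordB Y) (coordC Y) t-coord (k Y)
          A' H' : Mat4
          A' = rows (vec4 (d Y) 0# 0# 0#) (vec4 (A i1 i0) (A i1 i1) (A i1 i2) 0#) (vec4 (A i2 i0) (A i2 i1) (A i2 i2) 0#) (vec4 y₁ y₂ y₃ 1#)
          H' = rows (vec4 (σ δ) 0# 0# 0#) (vec4 0# (σ u₂) (- (σ δ * σ v₂)) 0#) (vec4 0# (- σ u₁) (σ δ * σ v₁) 0#) (vec4 0# 0# 0# 1#)
          A≡ : ∀ i j → A i j ≡ A' i j
          A≡ = cases4 (cases4 refl a01≡0 a02≡0 a03≡0) (cases4 refl refl refl a13≡0) (cases4 refl refl refl a23≡0)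
            (cases4 (r-row Y i0) (r-row Y i1) (r-row Y i2) (r-row Y i3))
          z : 0# ≡ σ 0#
          z = sym (frob-0 (k Y))
          H≡ : ∀ i j → H' i j ≡ σ (mat h i j)
          H≡ = cases4 (cases4 refl z z z) (cases4 z refl (sym (trans (frob-neg (k Y) _) (cong -_ (frob-* (k Y) δ v₂)))) z)
            (cases4 z (sym (frob-neg (k Y) u₁)) (sym (frob-* (k Y) δ v₁)) z) (cases4 z z z (sym (frob-1 (k Y))))

    opaque
      el-point : ∀ Y → El (coordA Y) (coordB Y) (coordC Y) (At.t-coord Y) (k Y)
      el-point Y = r Y , r-G Y , At.triangular Y

    opaque
      G⇒El : ∀ {g} → G g → Σ[ a ∈ Carrier ] Σ[ b ∈ Carrier ] Σ[ c ∈ Carrier ] Σ[ t ∈ Carrier ] Σ[ n ∈ ℕ ] ((g ⨾ h ≃ h ⨾ ε a b c t n) × ∃ λ Y → k Y ≡ n)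
      G⇒El Gg = let (Y , e) = point Gg in _ , _ , _ , _ , _ , ≃-trans (⨾-cong e ≃-refl) (At.triangular Y) , Y , refl

    opaque
      same-element : ∀ {g a b c t n a' b' c' t' n'} → g ⨾ h ≃ h ⨾ ε a b c t n → g ⨾ h ≃ h ⨾ ε a' b' c' t' n' → (a ≡ a' × b ≡ b' × c ≡ c' × t ≡ t') × n ≋ n'
      same-element {g} {a} {b} {c} {t} {n} {a'} {b'} {c'} {t'} {n'} q q' = ε-components {a} {b} {c} {t} {n} {a'} {b'} {c'} {t'} {n'} (cancelˡ h⁻¹-h (≃-trans (≃-sym q) q'))

    opaque
      -- The coordinates (a , b , c) are an invertible linear function of the image of the origin,
      -- which determines a group element by regularity.
      same-coords : ∀ {a b c t n t' n'} → (g : El a b c t n) (g' : El a b c t' n') → proj₁ g ≃ proj₁ g'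
      same-coords {a} {b} {c} {t} {n} {t'} {n'} (g , Gg , q) (g' , Gg' , q') with point Gg | point Gg'
      ... | X , e | Y , e' with same-element q (≃-trans (⨾-cong e ≃-refl) (At.triangular X)) | same-element q' (≃-trans (⨾-cong e' ≃-refl) (At.triangular Y))
      ...   | (ea , eb , ec , _) , _ | (fa , fb , fc , _) , _ =
              ≃-trans e (≃-trans (subst (λ Z → r X ≃ r Z) (coord-injective (trans (sym ea) fa) (trans (sym eb) fb) (trans (sym ec) fc)) ≃-refl) (≃-sym e'))

    opaque
      El-unique : ∀ {a b c t n t' n'} → El a b c t n → El a b c t' n' → t ≡ t' × n ≋ n'
      El-unique g@(_ , _ , q) g'@(_ , _ , q') with same-element q (≃-trans (⨾-cong (same-coords g g') ≃-refl) q')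
      ... | (_ , _ , _ , et) , en = et , en

    opaque
      ε-product : ∀ a b c t n x y z u l → ε a b c t n ⨾ ε x y z u l ≃ ε (frob l a + x - frob l b * z + frob l c * (y - z * u)) (frob l b + y + frob l c * u) (frob l c + z) (frob l t + u) (n +ℕ l)
      ε-product a b c t n x y z u l = subst (_≃ e) (sym (⨾-≡ (ε a b c t n) (ε x y z u l))) (≐⇒≃ {ε a b c t n ∘ˢ ε x y z u l} {e} (E-product a b c t n x y z u l))
        where
        e : Semilinear
        e = ε (frob l a + x - frob l b * z + frob l c * (y - z * u)) (frob l b + y + frob l c * u) (frob l c + z) (frob l t + u) (n +ℕ l)

    opaque
      compose : ∀ {g g' s e e'} → g ⨾ s ≃ s ⨾ e → g' ⨾ s ≃ s ⨾ e' → (g ⨾ g') ⨾ s ≃ s ⨾ (e ⨾ e')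
      compose {g} {g'} {s} {e} {e'} q q' = begin≃
          (g ⨾ g') ⨾ s ≃⟨ ⨾-assoc _ _ _ ⟩
          g ⨾ (g' ⨾ s) ≃⟨ ⨾-cong ≃-refl q' ⟩
          g ⨾ (s ⨾ e') ≃⟨ ≃-sym (⨾-assoc _ _ _) ⟩
          (g ⨾ s) ⨾ e' ≃⟨ ⨾-cong q ≃-refl ⟩
          (s ⨾ e) ⨾ e' ≃⟨ ⨾-assoc _ _ _ ⟩
          s ⨾ (e ⨾ e') ∎≃
        where open ≃-Reasoning

    opaque
      El-mul : ∀ {a b c t n x y z u l} → El a b c t n → El x y z u l →
        El (frob l a + x - frob l b * z + frob l c * (y - z * u)) (frob l b + y + frob l c * u) (frob l c + z) (frob l t + u) (n +ℕ l)
      El-mul {a} {b} {c} {t} {n} {x} {y} {z} {u} {l} (g , Gg , q) (g' , Gg' , q') = g ⨾ g' , closed⨾ Gg Gg' , ≃-trans (compose q q') (⨾-cong ≃-refl (ε-product a b c t n x y z u l))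

    opaque
      El-resp : ∀ {a b c t n n'} → n ≋ n' → El a b c t n → El a b c t n'
      El-resp {a} {b} {c} {t} e (g , Gg , q) = g , Gg , ≃-trans q (⨾-cong ≃-refl (ε-≋ {a} {b} {c} {t} e))

    private
      K : ℕ
      K = m +ℕ (m +ℕ m)

    opaque
      ≋⇒% : ∀ {i j} → i ≋ j → i % m ≡ j % m
      ≋⇒% {i} {j} e = by-cases (ℕₚ.<-cmp (i % m) (j % m))
        where
        open import Relation.Binary.Definitions using (Tri; tri<; tri≈; tri>)
        e' : i % m ≋ j % m
        e' x = trans (sym (frob-% i x)) (trans (e x) (frob-% j x))
        by-cases : Tri (i % m < j % m) (i % m ≡ j % m) (j % m < i % m) → i % m ≡ j % m
        by-cases (tri< lt _ _) = ⊥-elim (frob-distinct lt (m%n<n j m) e')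
        by-cases (tri≈ _ eq _) = eq
        by-cases (tri> _ _ gt) = ⊥-elim (frob-distinct gt (m%n<n i m) (λ x → sym (e' x)))

    opaque
      %⇒≋ : ∀ {i j} → i % m ≡ j % m → i ≋ j
      %⇒≋ {i} {j} e x = trans (frob-% i x) (trans (cong (λ n → frob n x) e) (sym (frob-% j x)))

    opaque
      exponent-generator : ∃ λ l → 1 ≤ l × l ∣ m × (∀ Y → l ∣ k Y) × ∃ λ Y → k Y % m ≡ l % m
      exponent-generator = CyclicGenerator.generator finitePoint k m
        (let (e , q , _) = unit-point in e , trans (≋⇒% {k e} {0} q) (n∣m⇒m%n≡0 0 m (divides 0 refl))) (λ X Y → X · Y , ≋⇒% (k-· X Y))

    private
      l P : ℕ
      l = proj₁ exponent-generator
      P = _∣_.quotient (proj₁ (proj₂ (proj₂ exponent-generator)))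

      Y₁ : Point
      Y₁ = proj₁ (proj₂ (proj₂ (proj₂ (proj₂ exponent-generator))))

    opaque
      m≡ : m ≡ l *ℕ P
      m≡ = trans (_∣_.equality (proj₁ (proj₂ (proj₂ exponent-generator)))) (ℕₚ.*-comm P l)

    opaque
      l≥1 : 1 ≤ l
      l≥1 = proj₁ (proj₂ exponent-generator)

    opaque
      l∣k : ∀ Y → l ∣ k Y
      l∣k = proj₁ (proj₂ (proj₂ (proj₂ exponent-generator)))

    opaque
      k-Y₁ : k Y₁ % m ≡ l % m
      k-Y₁ = proj₂ (proj₂ (proj₂ (proj₂ (proj₂ exponent-generator))))

    opaque
      -- The element at Y₁ has exponent l modulo m, and p^K annihilates it. Hence m = l P divides l
      -- p^K.
      P∣ : P ∣ p ^ K
      P∣ = *-cancelˡ-∣ l {{Data.Nat.>-nonZero l≥1}} (subst (_∣ l *ℕ p ^ K) m≡ (m%n≡0⇒n∣m (l *ℕ p ^ K) m (begin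
          (l *ℕ p ^ K) % m ≡⟨ %-distribˡ-* l (p ^ K) m ⟩
          (l % m *ℕ (p ^ K % m)) % m ≡⟨ cong (λ q → (q *ℕ (p ^ K % m)) % m) k-Y₁ ⟨
          (k Y₁ % m *ℕ (p ^ K % m)) % m ≡⟨ %-distribˡ-* (k Y₁) (p ^ K) m ⟨
          (k Y₁ *ℕ p ^ K) % m ≡⟨ cong (_% m) (ℕₚ.*-comm (k Y₁) (p ^ K)) ⟩
          (p ^ K *ℕ k Y₁) % m ≡⟨ n∣m⇒m%n≡0 _ m (frob-period (k-torsion Y₁)) ⟩
          0 ∎)))
        where open ≡-Reasoning

    opaque
      index : ∀ {n} → (∃ λ Y → k Y ≡ n) → ∃ λ j → n ≡ l *ℕ j
      index (Y , refl) with l∣k Y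
      ... | divides j e = j , trans e (ℕₚ.*-comm j l)

    Elₗ : Carrier → Carrier → Carrier → Carrier → ℕ → Set
    Elₗ a b c t j = El a b c t (l *ℕ j)

    Quotient-El : (a b c t : Carrier) (i : ℕ) (a' b' c' t' : Carrier) (i' : ℕ) → Set
    Quotient-El a b c t i a' b' c' t' i' =
        Σ[ x ∈ Carrier ] Σ[ y ∈ Carrier ] Σ[ z ∈ Carrier ] Σ[ u ∈ Carrier ] Σ[ j ∈ ℕ ] let σ = frob (l *ℕ j) in
          (Elₗ x y z u j × a' ≡ σ a + x - σ b * z + σ c * (y - z * u) × b' ≡ σ b + y + σ c * u × c' ≡ σ c + z × t' ≡ σ t + u
          × (∀ v → frob (l *ℕ (i +ℕ j)) v ≡ frob (l *ℕ i') v))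

    opaque
      El-total : ∀ a b c → Σ[ t ∈ Carrier ] Σ[ j ∈ ℕ ] Elₗ a b c t j
      El-total a b c = go (coord-surjective a b c)
        where
        go : (∃ λ Y → coordA Y ≡ a × coordB Y ≡ b × coordC Y ≡ c) → Σ[ t ∈ Carrier ] Σ[ j ∈ ℕ ] Elₗ a b c t j
        go (Y , refl , refl , refl) = let (j , e) = index (Y , refl) in At.t-coord Y , j , subst (El (coordA Y) (coordB Y) (coordC Y) (At.t-coord Y)) e (el-point Y)

    opaque
      El-quotient : ∀ {a b c t i a' b' c' t' i' x y z u j g g' g₁} → G g₁ → G g' → g ⨾ h ≃ h ⨾ ε a b c t (l *ℕ i) → g' ⨾ h ≃ h ⨾ ε a' b' c' t' (l *ℕ i') →
        g ⨾ g₁ ≃ idˢ → (g₁ ⨾ g') ⨾ h ≃ h ⨾ ε x y z u (l *ℕ j) → Quotient-El a b c t i a' b' c' t' i'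
      El-quotient {a} {b} {c} {t} {i} {a'} {b'} {c'} {t'} {i'} {x} {y} {z} {u} {j} {g} {g'} {g₁} Gg₁ Gg' q q' e₁ qW = go (same-element {g'} {a'} {b'} {c'} {t'} {l *ℕ i'} {xa} {xb} {xc} {xt} {l *ℕ i +ℕ l *ℕ j} q' together)
        where
        σ : Carrier → Carrier
        σ = frob (l *ℕ j)
        xa xb xc xt : Carrier
        xa = σ a + x - σ b * z + σ c * (y - z * u)
        xb = σ b + y + σ c * u
        xc = σ c + z
        xt = σ t + u
        back : g ⨾ (g₁ ⨾ g') ≃ g'
        back = ≃-trans (≃-sym (⨾-assoc g g₁ g')) (≃-trans (⨾-cong e₁ ≃-refl) (⨾-idˡ g'))
        together : g' ⨾ h ≃ h ⨾ ε xa xb xc xt (l *ℕ i +ℕ l *ℕ j)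
        together = ≃-trans (⨾-cong (≃-sym back) ≃-refl) (≃-trans (compose q qW) (⨾-cong ≃-refl (ε-product a b c t (l *ℕ i) x y z u (l *ℕ j))))
        go : (a' ≡ xa × b' ≡ xb × c' ≡ xc × t' ≡ xt) × (l *ℕ i' ≋ l *ℕ i +ℕ l *ℕ j) → Quotient-El a b c t i a' b' c' t' i'
        go ((ea , eb , ec , et) , en) = x , y , z , u , j , (g₁ ⨾ g' , closed⨾ Gg₁ Gg' , qW) , ea , eb , ec , et
          , λ v → trans (cong (λ n → frob n v) (ℕₚ.*-distribˡ-+ l i j)) (sym (en v))

    opaque
      El-div : ∀ {a b c t i a' b' c' t' i'} → Elₗ a b c t i → Elₗ a' b' c' t' i' → Quotient-El a b c t i a' b' c' t' i'
      El-div {a} {b} {c} {t} {i} {a'} {b'} {c'} {t'} {i'} (g , Gg , q) (g' , Gg' , q') = go₁ (inverse⨾ Gg)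
        where
        go₂ : ∀ {g₁} → G g₁ → g ⨾ g₁ ≃ idˢ → Σ[ x ∈ Carrier ] Σ[ y ∈ Carrier ] Σ[ z ∈ Carrier ] Σ[ u ∈ Carrier ] Σ[ n ∈ ℕ ] (((g₁ ⨾ g') ⨾ h ≃ h ⨾ ε x y z u n) × ∃ λ Y → k Y ≡ n) →
          Quotient-El a b c t i a' b' c' t' i'
        go₂ {g₁} Gg₁ e₁ (x , y , z , u , n , qW , Yn) = let (j , e) = index Yn in
          El-quotient {a} {b} {c} {t} {i} {a'} {b'} {c'} {t'} {i'} {x} {y} {z} {u} {j} {g} {g'} {g₁} Gg₁ Gg' q q' e₁ (subst (λ n → (g₁ ⨾ g') ⨾ h ≃ h ⨾ ε x y z u n) e qW)
        go₁ : (∃ λ g₁ → G g₁ × g ⨾ g₁ ≃ idˢ) → Quotient-El a b c t i a' b' c' t' i'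
        go₁ (g₁ , Gg₁ , e₁) = go₂ Gg₁ e₁ (G⇒El (closed⨾ Gg₁ Gg'))

    opaque
      El-gen : Σ[ a ∈ Carrier ] Σ[ b ∈ Carrier ] Σ[ c ∈ Carrier ] Σ[ t ∈ Carrier ] Elₗ a b c t 1
      El-gen = coordA Y₁ , coordB Y₁ , coordC Y₁ , At.t-coord Y₁ , El-resp (%⇒≋ (trans k-Y₁ (cong (_% m) (sym (ℕₚ.*-identityʳ l))))) (el-point Y₁)

    opaque
      system : System l Elₗ
      system = record
        { mul = λ {_} {_} {_} {_} {i} {_} {_} {_} {_} {j} g h → subst (El _ _ _ _) (sym (ℕₚ.*-distribˡ-+ l i j)) (El-mul g h)
        ; total = El-total
        ; unique = El-unique
        ; resp = El-resp
        ; div = El-div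
        ; gen = El-gen }

    open Operator l using (σ)

    nilpotent : ∀ x → iter (p ^ K) (Operator.N l) x ≡ 0#
    nilpotent x = trans (Operator.N-nilpotent l K x) (x≡y⇒x-y≡0 (frob-∣ (subst (_∣ l *ℕ p ^ K) (sym m≡) (*-monoʳ-∣ l P∣)) x))

    module Red = Reduction l system (p ^ K) nilpotent

    E₂ : Carrier → Carrier → Carrier → ℕ → Set
    E₂ = Elₗ 0#

    opaque
      InP-resp : ∀ {A B : Mat4} {n n'} → (∀ i j → A i j ≡ B i j) → InPΓSpP (mkS A n) → InPΓSpP (mkS B n')
      InP-resp {A} {B} e ((A' , rA , lA) , (ν , nν , f) , a1 , a2 , a3) =
          (A' , (λ i j → trans (matMul-cong {B} {A} {A'} {A'} (λ i j → sym (e i j)) (λ _ _ → refl) i j) (rA i j))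
              , (λ i j → trans (matMul-cong {A'} {A'} {B} {A} (λ _ _ → refl) (λ i j → sym (e i j)) i j) (lA i j)))
        , (ν , nν , λ x y → trans (form-cong {vecMat x B} {vecMat x A} {vecMat y B} {vecMat y A} (im x) (im y)) (f x y))
        , trans (sym (e i0 i1)) a1 , trans (sym (e i0 i2)) a2 , trans (sym (e i0 i3)) a3
        where
        im : ∀ x j → vecMat x B j ≡ vecMat x A j
        im x j = sum4-cong (λ i → cong (x i *_) (sym (e i j)))

    opaque
      -- E(0,0,0,w) is an instance of `H`, whose membership is already established.
      shear-InP : ∀ w → InPΓSpP (ε 0# 0# 0# w 0)
      shear-InP w = InP-resp {H 1# 0# (- w) 1# 1#} {E 0# 0# 0# w} {0} {0} entries
          (Inverse.H-InP 1# 0# (- w) 1# 1# 1# (solve 1 (λ a → `1 :* `1 :- `0 :* :- a := `1) refl w) (solve 0 (`1 :* `1 := `1) refl))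
        where
        entries : ∀ i j → H 1# 0# (- w) 1# 1# i j ≡ E 0# 0# 0# w i j
        entries = cases4 (cases4 refl refl refl refl) (cases4 (solve 0 (`0 := :- `0) refl) refl (solve 0 (:- (`1 :* `0) := `0) refl) refl)
          (cases4 (solve 1 (λ a → `0 := `0 :- `0 :* a) refl w) (solve 1 (λ a → :- (:- a) := a) refl w) (solve 0 (`1 :* `1 := `1) refl) refl) (cases4 refl refl refl refl)

    module Shear (w : Carrier) where
      nʷ hʷ : Semilinear
      nʷ = ε 0# 0# 0# w 0
      hʷ = h ∘ˢ nʷ

      Tw : Carrier → Carrier → Carrier → ℕ → Set
      Tw = twist l w E₂

      Conj : Semilinear → Set
      Conj g' = Σ[ g ∈ Semilinear ] (G g × g ⨾ hʷ ≃ hʷ ⨾ g')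

      opaque
        hʷ-InP : InPΓSpP hʷ
        hʷ-InP = InP-∘ {H v₁ v₂ u₁ u₂ δ} {E 0# 0# 0# w} {0} {0} HI.H-InP (shear-InP w)

      opaque
        hʷ⁻¹ : Semilinear
        hʷ⁻¹ = mkS (proj₁ (proj₁ hʷ-InP)) 0
        hʷ-right : hʷ ⨾ hʷ⁻¹ ≃ idˢ
        hʷ-right = subst (_≃ idˢ) (sym (⨾-≡ hʷ hʷ⁻¹)) (≐⇒≃ {hʷ ∘ˢ hʷ⁻¹} {idˢ} ((λ _ → refl) , proj₁ (proj₂ (proj₁ hʷ-InP))))

      opaque
        -- The source of `twist`: moving E(0,0,0,w) across an element adds c w to b and w - σ w to
        -- t, and `twist` asks for the label before this change.
        shear-conjugate : ∀ a b c t n → ε a b c t n ⨾ nʷ ≃ nʷ ⨾ ε a (b + c * w) c (t + w - frob n w) n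
        shear-conjugate a b c t n = ≃-trans (ε-product a b c t n 0# 0# 0# w 0) (≃-trans
            (≐⇒≃ {ε (a + 0# - b * 0# + c * (0# - 0# * w)) (b + 0# + c * w) (c + 0#) (t + w) (n +ℕ 0)} {ε (frob n 0# + a - frob n 0# * c + frob n 0# * (b' - c * t')) (frob n 0# + b' + frob n 0# * t') (frob n 0# + c) (frob n w + t') (0 +ℕ n)}
              ((λ x → cong (λ k → frob k x) (ℕₚ.+-identityʳ n)) , λ i j → cong (λ f → f i j) (E-cong
                (trans (solve 6 (λ a b c d e f → a :+ `0 :- b :* `0 :+ c :* (`0 :- `0 :* d) := `0 :+ a :- `0 :* c :+ `0 :* (e :- c :* f)) refl a b c w b' t') (cong (λ z → z + a - z * c + z * (b' - c * t')) z0))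
                (trans (solve 4 (λ a b c d → a :+ `0 :+ b :* c := `0 :+ (a :+ b :* c) :+ `0 :* d) refl b c w t') (cong (λ z → z + b' + z * t') z0))
                (trans (+-comm c 0#) (cong (_+ c) z0))
                (solve 3 (λ a b c → a :+ b := c :+ (a :+ b :- c)) refl t w (frob n w)))))
            (≃-sym (ε-product 0# 0# 0# w 0 a b' c t' n)))
          where
          b' t' : Carrier
          b' = b + c * w
          t' = t + w - frob n w
          z0 : 0# ≡ frob n 0#
          z0 = sym (frob-0 n)
          E-cong : ∀ {a b c t a' b' c' t'} → a ≡ a' → b ≡ b' → c ≡ c' → t ≡ t' → E a b c t ≡ E a' b' c' t'
          E-cong refl refl refl refl = refl

      opaque
        sheared : ∀ {g a b c t n} → g ⨾ h ≃ h ⨾ ε a b c t n → g ⨾ hʷ ≃ hʷ ⨾ ε a (b + c * w) c (t + w - frob n w) n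
        sheared {g} {a} {b} {c} {t} {n} q = subst (λ s → g ⨾ s ≃ s ⨾ ε a (b + c * w) c (t + w - frob n w) n) (⨾-≡ h nʷ) (begin≃
            g ⨾ (h ⨾ nʷ) ≃⟨ ≃-sym (⨾-assoc _ _ _) ⟩
            (g ⨾ h) ⨾ nʷ ≃⟨ ⨾-cong q ≃-refl ⟩
            (h ⨾ ε a b c t n) ⨾ nʷ ≃⟨ ⨾-assoc _ _ _ ⟩
            h ⨾ (ε a b c t n ⨾ nʷ) ≃⟨ ⨾-cong ≃-refl (shear-conjugate a b c t n) ⟩
            h ⨾ (nʷ ⨾ ε a (b + c * w) c (t + w - frob n w) n) ≃⟨ ≃-sym (⨾-assoc _ _ _) ⟩
            (h ⨾ nʷ) ⨾ ε a (b + c * w) c (t + w - frob n w) n ∎≃)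
          where open ≃-Reasoning

      opaque
        forward : ∀ {g} → G g → Σ[ a ∈ Carrier ] Σ[ b ∈ Carrier ] Σ[ c ∈ Carrier ] Σ[ t ∈ Carrier ] Σ[ j ∈ ℕ ] ((g ⨾ hʷ ≃ hʷ ⨾ ε a b c t (l *ℕ j)) × Tw b c t j)
        forward {g} Gg = go (G⇒El Gg)
          where
          go : Σ[ a ∈ Carrier ] Σ[ b ∈ Carrier ] Σ[ c ∈ Carrier ] Σ[ t ∈ Carrier ] Σ[ n ∈ ℕ ] ((g ⨾ h ≃ h ⨾ ε a b c t n) × ∃ λ Y → k Y ≡ n) →
            Σ[ a ∈ Carrier ] Σ[ b ∈ Carrier ] Σ[ c ∈ Carrier ] Σ[ t ∈ Carrier ] Σ[ j ∈ ℕ ] ((g ⨾ hʷ ≃ hʷ ⨾ ε a b c t (l *ℕ j)) × Tw b c t j)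
          go (a , b , c , t , n , q , Yn) = let (j , e) = index Yn ; q' = subst (λ n → g ⨾ h ≃ h ⨾ ε a b c t n) e q in
            a , b + c * w , c , t + w - σ j w , j , sheared {g} {a} {b} {c} {t} {l *ℕ j} q' , twist-el l Red.system₂ w (Red.El-free 0# (g , Gg , q'))

      opaque
        backward : ∀ a {b c t j} → Tw b c t j → Conj (ε a b c t (l *ℕ j))
        backward a {b} {c} {t} {j} g = go (Red.El-free a g)
          where
          go : Elₗ a (b - c * w) c (t - w + σ j w) j → Conj (ε a b c t (l *ℕ j))
          go (g , Gg , q) = g , Gg , subst₂ (λ x y → g ⨾ hʷ ≃ hʷ ⨾ ε a x c y (l *ℕ j)) (solve 3 (λ a b c → a :- b :* c :+ b :* c := a) refl b c w) (solve 3 (λ a b c → a :- b :+ c :+ b :- c := a) refl t w (σ j w))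
            (sheared {g} {a} {b - c * w} {c} {t - w + σ j w} {l *ℕ j} q)

      opaque
        Conj-resp : ∀ {s t} → s ≃ t → Conj s → Conj t
        Conj-resp e (g , Gg , q) = g , Gg , ≃-trans q (⨾-cong ≃-refl e)

      opaque
        Conj-unit : Conj idˢ
        Conj-unit = idˢ , hasId , ≃-trans (⨾-idˡ hʷ) (≃-sym (⨾-idʳ hʷ))

      opaque
        Conj-mul : ∀ {s t} → Conj s → Conj t → Conj (s ⨾ t)
        Conj-mul (g , Gg , q) (g' , Gg' , q') = g ⨾ g' , closed⨾ Gg Gg' , compose q q'

      opaque
        left-inverse : ∀ {g g'} → G g' → g ⨾ g' ≃ idˢ → g' ⨾ g ≃ idˢ
        left-inverse {g} {g'} Gg' e = go (inverse⨾ Gg')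
          where
          go : (∃ λ g'' → G g'' × g' ⨾ g'' ≃ idˢ) → g' ⨾ g ≃ idˢ
          go (g'' , _ , e') = ≃-trans (⨾-cong ≃-refl g≃) e'
            where
            g≃ : g ≃ g''
            g≃ = ≃-trans (≃-sym (⨾-idʳ g)) (≃-trans (⨾-cong ≃-refl (≃-sym e')) (≃-trans (≃-sym (⨾-assoc g g' g'')) (≃-trans (⨾-cong e ≃-refl) (⨾-idˡ g''))))

      opaque
        Conj-inv : ∀ {s t} → Conj s → s ⨾ t ≃ idˢ → Conj t
        Conj-inv {s} {t} (g , Gg , q) e = go (inverse⨾ Gg)
          where
          open ≃-Reasoning
          go : (∃ λ g' → G g' × g ⨾ g' ≃ idˢ) → Conj t
          go (g' , Gg' , e') = g' , Gg' , cancelˡ (left-inverse Gg' e') (begin≃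
            g ⨾ (g' ⨾ hʷ) ≃⟨ ≃-sym (⨾-assoc _ _ _) ⟩
            (g ⨾ g') ⨾ hʷ ≃⟨ ≃-trans (⨾-cong e' ≃-refl) (⨾-idˡ hʷ) ⟩
            hʷ ≃⟨ ≃-trans (≃-sym (⨾-idʳ hʷ)) (⨾-cong ≃-refl (≃-sym e)) ⟩
            hʷ ⨾ (s ⨾ t) ≃⟨ ≃-sym (⨾-assoc _ _ _) ⟩
            (hʷ ⨾ s) ⨾ t ≃⟨ ⨾-cong (≃-sym q) ≃-refl ⟩
            (g ⨾ hʷ) ⨾ t ≃⟨ ⨾-assoc _ _ _ ⟩
            g ⨾ (hʷ ⨾ t) ∎≃)

      opaque
        conjugate-to : ∀ (Γ : Semilinear → Set) → (∀ a {b c t j} → Tw b c t j → Γ (ε a b c t (l *ℕ j))) → (∀ {g'} → Γ g' → Conj g') → ConjugateTo G Γ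
        conjugate-to Γ into out = hʷ , hʷ-InP , λ g → to g , from g
          where
          to : ∀ g → G g → Σ[ g' ∈ Semilinear ] (Γ g' × (g ∘ˢ hʷ) ≈ˢ (hʷ ∘ˢ g'))
          to g Gg = let (a , b , c , t , j , q , x) = forward Gg in ε a b c t (l *ℕ j) , into a x , ≃⇒≈ (subst₂ _≃_ (⨾-≡ g hʷ) (⨾-≡ hʷ (ε a b c t (l *ℕ j))) q)
          from : ∀ g → Σ[ g' ∈ Semilinear ] (Γ g' × (g ∘ˢ hʷ) ≈ˢ (hʷ ∘ˢ g')) → G g
          from g (g' , x , e) = let (g₂ , Gg₂ , q) = out x in respects≃ (cancelᵣ hʷ-right (≃-trans q (≃-sym (subst₂ _≃_ (sym (⨾-≡ g hʷ)) (sym (⨾-≡ hʷ g')) ⟨ e ⟩)))) Gg₂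

      opaque
        ε-≡ : ∀ a b c {t t'} n n' → t ≡ t' → n ≋ n' → ε a b c t n ≈ˢ ε a b c t' n'
        ε-≡ a b c {t} n n' refl e = ≃⇒≈ (ε-≋ {a} {b} {c} {t} {n} {n'} e)

      opaque
        from-ε : ∀ {g a b c t n j} → n ≋ l *ℕ j → g ≈ˢ ε a b c t n → Tw b c t j → Conj g
        from-ε {g} {a} {b} {c} {t} {n} {j} e q x = Conj-resp (≃-sym (≃-trans ⟨ q ⟩ (ε-≋ {a} {b} {c} {t} {n} {l *ℕ j} e))) (backward a x)

      opaque
        resultA : FormA l Tw → CaseA m G
        resultA (s , to , from) = s , conjugate-to (GroupA m s)
          (λ a {b} {c} {t} {j} x → a , b , c , ε-≡ a b c (l *ℕ j) 0 (proj₁ (to x)) (proj₂ (to x)))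
          (λ (a , b , c , q) → from-ε {a = a} {b} {c} {n = 0} {0} (λ x → sym (Operator.σ-0 l x)) q (from b c))

      opaque
        resultB : FormB l Tw → CaseB m G
        resultB (s , μ , e₁ , e₂ , e₃ , e₄ , to , from) = l , s , μ , l≥1 , e₁ , e₂ , e₃ , e₄ , conjugate-to (GroupB m l s μ)
          (λ a {b} {c} {t} {j} x → a , b , c , j , proj₂ (to x) , ε-≡ a b c (l *ℕ j) (l *ℕ j) (proj₁ (to x)) (λ _ → refl))
          (λ (a , b , c , j , i , q) → from-ε {a = a} {b} {c} {n = l *ℕ j} {j} (λ _ → refl) q (from b c j i))

      opaque
        resultC : FormC l Tw → CaseC m G
        resultC (s , μ , e₁ , e₂ , e₃ , e₄ , e₅ , to , from) = l , s , μ , e₁ , e₂ , e₃ , e₄ , e₅ , conjugate-to (GroupC m l s μ)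
          (λ a {b} {c} {t} {j} x → a , b , c , j , proj₂ (to x) , ε-≡ a b c (l *ℕ j) (l *ℕ j) (proj₁ (to x)) (λ _ → refl))
          (λ (a , b , c , j , i , q) → from-ε {a = a} {b} {c} {n = l *ℕ j} {j} (λ _ → refl) q (from b c j i))

      module ResultD (u tC μB : Carrier) (s : ℕ → Carrier) (α λ₀ : Carrier) (form : FormD-at l Tw u tC μB s α λ₀ (u - frob l u)) where
        μC : Carrier
        μC = u - frob l u

        graph-label : ∀ {b c t j} → Tw b c t j → t ≡ lin m s c × ι j ≡ tr m (μC * c)
        graph-label = let (_ , _ , _ , _ , _ , _ , _ , _ , _ , _ , _ , _ , _ , _ , q , _) = form in q

        in-K : ∀ {b c t j} → Tw b c t j → tr m (μC * c) ≡ 0# → ∃ λ k → (∀ x → σ j x ≡ σ (3 *ℕ k) x) × ι k ≡ half * Qf m s μB c + tr m (α * c + μB * b)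
        in-K = let (_ , _ , _ , _ , _ , _ , _ , _ , _ , _ , _ , _ , _ , _ , _ , q , _) = form in q

        from-K : ∀ b c k → tr m (μC * c) ≡ 0# → ι k ≡ half * Qf m s μB c + tr m (α * c + μB * b) → Tw b c (lin m s c) (3 *ℕ k)
        from-K = let (_ , _ , _ , _ , _ , _ , _ , _ , _ , _ , _ , _ , _ , _ , _ , _ , q , _) = form in q

        g-tC : Tw 0# tC (lin m s tC) 1
        g-tC = let (_ , _ , _ , _ , _ , _ , _ , _ , _ , _ , _ , _ , _ , _ , _ , _ , _ , q) = form in q

        Γ : Semilinear → Set
        Γ = GroupD m l s μB μC α tC

        private
          module T = System₂ (twist-system l Red.system₂ w)
          uC : Carrier
          uC = lin m s tC

        opaque
          triple : ∀ k → 3 *ℕ l *ℕ k ≡ l *ℕ (3 *ℕ k)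
          triple k = trans (cong (_*ℕ k) (ℕₚ.*-comm 3 l)) (ℕₚ.*-assoc l 3 k)

        opaque
          -- The given values are the solution, up to the preimage under φ, of dividing (a , b , c)
          -- on the right by the generator over `tC`.
          peel-algebra : ∀ a b c φa φb φc → φc ≡ c - tC → φb ≡ b - (c - tC) * uC → φa ≡ a + (b - (c - tC) * uC) * tC + (c - tC) * tC * uC →
            (φa + 0# - φb * tC + φc * (0# - tC * uC) ≡ a) × (φb + 0# + φc * uC ≡ b) × (φc + tC ≡ c)
          peel-algebra a b c φa φb φc refl refl refl =
              (solve 5 (λ a b c d e → a :+ (b :- (c :- d) :* e) :* d :+ (c :- d) :* d :* e :+ `0 :- (b :- (c :- d) :* e) :* d :+ (c :- d) :* (`0 :- d :* e) := a) refl a b c tC uC)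
            , (solve 4 (λ a b c d → a :- (b :- c) :* d :+ `0 :+ (b :- c) :* d := a) refl b c tC uC) , (solve 2 (λ a b → a :- b :+ b := a) refl c tC)

        opaque
          generator : Γ (ε 0# 0# tC uC (l *ℕ 1))
          generator = Theory.gen (ε 0# 0# tC uC (l *ℕ 1)) (inj₂ (ε-≡ 0# 0# tC (l *ℕ 1) l refl (λ x → cong (λ n → frob n x) (ℕₚ.*-identityʳ l))))

        opaque
          -- Induction on a natural number n representing tr (μC c). Right division by the generator
          -- over `tC` lowers it by one, since tr (μC tC) = 1; at n = 0 the element lies over K and
          -- belongs to `GroupK`.
          generated : ∀ n a {b c t j} → Tw b c t j → tr m (μC * c) ≡ ι n → Γ (ε a b c t (l *ℕ j))
          generated zero a {b} {c} {t} {j} x e = let (k , ek , lab) = in-K x e in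
            Theory.gen (ε a b c t (l *ℕ j)) (inj₁ (a , b , c , k , e , lab , ε-≡ a b c (l *ℕ j) (3 *ℕ l *ℕ k) (proj₁ (graph-label x)) (λ v → trans (ek v) (cong (λ n → frob n v) (sym (triple k))))))
          generated (suc n) a {b} {c} {t} {j} x e = finish (T.total b' c')
            where
            φ : Carrier → Carrier
            φ = frob (l *ℕ 1)
            pre : ∀ v → ∃ λ v' → φ v' ≡ v
            pre = frob-surjective (l *ℕ 1)
            a' b' c' : Carrier
            a' = proj₁ (pre (a + (b - (c - tC) * uC) * tC + (c - tC) * tC * uC))
            b' = proj₁ (pre (b - (c - tC) * uC))
            c' = proj₁ (pre (c - tC))
            eqs : (φ a' + 0# - φ b' * tC + φ c' * (0# - tC * uC) ≡ a) × (φ b' + 0# + φ c' * uC ≡ b) × (φ c' + tC ≡ c)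
            eqs = peel-algebra a b c (φ a') (φ b') (φ c') (proj₂ (pre (c - tC))) (proj₂ (pre (b - (c - tC) * uC))) (proj₂ (pre (a + (b - (c - tC) * uC) * tC + (c - tC) * tC * uC)))
            finish : (Σ[ t' ∈ Carrier ] Σ[ j' ∈ ℕ ] Tw b' c' t' j') → Γ (ε a b c t (l *ℕ j))
            finish (t' , j' , x') = Theory.mul (ε a' b' c' t' (l *ℕ j')) (ε 0# 0# tC uC (l *ℕ 1)) (ε a b c t (l *ℕ j)) (generated n a' x' label) generator (≃⇒≈ together)
              where
              x'' : Tw b c (φ t' + uC) (j' +ℕ 1)
              x'' = subst₂ (λ b c → Tw b c (φ t' + uC) (j' +ℕ 1)) (proj₁ (proj₂ eqs)) (proj₂ (proj₂ eqs)) (T.mul x' g-tC)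
              same : (t ≡ φ t' + uC) × (∀ v → σ j v ≡ σ (j' +ℕ 1) v)
              same = T.unique x x''
              label : tr m (μC * c') ≡ ι n
              label = trans (sym (proj₂ (graph-label x'))) (combine₁ 1# (trans (sym (ι-+ j' 1)) (trans (proj₂ (graph-label x'')) e)) (solve 2 (λ a b → a :+ `1 :* (`1 :+ b) := b :+ `1 :* (a :+ (`1 :+ `0))) refl (ι j') (ι n)))
              together : (ε a' b' c' t' (l *ℕ j') ∘ˢ ε 0# 0# tC uC (l *ℕ 1)) ≃ ε a b c t (l *ℕ j)
              together = ≃-trans (subst (_≃ ε xa xb xc xt (l *ℕ j' +ℕ l *ℕ 1)) (⨾-≡ (ε a' b' c' t' (l *ℕ j')) (ε 0# 0# tC uC (l *ℕ 1))) (ε-product a' b' c' t' (l *ℕ j') 0# 0# tC uC (l *ℕ 1)))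
                  (coords (proj₁ eqs) (proj₁ (proj₂ eqs)) (proj₂ (proj₂ eqs)) (sym (proj₁ same)) (λ v → trans (cong (λ n → frob n v) (sym (ℕₚ.*-distribˡ-+ l j' 1))) (sym (proj₂ same v))))
                where
                xa xb xc xt : Carrier
                xa = φ a' + 0# - φ b' * tC + φ c' * (0# - tC * uC)
                xb = φ b' + 0# + φ c' * uC
                xc = φ c' + tC
                xt = φ t' + uC
                coords : ∀ {a b c t a' b' c' t' n n'} → a ≡ a' → b ≡ b' → c ≡ c' → t ≡ t' → n ≋ n' → ε a b c t n ≃ ε a' b' c' t' n'
                coords {a} {b} {c} {t} refl refl refl refl e = ε-≋ {a} {b} {c} {t} e

        opaque
          into : ∀ a {b c t j} → Tw b c t j → Γ (ε a b c t (l *ℕ j))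
          into a {c = c} x = let (n , _ , e) = tr-prime (μC * c) in generated n a x e

        opaque
          out : ∀ {g} → Γ g → Conj g
          out (Theory.gen g (inj₁ (a , b , c , k , e , lab , q))) = from-ε {a = a} {b} {c} {n = 3 *ℕ l *ℕ k} {3 *ℕ k} (λ x → cong (λ n → frob n x) (triple k)) q (from-K b c k e lab)
          out (Theory.gen g (inj₂ q)) = from-ε {a = 0# } {0# } {tC} {n = l} {1} (λ x → cong (λ n → frob n x) (sym (ℕₚ.*-identityʳ l))) q g-tC
          out (Theory.unit g q) = Conj-resp (≃-sym ⟨ q ⟩) Conj-unit
          out (Theory.mul a b g x y q) = Conj-resp (≃-trans (subst (_≃ (a ∘ˢ b)) (sym (⨾-≡ a b)) ≃-refl) ⟨ q ⟩) (Conj-mul (out x) (out y))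
          out (Theory.inv a g x q) = Conj-inv (out x) (subst (_≃ idˢ) (sym (⨾-≡ a g)) ⟨ q ⟩)

        opaque
          resultD : CaseD m G
          resultD = let (p3 , m9 , d₁ , d₂ , d₃ , d₄ , d₅ , d₆ , d₇ , d₈ , d₉ , d₁₀ , d₁₁ , d₁₂ , _) = form in
            l , u , tC , μB , s , α , λ₀ , p3 , m9 , d₁ , d₂ , d₃ , d₄ , (λ e → 1≢0 (trans (sym d₅) e)) , d₆ , d₇ , d₈ , d₉ , d₁₀ , d₁₁
            -- The construction asks for λ_C u in place of u; here λ_C = 1.
            , trans d₁₂ (cong (_+ λ₀ * μC) (trans (sym (*-identityˡ u)) (cong (_* u) (sym d₅)))) , conjugate-to Γ into out

      result : Form l Tw → ConjugateToConstruction m G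
      result (inj₁ f)               = inj₁ (resultA f)
      result (inj₂ (inj₁ f))        = inj₂ (inj₁ (resultB f))
      result (inj₂ (inj₂ (inj₁ f))) = inj₂ (inj₂ (inj₁ (resultC f)))
      result (inj₂ (inj₂ (inj₂ (u , tC , μB , s , α , λ₀ , f)))) = inj₂ (inj₂ (inj₂ (ResultD.resultD u tC μB s α λ₀ f)))

    classification : ConjugateToConstruction m G
    classification = let (w , f) = Classify.classify l P m≡ K P∣ Red.system₂ in Shear.result w f

theorem2p11 : (F : FiniteField) (p m : ℕ) → Prime p → p ≢ 2
    → FiniteField.card F ≡ p ^ m → 5 ≤ p ^ m
    → (G : Theory.Semilinear F p → Set)
    → Theory.IsSubgroupPΓSpP F p G
    → Theory.RegularOnPoints F p G
    → Theory.ConjugateToConstruction F p m G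
-- With m = 0 the size bound would read 5 ≤ 1.
theorem2p11 F p zero    pr p≢2 card≡ (s≤s ()) G sub reg
theorem2p11 F p (suc m) pr p≢2 card≡ _        G sub reg = Development.Main.classification F p (suc m) pr card≡ (s≤s z≤n) p≢2 G sub reg
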